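{- Let $\eta=(\eta_1,\dots,\eta_n)$ be a composition and $a<b$ nonnegative integers such that every part of $\eta$ equal to $a$ lies to the left of every part equal to $b$ (i.e. the parts of sizes $a$ and $b$ occur in increasing order from left to right), and such that $\eta$ has no part $h$ with $a<h<b$. Let $\hat\eta$ be the composition obtained from $\eta$ either by changing all parts equal to $a$ into $b$, or by changing all parts equal to $b$ into $a$. Then at $q=1$, \[ \frac{E_\eta(\mathbf{x};1,t)}{E_{\hat\eta}(\mathbf{x};1,t)}=\left(\frac{e_{\#\{i:\eta_i\ge b\}}(\mathbf{x})}{e_{\#\{i:\hat\eta_i\ge b\}}(\mathbf{x})}\right)^{b-a}. \]
   Context: $\mathbf{x}=(x_1,\dots,x_n)$ and $e_k(\mathbf{x})$ is the elementary symmetric polynomial of degree $k$ ($e_0=1$). Nonsymmetric Macdonald polynomials: for $f\in\mathbb{Q}(q,t)[x_1,\dots,x_n]$ and $1\le i\le n-1$, $s_if$ swaps $x_i,x_{i+1}$; $L_if=\frac{tx_i-x_{i+1}}{x_i-x_{i+1}}(f-s_if)$; $T_if=tf-L_if$; $T_i^{ -1}f=t^{ -1}f-t^{ -1}L_if$; $(\omega f)(x_1,\dots,x_n)=f(qx_n,x_1,\dots,x_{n-1})$; $Y_i=t^{ -(i-1)}T_i^{ -1}\cdots T_{n-1}^{ -1}\,\omega\, T_1\cdots T_{i-1}$. For a composition $\eta$ (an $n$-tuple of nonnegative integers) let $y_i(\eta)=q^{\eta_i}t^{ -\#\{j>i:\eta_j\ge\eta_i\}-\#\{j<i:\eta_j>\eta_i\}}$.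 Let $\eta^+$ be the weakly decreasing rearrangement of $\eta$. For partitions of equal size, $\lambda\le\mu$ means $\lambda_1+\dots+\lambda_i\le\mu_1+\dots+\mu_i$ for all $i$; for compositions, $\eta\le\nu$ means either $\eta^+\le\nu^+$, or $\eta^+=\nu^+$ and $\eta_1+\dots+\eta_i\le\nu_1+\dots+\nu_i$ for all $i$. The nonsymmetric Macdonald polynomial $E_\eta(\mathbf{x};q,t)$ is the unique polynomial of the form $\sum_{\zeta\le\eta}v_{\eta,\zeta}(q,t)\mathbf{x}^\zeta$ with $v_{\eta,\eta}=1$ such that $Y_iE_\eta=y_i(\eta)E_\eta$ for all $1\le i\le n$. $E_\eta(\mathbf{x};1,t)$ is its specialisation at $q=1$. -}

module Defs where

-- Polynomials in x_1..x_n with coefficients in ℚ[q, t, t⁻¹], represented as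
-- formal sums (lists of terms) and compared coefficientwise.
-- An element of ℚ(q,t)[x] is represented as F / c with F : Poly n, c : Poly 0, c ≠ 0.

open import Data.Nat as ℕ using (ℕ; zero; suc; _∸_; _<_; _≤_)
open import Data.Nat.Properties as ℕP using (≤-decTotalOrder)
open import Data.Integer as ℤ using (ℤ; +_)
open import Data.Rational as ℚ using (ℚ; 0ℚ; 1ℚ)
open import Data.Vec as V using (Vec; []; _∷_)
open import Data.List as L using (List; []; _∷_; _++_)
open import Data.List.Relation.Binary.Pointwise using (Pointwise)
open import Data.Nat.ListAction using (sum)
open import Data.Bool using (Bool; true; false; _∧_; if_then_else_)
open import Data.Product using (_×_; _,_)
open import Data.Sum using (_⊎_)
open import Data.Fin as F using (Fin; toℕ)
open import Relation.Binary.PropositionalEquality using (_≡_)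
open import Relation.Nullary using (¬_; does)
import Data.List.Sort.InsertionSort.Base as IS

record Mono (n : ℕ) : Set where
  constructor mono
  field
    qe : ℕ
    te : ℤ
    xe : Vec ℕ n

Poly : ℕ → Set
Poly n = List (ℚ × Mono n)

eqVec : ∀ {n} → Vec ℕ n → Vec ℕ n → Bool
eqVec [] [] = true
eqVec (x ∷ xs) (y ∷ ys) = (x ℕ.≡ᵇ y) ∧ eqVec xs ys

eqMono : ∀ {n} → Mono n → Mono n → Bool
eqMono (mono q t x) (mono q' t' x') = (q ℕ.≡ᵇ q') ∧ (does (t ℤ.≟ t') ∧ eqVec x x')

coeff : ∀ {n} → Poly n → Mono n → ℚ
coeff [] m = 0ℚ
coeff ((c , m') ∷ f) m = if eqMono m m' then c ℚ.+ coeff f m else coeff f m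

infix 4 _≈_
_≈_ : ∀ {n} → Poly n → Poly n → Set
f ≈ g = ∀ m → coeff f m ≡ coeff g m

zeroP : ∀ {n} → Poly n
zeroP = []

infixl 6 _⊕_ _⊖_
infixl 7 _⊗_

_⊕_ : ∀ {n} → Poly n → Poly n → Poly n
f ⊕ g = f ++ g

negP : ∀ {n} → Poly n → Poly n
negP = L.map (λ { (c , m) → (ℚ.- c , m) })

_⊖_ : ∀ {n} → Poly n → Poly n → Poly n
f ⊖ g = f ++ negP g

monoMul : ∀ {n} → Mono n → Mono n → Mono n
monoMul (mono q t x) (mono q' t' x') = mono (q ℕ.+ q') (t ℤ.+ t') (V.zipWith ℕ._+_ x x')

_⊗_ : ∀ {n} → Poly n → Poly n → Poly n
f ⊗ g = L.concatMap (λ { (c , m) → L.map (λ { (c' , m') → (c ℚ.* c' , monoMul m m') }) g }) f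

oneP : ∀ {n} → Poly n
oneP {n} = (1ℚ , mono 0 (+ 0) (V.replicate n 0)) ∷ []

_^^_ : ∀ {n} → Poly n → ℕ → Poly n
f ^^ zero = oneP
f ^^ suc k = f ⊗ (f ^^ k)

qtMono : ∀ {n} → ℕ → ℤ → Poly n
qtMono {n} a z = (1ℚ , mono a z (V.replicate n 0)) ∷ []

getAt : ∀ {n} → ℕ → Vec ℕ n → ℕ
getAt _ [] = 0
getAt zero (x ∷ _) = x
getAt (suc p) (_ ∷ xs) = getAt p xs

setAt : ∀ {n} → ℕ → ℕ → Vec ℕ n → Vec ℕ n
setAt _ _ [] = []
setAt zero v (_ ∷ xs) = v ∷ xs
setAt (suc p) v (x ∷ xs) = x ∷ setAt p v xs

swapAt : ∀ {n} → ℕ → Vec ℕ n → Vec ℕ n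
swapAt p v = setAt p (getAt (suc p) v) (setAt (suc p) (getAt p v) v)

-- the variable x_{p+1} (0-based position p)
xvar : ∀ {n} → ℕ → Poly n
xvar {n} p = (1ℚ , mono 0 (+ 0) (setAt p 1 (V.replicate n 0))) ∷ []

-- Operators, with 1-based index i (acting on x_i, x_{i+1})

sOp : ∀ {n} → ℕ → Poly n → Poly n
sOp i = L.map (λ { (c , mono q t x) → (c , mono q t (swapAt (i ∸ 1) x)) })

-- exact quotient (m - s_i m) / (x_i - x_{i+1}) for a single term
divDiffTerm : ∀ {n} → ℕ → ℚ × Mono n → Poly n
divDiffTerm i (c , mono q t x) =
  let p = i ∸ 1
      a = getAt p x
      b = getAt (suc p) x
      mk : ℚ → ℕ → ℕ → ℕ → ℚ × Mono _
      mk c' base k j = (c' , mono q t (setAt p (base ℕ.+ (k ∸ suc j)) (setAt (suc p) (base ℕ.+ j) x)))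
  in if b ℕ.≤ᵇ a
     then L.map (mk c b (a ∸ b)) (L.upTo (a ∸ b))
     else L.map (mk (ℚ.- c) a (b ∸ a)) (L.upTo (b ∸ a))

divDiff : ∀ {n} → ℕ → Poly n → Poly n
divDiff i = L.concatMap (divDiffTerm i)

LOp : ∀ {n} → ℕ → Poly n → Poly n
LOp i f = (qtMono 0 (+ 1) ⊗ xvar (i ∸ 1) ⊖ xvar i) ⊗ divDiff i f

TOp : ∀ {n} → ℕ → Poly n → Poly n
TOp i f = qtMono 0 (+ 1) ⊗ f ⊖ LOp i f

TinvOp : ∀ {n} → ℕ → Poly n → Poly n
TinvOp i f = qtMono 0 (ℤ.- (+ 1)) ⊗ f ⊖ qtMono 0 (ℤ.- (+ 1)) ⊗ LOp i f

snoc : ∀ {A : Set} {m} → Vec A m → A → Vec A (suc m)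
snoc [] a = a ∷ []
snoc (x ∷ xs) a = x ∷ snoc xs a

head0 : ∀ {n} → Vec ℕ n → ℕ
head0 [] = 0
head0 (x ∷ _) = x

rotl : ∀ {n} → Vec ℕ n → Vec ℕ n
rotl [] = []
rotl (x ∷ xs) = snoc xs x

-- (ω f)(x_1,…,x_n) = f(q x_n, x_1, …, x_{n-1}):
-- x^α ↦ q^{α_1} x_1^{α_2} ⋯ x_{n-1}^{α_n} x_n^{α_1}
ωOp : ∀ {n} → Poly n → Poly n
ωOp = L.map (λ { (c , mono q t x) → (c , mono (q ℕ.+ head0 x) t (rotl x)) })

-- Y_i = t^{-(i-1)} T_i⁻¹ ⋯ T_{n-1}⁻¹ ω T_1 ⋯ T_{i-1}   (1-based i)
YOp : ∀ {n} → ℕ → Poly n → Poly n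
YOp {n} i f =
  qtMono 0 (ℤ.- (+ (i ∸ 1))) ⊗
    L.foldr TinvOp
      (ωOp (L.foldr TOp f (L.map suc (L.upTo (i ∸ 1)))))
      (L.map (i ℕ.+_) (L.upTo (n ∸ i)))

countF : ∀ {n} → (Fin n → Bool) → ℕ
countF {n} P = sum (L.map (λ j → if P j then 1 else 0) (L.allFin n))

yExp : ∀ {n} → Vec ℕ n → Fin n → ℕ
yExp η i =
  countF (λ j → (toℕ i ℕ.<ᵇ toℕ j) ∧ (V.lookup η i ℕ.≤ᵇ V.lookup η j)) ℕ.+
  countF (λ j → (toℕ j ℕ.<ᵇ toℕ i) ∧ (V.lookup η i ℕ.<ᵇ V.lookup η j))

yVal : ∀ {n} → Vec ℕ n → Fin n → Poly n
yVal η i = qtMono (V.lookup η i) (ℤ.- (+ yExp η i))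

sortDesc : ∀ {n} → Vec ℕ n → List ℕ
sortDesc η = L.reverse (IS.sort ≤-decTotalOrder (V.toList η))

psums : List ℕ → List ℕ
psums = L.scanl ℕ._+_ 0

PSumLe : List ℕ → List ℕ → Set
PSumLe xs ys = Pointwise _≤_ (psums xs) (psums ys)

PartLe : List ℕ → List ℕ → Set
PartLe λ' μ = (sum λ' ≡ sum μ) × PSumLe λ' μ

CompLe : ∀ {n} → Vec ℕ n → Vec ℕ n → Set
CompLe ζ η = PartLe (sortDesc ζ) (sortDesc η)
           ⊎ ((sortDesc ζ ≡ sortDesc η) × PSumLe (V.toList ζ) (V.toList η))

xcoeff : ∀ {n} → Poly n → Vec ℕ n → Poly 0
xcoeff F ζ = L.concatMap (λ { (c , mono q t x) → if eqVec x ζ then (c , mono q t []) ∷ [] else [] }) F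

-- (F, c) represents E_η = F / c  ∈ ℚ(q,t)[x]
IsE : ∀ {n} → Vec ℕ n → Poly n → Poly 0 → Set
IsE {n} η F c =
  ¬ (c ≈ zeroP)
  × (∀ ζ → ¬ CompLe ζ η → xcoeff F ζ ≈ zeroP)
  × (xcoeff F η ≈ c)
  × (∀ (i : Fin n) → YOp (suc (toℕ i)) F ≈ yVal η i ⊗ F)

atQ1 : ∀ {n} → Poly n → Poly n
atQ1 = L.map (λ { (c , mono q t x) → (c , mono 0 t x) })

liftC : ∀ {n} → Poly 0 → Poly n
liftC {n} = L.map (λ { (c , mono q t _) → (c , mono q t (V.replicate n 0)) })

subsets01 : (n k : ℕ) → List (Vec ℕ n)
subsets01 zero zero = [] ∷ []
subsets01 zero (suc k) = []
subsets01 (suc n) zero = L.map (0 ∷_) (subsets01 n zero)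
subsets01 (suc n) (suc k) = L.map (0 ∷_) (subsets01 n (suc k)) ++ L.map (1 ∷_) (subsets01 n k)

esym : (n k : ℕ) → Poly n
esym n k = L.map (λ x → (1ℚ , mono 0 (+ 0) x)) (subsets01 n k)

replaceParts : ∀ {n} → ℕ → ℕ → Vec ℕ n → Vec ℕ n
replaceParts a b = V.map (λ x → if x ℕ.≡ᵇ a then b else x)

countGe : ∀ {n} → ℕ → Vec ℕ n → ℕ
countGe b η = countF (λ i → b ℕ.≤ᵇ V.lookup η i)

{-# OPTIONS --safe #-}
-- At q = 1 the eigenvalues of the Y_i depend only on the type of η, the way its entries compare from left to right, and all
-- operators commute with symmetric polynomials. For ε(η) = ∏_{r ≥ 1} e_{#{i : η_i ≥ r}} we have E_η ε(η') = E_η' ε(η) at q = 1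
-- whenever η and η' have the same type, and ηh has the type of η.
-- E_η is built by the recursion of Knop and Sahi: the affine shift η ↦ (η_n + 1, η_1, …, η_{n−1}) and intertwiners moving a
-- nonzero part to the right across leading zeros. At q = 1 both steps depend only on the type, so two compositions with the
-- same number of leading zeros are treated in parallel. This reduces the claim to comparing ζ⁺ with ζ, where ζ has the least
-- degree in its type and ζ⁺ adds 1 to all entries of ζ after the first k zeros. For k = 0 this is the n-th power of the shift,
-- which multiplies by e_n. For k > 0 the difference of E_ζ⁺ and e_{n−k} E_ζ vanishes at x_1 = 0, by induction on n, and hence
-- altogether: a nonzero eigenvector contains a monomial of its own type, here one without zero exponents, and lowering all
-- its exponents by one contradicts the minimality of ζ.

module Submission where

open import Defs
open import Data.Nat as ℕ using (ℕ; zero; suc; _∸_; _<_; _≤_; z≤n; s≤s)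
import Data.Nat.Properties as ℕP
import Data.Nat.Solver as ℕS
import Data.Integer.Solver as ℤS
open import Data.Integer as ℤ using (ℤ; +_)
import Data.Integer.Properties as ℤP
open import Data.Rational as ℚ using (ℚ; 0ℚ; 1ℚ)
import Data.Rational.Properties as ℚP
import Data.Rational.Solver as ℚS
open import Data.Vec as V using (Vec; []; _∷_)
import Data.Vec.Properties as VP
import Data.List.Properties as LP
open import Data.Maybe using (Maybe; just; nothing)
import Algebra.Solver.Ring as RingSolver
open import Algebra.Solver.Ring.AlmostCommutativeRing using (_-Raw-AlmostCommutative⟶_; fromCommutativeRing)
open import Data.List as L using (List; []; _∷_; _++_)
open import Data.Bool as Bool using (Bool; true; false; _∧_; if_then_else_; T)
open import Data.Fin as F using (Fin)
import Data.Fin.Properties as FP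
open import Data.Nat.ListAction using (sum)
open import Data.Sum using (_⊎_; inj₁; inj₂)
open import Data.Product using (Σ; _×_; _,_; proj₁; proj₂; ∃)
open import Data.Unit using (⊤; tt)
open import Data.Empty using (⊥; ⊥-elim)
open import Relation.Binary.PropositionalEquality
open import Relation.Nullary using (¬_; Dec; yes; no; does)
open import Relation.Nullary.Decidable using (decidable-stable)
open import Algebra.Bundles using (CommutativeRing)
open import Relation.Binary.Bundles using (Setoid)
open import Data.Nat.ListAction.Properties using (sum-↭)
open import Data.List.Relation.Unary.All as All using (All; []; _∷_)
open import Data.List.Relation.Unary.AllPairs using (AllPairs; []; _∷_)
import Data.List.Relation.Unary.AllPairs.Properties as AllPairsP
import Data.List.Relation.Unary.Linked.Properties as LinkedP
open import Data.List.Relation.Binary.Pointwise using (Pointwise; []; _∷_)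
open import Data.List.Relation.Binary.Permutation.Propositional using (_↭_; ↭-trans; ↭-sym)
import Data.List.Relation.Binary.Permutation.Propositional.Properties as PermP
open import Relation.Binary.Definitions using (Tri; tri<; tri≈; tri>)
import Data.Fin as Fin
open import Data.Vec using (lookup)

-- Polynomials as functionals

-- The Y-equations determine E_η only for generic q. At q = 1 many compositions share all
-- eigenvalues, so two eigenvectors cannot be recognised as proportional from their eigenvalues.
-- Hence the ratio is followed along the recursion, and uniqueness enters only in a weak form, for
-- eigenvectors without monomials of the type in question. That form needs the Y_i at q = 1 to be
-- triangular, which is derived from the E_ζ themselves. The denominators are the second obstacle.
-- The recursion divides by 1 - z with z a ratio of eigenvalues. It is kept free of fractions as F /
-- c, and c must survive q = 1: apart from powers of q its factors become 1 - t^r with r > 0,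
-- because intertwiners are applied only at descents. Cross-multiplied identities and regular
-- elements then stand in for fractions. The product ε(η) arises because the shift turns one part a
-- into a + 1, so that exactly one count of parts ≥ r grows, by one. The exponent b - a is the
-- number of r with a < r ≤ b, for which the counts agree since no part lies strictly between a and
-- b.

eqVec-sound : ∀ {n} (x y : Vec ℕ n) → eqVec x y ≡ true → x ≡ y
eqVec-sound [] [] _ = refl
eqVec-sound (a ∷ x) (b ∷ y) e with a ℕ.≡ᵇ b in p
... | true = cong₂ _∷_ (ℕP.≡ᵇ⇒≡ a b (subst T (sym p) tt)) (eqVec-sound x y e)

≡ᵇ-refl : ∀ a → (a ℕ.≡ᵇ a) ≡ true
≡ᵇ-refl zero = refl
≡ᵇ-refl (suc a) = ≡ᵇ-refl a

eqVec-refl : ∀ {n} (x : Vec ℕ n) → eqVec x x ≡ true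
eqVec-refl [] = refl
eqVec-refl (a ∷ x) rewrite ≡ᵇ-refl a = eqVec-refl x

eqMono-sound : ∀ {n} (m m' : Mono n) → eqMono m m' ≡ true → m ≡ m'
eqMono-sound (mono q t x) (mono q' t' x') e with q ℕ.≡ᵇ q' in p | t ℤ.≟ t'
... | true | yes refl rewrite ℕP.≡ᵇ⇒≡ q q' (subst T (sym p) tt) | eqVec-sound x x' e = refl

eqMono-refl : ∀ {n} (m : Mono n) → eqMono m m ≡ true
eqMono-refl (mono q t x) rewrite ≡ᵇ-refl q with t ℤ.≟ t
... | yes _ = eqVec-refl x
... | no c = ⊥-elim (c refl)

-- A polynomial is treated as a finitely supported functional on functions of monomials; equality of
-- polynomials is equality of functionals, and an operator is determined by its adjoint.
ev : ∀ {n} → Poly n → (Mono n → ℚ) → ℚ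
ev [] h = 0ℚ
ev ((c , m) ∷ f) h = c ℚ.* h m ℚ.+ ev f h

infix 4 _≋_
record _≋_ {n : ℕ} (f g : Poly n) : Set where
  constructor mk≋
  field at : ∀ h → ev f h ≡ ev g h
open _≋_ public

private
  rid : ∀ c x → (c ℚ.* 0ℚ) ℚ.+ x ≡ x
  rid = ℚS.+-*-Solver.solve 2 (λ c x → c :* con 0ℚ :+ x := x) refl
    where open ℚS.+-*-Solver

ev-cong : ∀ {n} (f : Poly n) {h k} → (∀ m → h m ≡ k m) → ev f h ≡ ev f k
ev-cong [] e = refl
ev-cong ((c , m) ∷ f) e = cong₂ (λ a b → c ℚ.* a ℚ.+ b) (e m) (ev-cong f e)

ev-0 : ∀ {n} (f : Poly n) → ev f (λ _ → 0ℚ) ≡ 0ℚ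
ev-0 [] = refl
ev-0 ((c , m) ∷ f) = trans (rid c _) (ev-0 f)

ev-+ : ∀ {n} (f : Poly n) h k → ev f (λ m → h m ℚ.+ k m) ≡ ev f h ℚ.+ ev f k
ev-+ [] h k = refl
ev-+ ((c , m) ∷ f) h k = trans (cong (c ℚ.* (h m ℚ.+ k m) ℚ.+_) (ev-+ f h k))
  (solve 5 (λ c a b x y → c :* (a :+ b) :+ (x :+ y) := (c :* a :+ x) :+ (c :* b :+ y)) refl c (h m) (k m) (ev f h) (ev f k))
  where open ℚS.+-*-Solver

ev-* : ∀ {n} (f : Poly n) d h → ev f (λ m → d ℚ.* h m) ≡ d ℚ.* ev f h
ev-* [] d h = sym (ℚP.*-zeroʳ d)
ev-* ((c , m) ∷ f) d h = trans (cong (c ℚ.* (d ℚ.* h m) ℚ.+_) (ev-* f d h))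
  (solve 4 (λ c a d x → c :* (d :* a) :+ d :* x := d :* (c :* a :+ x)) refl c (h m) d (ev f h))
  where open ℚS.+-*-Solver

ev-- : ∀ {n} (f : Poly n) h → ev f (λ m → ℚ.- h m) ≡ ℚ.- ev f h
ev-- [] h = refl
ev-- ((c , m) ∷ f) h = trans (cong (c ℚ.* (ℚ.- h m) ℚ.+_) (ev-- f h))
  (solve 3 (λ c a x → c :* (:- a) :+ (:- x) := :- (c :* a :+ x)) refl c (h m) (ev f h))
  where open ℚS.+-*-Solver

ev-swap : ∀ {n m} (f : Poly n) (g : Poly m) (k : Mono n → Mono m → ℚ) →
  ev f (λ a → ev g (λ b → k a b)) ≡ ev g (λ b → ev f (λ a → k a b))
ev-swap [] g k = sym (ev-0 g)
ev-swap ((c , a) ∷ f) g k = trans (cong₂ ℚ._+_ (sym (ev-* g c (k a))) (ev-swap f g k))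
  (sym (ev-+ g (λ b → c ℚ.* k a b) (λ b → ev f (λ a → k a b))))

ev-⊕ : ∀ {n} (f g : Poly n) h → ev (f ⊕ g) h ≡ ev f h ℚ.+ ev g h
ev-⊕ [] g h = sym (ℚP.+-identityˡ _)
ev-⊕ ((c , m) ∷ f) g h = trans (cong (c ℚ.* h m ℚ.+_) (ev-⊕ f g h)) (sym (ℚP.+-assoc (c ℚ.* h m) _ _))

ev-neg : ∀ {n} (f : Poly n) h → ev (negP f) h ≡ ℚ.- ev f h
ev-neg [] h = refl
ev-neg ((c , m) ∷ f) h = trans (cong (ℚ.- c ℚ.* h m ℚ.+_) (ev-neg f h))
  (solve 3 (λ c a x → (:- c) :* a :+ (:- x) := :- (c :* a :+ x)) refl c (h m) (ev f h))
  where open ℚS.+-*-Solver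

ev-⊖ : ∀ {n} (f g : Poly n) h → ev (f ⊖ g) h ≡ ev f h ℚ.- ev g h
ev-⊖ f g h = trans (ev-⊕ f (negP g) h) (cong (ev f h ℚ.+_) (ev-neg g h))

ev-map : ∀ {n m} (φ : Mono n → Mono m) (f : Poly n) h →
  ev (L.map (λ { (c , x) → (c , φ x) }) f) h ≡ ev f (λ x → h (φ x))
ev-map φ [] h = refl
ev-map φ ((c , m) ∷ f) h = cong (c ℚ.* h (φ m) ℚ.+_) (ev-map φ f h)

private
  ev-scaled : ∀ {n} c (m : Mono n) (g : Poly n) h →
    ev (L.map (λ { (c' , m') → (c ℚ.* c' , monoMul m m') }) g) h ≡ c ℚ.* ev g (λ m' → h (monoMul m m'))
  ev-scaled c m [] h = sym (ℚP.*-zeroʳ c)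
  ev-scaled c m ((d , m') ∷ g) h = trans (cong ((c ℚ.* d) ℚ.* h (monoMul m m') ℚ.+_) (ev-scaled c m g h))
    (solve 4 (λ c d a x → (c :* d) :* a :+ c :* x := c :* (d :* a :+ x)) refl c d (h (monoMul m m')) _)
    where open ℚS.+-*-Solver

ev-⊗ : ∀ {n} (f g : Poly n) h → ev (f ⊗ g) h ≡ ev f (λ m → ev g (λ m' → h (monoMul m m')))
ev-⊗ [] g h = refl
ev-⊗ ((c , m) ∷ f) g h = trans (ev-⊕ (L.map _ g) (f ⊗ g) h)
  (cong₂ ℚ._+_ (ev-scaled c m g h) (ev-⊗ f g h))

≋-refl : ∀ {n} {f : Poly n} → f ≋ f
≋-refl = mk≋ λ h → refl
≋-sym : ∀ {n} {f g : Poly n} → f ≋ g → g ≋ f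
≋-sym e = mk≋ λ h → sym (at e h)
≋-trans : ∀ {n} {f g k : Poly n} → f ≋ g → g ≋ k → f ≋ k
≋-trans e e' = mk≋ λ h → trans (at e h) (at e' h)
≡⇒≋ : ∀ {n} {f g : Poly n} → f ≡ g → f ≋ g
≡⇒≋ refl = ≋-refl

polySetoid : ℕ → Setoid _ _
polySetoid n = record { Carrier = Poly n ; _≈_ = _≋_
  ; isEquivalence = record { refl = ≋-refl ; sym = ≋-sym ; trans = ≋-trans } }

δ : ∀ {n} → Mono n → Mono n → ℚ
δ m m' = if eqMono m m' then 1ℚ else 0ℚ

coeff-ev : ∀ {n} (f : Poly n) m → coeff f m ≡ ev f (δ m)
coeff-ev [] m = refl
coeff-ev ((c , m') ∷ f) m with eqMono m m'
... | true = cong₂ ℚ._+_ (sym (ℚP.*-identityʳ c)) (coeff-ev f m)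
... | false = trans (coeff-ev f m) (sym (rid c _))

≋⇒≈ : ∀ {n} {f g : Poly n} → f ≋ g → f ≈ g
≋⇒≈ {f = f} {g} e m = trans (coeff-ev f m) (trans (at e (δ m)) (sym (coeff-ev g m)))

private
  remove : ∀ {n} → Mono n → Poly n → Poly n
  remove m [] = []
  remove m ((c , m') ∷ f) = if eqMono m m' then remove m f else (c , m') ∷ remove m f

  remove-length : ∀ {n} (m : Mono n) f → L.length (remove m f) ≤ L.length f
  remove-length m [] = z≤n
  remove-length m ((c , m') ∷ f) with eqMono m m'
  ... | true = ℕP.m≤n⇒m≤1+n (remove-length m f)
  ... | false = s≤s (remove-length m f)

  ev-remove : ∀ {n} (m : Mono n) f h → ev f h ≡ coeff f m ℚ.* h m ℚ.+ ev (remove m f) h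
  ev-remove m [] h = sym (trans (cong (ℚ._+ 0ℚ) (ℚP.*-zeroˡ (h m))) refl)
  ev-remove m ((c , m') ∷ f) h with eqMono m m' in p
  ... | true rewrite sym (eqMono-sound m m' p) = trans (cong (c ℚ.* h m ℚ.+_) (ev-remove m f h))
    (solve 4 (λ c k a x → c :* a :+ (k :* a :+ x) := (c :+ k) :* a :+ x) refl c (coeff f m) (h m) _)
    where open ℚS.+-*-Solver
  ... | false = trans (cong (c ℚ.* h m' ℚ.+_) (ev-remove m f h))
    (solve 3 (λ a b x → a :+ (b :+ x) := b :+ (a :+ x)) refl (c ℚ.* h m') (coeff f m ℚ.* h m) _)
    where open ℚS.+-*-Solver

  coeff-remove : ∀ {n} (m : Mono n) f m' → coeff f m' ≡ 0ℚ → coeff (remove m f) m' ≡ 0ℚ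
  coeff-remove m f m' e with eqMono m m' in p
  ... | true rewrite sym (eqMono-sound m m' p) = same f
    where
    same : ∀ f → coeff (remove m f) m ≡ 0ℚ
    same [] = refl
    same ((c , a) ∷ f) with eqMono m a in q
    ... | true = same f
    ... | false rewrite q = same f
  ... | false = trans (other f) e
    where
    other : ∀ f → coeff (remove m f) m' ≡ coeff f m'
    other [] = refl
    other ((c , a) ∷ f) with eqMono m a in q
    other ((c , a) ∷ f) | true with eqMono m' a in r
    ... | true = ⊥-elim (absurd (trans (sym p) (trans (cong₂ eqMono (eqMono-sound m a q) (eqMono-sound m' a r)) (eqMono-refl a))))
      where absurd : false ≡ true → ⊥
            absurd ()
    ... | false = other f
    other ((c , a) ∷ f) | false with eqMono m' a
    ... | true = cong (c ℚ.+_) (other f)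
    ... | false = other f

  -- Terms with the same monomial may be scattered over the list and cancel only in total, so each
  -- step removes all copies of the leading monomial at once. The length bound `k` makes this
  -- terminate.
  zero-ev : ∀ {n} k (f : Poly n) → L.length f ≤ k → (∀ m → coeff f m ≡ 0ℚ) → ∀ h → ev f h ≡ 0ℚ
  zero-ev k [] _ _ h = refl
  zero-ev (suc k) f@((c , m) ∷ f') (s≤s l) z h = trans (ev-remove m f h)
    (trans (cong₂ (λ a b → a ℚ.* h m ℚ.+ b) (z m)
      (zero-ev k (remove m f) (subst (λ g → L.length g ≤ k) (sym red) (ℕP.≤-trans (remove-length m f') l))
        (λ m' → coeff-remove m f m' (z m')) h))
      (trans (ℚP.+-identityʳ _) (ℚP.*-zeroˡ (h m))))
    where
    red : remove m f ≡ remove m f'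
    red rewrite eqMono-refl m = refl

x-y≡0⇒x≡y : ∀ {x y} → x ℚ.- y ≡ 0ℚ → x ≡ y
x-y≡0⇒x≡y {x} {y} p = trans (solve 2 (λ x y → x := (x :- y) :+ y) refl x y) (trans (cong (ℚ._+ y) p) (ℚP.+-identityˡ y))
  where open ℚS.+-*-Solver

≈⇒≋ : ∀ {n} {f g : Poly n} → f ≈ g → f ≋ g
≈⇒≋ {f = f} {g} e = mk≋ λ h → x-y≡0⇒x≡y (trans (sym (ev-⊖ f g h)) (zero-ev _ (f ⊖ g) ℕP.≤-refl diff h))
  where
  diff : ∀ m → coeff (f ⊖ g) m ≡ 0ℚ
  diff m = trans (coeff-ev (f ⊖ g) m) (trans (ev-⊖ f g (δ m))
    (trans (cong₂ ℚ._-_ (trans (sym (coeff-ev f m)) (e m)) (sym (coeff-ev g m))) (ℚP.+-inverseʳ (coeff g m))))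

infixl 6 _+ₚ_ _-ₚ_
infixl 7 _*ₚ_
infix 8 -ₚ_

-- Opaque copies of the polynomial operations: unification must not unfold them to list programs.
opaque
  _+ₚ_ _*ₚ_ : ∀ {n} → Poly n → Poly n → Poly n
  f +ₚ g = f ⊕ g
  f *ₚ g = f ⊗ g

  -ₚ_ : ∀ {n} → Poly n → Poly n
  -ₚ f = negP f

  0ₚ : ∀ {n} → Poly n
  0ₚ = zeroP

  qt : ∀ {n} → ℕ → ℤ → Poly n
  qt = qtMono

  X : ∀ {n} → ℕ → Poly n
  X = xvar

  const : ∀ {n} → ℚ → Poly n
  const {n} c = (c , mono 0 (+ 0) (V.replicate n 0)) ∷ []

  ⟨_⟩ : ∀ {n} → Mono n → Poly n
  ⟨ m ⟩ = (1ℚ , m) ∷ []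

1ₚ : ∀ {n} → Poly n
1ₚ = const 1ℚ

_-ₚ_ : ∀ {n} → Poly n → Poly n → Poly n
f -ₚ g = f +ₚ -ₚ g

one : ∀ {n} → Mono n
one {n} = mono 0 (+ 0) (V.replicate n 0)

opaque
  unfolding _+ₚ_

  *ₚ-def : ∀ {n} (f g : Poly n) → f *ₚ g ≡ f ⊗ g
  *ₚ-def f g = refl

  0ₚ-def : ∀ {n} → 0ₚ {n} ≡ zeroP
  0ₚ-def = refl

  1ₚ-def : ∀ {n} → 1ₚ {n} ≡ oneP
  1ₚ-def = refl

  qt-def : ∀ {n} a z → qt {n} a z ≡ qtMono a z
  qt-def a z = refl

  qt-one : ∀ {n} → qt {n} 0 (+ 0) ≡ 1ₚ
  qt-one = refl

  ev-+ₚ : ∀ {n} (f g : Poly n) h → ev (f +ₚ g) h ≡ ev f h ℚ.+ ev g h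
  ev-+ₚ = ev-⊕

  ev--ₚ : ∀ {n} (f : Poly n) h → ev (-ₚ f) h ≡ ℚ.- ev f h
  ev--ₚ = ev-neg

  ev-*ₚ : ∀ {n} (f g : Poly n) h → ev (f *ₚ g) h ≡ ev f (λ m → ev g (λ m' → h (monoMul m m')))
  ev-*ₚ = ev-⊗

  ev-0ₚ : ∀ {n} (h : Mono n → ℚ) → ev 0ₚ h ≡ 0ℚ
  ev-0ₚ h = refl

  ev-const : ∀ {n} c (h : Mono n → ℚ) → ev (const c) h ≡ c ℚ.* h one
  ev-const c h = ℚP.+-identityʳ _

  ev-⟨⟩ : ∀ {n} (m : Mono n) h → ev ⟨ m ⟩ h ≡ h m
  ev-⟨⟩ m h = solve 1 (λ a → con 1ℚ :* a :+ con 0ℚ := a) refl (h m)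
    where open ℚS.+-*-Solver

  1ₚ-⟨⟩ : ∀ {n} → 1ₚ {n} ≡ ⟨ one ⟩
  1ₚ-⟨⟩ = refl

  qt-⟨⟩ : ∀ {n} a z → qt {n} a z ≡ ⟨ mono a z (V.replicate n 0) ⟩
  qt-⟨⟩ a z = refl

  X-⟨⟩ : ∀ {n} p → X {n} p ≡ ⟨ mono 0 (+ 0) (setAt p 1 (V.replicate n 0)) ⟩
  X-⟨⟩ p = refl

ev--ₚ₂ : ∀ {n} (f g : Poly n) h → ev (f -ₚ g) h ≡ ev f h ℚ.- ev g h
ev--ₚ₂ f g h = trans (ev-+ₚ f (-ₚ g) h) (cong (ev f h ℚ.+_) (ev--ₚ g h))

ev-⟨⟩*ₚ : ∀ {n} (m : Mono n) (g : Poly n) h → ev (⟨ m ⟩ *ₚ g) h ≡ ev g (λ m' → h (monoMul m m'))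
ev-⟨⟩*ₚ m g h = trans (ev-*ₚ ⟨ m ⟩ g h) (ev-⟨⟩ m (λ m₁ → ev g (λ m' → h (monoMul m₁ m'))))

+ₚ-cong : ∀ {n} {f f' g g' : Poly n} → f ≋ f' → g ≋ g' → f +ₚ g ≋ f' +ₚ g'
+ₚ-cong {f = f} {f'} {g} {g'} a b = mk≋ λ h → trans (ev-+ₚ f g h) (trans (cong₂ ℚ._+_ (at a h) (at b h)) (sym (ev-+ₚ f' g' h)))

neg-cong : ∀ {n} {f g : Poly n} → f ≋ g → -ₚ f ≋ -ₚ g
neg-cong {f = f} {g} a = mk≋ λ h → trans (ev--ₚ f h) (trans (cong ℚ.-_ (at a h)) (sym (ev--ₚ g h)))

*ₚ-cong : ∀ {n} {f f' g g' : Poly n} → f ≋ f' → g ≋ g' → f *ₚ g ≋ f' *ₚ g'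
*ₚ-cong {f = f} {f'} {g} {g'} a b = mk≋ λ h → trans (ev-*ₚ f g h) (trans (at a _)
  (trans (ev-cong f' (λ m → at b _)) (sym (ev-*ₚ f' g' h))))

+ₚ-assoc : ∀ {n} (f g k : Poly n) → (f +ₚ g) +ₚ k ≋ f +ₚ (g +ₚ k)
+ₚ-assoc f g k = mk≋ λ h → trans (ev-+ₚ (f +ₚ g) k h) (trans (cong (ℚ._+ ev k h) (ev-+ₚ f g h))
  (trans (ℚP.+-assoc (ev f h) (ev g h) (ev k h)) (sym (trans (ev-+ₚ f (g +ₚ k) h) (cong (ev f h ℚ.+_) (ev-+ₚ g k h))))))

+ₚ-comm : ∀ {n} (f g : Poly n) → f +ₚ g ≋ g +ₚ f
+ₚ-comm f g = mk≋ λ h → trans (ev-+ₚ f g h) (trans (ℚP.+-comm (ev f h) (ev g h)) (sym (ev-+ₚ g f h)))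

+ₚ-idʳ : ∀ {n} (f : Poly n) → f +ₚ 0ₚ ≋ f
+ₚ-idʳ f = mk≋ λ h → trans (ev-+ₚ f 0ₚ h) (trans (cong (ev f h ℚ.+_) (ev-0ₚ h)) (ℚP.+-identityʳ _))

neg-invʳ : ∀ {n} (f : Poly n) → f +ₚ -ₚ f ≋ 0ₚ
neg-invʳ f = mk≋ λ h → trans (ev--ₚ₂ f f h) (trans (ℚP.+-inverseʳ (ev f h)) (sym (ev-0ₚ h)))

mono-cong : ∀ {n q q' t t'} {x x' : Vec ℕ n} → q ≡ q' → t ≡ t' → x ≡ x' → mono q t x ≡ mono q' t' x'
mono-cong refl refl refl = refl

monoMul-comm : ∀ {n} (a b : Mono n) → monoMul a b ≡ monoMul b a
monoMul-comm (mono q t x) (mono q' t' x') =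
  mono-cong (ℕP.+-comm q q') (ℤP.+-comm t t') (VP.zipWith-comm ℕP.+-comm x x')

monoMul-assoc : ∀ {n} (a b c : Mono n) → monoMul (monoMul a b) c ≡ monoMul a (monoMul b c)
monoMul-assoc (mono q t x) (mono q' t' x') (mono q'' t'' x'') =
  mono-cong (ℕP.+-assoc q q' q'') (ℤP.+-assoc t t' t'') (VP.zipWith-assoc ℕP.+-assoc x x' x'')

monoMul-idˡ : ∀ {n} (a : Mono n) → monoMul one a ≡ a
monoMul-idˡ (mono q t x) = cong₂ (mono q) (ℤP.+-identityˡ t) (VP.zipWith-identityˡ ℕP.+-identityˡ x)

*ₚ-comm : ∀ {n} (f g : Poly n) → f *ₚ g ≋ g *ₚ f
*ₚ-comm f g = mk≋ λ h → trans (ev-*ₚ f g h) (trans (ev-swap f g _)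
  (trans (ev-cong g (λ b → ev-cong f (λ a → cong h (monoMul-comm a b)))) (sym (ev-*ₚ g f h))))

*ₚ-assoc : ∀ {n} (f g k : Poly n) → (f *ₚ g) *ₚ k ≋ f *ₚ (g *ₚ k)
*ₚ-assoc f g k = mk≋ λ h → trans (ev-*ₚ (f *ₚ g) k h) (trans (ev-*ₚ f g _)
  (trans (ev-cong f (λ a → trans (ev-cong g (λ b → ev-cong k (λ c → cong h (monoMul-assoc a b c)))) (sym (ev-*ₚ g k _))))
      (sym (ev-*ₚ f (g *ₚ k) h))))

*ₚ-idˡ : ∀ {n} (f : Poly n) → 1ₚ *ₚ f ≋ f
*ₚ-idˡ f = mk≋ λ h → trans (cong (λ e → ev (e *ₚ f) h) 1ₚ-⟨⟩) (trans (ev-⟨⟩*ₚ one f h) (ev-cong f (λ m → cong h (monoMul-idˡ m))))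

*ₚ-distribˡ : ∀ {n} (f g k : Poly n) → f *ₚ (g +ₚ k) ≋ f *ₚ g +ₚ f *ₚ k
*ₚ-distribˡ f g k = mk≋ λ h → trans (ev-*ₚ f (g +ₚ k) h) (trans (ev-cong f (λ m → ev-+ₚ g k _))
  (trans (ev-+ f _ _) (trans (cong₂ ℚ._+_ (sym (ev-*ₚ f g h)) (sym (ev-*ₚ f k h))) (sym (ev-+ₚ (f *ₚ g) (f *ₚ k) h)))))

polyRing : ℕ → CommutativeRing _ _
polyRing n = record
  { Carrier = Poly n ; _≈_ = _≋_ ; _+_ = _+ₚ_ ; _*_ = _*ₚ_ ; -_ = -ₚ_ ; 0# = 0ₚ ; 1# = 1ₚ
  ; isCommutativeRing = record
    { isRing = record
      { +-isAbelianGroup = record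
        { isGroup = record
          { isMonoid = record
            { isSemigroup = record
              { isMagma = record { isEquivalence = Setoid.isEquivalence (polySetoid n) ; ∙-cong = +ₚ-cong }
              ; assoc = +ₚ-assoc }
            ; identity = (λ f → ≋-trans (+ₚ-comm 0ₚ f) (+ₚ-idʳ f)) , +ₚ-idʳ }
          ; inverse = (λ f → ≋-trans (+ₚ-comm (-ₚ f) f) (neg-invʳ f)) , neg-invʳ
          ; ⁻¹-cong = neg-cong }
        ; comm = +ₚ-comm }
      ; *-cong = *ₚ-cong
      ; *-assoc = *ₚ-assoc
      ; *-identity = *ₚ-idˡ , (λ f → ≋-trans (*ₚ-comm f 1ₚ) (*ₚ-idˡ f))
      ; distrib = *ₚ-distribˡ , (λ f g k → ≋-trans (*ₚ-comm (g +ₚ k) f)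
          (≋-trans (*ₚ-distribˡ f g k) (+ₚ-cong (*ₚ-comm f g) (*ₚ-comm f k)))) }
    ; *-comm = *ₚ-comm } }

coefficients : ∀ n → ℚP.+-*-rawRing -Raw-AlmostCommutative⟶ fromCommutativeRing (polyRing n)
coefficients n = record
  { ⟦_⟧ = const
  ; +-homo = λ c d → mk≋ λ h → trans (ev-const (c ℚ.+ d) h) (trans (ℚP.*-distribʳ-+ (h one) c d)
      (sym (trans (ev-+ₚ {n} (const c) (const d) h) (cong₂ ℚ._+_ (ev-const c h) (ev-const d h)))))
  ; *-homo = λ c d → mk≋ λ h → trans (ev-const (c ℚ.* d) h) (trans (ℚP.*-assoc c d (h one))
      (sym (trans (ev-*ₚ {n} (const c) (const d) h) (trans (ev-const c (λ m → ev (const {n} d) (λ m' → h (monoMul m m'))))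
        (cong (c ℚ.*_) (trans (ev-const d (λ m' → h (monoMul one m'))) (cong (λ m → d ℚ.* h m) (monoMul-idˡ one))))))))
  ; -‿homo = λ c → mk≋ λ h → trans (ev-const (ℚ.- c) h)
      (trans (sym (ℚP.neg-distribˡ-* c (h one))) (sym (trans (ev--ₚ (const c) h) (cong ℚ.-_ (ev-const c h)))))
  ; 0-homo = mk≋ λ h → trans (ev-const 0ℚ h) (trans (ℚP.*-zeroˡ (h one)) (sym (ev-0ₚ h)))
  ; 1-homo = ≋-refl }

const≟ : ∀ {n} (c d : ℚ) → Maybe (const {n} c ≋ const d)
const≟ c d with c ℚ.≟ d
... | yes refl = just ≋-refl
... | no _ = nothing

module PolySolver {n : ℕ} = RingSolver ℚP.+-*-rawRing (fromCommutativeRing (polyRing n)) (coefficients n) const≟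

-- Linear operators

-- Having an adjoint gives linearity over ℚ and compatibility with `≋` at once, although the
-- operators are programs on lists. Identities of operators can then be checked on single monomials.
record Lin {n m : ℕ} (A : Poly n → Poly m) : Set where
  constructor lin
  field
    adj : (Mono m → ℚ) → Mono n → ℚ
    ev-adj : ∀ f h → ev (A f) h ≡ ev f (adj h)
open Lin public

module _ {n m : ℕ} {A : Poly n → Poly m} (lA : Lin A) where
  lin-cong : ∀ {f g} → f ≋ g → A f ≋ A g
  lin-cong {f} {g} e = mk≋ λ h → trans (ev-adj lA f h) (trans (at e _) (sym (ev-adj lA g h)))

  lin-+ : ∀ f g → A (f +ₚ g) ≋ A f +ₚ A g
  lin-+ f g = mk≋ λ h → trans (ev-adj lA (f +ₚ g) h) (trans (ev-+ₚ f g _)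
    (trans (sym (cong₂ ℚ._+_ (ev-adj lA f h) (ev-adj lA g h))) (sym (ev-+ₚ (A f) (A g) h))))

  lin-neg : ∀ f → A (-ₚ f) ≋ -ₚ (A f)
  lin-neg f = mk≋ λ h → trans (ev-adj lA (-ₚ f) h) (trans (ev--ₚ f _)
    (trans (cong ℚ.-_ (sym (ev-adj lA f h))) (sym (ev--ₚ (A f) h))))

  lin-- : ∀ f g → A (f -ₚ g) ≋ A f -ₚ A g
  lin-- f g = ≋-trans (lin-+ f (-ₚ g)) (+ₚ-cong ≋-refl (lin-neg g))

  lin-0 : A 0ₚ ≋ 0ₚ
  lin-0 = mk≋ λ h → trans (ev-adj lA 0ₚ h) (trans (ev-0ₚ (adj lA h)) (sym (ev-0ₚ h)))

  lin-zero : ∀ {f} → f ≋ 0ₚ → A f ≋ 0ₚ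
  lin-zero e = ≋-trans (lin-cong e) lin-0

  adj-⟨⟩ : ∀ a h → ev (A ⟨ a ⟩) h ≡ adj lA h a
  adj-⟨⟩ a h = trans (ev-adj lA ⟨ a ⟩ h) (ev-⟨⟩ a (adj lA h))

lin-ext : ∀ {n m} {A B : Poly n → Poly m} → Lin A → Lin B → (∀ a → A ⟨ a ⟩ ≋ B ⟨ a ⟩) → ∀ f → A f ≋ B f
lin-ext {A = A} {B} lA lB e f = mk≋ λ h → trans (ev-adj lA f h) (trans
  (ev-cong f (λ a → trans (sym (adj-⟨⟩ lA a h)) (trans (at (e a) h) (adj-⟨⟩ lB a h)))) (sym (ev-adj lB f h)))

lin-id : ∀ {n} → Lin {n} (λ f → f)
lin-id = lin (λ h → h) (λ f h → refl)

lin-∘ : ∀ {n m k} {A : Poly m → Poly k} {B : Poly n → Poly m} → Lin A → Lin B → Lin (λ f → A (B f))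
lin-∘ {B = B} lA lB = lin (λ h → adj lB (adj lA h)) (λ f h → trans (ev-adj lA (B f) h) (ev-adj lB f _))

lin-add : ∀ {n m} {A B : Poly n → Poly m} → Lin A → Lin B → Lin (λ f → A f +ₚ B f)
lin-add {A = A} {B} lA lB = lin (λ h a → adj lA h a ℚ.+ adj lB h a)
  (λ f h → trans (ev-+ₚ (A f) (B f) h) (trans (cong₂ ℚ._+_ (ev-adj lA f h) (ev-adj lB f h)) (sym (ev-+ f _ _))))

lin-negP : ∀ {n m} {A : Poly n → Poly m} → Lin A → Lin (λ f → -ₚ (A f))
lin-negP {A = A} lA = lin (λ h a → ℚ.- adj lA h a)
  (λ f h → trans (ev--ₚ (A f) h) (trans (cong ℚ.-_ (ev-adj lA f h)) (sym (ev-- f _))))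

lin-sub : ∀ {n m} {A B : Poly n → Poly m} → Lin A → Lin B → Lin (λ f → A f -ₚ B f)
lin-sub lA lB = lin-add lA (lin-negP lB)

lin-mul : ∀ {n m} {A : Poly n → Poly m} p → Lin A → Lin (λ f → p *ₚ A f)
lin-mul {A = A} p lA = lin (λ h a → ev p (λ b → adj lA (λ c → h (monoMul b c)) a))
  (λ f h → trans (ev-*ₚ p (A f) h) (trans (ev-cong p (λ b → ev-adj lA f _)) (ev-swap p f _)))

lin-mulʳ : ∀ {n m} {A : Poly n → Poly m} p → Lin A → Lin (λ f → A f *ₚ p)
lin-mulʳ {A = A} p lA = lin (adj (lin-mul p lA))
  (λ f h → trans (at (*ₚ-comm (A f) p) h) (ev-adj (lin-mul p lA) f h))

lin-concat : ∀ {n m} (φ : ℚ × Mono n → Poly m) (k : (Mono m → ℚ) → Mono n → ℚ) →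
  (∀ c a h → ev (φ (c , a)) h ≡ c ℚ.* k h a) → Lin (L.concatMap φ)
lin-concat φ k e = lin k go
  where
  go : ∀ f h → ev (L.concatMap φ f) h ≡ ev f (k h)
  go [] h = refl
  go ((c , a) ∷ f) h = trans (ev-⊕ (φ (c , a)) (L.concatMap φ f) h) (cong₂ ℚ._+_ (e c a h) (go f h))

-- Together with `Lin` this is linearity over the scalars ℚ[q, t, t⁻¹], which are spanned by the
-- `qt a z`.
QT : ∀ {n m} → (Poly n → Poly m) → Set
QT A = ∀ a z f → A (qt a z *ₚ f) ≋ qt a z *ₚ A f

qt-∘ : ∀ {n m k} {A : Poly m → Poly k} {B : Poly n → Poly m} → Lin A → QT A → QT B → QT (λ f → A (B f))
qt-∘ lA qA qB a z f = ≋-trans (lin-cong lA (qB a z f)) (qA a z _)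

shiftM : ∀ {n} → ℕ → ℤ → Mono n → Mono n
shiftM a z (mono q t x) = mono (a ℕ.+ q) (z ℤ.+ t) x

ev-qt : ∀ {n} a z (f : Poly n) h → ev (qt a z *ₚ f) h ≡ ev f (λ m → h (shiftM a z m))
ev-qt a z f h = trans (cong (λ s → ev (s *ₚ f) h) (qt-⟨⟩ a z))
    (trans (ev-⟨⟩*ₚ _ f h)
    (ev-cong f (λ { (mono q t x) → cong h (mono-cong refl refl (VP.zipWith-identityˡ ℕP.+-identityˡ x)) })))

qt-mul : ∀ {n m} {A : Poly n → Poly m} p → QT A → QT (λ f → p *ₚ A f)
qt-mul {m = m} {A} p qA a z f = ≋-trans (*ₚ-cong ≋-refl (qA a z f))
  (solve 3 (λ p s g → p :* (s :* g) := s :* (p :* g)) ≋-refl p (qt a z) (A f))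
  where open PolySolver {m}

qt-add : ∀ {n m} {A B : Poly n → Poly m} → QT A → QT B → QT (λ f → A f +ₚ B f)
qt-add qA qB a z f = ≋-trans (+ₚ-cong (qA a z f) (qB a z f)) (≋-sym (*ₚ-distribˡ _ _ _))

qt-sub : ∀ {n m} {A B : Poly n → Poly m} → QT A → QT B → QT (λ f → A f -ₚ B f)
qt-sub {m = m} {A} {B} qA qB a z f = ≋-trans (+ₚ-cong (qA a z f) (neg-cong (qB a z f)))
  (solve 3 (λ s g k → s :* g :- s :* k := s :* (g :- k)) ≋-refl (qt a z) (A f) (B f))
  where open PolySolver {m}

-- Exponent vectors and induction over monomials

inc : ∀ {n} → ℕ → Vec ℕ n → Vec ℕ n
inc _ [] = []
inc zero (x ∷ xs) = suc x ∷ xs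
inc (suc p) (x ∷ xs) = x ∷ inc p xs

inc-spec : ∀ {n} p (x : Vec ℕ n) → V.zipWith ℕ._+_ (setAt p 1 (V.replicate n 0)) x ≡ inc p x
inc-spec p [] = refl
inc-spec zero (x ∷ xs) = cong (suc x ∷_) (VP.zipWith-identityˡ ℕP.+-identityˡ xs)
inc-spec (suc p) (x ∷ xs) = cong (x ∷_) (inc-spec p xs)

incM : ∀ {n} → ℕ → Mono n → Mono n
incM p (mono q t x) = mono q t (inc p x)

ev-X : ∀ {n} p (f : Poly n) h → ev (X p *ₚ f) h ≡ ev f (λ a → h (incM p a))
ev-X p f h = trans (cong (λ s → ev (s *ₚ f) h) (X-⟨⟩ p))
    (trans (ev-⟨⟩*ₚ _ f h) (ev-cong f (λ { (mono q t x) → cong h (mono-cong refl (ℤP.+-identityˡ t) (inc-spec p x)) })))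

vec-ind : ∀ {n} (P : Vec ℕ n → Set) → P (V.replicate n 0) → (∀ p x → p < n → P x → P (inc p x)) → ∀ x → P x
vec-ind P z s [] = z
vec-ind {suc n} P z s (a ∷ xs) = head a
  where
  head : ∀ a → P (a ∷ xs)
  head zero = vec-ind (λ y → P (0 ∷ y)) z (λ p x l → s (suc p) (0 ∷ x) (s≤s l)) xs
  head (suc a) = s zero (a ∷ xs) (s≤s z≤n) (head a)

-- Monomials in x are generated from 1 by the variables, so two scalar-linear operators agree once
-- they agree at 1 and multiplication by a variable preserves agreement. The Hecke relations are
-- obtained in this way from the rules for moving a variable through an operator.
mono-ind : ∀ {n m} {A B : Poly n → Poly m} → Lin A → Lin B → QT A → QT B → A 1ₚ ≋ B 1ₚ →
  (∀ p → p < n → ∀ f → A f ≋ B f → A (X p *ₚ f) ≋ B (X p *ₚ f)) → ∀ f → A f ≋ B f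
mono-ind {n} {A = A} {B} lA lB qA qB o s = lin-ext lA lB λ { (mono q t x) →
  ≋-trans (lin-cong lA (split q t x)) (≋-trans (qA q t ⟨ mono 0 (+ 0) x ⟩) (≋-trans (*ₚ-cong (≋-refl {f = qt q t}) (pure x))
    (≋-trans (≋-sym (qB q t ⟨ mono 0 (+ 0) x ⟩)) (lin-cong lB (≋-sym (split q t x)))))) }
  where
  split : ∀ q t x → ⟨ mono q t x ⟩ ≋ qt q t *ₚ ⟨ mono 0 (+ 0) x ⟩
  split q t x = mk≋ λ h → trans (ev-⟨⟩ (mono q t x) h) (sym (trans (ev-qt q t ⟨ mono 0 (+ 0) x ⟩ h)
    (trans (ev-⟨⟩ (mono 0 (+ 0) x) _) (cong h (mono-cong (ℕP.+-identityʳ q) (ℤP.+-identityʳ t) refl)))))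
  pure : ∀ x → A ⟨ mono 0 (+ 0) x ⟩ ≋ B ⟨ mono 0 (+ 0) x ⟩
  pure = vec-ind (λ x → A ⟨ mono 0 (+ 0) x ⟩ ≋ B ⟨ mono 0 (+ 0) x ⟩) (subst (λ u → A u ≋ B u) 1ₚ-⟨⟩ o)
    (λ p x l e → ≋-trans (lin-cong lA (step p x)) (≋-trans (s p l _ e) (lin-cong lB (≋-sym (step p x)))))
    where
    step : ∀ p x → ⟨ mono 0 (+ 0) (inc p x) ⟩ ≋ X p *ₚ ⟨ mono 0 (+ 0) x ⟩
    step p x = mk≋ λ h → trans (ev-⟨⟩ (mono 0 (+ 0) (inc p x)) h)
        (sym (trans (ev-X p ⟨ mono 0 (+ 0) x ⟩ h) (ev-⟨⟩ (mono 0 (+ 0) x) _)))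

put : ∀ {n} → ℕ → ℕ → ℕ → Vec ℕ n → Vec ℕ n
put p u v x = setAt p u (setAt (suc p) v x)

put-put : ∀ {n} p u v u' v' (x : Vec ℕ n) → put p u v (put p u' v' x) ≡ put p u v x
put-put p u v u' v' [] = refl
put-put zero u v u' v' (a ∷ []) = refl
put-put zero u v u' v' (a ∷ b ∷ x) = refl
put-put (suc p) u v u' v' (a ∷ x) = cong (a ∷_) (put-put p u v u' v' x)

get-put₀ : ∀ {n} p u v (x : Vec ℕ n) → suc p < n → getAt p (put p u v x) ≡ u
get-put₀ zero u v (a ∷ x) l = refl
get-put₀ (suc p) u v (a ∷ x) (s≤s l) = get-put₀ p u v x l

get-put₁ : ∀ {n} p u v (x : Vec ℕ n) → suc p < n → getAt (suc p) (put p u v x) ≡ v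
get-put₁ zero u v (a ∷ []) (s≤s ())
get-put₁ zero u v (a ∷ b ∷ x) l = refl
get-put₁ (suc p) u v (a ∷ x) (s≤s l) = get-put₁ p u v x l

put-self : ∀ {n} p (x : Vec ℕ n) → put p (getAt p x) (getAt (suc p) x) x ≡ x
put-self p [] = refl
put-self zero (a ∷ []) = refl
put-self zero (a ∷ b ∷ x) = refl
put-self (suc p) (a ∷ x) = cong (a ∷_) (put-self p x)

inc-put₀ : ∀ {n} p u v (x : Vec ℕ n) → inc p (put p u v x) ≡ put p (suc u) v x
inc-put₀ p u v [] = refl
inc-put₀ zero u v (a ∷ x) = refl
inc-put₀ (suc p) u v (a ∷ x) = cong (a ∷_) (inc-put₀ p u v x)

inc-put₁ : ∀ {n} p u v (x : Vec ℕ n) → inc (suc p) (put p u v x) ≡ put p u (suc v) x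
inc-put₁ p u v [] = refl
inc-put₁ zero u v (a ∷ []) = refl
inc-put₁ zero u v (a ∷ b ∷ x) = refl
inc-put₁ (suc p) u v (a ∷ x) = cong (a ∷_) (inc-put₁ p u v x)

get-inc : ∀ {n} p (x : Vec ℕ n) → p < n → getAt p (inc p x) ≡ suc (getAt p x)
get-inc zero (a ∷ x) l = refl
get-inc (suc p) (a ∷ x) (s≤s l) = get-inc p x l

get-inc-≢ : ∀ {n} p j (x : Vec ℕ n) → p ≢ j → getAt p (inc j x) ≡ getAt p x
get-inc-≢ p j [] ne = refl
get-inc-≢ zero zero (a ∷ x) ne = ⊥-elim (ne refl)
get-inc-≢ zero (suc j) (a ∷ x) ne = refl
get-inc-≢ (suc p) zero (a ∷ x) ne = refl
get-inc-≢ (suc p) (suc j) (a ∷ x) ne = get-inc-≢ p j x (λ e → ne (cong suc e))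

put-inc₀ : ∀ {n} p u v (x : Vec ℕ n) → put p u v (inc p x) ≡ put p u v x
put-inc₀ p u v [] = refl
put-inc₀ zero u v (a ∷ []) = refl
put-inc₀ zero u v (a ∷ b ∷ x) = refl
put-inc₀ (suc p) u v (a ∷ x) = cong (a ∷_) (put-inc₀ p u v x)

put-inc₁ : ∀ {n} p u v (x : Vec ℕ n) → put p u v (inc (suc p) x) ≡ put p u v x
put-inc₁ p u v [] = refl
put-inc₁ zero u v (a ∷ []) = refl
put-inc₁ zero u v (a ∷ b ∷ x) = refl
put-inc₁ (suc p) u v (a ∷ x) = cong (a ∷_) (put-inc₁ p u v x)

put-inc-≢ : ∀ {n} p j u v (x : Vec ℕ n) → j ≢ p → j ≢ suc p → put p u v (inc j x) ≡ inc j (put p u v x)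
put-inc-≢ p j u v [] _ _ = refl
put-inc-≢ zero zero u v (a ∷ x) ne _ = ⊥-elim (ne refl)
put-inc-≢ zero (suc j) u v (a ∷ []) ne _ = refl
put-inc-≢ zero (suc zero) u v (a ∷ b ∷ x) _ ne = ⊥-elim (ne refl)
put-inc-≢ zero (suc (suc j)) u v (a ∷ b ∷ x) _ _ = refl
put-inc-≢ (suc p) zero u v (a ∷ x) _ _ = refl
put-inc-≢ (suc p) (suc j) u v (a ∷ x) ne ne' = cong (a ∷_) (put-inc-≢ p j u v x (λ e → ne (cong suc e)) (λ e → ne' (cong suc e)))

-- Divided differences of monomials in two variables

Sum : ℕ → (ℕ → ℚ) → ℚ
Sum zero g = 0ℚ
Sum (suc n) g = g 0 ℚ.+ Sum n (λ j → g (suc j))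

Sum-cong : ∀ n {g k} → (∀ j → j < n → g j ≡ k j) → Sum n g ≡ Sum n k
Sum-cong zero e = refl
Sum-cong (suc n) e = cong₂ ℚ._+_ (e 0 (s≤s z≤n)) (Sum-cong n (λ j l → e (suc j) (s≤s l)))

Sum-last : ∀ n g → Sum (suc n) g ≡ Sum n g ℚ.+ g n
Sum-last zero g = ℚP.+-comm (g 0) 0ℚ
Sum-last (suc n) g = trans (cong (g 0 ℚ.+_) (Sum-last n (λ j → g (suc j)))) (sym (ℚP.+-assoc (g 0) _ _))

Sum-* : ∀ n c g → Sum n (λ j → c ℚ.* g j) ≡ c ℚ.* Sum n g
Sum-* zero c g = sym (ℚP.*-zeroʳ c)
Sum-* (suc n) c g = trans (cong (c ℚ.* g 0 ℚ.+_) (Sum-* n c _)) (sym (ℚP.*-distribˡ-+ c (g 0) _))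

opaque
  -- The quotient (x^a y^b - x^b y^a) / (x - y) written out as a geometric sum, with `k u v` in
  -- place of x^u y^v.
  D : ℕ → ℕ → (ℕ → ℕ → ℚ) → ℚ
  D a b k = if b ℕ.≤ᵇ a
    then Sum (a ∸ b) (λ j → k (b ℕ.+ ((a ∸ b) ∸ suc j)) (b ℕ.+ j))
    else ℚ.- Sum (b ∸ a) (λ j → k (a ℕ.+ ((b ∸ a) ∸ suc j)) (a ℕ.+ j))

≤ᵇ-true : ∀ {a b} → a ≤ b → (a ℕ.≤ᵇ b) ≡ true
≤ᵇ-true {a} {b} l with a ℕ.≤ᵇ b in e
... | true = refl
... | false = ⊥-elim (subst T e (ℕP.≤⇒≤ᵇ l))

≤ᵇ-false : ∀ {a b} → b < a → (a ℕ.≤ᵇ b) ≡ false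
≤ᵇ-false {a} {b} l with a ℕ.≤ᵇ b in e
... | false = refl
... | true = ⊥-elim (ℕP.<⇒≱ l (ℕP.≤ᵇ⇒≤ a b (subst T (sym e) tt)))

opaque
  unfolding D

  D-ge : ∀ b d k → D (b ℕ.+ d) b k ≡ Sum d (λ j → k (b ℕ.+ (d ∸ suc j)) (b ℕ.+ j))
  D-ge b d k rewrite ≤ᵇ-true (ℕP.m≤m+n b d) | ℕP.m+n∸m≡n b d = refl

  D-le : ∀ a d k → D a (a ℕ.+ d) k ≡ ℚ.- Sum d (λ j → k (a ℕ.+ (d ∸ suc j)) (a ℕ.+ j))
  D-le a zero k rewrite ℕP.+-identityʳ a | ≤ᵇ-true (ℕP.≤-refl {a}) | ℕP.n∸n≡0 a = refl
  D-le a (suc d) k rewrite ≤ᵇ-false {a ℕ.+ suc d} {a} (subst (a <_) (sym (ℕP.+-suc a d)) (s≤s (ℕP.m≤m+n a d))) | ℕP.m+n∸m≡n a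
      (suc d) = refl

  D-cong : ∀ a b {k k'} → (∀ u v → k u v ≡ k' u v) → D a b k ≡ D a b k'
  D-cong a b e with b ℕ.≤ᵇ a
  ... | true = Sum-cong (a ∸ b) (λ j _ → e _ _)
  ... | false = cong ℚ.-_ (Sum-cong (b ∸ a) (λ j _ → e _ _))

D-diag : ∀ a k → D a a k ≡ 0ℚ
D-diag a k = trans (cong (λ b → D a b k) (sym (ℕP.+-identityʳ a))) (D-le a 0 k)

private
  drop-suc : ∀ d j → j < d → d ∸ j ≡ suc (d ∸ suc j)
  drop-suc (suc d) zero l = refl
  drop-suc (suc d) (suc j) (s≤s l) = drop-suc d j l

  neg-flip : ∀ x y → ℚ.- x ≡ y ℚ.- (x ℚ.+ y)
  neg-flip = solve 2 (λ x y → :- x := y :- (x :+ y)) refl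
    where open ℚS.+-*-Solver

-- The rule ∂(x f) = f + y ∂f for f = x^a y^b. If b ≤ a, the new term is the first summand; if a <
-- b, it cancels the last summand of the negative sum.
D-suc₀ : ∀ a b k → D (suc a) b k ≡ k a b ℚ.+ D a b (λ u v → k u (suc v))
D-suc₀ a b k with b ℕ.≤? a
... | yes l with d , refl ← ℕP.m≤n⇒∃[o]m+o≡n l =
  trans (cong (λ c → D c b k) (sym (ℕP.+-suc b d))) (trans (D-ge b (suc d) k)
    (cong₂ ℚ._+_ (cong (k (b ℕ.+ d)) (ℕP.+-identityʳ b))
      (trans (Sum-cong d (λ j _ → cong (k _) (ℕP.+-suc b j))) (sym (D-ge b d _)))))
... | no nl with d , refl ← ℕP.m≤n⇒∃[o]m+o≡n (ℕP.≰⇒> nl) =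
  trans (D-le (suc a) d k) (trans (neg-flip _ (k a (suc (a ℕ.+ d)))) (cong (k a (suc (a ℕ.+ d)) ℚ.+_)
    (sym (trans (cong (λ c → D a c (λ u v → k u (suc v))) (sym (ℕP.+-suc a d))) (trans (D-le a (suc d) _)
      (cong ℚ.-_ (trans (Sum-last d _) (cong₂ ℚ._+_
        (Sum-cong d (λ j l → cong (λ c → k c (suc (a ℕ.+ j))) (trans (cong (a ℕ.+_) (drop-suc d j l)) (ℕP.+-suc a _))))
        (cong (λ c → k c (suc (a ℕ.+ d))) (trans (cong (a ℕ.+_) (ℕP.n∸n≡0 d)) (ℕP.+-identityʳ a)))))))))))

D-suc₁ : ∀ a b k → D a (suc b) k ≡ ℚ.- k a b ℚ.+ D a b (λ u v → k (suc u) v)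
D-suc₁ a b k with a ℕ.≤? b
... | yes l with d , refl ← ℕP.m≤n⇒∃[o]m+o≡n l =
  trans (cong (λ c → D a c k) (sym (ℕP.+-suc a d))) (trans (D-le a (suc d) k)
    (trans (cong ℚ.-_ (trans (Sum-last d _) (cong₂ ℚ._+_
        (Sum-cong d (λ j l → cong (λ c → k c (a ℕ.+ j)) (trans (cong (a ℕ.+_) (drop-suc d j l)) (ℕP.+-suc a _))))
        (cong (λ c → k c (a ℕ.+ d)) (trans (cong (a ℕ.+_) (ℕP.n∸n≡0 d)) (ℕP.+-identityʳ a))))))
      (trans (solve 2 (λ x y → :- (x :+ y) := (:- y) :+ (:- x)) refl (Sum d (λ j → k (suc (a ℕ.+ (d ∸ suc j))) (a ℕ.+ j)))
          (k a (a ℕ.+ d)))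
      (cong (ℚ.- k a (a ℕ.+ d) ℚ.+_) (sym (D-le a d _))))))
  where open ℚS.+-*-Solver
... | no nl with d , refl ← ℕP.m≤n⇒∃[o]m+o≡n (ℕP.≰⇒> nl) =
  trans (D-ge (suc b) d k)
      (trans (solve 2 (λ x y → x := (:- y) :+ (y :+ x)) refl (Sum d (λ j → k (suc (b ℕ.+ (d ∸ suc j))) (suc (b ℕ.+ j))))
      (k (suc (b ℕ.+ d)) b))
    (cong (ℚ.- k (suc (b ℕ.+ d)) b ℚ.+_)
        (sym (trans (cong (λ c → D c b (λ u v → k (suc u) v)) (sym (ℕP.+-suc b d))) (trans (D-ge b (suc d) _)
      (cong₂ ℚ._+_ (cong (k (suc (b ℕ.+ d))) (ℕP.+-identityʳ b)) (Sum-cong d (λ j _ → cong (k _) (ℕP.+-suc b j)))))))))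
  where open ℚS.+-*-Solver

-- The rule (x - y) ∂f = f - s f. Lowering the exponents one at a time makes the right side
-- telescope.
D-swap : ∀ a b (k : ℕ → ℕ → ℚ) → D a b (λ u v → k (suc u) v) ℚ.- D a b (λ u v → k u (suc v)) ≡ k a b ℚ.- k b a
D-swap zero zero k = trans (cong₂ ℚ._-_ (D-diag 0 (λ u v → k (suc u) v)) (D-diag 0 (λ u v → k u (suc v))))
    (sym (ℚP.+-inverseʳ (k 0 0)))
D-swap (suc a) b k = trans (cong₂ ℚ._-_ (D-suc₀ a b _) (D-suc₀ a b _))
  (trans (solve 4 (λ x y z w → (x :+ y) :- (z :+ w) := (x :- z) :+ (y :- w)) refl (k (suc a) b) (D a b _) (k a (suc b)) (D a b _))
  (trans (cong (k (suc a) b ℚ.- k a (suc b) ℚ.+_) (D-swap a b (λ u v → k u (suc v))))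
    (solve 3 (λ x y z → (x :- y) :+ (y :- z) := x :- z) refl (k (suc a) b) (k a (suc b)) (k b (suc a)))))
  where open ℚS.+-*-Solver
D-swap zero (suc b) k = trans (cong₂ ℚ._-_ (D-suc₁ 0 b _) (D-suc₁ 0 b _))
  (trans (solve 4 (λ x y z w → ((:- x) :+ y) :- ((:- z) :+ w) := (z :- x) :+ (y :- w)) refl (k 1 b) (D 0 b _) (k 0 (suc b))
      (D 0 b _))
  (trans (cong (k 0 (suc b) ℚ.- k 1 b ℚ.+_) (D-swap 0 b (λ u v → k (suc u) v)))
    (solve 3 (λ x y z → (x :- y) :+ (y :- z) := x :- z) refl (k 0 (suc b)) (k 1 b) (k (suc b) 0))))
  where open ℚS.+-*-Solver

-- Divided differences and Hecke operators

∂adj : ∀ {n} → ℕ → (Mono n → ℚ) → Mono n → ℚ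
∂adj p h (mono q t x) = D (getAt p x) (getAt (suc p) x) (λ u v → h (mono q t (put p u v x)))

private
  ev-applyUpTo : ∀ {n} (f : ℕ → ℕ) (g : ℕ → ℚ × Mono n) N h →
    ev (L.map g (L.applyUpTo f N)) h ≡ Sum N (λ j → proj₁ (g (f j)) ℚ.* h (proj₂ (g (f j))))
  ev-applyUpTo f g zero h = refl
  ev-applyUpTo f g (suc N) h = cong (proj₁ (g (f 0)) ℚ.* h (proj₂ (g (f 0))) ℚ.+_) (ev-applyUpTo (λ j → f (suc j)) g N h)

opaque
  unfolding D

  ∂ : ∀ {n} → ℕ → Poly n → Poly n
  ∂ p = divDiff (suc p)

  s : ∀ {n} → ℕ → Poly n → Poly n
  s p = sOp (suc p)

  s-def : ∀ {n} p (f : Poly n) → s p f ≡ sOp (suc p) f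
  s-def p f = refl

  ev-∂ : ∀ {n} p (f : Poly n) h → ev (∂ p f) h ≡ ev f (∂adj p h)
  ev-∂ {n} p = ev-adj (lin-concat (divDiffTerm (suc p)) (∂adj p) term)
    where
    term : ∀ c (a : Mono n) h → ev (divDiffTerm (suc p) (c , a)) h ≡ c ℚ.* ∂adj p h a
    term c (mono q t x) h = branch (getAt (suc p) x ℕ.≤ᵇ getAt p x)
      (trans (ev-applyUpTo (λ j → j) (mk c b (a ∸ b)) (a ∸ b) h) (Sum-* (a ∸ b) c (λ j → h (proj₂ (mk c b (a ∸ b) j)))))
      (trans (ev-applyUpTo (λ j → j) (mk (ℚ.- c) a (b ∸ a)) (b ∸ a) h)
        (trans (Sum-* (b ∸ a) (ℚ.- c) (λ j → h (proj₂ (mk (ℚ.- c) a (b ∸ a) j))))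
          (solve 2 (λ c s → (:- c) :* s := c :* (:- s)) refl c (Sum (b ∸ a) (λ j → h (proj₂ (mk (ℚ.- c) a (b ∸ a) j)))))))
      where
      open ℚS.+-*-Solver
      a b : ℕ
      a = getAt p x
      b = getAt (suc p) x
      mk : ℚ → ℕ → ℕ → ℕ → ℚ × Mono n
      mk c' base k j = (c' , mono q t (setAt p (base ℕ.+ (k ∸ suc j)) (setAt (suc p) (base ℕ.+ j) x)))
      branch : ∀ e {l l' : Poly n} {y y'} → ev l h ≡ c ℚ.* y → ev l' h ≡ c ℚ.* (ℚ.- y') →
        ev (if e then l else l') h ≡ c ℚ.* (if e then y else ℚ.- y')
      branch true e e' = e
      branch false e e' = e'

∂-lin : ∀ {n} p → Lin {n} (∂ p)
∂-lin p = lin (∂adj p) (ev-∂ p)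

sM : ∀ {n} → ℕ → Mono n → Mono n
sM p (mono q t x) = mono q t (swapAt p x)

ev-s : ∀ {n} p (f : Poly n) h → ev (s p f) h ≡ ev f (λ a → h (sM p a))
ev-s p f h = trans (cong (λ g → ev g h) (s-def p f)) (ev-map (sM p) f h)

s-lin : ∀ {n} p → Lin {n} (s p)
s-lin p = lin (λ h a → h (sM p a)) (ev-s p)

∂-X₀ : ∀ {n} p → suc p < n → (f : Poly n) → ∂ p (X p *ₚ f) ≋ f +ₚ X (suc p) *ₚ ∂ p f
∂-X₀ p l f = mk≋ λ h → trans (ev-∂ p (X p *ₚ f) h) (trans (ev-X p f (∂adj p h)) (sym (trans (ev-+ₚ f (X (suc p) *ₚ ∂ p f) h)
  (trans (cong (ev f h ℚ.+_) (trans (ev-X (suc p) (∂ p f) h) (ev-∂ p f (λ a → h (incM (suc p) a)))))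
  (trans (sym (ev-+ f h (∂adj p (λ a → h (incM (suc p) a))))) (ev-cong f (λ { (mono q t x) → sym (term q t x h) })))))))
  where
  term : ∀ q t x h → ∂adj p h (mono q t (inc p x)) ≡ h (mono q t x) ℚ.+ ∂adj p (λ a → h (incM (suc p) a)) (mono q t x)
  term q t x h rewrite get-inc p x (ℕP.<-trans (ℕP.n<1+n p) l) | get-inc-≢ (suc p) p x (λ ()) =
    trans (D-suc₀ (getAt p x) (getAt (suc p) x) _) (cong₂ ℚ._+_
      (cong (λ y → h (mono q t y)) (trans (put-inc₀ p _ _ x) (put-self p x)))
      (D-cong _ _ (λ u v → cong (λ y → h (mono q t y)) (trans (put-inc₀ p u (suc v) x) (sym (inc-put₁ p u v x))))))

∂-X₁ : ∀ {n} p → suc p < n → (f : Poly n) → ∂ p (X (suc p) *ₚ f) ≋ X p *ₚ ∂ p f -ₚ f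
∂-X₁ p l f = mk≋ λ h → trans (ev-∂ p (X (suc p) *ₚ f) h)
    (trans (ev-X (suc p) f (∂adj p h)) (sym (trans (ev--ₚ₂ (X p *ₚ ∂ p f) f h)
  (trans (cong (ℚ._- ev f h) (trans (ev-X p (∂ p f) h) (ev-∂ p f (λ a → h (incM p a)))))
  (trans (trans (ℚP.+-comm _ (ℚ.- ev f h)) (trans (cong (ℚ._+ ev f (∂adj p (λ a → h (incM p a)))) (sym (ev-- f h)))
     (sym (ev-+ f (λ a → ℚ.- h a) (∂adj p (λ a → h (incM p a))))))) (ev-cong f (λ { (mono q t x) → sym (term q t x h) })))))))
  where
  term : ∀ q t x h → ∂adj p h (mono q t (inc (suc p) x)) ≡ ℚ.- h (mono q t x) ℚ.+ ∂adj p (λ a → h (incM p a)) (mono q t x)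
  term q t x h rewrite get-inc (suc p) x l | get-inc-≢ p (suc p) x (λ ()) =
    trans (D-suc₁ (getAt p x) (getAt (suc p) x) _) (cong₂ ℚ._+_
      (cong (λ y → ℚ.- h (mono q t y)) (trans (put-inc₁ p _ _ x) (put-self p x)))
      (D-cong _ _ (λ u v → cong (λ y → h (mono q t y)) (trans (put-inc₁ p (suc u) v x) (sym (inc-put₀ p u v x))))))

∂-X-far : ∀ {n} p j → j ≢ p → j ≢ suc p → (f : Poly n) → ∂ p (X j *ₚ f) ≋ X j *ₚ ∂ p f
∂-X-far p j ne ne' f = mk≋ λ h → trans (ev-∂ p (X j *ₚ f) h) (trans (ev-X j f (∂adj p h))
  (trans (ev-cong f (λ { (mono q t x) → term q t x h })) (sym (trans (ev-X j (∂ p f) h) (ev-∂ p f _)))))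
  where
  term : ∀ q t x h → ∂adj p h (mono q t (inc j x)) ≡ ∂adj p (λ a → h (incM j a)) (mono q t x)
  term q t x h rewrite get-inc-≢ p j x (λ e → ne (sym e)) | get-inc-≢ (suc p) j x (λ e → ne' (sym e)) =
    D-cong _ _ (λ u v → cong (λ y → h (mono q t y)) (put-inc-≢ p j u v x ne ne'))

∂-qt : ∀ {n} p → QT {n} (∂ p)
∂-qt p a z f = mk≋ λ h → trans (ev-∂ p (qt a z *ₚ f) h) (trans (ev-qt a z f (∂adj p h))
  (trans (ev-cong f (λ { (mono q t x) → refl })) (sym (trans (ev-qt a z (∂ p f) h) (ev-∂ p f _)))))

getAt-replicate : ∀ {n} p → getAt p (V.replicate n 0) ≡ 0
getAt-replicate {zero} p = refl
getAt-replicate {suc n} zero = refl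
getAt-replicate {suc n} (suc p) = getAt-replicate {n} p

∂-1 : ∀ {n} p → ∂ p (1ₚ {n}) ≋ 0ₚ
∂-1 {n} p = mk≋ λ h → trans (cong (λ e → ev (∂ p e) h) 1ₚ-⟨⟩) (trans (adj-⟨⟩ (∂-lin p) one h) (trans (term h) (sym (ev-0ₚ h))))
  where
  term : ∀ h → ∂adj p h (one {n}) ≡ 0ℚ
  term h rewrite getAt-replicate {n} p | getAt-replicate {n} (suc p) = D-diag 0 _

∂-s : ∀ {n} p → suc p < n → (f : Poly n) → X p *ₚ ∂ p f -ₚ X (suc p) *ₚ ∂ p f ≋ f -ₚ s p f
∂-s p l f = mk≋ λ h → trans (ev--ₚ₂ (X p *ₚ ∂ p f) (X (suc p) *ₚ ∂ p f) h)
  (trans (cong₂ ℚ._-_ (trans (ev-X p (∂ p f) h) (ev-∂ p f _)) (trans (ev-X (suc p) (∂ p f) h) (ev-∂ p f _)))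
  (trans (minus f _ _) (trans (ev-cong f (λ { (mono q t x) → term q t x h }))
  (sym (trans (ev--ₚ₂ f (s p f) h) (trans (cong (λ e → ev f h ℚ.- e) (ev-s p f h)) (minus f h _)))))))
  where
  minus : ∀ f h k → ev f h ℚ.- ev f k ≡ ev f (λ a → h a ℚ.- k a)
  minus f h k = sym (trans (ev-+ f h (λ a → ℚ.- k a)) (cong (ev f h ℚ.+_) (ev-- f k)))
  term : ∀ q t x h → ∂adj p (λ a → h (incM p a)) (mono q t x) ℚ.- ∂adj p (λ a → h (incM (suc p) a)) (mono q t x) ≡ h (mono q t x)
      ℚ.- h (sM p (mono q t x))
  term q t x h = trans (cong₂ ℚ._-_ (D-cong _ _ (λ u v → cong (λ y → h (mono q t y)) (inc-put₀ p u v x)))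
      (D-cong _ _ (λ u v → cong (λ y → h (mono q t y)) (inc-put₁ p u v x))))
    (trans (D-swap (getAt p x) (getAt (suc p) x) (λ u v → h (mono q t (put p u v x))))
    (cong (λ y → h (mono q t y) ℚ.- h (sM p (mono q t x))) (put-self p x)))

𝐭 𝐭⁻ 𝐮 : ∀ {n} → Poly n
𝐭 = qt 0 (+ 1)
𝐭⁻ = qt 0 (ℤ.- (+ 1))
𝐮 = 𝐭 -ₚ 1ₚ

qt-* : ∀ {n} a z a' z' → qt {n} a z *ₚ qt a' z' ≋ qt (a ℕ.+ a') (z ℤ.+ z')
qt-* {n} a z a' z' = mk≋ λ h → trans (ev-qt a z (qt a' z') h) (trans (cong (λ e → ev e (λ m → h (shiftM a z m))) (qt-⟨⟩ a' z'))
  (trans (ev-⟨⟩ _ (λ m → h (shiftM a z m))) (sym (trans (cong (λ e → ev e h) (qt-⟨⟩ (a ℕ.+ a') (z ℤ.+ z'))) (ev-⟨⟩ _ h)))))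

𝐭𝐭⁻ : ∀ {n} → 𝐭 {n} *ₚ 𝐭⁻ ≋ 1ₚ
𝐭𝐭⁻ = ≋-trans (qt-* 0 (+ 1) 0 (ℤ.- (+ 1))) (≡⇒≋ qt-one)

infixl 6 _⟨+⟩_ _⟨-⟩_
infixl 7 _⟨*⟩_
_⟨+⟩_ : ∀ {n} {f f' g g' : Poly n} → f ≋ f' → g ≋ g' → f +ₚ g ≋ f' +ₚ g'
_⟨+⟩_ = +ₚ-cong
_⟨-⟩_ : ∀ {n} {f f' g g' : Poly n} → f ≋ f' → g ≋ g' → f -ₚ g ≋ f' -ₚ g'
a ⟨-⟩ b = +ₚ-cong a (neg-cong b)
_⟨*⟩_ : ∀ {n} {f f' g g' : Poly n} → f ≋ f' → g ≋ g' → f *ₚ g ≋ f' *ₚ g'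
_⟨*⟩_ = *ₚ-cong

opaque
  -- The inverse is written as prescribed by the quadratic relation (T - t)(T + 1) = 0, so each rule
  -- for it follows from the corresponding rule for T.
  T⟨_⟩ T⁻⟨_⟩ : ∀ {n} → ℕ → Poly n → Poly n
  T⟨ p ⟩ f = 𝐭 *ₚ f -ₚ (𝐭 *ₚ X p -ₚ X (suc p)) *ₚ ∂ p f
  T⁻⟨ p ⟩ f = 𝐭⁻ *ₚ (T⟨ p ⟩ f -ₚ 𝐮 *ₚ f)

  T-eq : ∀ {n} p (f : Poly n) → T⟨ p ⟩ f ≡ 𝐭 *ₚ f -ₚ (𝐭 *ₚ X p -ₚ X (suc p)) *ₚ ∂ p f
  T-eq p f = refl

  T⁻-eq : ∀ {n} p (f : Poly n) → T⁻⟨ p ⟩ f ≡ 𝐭⁻ *ₚ (T⟨ p ⟩ f -ₚ 𝐮 *ₚ f)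
  T⁻-eq p f = refl

  T-lin : ∀ {n} p → Lin {n} T⟨ p ⟩
  T-lin p = lin-sub (lin-mul 𝐭 lin-id) (lin-mul (𝐭 *ₚ X p -ₚ X (suc p)) (∂-lin p))

  T-qt : ∀ {n} p → QT {n} T⟨ p ⟩
  T-qt p = qt-sub (qt-mul 𝐭 (λ a z f → ≋-refl)) (qt-mul (𝐭 *ₚ X p -ₚ X (suc p)) (∂-qt p))

  T⁻-lin : ∀ {n} p → Lin {n} T⁻⟨ p ⟩
  T⁻-lin p = lin-mul 𝐭⁻ (lin-sub (T-lin p) (lin-mul 𝐮 lin-id))

  T⁻-qt : ∀ {n} p → QT {n} T⁻⟨ p ⟩
  T⁻-qt p = qt-mul 𝐭⁻ (qt-sub (T-qt p) (qt-mul 𝐮 (λ a z f → ≋-refl)))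

opaque
  unfolding _+ₚ_ ∂ T⟨_⟩

  T-def : ∀ {n} p (f : Poly n) → TOp (suc p) f ≡ T⟨ p ⟩ f
  T-def p f = refl

  private
    T⁻-raw : ∀ {n} p (f : Poly n) → TinvOp (suc p) f ≡ 𝐭⁻ *ₚ f -ₚ 𝐭⁻ *ₚ ((𝐭 *ₚ X p -ₚ X (suc p)) *ₚ ∂ p f)
    T⁻-raw p f = refl

T⁻-def : ∀ {n} p (f : Poly n) → TinvOp (suc p) f ≋ T⁻⟨ p ⟩ f
T⁻-def {n} p f = ≋-trans (≡⇒≋ (T⁻-raw p f)) (≋-trans
  (solve 4 (λ t t⁻ f d → t⁻ :* f :- t⁻ :* d := t⁻ :* ((t :* f :- d) :- (t :- con 1ℚ) :* f)) ≋-refl 𝐭 𝐭⁻ f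
      ((𝐭 *ₚ X p -ₚ X (suc p)) *ₚ ∂ p f))
  (≋-trans (*ₚ-cong ≋-refl (≡⇒≋ (sym (T-eq p f)) ⟨-⟩ ≋-refl)) (≡⇒≋ (sym (T⁻-eq p f)))))
  where open PolySolver {n}

-- Setting x_p = 0 leaves s_p + t − 1.
T-s : ∀ {n} p → suc p < n → (f : Poly n) → T⟨ p ⟩ f ≋ s p f +ₚ 𝐮 *ₚ (f -ₚ X p *ₚ ∂ p f)
T-s {n} p l f = ≋-trans (≡⇒≋ (T-eq p f)) (≋-trans
  (solve 5 (λ t x y d f → t :* f :- (t :* x :- y) :* d := f :- (x :* d :- y :* d) :+ (t :- con 1ℚ) :* (f :- x :* d)) ≋-refl 𝐭
      (X p) (X (suc p)) (∂ p f) f)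
  (≋-trans ((≋-refl ⟨-⟩ ∂-s p l f) ⟨+⟩ ≋-refl)
  (solve 3 (λ f s w → f :- (f :- s) :+ w := s :+ w) ≋-refl f (s p f) (𝐮 *ₚ (f -ₚ X p *ₚ ∂ p f)))))
  where open PolySolver {n}

𝐮-comm : ∀ {n m} {A : Poly n → Poly m} → Lin A → QT A → ∀ f → A (𝐮 *ₚ f) ≋ 𝐮 *ₚ A f
𝐮-comm {n} {m} {A} lA qA f = ≋-trans (lin-cong lA (solve 2 (λ t f → (t :- con 1ℚ) :* f := t :* f :- f) ≋-refl 𝐭 f))
  (≋-trans (lin-- lA (𝐭 *ₚ f) f) (≋-trans (qA 0 (+ 1) f ⟨-⟩ ≋-refl)
  (S'.solve 2 (λ t f → t S'.:* f S'.:- f S'.:= (t S'.:- S'.con 1ℚ) S'.:* f) ≋-refl 𝐭 (A f))))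
  where
  open PolySolver {n}
  module S' = PolySolver {m}

module _ {n m} {A : Poly n → Poly m} (lA : Lin A) (qA : QT A) where
  lin-u- : ∀ f g → A (f -ₚ 𝐮 *ₚ g) ≋ A f -ₚ 𝐮 *ₚ A g
  lin-u- f g = ≋-trans (lin-- lA f (𝐮 *ₚ g)) (≋-refl ⟨-⟩ 𝐮-comm lA qA g)
  lin-u+ : ∀ f g → A (f +ₚ 𝐮 *ₚ g) ≋ A f +ₚ 𝐮 *ₚ A g
  lin-u+ f g = ≋-trans (lin-+ lA f (𝐮 *ₚ g)) (≋-refl ⟨+⟩ 𝐮-comm lA qA g)

T-cong : ∀ {n} p {f g : Poly n} → f ≋ g → T⟨ p ⟩ f ≋ T⟨ p ⟩ g
T-cong p = lin-cong (T-lin p)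

T⁻-cong : ∀ {n} p {f g : Poly n} → f ≋ g → T⁻⟨ p ⟩ f ≋ T⁻⟨ p ⟩ g
T⁻-cong p = lin-cong (T⁻-lin p)

infixr 5 _⨾_
_⨾_ : ∀ {n} {f g k : Poly n} → f ≋ g → g ≋ k → f ≋ k
_⨾_ = ≋-trans

-- This is the cross relation T x_p T = t x_{p+1} of the affine Hecke algebra. It is stated with T -
-- (t - 1) for t T⁻¹, since T is shown to be invertible only by means of `T-quad`, whose proof needs
-- this rule.
T-X₀ : ∀ {n} p → suc p < n → (f : Poly n) → T⟨ p ⟩ (X p *ₚ f) ≋ X (suc p) *ₚ (T⟨ p ⟩ f -ₚ 𝐮 *ₚ f)
T-X₀ {n} p l f = ≡⇒≋ (T-eq p (X p *ₚ f)) ⨾ ≋-refl ⟨-⟩ ≋-refl ⟨*⟩ ∂-X₀ p l f ⨾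
  solve 5 (λ t x y f d → t :* (x :* f) :- (t :* x :- y) :* (f :+ y :* d) := y :*
      ((t :* f :- (t :* x :- y) :* d) :- (t :- con 1ℚ) :* f)) ≋-refl 𝐭 (X p) (X (suc p)) f (∂ p f) ⨾
  ≋-refl ⟨*⟩ (≡⇒≋ (sym (T-eq p f)) ⟨-⟩ ≋-refl)
  where open PolySolver {n}

T-X₁ : ∀ {n} p → suc p < n → (f : Poly n) → T⟨ p ⟩ (X (suc p) *ₚ f) ≋ X p *ₚ T⟨ p ⟩ f +ₚ 𝐮 *ₚ (X (suc p) *ₚ f)
T-X₁ {n} p l f = ≡⇒≋ (T-eq p (X (suc p) *ₚ f)) ⨾ ≋-refl ⟨-⟩ ≋-refl ⟨*⟩ ∂-X₁ p l f ⨾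
  solve 5 (λ t x y f d → t :* (y :* f) :- (t :* x :- y) :* (x :* d :- f) := x :* (t :* f :- (t :* x :- y) :* d) :+ (t :- con 1ℚ)
      :* (y :* f)) ≋-refl 𝐭 (X p) (X (suc p)) f (∂ p f) ⨾
  ≋-refl ⟨*⟩ ≡⇒≋ (sym (T-eq p f)) ⟨+⟩ ≋-refl
  where open PolySolver {n}

T-X-far : ∀ {n} p j → j ≢ p → j ≢ suc p → (f : Poly n) → T⟨ p ⟩ (X j *ₚ f) ≋ X j *ₚ T⟨ p ⟩ f
T-X-far {n} p j ne ne' f = ≡⇒≋ (T-eq p (X j *ₚ f)) ⨾ ≋-refl ⟨-⟩ ≋-refl ⟨*⟩ ∂-X-far p j ne ne' f ⨾
  solve 5 (λ t a z f d → t :* (z :* f) :- a :* (z :* d) := z :* (t :* f :- a :* d)) ≋-refl 𝐭 (𝐭 *ₚ X p -ₚ X (suc p)) (X j) f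
      (∂ p f) ⨾
  ≋-refl ⟨*⟩ ≡⇒≋ (sym (T-eq p f))
  where open PolySolver {n}

T-1 : ∀ {n} p → T⟨ p ⟩ (1ₚ {n}) ≋ 𝐭
T-1 {n} p = ≡⇒≋ (T-eq p 1ₚ) ⨾ ≋-refl ⟨-⟩ ≋-refl ⟨*⟩ (∂-1 p ⨾ ≋-sym zero') ⨾
  solve 2 (λ t a → t :* con 1ℚ :- a :* con 0ℚ := t) ≋-refl 𝐭 (𝐭 *ₚ X p -ₚ X (suc p))
  where
  open PolySolver {n}
  zero' : const 0ℚ ≋ 0ₚ
  zero' = mk≋ λ h → trans (ev-const 0ℚ h) (trans (ℚP.*-zeroˡ (h one)) (sym (ev-0ₚ h)))

data Near (p j : ℕ) : Set where
  at₀ : j ≡ p → Near p j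
  at₁ : j ≡ suc p → Near p j
  far : j ≢ p → j ≢ suc p → Near p j

near : ∀ p j → Near p j
near p j with j ℕ.≟ p | j ℕ.≟ suc p
... | yes e | _ = at₀ e
... | no _ | yes e = at₁ e
... | no a | no b = far a b

-- The relation (T - t)(T + 1) = 0. It holds at 1 because T 1 = t. A variable is moved through both
-- generators by the cross relations, and the remaining T T f is replaced by means of the hypothesis
-- on f.
T-quad : ∀ {n} p → suc p < n → (f : Poly n) → T⟨ p ⟩ (T⟨ p ⟩ f) ≋ 𝐮 *ₚ T⟨ p ⟩ f +ₚ 𝐭 *ₚ f
T-quad {n} p l = mono-ind (lin-∘ (T-lin p) (T-lin p)) (lin-add (lin-mul 𝐮 (T-lin p)) (lin-mul 𝐭 lin-id))
  (qt-∘ (T-lin p) (T-qt p) (T-qt p)) (qt-add (qt-mul 𝐮 (T-qt p)) (qt-mul 𝐭 (λ a z f → ≋-refl)))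
  base step
  where
  open PolySolver {n}
  base : T⟨ p ⟩ (T⟨ p ⟩ 1ₚ) ≋ 𝐮 *ₚ T⟨ p ⟩ 1ₚ +ₚ 𝐭 *ₚ 1ₚ
  base = T-cong p (T-1 p ⨾ solve 1 (λ t → t := t :* con 1ℚ) ≋-refl 𝐭) ⨾ T-qt p 0 (+ 1) 1ₚ ⨾ ≋-refl ⟨*⟩ T-1 p ⨾
    solve 1 (λ t → t :* t := (t :- con 1ℚ) :* t :+ t :* con 1ℚ) ≋-refl 𝐭 ⨾ ≋-refl ⟨*⟩ ≋-sym (T-1 p) ⟨+⟩ ≋-refl
  step : ∀ j → j < n → ∀ f → T⟨ p ⟩ (T⟨ p ⟩ f) ≋ 𝐮 *ₚ T⟨ p ⟩ f +ₚ 𝐭 *ₚ f →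
    T⟨ p ⟩ (T⟨ p ⟩ (X j *ₚ f)) ≋ 𝐮 *ₚ T⟨ p ⟩ (X j *ₚ f) +ₚ 𝐭 *ₚ (X j *ₚ f)
  step j _ f e with near p j
  ... | at₀ refl = T-cong p (T-X₀ p l f) ⨾ T-X₁ p l _ ⨾ ≋-refl ⟨*⟩ (lin-u- (T-lin p) (T-qt p) _ f ⨾ e ⟨-⟩ ≋-refl) ⟨+⟩ ≋-refl ⨾
    solve 5 (λ t x y g f → x :* (((t :- con 1ℚ) :* g :+ t :* f) :- (t :- con 1ℚ) :* g) :+ (t :- con 1ℚ) :*
        (y :* (g :- (t :- con 1ℚ) :* f))
       := (t :- con 1ℚ) :* (y :* (g :- (t :- con 1ℚ) :* f)) :+ t :* (x :* f)) ≋-refl 𝐭 (X p) (X (suc p)) (T⟨ p ⟩ f) f ⨾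
    ≋-refl ⟨*⟩ ≋-sym (T-X₀ p l f) ⟨+⟩ ≋-refl
  ... | at₁ refl = T-cong p (T-X₁ p l f) ⨾ lin-u+ (T-lin p) (T-qt p) _ _ ⨾
      (T-X₀ p l (T⟨ p ⟩ f) ⨾ ≋-refl ⟨*⟩ (e ⟨-⟩ ≋-refl)) ⟨+⟩ ≋-refl ⨾
    solve 5 (λ t y g f w → y :* (((t :- con 1ℚ) :* g :+ t :* f) :- (t :- con 1ℚ) :* g) :+ (t :- con 1ℚ) :* w
       := (t :- con 1ℚ) :* w :+ t :* (y :* f)) ≋-refl 𝐭 (X (suc p)) (T⟨ p ⟩ f) f (T⟨ p ⟩ (X (suc p) *ₚ f))
  ... | far a b = T-cong p (T-X-far p j a b f) ⨾ T-X-far p j a b _ ⨾ ≋-refl ⟨*⟩ e ⨾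
    solve 4 (λ t x g f → x :* ((t :- con 1ℚ) :* g :+ t :* f) := (t :- con 1ℚ) :* (x :* g) :+ t :* (x :* f)) ≋-refl 𝐭 (X j)
        (T⟨ p ⟩ f) f ⨾
    ≋-refl ⟨*⟩ ≋-sym (T-X-far p j a b f) ⟨+⟩ ≋-refl

TT⁻ : ∀ {n} p → suc p < n → (f : Poly n) → T⟨ p ⟩ (T⁻⟨ p ⟩ f) ≋ f
TT⁻ {n} p l f = T-cong p (≡⇒≋ (T⁻-eq p f)) ⨾ T-qt p 0 (ℤ.- (+ 1)) _ ⨾
    ≋-refl ⟨*⟩ (lin-u- (T-lin p) (T-qt p) _ f ⨾ T-quad p l f ⟨-⟩ ≋-refl) ⨾
  solve 4 (λ t⁻ w t f → t⁻ :* ((w :+ t :* f) :- w) := (t :* t⁻) :* f) ≋-refl 𝐭⁻ (𝐮 *ₚ T⟨ p ⟩ f) 𝐭 f ⨾ 𝐭𝐭⁻ ⟨*⟩ ≋-refl ⨾ *ₚ-idˡ f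
  where open PolySolver {n}

T⁻T : ∀ {n} p → suc p < n → (f : Poly n) → T⁻⟨ p ⟩ (T⟨ p ⟩ f) ≋ f
T⁻T {n} p l f = ≡⇒≋ (T⁻-eq p (T⟨ p ⟩ f)) ⨾ ≋-refl ⟨*⟩ (T-quad p l f ⟨-⟩ ≋-refl) ⨾
  solve 4 (λ t⁻ w t f → t⁻ :* ((w :+ t :* f) :- w) := (t :* t⁻) :* f) ≋-refl 𝐭⁻ (𝐮 *ₚ T⟨ p ⟩ f) 𝐭 f ⨾ 𝐭𝐭⁻ ⟨*⟩ ≋-refl ⨾ *ₚ-idˡ f
  where open PolySolver {n}

T-𝐭T⁻ : ∀ {n} p → (f : Poly n) → T⟨ p ⟩ f ≋ 𝐭 *ₚ T⁻⟨ p ⟩ f +ₚ 𝐮 *ₚ f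
T-𝐭T⁻ {n} p f = ≋-sym (≋-refl ⟨*⟩ ≡⇒≋ (T⁻-eq p f) ⟨+⟩ ≋-refl ⨾
  solve 4 (λ t t⁻ g w → t :* (t⁻ :* (g :- w)) :+ w := (t :* t⁻) :* (g :- w) :+ w) ≋-refl 𝐭 𝐭⁻ (T⟨ p ⟩ f) (𝐮 *ₚ f) ⨾
  (𝐭𝐭⁻ ⟨*⟩ ≋-refl ⨾ *ₚ-idˡ _) ⟨+⟩ ≋-refl ⨾ solve 2 (λ g w → (g :- w) :+ w := g) ≋-refl (T⟨ p ⟩ f) (𝐮 *ₚ f))
  where open PolySolver {n}

T-𝐭 : ∀ {n} p q → suc p < n → suc q < n → T⟨ p ⟩ (T⟨ q ⟩ (1ₚ {n})) ≋ 𝐭 *ₚ 𝐭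
T-𝐭 {n} p q _ _ = T-cong p (T-1 q ⨾ solve 1 (λ t → t := t :* con 1ℚ) ≋-refl 𝐭) ⨾ T-qt p 0 (+ 1) 1ₚ ⨾ ≋-refl ⟨*⟩ T-1 p
  where open PolySolver {n}

T-far : ∀ {n} p q → suc p < n → suc q < n → suc p < q → (f : Poly n) → T⟨ p ⟩ (T⟨ q ⟩ f) ≋ T⟨ q ⟩ (T⟨ p ⟩ f)
T-far {n} p q l l' d = mono-ind (lin-∘ (T-lin p) (T-lin q)) (lin-∘ (T-lin q) (T-lin p))
  (qt-∘ (T-lin p) (T-qt p) (T-qt q)) (qt-∘ (T-lin q) (T-qt q) (T-qt p))
  (T-𝐭 p q l l' ⨾ ≋-sym (T-𝐭 q p l' l)) step
  where
  p≢q : p ≢ q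
  p≢q e = ℕP.<⇒≢ (ℕP.<-trans (ℕP.n<1+n p) d) e
  p≢sq : p ≢ suc q
  p≢sq e = ℕP.<⇒≢ (ℕP.<-trans (ℕP.<-trans (ℕP.n<1+n p) d) (ℕP.n<1+n q)) e
  sp≢q : suc p ≢ q
  sp≢q e = ℕP.<⇒≢ d e
  sp≢sq : suc p ≢ suc q
  sp≢sq e = ℕP.<⇒≢ (ℕP.<-trans d (ℕP.n<1+n q)) e
  ≢-sym' : ∀ {a b : ℕ} → a ≢ b → b ≢ a
  ≢-sym' ne e = ne (sym e)
  step : ∀ j → j < n → ∀ f → T⟨ p ⟩ (T⟨ q ⟩ f) ≋ T⟨ q ⟩ (T⟨ p ⟩ f) → T⟨ p ⟩ (T⟨ q ⟩ (X j *ₚ f)) ≋ T⟨ q ⟩ (T⟨ p ⟩ (X j *ₚ f))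
  step j _ f e with near p j | near q j
  ... | at₀ refl | _ = T-cong p (T-X-far q p p≢q p≢sq f) ⨾ T-X₀ p l _ ⨾ ≋-refl ⟨*⟩ (e ⟨-⟩ ≋-refl) ⨾
     ≋-refl ⟨*⟩ ≋-sym (lin-u- (T-lin q) (T-qt q) _ f) ⨾ ≋-sym (T-X-far q (suc p) sp≢q sp≢sq _) ⨾ T-cong q (≋-sym (T-X₀ p l f))
  ... | at₁ refl | _ = T-cong p (T-X-far q (suc p) sp≢q sp≢sq f) ⨾ T-X₁ p l _ ⨾ ≋-refl ⟨*⟩ e ⟨+⟩ ≋-refl ⨾
     ≋-sym (T-X-far q p p≢q p≢sq _) ⟨+⟩ ≋-refl ⟨*⟩ ≋-sym (T-X-far q (suc p) sp≢q sp≢sq f) ⨾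
     ≋-sym (lin-u+ (T-lin q) (T-qt q) _ _) ⨾ T-cong q (≋-sym (T-X₁ p l f))
  ... | far a b | at₀ refl = T-cong p (T-X₀ q l' f) ⨾ T-X-far p (suc q) (≢-sym' p≢sq) (≢-sym' sp≢sq) _ ⨾
      ≋-refl ⟨*⟩ (lin-u- (T-lin p) (T-qt p) _ f ⨾ e ⟨-⟩ ≋-refl) ⨾
     ≋-sym (T-X₀ q l' _) ⨾ T-cong q (≋-sym (T-X-far p q a b f))
  ... | far a b | at₁ refl = T-cong p (T-X₁ q l' f) ⨾ lin-u+ (T-lin p) (T-qt p) _ _ ⨾
     (T-X-far p q (≢-sym' p≢q) (≢-sym' sp≢q) _ ⨾ ≋-refl ⟨*⟩ e) ⟨+⟩ ≋-refl ⟨*⟩ T-X-far p (suc q) a b f ⨾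
     ≋-sym (T-X₁ q l' _) ⨾ T-cong q (≋-sym (T-X-far p (suc q) a b f))
  ... | far a b | far c d = T-cong p (T-X-far q j c d f) ⨾ T-X-far p j a b _ ⨾ ≋-refl ⟨*⟩ e ⨾ ≋-sym (T-X-far q j c d _) ⨾
      T-cong q (≋-sym (T-X-far p j a b f))

-- Each of x_p, x_{p+1}, x_{p+2} is carried through the three generators on both sides. The
-- hypothesis `e` identifies the terms that still contain three generators; where a generator occurs
-- twice in a row, the quadratic relation brings the two sides to the same form.
T-braid : ∀ {n} p → suc (suc p) < n → (f : Poly n) →
  T⟨ p ⟩ (T⟨ suc p ⟩ (T⟨ p ⟩ f)) ≋ T⟨ suc p ⟩ (T⟨ p ⟩ (T⟨ suc p ⟩ f))
T-braid {n} p l' = mono-ind (lin-∘ l₁ (lin-∘ l₂ l₁)) (lin-∘ l₂ (lin-∘ l₁ l₂)) (qt-∘ l₁ q₁ (qt-∘ l₂ q₂ q₁))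
    (qt-∘ l₂ q₂ (qt-∘ l₁ q₁ q₂))
  (base p (suc p) ⨾ ≋-sym (base (suc p) p)) step
  where
  open PolySolver {n}
  l : suc p < n
  l = ℕP.<-trans (ℕP.n<1+n _) l'
  p' : ℕ
  p' = suc p
  l₁ : Lin T⟨ p ⟩
  l₁ = T-lin p
  l₂ : Lin T⟨ p' ⟩
  l₂ = T-lin p'
  q₁ : QT T⟨ p ⟩
  q₁ = T-qt p
  q₂ : QT T⟨ p' ⟩
  q₂ = T-qt p'
  U V : Poly n → Poly n
  U = T⟨ p ⟩
  V = T⟨ p' ⟩
  x y z : Poly n
  x = X p
  y = X p'
  z = X (suc p')
  base : ∀ a b → T⟨ a ⟩ (T⟨ b ⟩ (T⟨ a ⟩ 1ₚ)) ≋ 𝐭 *ₚ (𝐭 *ₚ 𝐭)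
  base a b = T-cong a (T-cong b (T-1 a ⨾ unit) ⨾ T-qt b 0 (+ 1) 1ₚ ⨾ ≋-refl ⟨*⟩ (T-1 b ⨾ unit)) ⨾ T-qt a 0 (+ 1) _ ⨾
    ≋-refl ⟨*⟩ (T-qt a 0 (+ 1) 1ₚ ⨾ ≋-refl ⟨*⟩ T-1 a)
    where
    unit : 𝐭 ≋ 𝐭 *ₚ 1ₚ
    unit = solve 1 (λ t → t := t :* con 1ℚ) ≋-refl 𝐭
  Uz : ∀ g → U (z *ₚ g) ≋ z *ₚ U g
  Uz = T-X-far p (suc p') (λ ()) (λ ())
  Vx : ∀ g → V (x *ₚ g) ≋ x *ₚ V g
  Vx = T-X-far p' p (λ ()) (λ ())
  step : ∀ j → j < n → ∀ f → U (V (U f)) ≋ V (U (V f)) → U (V (U (X j *ₚ f))) ≋ V (U (V (X j *ₚ f)))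
  step j _ f e with near p j | near p' j
  ... | at₀ refl | _ = lin-cong l₁ (lin-cong l₂ (T-X₀ p l f) ⨾ T-X₀ p' l' _) ⨾ Uz _ ⨾
      ≋-refl ⟨*⟩ (lin-u- l₁ q₁ _ _ ⨾ (lin-cong l₁ (lin-u- l₂ q₂ _ f) ⨾ lin-u- l₁ q₁ _ _ ⨾ e ⟨-⟩ ≋-refl) ⟨-⟩ ≋-refl ⟨*⟩
          (lin-u- l₁ q₁ _ f ⨾ T-quad p l f ⟨-⟩ ≋-refl)) ⨾
      solve 7 (λ t z w a b c f →
          z :* ((w :- (t :- con 1ℚ) :* a) :- (t :- con 1ℚ) :* (((t :- con 1ℚ) :* b :+ t :* f) :- (t :- con 1ℚ) :* b))
          := z :* ((w :- (t :- con 1ℚ) :* ((t :- con 1ℚ) :* c :+ t :* f)) :- (t :- con 1ℚ) :* (a :- (t :- con 1ℚ) :* c))) ≋-refl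
              𝐭 z (V (U (V f))) (U (V f)) (U f) (V f) f ⨾
      ≋-sym (lin-cong l₂ (lin-cong l₁ (Vx f) ⨾ T-X₀ p l _) ⨾ T-X₀ p' l' _ ⨾
        ≋-refl ⟨*⟩ ((lin-u- l₂ q₂ _ _ ⨾ ≋-refl ⟨-⟩ ≋-refl ⟨*⟩ T-quad p' l' f) ⟨-⟩ ≋-refl))
  ... | at₁ refl | _ = lin-cong l₁ (lin-cong l₂ (T-X₁ p l f) ⨾ lin-u+ l₂ q₂ _ _ ⨾ Vx _ ⟨+⟩ ≋-refl ⟨*⟩ T-X₀ p' l' f) ⨾
      lin-u+ l₁ q₁ _ _ ⨾
      (T-X₀ p l _ ⨾ ≋-refl ⟨*⟩ (e ⟨-⟩ ≋-refl)) ⟨+⟩ ≋-refl ⟨*⟩ (Uz _ ⨾ ≋-refl ⟨*⟩ lin-u- l₁ q₁ _ f) ⨾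
      ≋-sym (lin-cong l₂ (lin-cong l₁ (T-X₀ p' l' f) ⨾ Uz _ ⨾ ≋-refl ⟨*⟩ lin-u- l₁ q₁ _ f) ⨾ T-X₁ p' l' _ ⨾
          ≋-refl ⟨*⟩ lin-u- l₂ q₂ _ _ ⟨+⟩ ≋-refl)
  ... | far a b | at₁ refl = lin-cong l₁ (lin-cong l₂ (Uz f) ⨾ T-X₁ p' l' _) ⨾ lin-u+ l₁ q₁ _ _ ⨾
      (T-X₁ p l _ ⨾ ≋-refl ⟨*⟩ e ⟨+⟩ ≋-refl) ⟨+⟩ ≋-refl ⟨*⟩ (Uz _ ⨾ ≋-refl ⟨*⟩ T-quad p l f) ⨾
      solve 9 (λ t x y z w a b c f → (x :* w :+ (t :- con 1ℚ) :* (y :* a)) :+ (t :- con 1ℚ) :*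
          (z :* ((t :- con 1ℚ) :* b :+ t :* f))
          := (x :* w :+ (t :- con 1ℚ) :* (z :* (((t :- con 1ℚ) :* c :+ t :* f) :- (t :- con 1ℚ) :* c))) :+ (t :- con 1ℚ) :*
              (y :* a :+ (t :- con 1ℚ) :* (z :* b)))
        ≋-refl 𝐭 x y z (V (U (V f))) (V (U f)) (U f) (V f) f ⨾
      ≋-sym (lin-cong l₂ (lin-cong l₁ (T-X₁ p' l' f) ⨾ lin-u+ l₁ q₁ _ _ ⨾ T-X₁ p l _ ⟨+⟩ ≋-refl ⟨*⟩ Uz f) ⨾ lin-u+ l₂ q₂ _ _ ⨾
        (lin-u+ l₂ q₂ _ _ ⨾ Vx _ ⟨+⟩ ≋-refl ⟨*⟩ (T-X₀ p' l' _ ⨾ ≋-refl ⟨*⟩ (T-quad p' l' f ⟨-⟩ ≋-refl))) ⟨+⟩ ≋-refl ⟨*⟩ T-X₁ p'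
            l' _)
  ... | far a b | at₀ refl = ⊥-elim (b refl)
  ... | far a b | far c d = lin-cong l₁ (lin-cong l₂ (T-X-far p j a b f) ⨾ T-X-far p' j c d _) ⨾ T-X-far p j a b _ ⨾
      ≋-refl ⟨*⟩ e ⨾
      ≋-sym (lin-cong l₂ (lin-cong l₁ (T-X-far p' j c d f) ⨾ T-X-far p j a b _) ⨾ T-X-far p' j c d _)

-- Cherednik operators

rotM : ∀ {n} → ℕ → Mono n → Mono n
rotM w (mono q t x) = mono (q ℕ.+ w ℕ.* head0 x) t (rotl x)

opaque
  -- ω 1 is the operator ω and ω 0 its specialisation at q = 1.
  ω : ∀ {n} → ℕ → Poly n → Poly n
  ω w f = L.map (λ { (c , x) → (c , rotM w x) }) f

  ev-ω : ∀ {n} w (f : Poly n) h → ev (ω w f) h ≡ ev f (λ a → h (rotM w a))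
  ev-ω w f h = ev-map (rotM w) f h

ω-def : ∀ {n} (f : Poly n) → ωOp f ≋ ω 1 f
ω-def f = mk≋ λ h → trans (ev-map θ f h)
  (trans (ev-cong f (λ { (mono q t x) → cong h (mono-cong (cong (q ℕ.+_) (sym (ℕP.+-identityʳ (head0 x)))) refl refl) }))
      (sym (ev-ω 1 f h)))
  where
  θ : Mono _ → Mono _
  θ (mono q t x) = mono (q ℕ.+ head0 x) t (rotl x)

ω-lin : ∀ {n} w → Lin {n} (ω w)
ω-lin w = lin (λ h a → h (rotM w a)) (ev-ω w)

ω-qt : ∀ {n} w → QT {n} (ω w)
ω-qt w a z f = mk≋ λ h → trans (ev-ω w (qt a z *ₚ f) h) (trans (ev-qt a z f _)
  (trans (ev-cong f (λ { (mono q t x) → cong h (mono-cong (ℕP.+-assoc a q (w ℕ.* head0 x)) refl refl) }))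
      (sym (trans (ev-qt a z (ω w f) h) (ev-ω w f _)))))

inc-snoc : ∀ {m} j (x : Vec ℕ m) a → j < m → inc j (snoc x a) ≡ snoc (inc j x) a
inc-snoc zero (b ∷ x) a l = refl
inc-snoc (suc j) (b ∷ x) a (s≤s l) = cong (b ∷_) (inc-snoc j x a l)

inc-last : ∀ {m} (x : Vec ℕ m) a → inc m (snoc x a) ≡ snoc x (suc a)
inc-last [] a = refl
inc-last (b ∷ x) a = cong (b ∷_) (inc-last x a)

ω-X₀ : ∀ {N} w (f : Poly (suc N)) → ω w (X 0 *ₚ f) ≋ qt w (+ 0) *ₚ (X N *ₚ ω w f)
ω-X₀ {N} w f = mk≋ λ h → trans (ev-ω w (X 0 *ₚ f) h) (trans (ev-X 0 f _)
  (trans (ev-cong f (λ { (mono q t (b ∷ x)) → cong h (mono-cong (arith q b) (sym (ℤP.+-identityˡ t)) (sym (inc-last x b))) }))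
  (sym (trans (ev-qt w (+ 0) _ h) (trans (ev-X N (ω w f) _) (ev-ω w f _))))))
  where
  arith : ∀ q b → q ℕ.+ w ℕ.* suc b ≡ w ℕ.+ (q ℕ.+ w ℕ.* b)
  arith q b = trans (cong (q ℕ.+_) (ℕP.*-suc w b))
      (trans (sym (ℕP.+-assoc q w _)) (trans (cong (ℕ._+ w ℕ.* b) (ℕP.+-comm q w)) (ℕP.+-assoc w q _)))

ω-X₊ : ∀ {N} w j → j < N → (f : Poly (suc N)) → ω w (X (suc j) *ₚ f) ≋ X j *ₚ ω w f
ω-X₊ w j l f = mk≋ λ h → trans (ev-ω w (X (suc j) *ₚ f) h) (trans (ev-X (suc j) f _)
  (trans (ev-cong f (λ { (mono q t (b ∷ x)) → cong h (mono-cong refl refl (sym (inc-snoc j x b l))) }))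
  (sym (trans (ev-X j (ω w f) h) (ev-ω w f _)))))

ω-1 : ∀ {n} w → ω w (1ₚ {n}) ≋ 1ₚ
ω-1 {n} w = mk≋ λ h → trans (cong (λ e → ev (ω w e) h) 1ₚ-⟨⟩)
    (trans (ev-ω w ⟨ one ⟩ h) (trans (ev-⟨⟩ one (λ a → h (rotM w a))) (trans (cong h (fix n))
  (sym (trans (cong (λ e → ev e h) 1ₚ-⟨⟩) (ev-⟨⟩ one h))))))
  where
  snoc0 : ∀ m → snoc (V.replicate m 0) 0 ≡ V.replicate (suc m) 0
  snoc0 zero = refl
  snoc0 (suc m) = cong (0 ∷_) (snoc0 m)
  fix : ∀ n → rotM w (one {n}) ≡ one
  fix zero = mono-cong (ℕP.*-zeroʳ w) refl refl
  fix (suc m) = mono-cong (ℕP.*-zeroʳ w) refl (snoc0 m)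

ω-T : ∀ {N} w p → suc p < N → (f : Poly (suc N)) → ω w (T⟨ suc p ⟩ f) ≋ T⟨ p ⟩ (ω w f)
ω-T {N} w p l = mono-ind (lin-∘ (ω-lin w) (T-lin (suc p))) (lin-∘ (T-lin p) (ω-lin w)) (qt-∘ (ω-lin w) (ω-qt w) (T-qt (suc p)))
    (qt-∘ (T-lin p) (T-qt p) (ω-qt w))
  (lin-cong (ω-lin w) (T-1 (suc p) ⨾ unit) ⨾ ω-qt w 0 (+ 1) 1ₚ ⨾ ≋-refl ⟨*⟩ ω-1 w ⨾ ≋-sym unit ⨾ ≋-sym (T-1 p) ⨾
      T-cong p (≋-sym (ω-1 w))) step
  where
  open PolySolver {suc N}
  unit : 𝐭 ≋ 𝐭 *ₚ 1ₚ
  unit = solve 1 (λ t → t := t :* con 1ℚ) ≋-refl 𝐭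
  l₀ : suc p < suc N
  l₀ = ℕP.<-trans l (ℕP.n<1+n N)
  p<N : p < N
  p<N = ℕP.<-trans (ℕP.n<1+n p) l
  step : ∀ j → j < suc N → ∀ f → ω w (T⟨ suc p ⟩ f) ≋ T⟨ p ⟩ (ω w f) → ω w (T⟨ suc p ⟩ (X j *ₚ f)) ≋ T⟨ p ⟩ (ω w (X j *ₚ f))
  step zero _ f e = lin-cong (ω-lin w) (T-X-far (suc p) 0 (λ ()) (λ ()) f) ⨾ ω-X₀ w _ ⨾ ≋-refl ⟨*⟩ (≋-refl ⟨*⟩ e ⨾
      ≋-sym (T-X-far p N (λ eq → ℕP.<⇒≢ p<N (sym eq)) (λ eq → ℕP.<⇒≢ l (sym eq)) _)) ⨾ ≋-sym (T-qt p w (+ 0) _) ⨾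
          T-cong p (≋-sym (ω-X₀ w f))
  step (suc j) (s≤s j<N) f e with near p j
  ... | at₀ refl = lin-cong (ω-lin w) (T-X₀ (suc p) (s≤s l) f) ⨾ ω-X₊ w (suc p) l _ ⨾
      ≋-refl ⟨*⟩ (lin-u- (ω-lin w) (ω-qt w) _ f ⨾ e ⟨-⟩ ≋-refl) ⨾
      ≋-sym (T-X₀ p l₀ _) ⨾ T-cong p (≋-sym (ω-X₊ w p p<N f))
  ... | at₁ refl = lin-cong (ω-lin w) (T-X₁ (suc p) (s≤s l) f) ⨾ lin-u+ (ω-lin w) (ω-qt w) _ _ ⨾
      (ω-X₊ w p p<N _ ⨾ ≋-refl ⟨*⟩ e) ⟨+⟩ ≋-refl ⟨*⟩ ω-X₊ w (suc p) l f ⨾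
      ≋-sym (T-X₁ p l₀ _) ⨾ T-cong p (≋-sym (ω-X₊ w (suc p) l f))
  ... | far a b = lin-cong (ω-lin w) (T-X-far (suc p) (suc j) (λ eq → a (ℕP.suc-injective eq)) (λ eq → b (ℕP.suc-injective eq))
      f) ⨾ ω-X₊ w j j<N _ ⨾ ≋-refl ⟨*⟩ e ⨾
      ≋-sym (T-X-far p j a b _) ⨾ T-cong p (≋-sym (ω-X₊ w j j<N f))

-- Products of consecutive Hecke generators

chain : ∀ {n} → (ℕ → Poly n → Poly n) → ℕ → ℕ → Poly n → Poly n
chain O a zero f = f
chain O a (suc k) f = O a (chain O (suc a) k f)

module _ {n} {O : ℕ → Poly n → Poly n} (lO : ∀ p → Lin (O p)) where
  chain-lin : ∀ a k → Lin (chain O a k)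
  chain-lin a zero = lin-id
  chain-lin a (suc k) = lin-∘ (lO a) (chain-lin (suc a) k)

  chain-qt : (∀ p → QT (O p)) → ∀ a k → QT (chain O a k)
  chain-qt qO a zero _ _ _ = ≋-refl
  chain-qt qO a (suc k) = qt-∘ (lO a) (qO a) (chain-qt qO (suc a) k)

  chain-comm : {A : Poly n → Poly n} → Lin A → ∀ a k → (∀ j → a ≤ j → j < a ℕ.+ k → ∀ f → A (O j f) ≋ O j (A f)) →
    ∀ f → A (chain O a k f) ≋ chain O a k (A f)
  chain-comm lA a zero c f = ≋-refl
  chain-comm {A} lA a (suc k) c f = c a ℕP.≤-refl (ℕP.m<m+n a (s≤s z≤n)) _ ⨾
    lin-cong (lO a) (chain-comm lA (suc a) k (λ j l l' → c j (ℕP.≤-trans (ℕP.n≤1+n a) l) (subst (j <_) (sym (ℕP.+-suc a k)) l'))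
        f)

chain-snoc : ∀ {n} (O : ℕ → Poly n → Poly n) a k f → chain O a (suc k) f ≡ chain O a k (O (a ℕ.+ k) f)
chain-snoc O a zero f = cong (λ b → O b f) (sym (ℕP.+-identityʳ a))
chain-snoc O a (suc k) f = cong (O a)
    (trans (chain-snoc O (suc a) k f) (cong (λ b → chain O (suc a) k (O b f)) (sym (ℕP.+-suc a k))))

T⁻-far : ∀ {n} p q → suc p < n → suc q < n → suc p < q → (f : Poly n) → T⁻⟨ p ⟩ (T⟨ q ⟩ f) ≋ T⟨ q ⟩ (T⁻⟨ p ⟩ f)
T⁻-far p q l l' d f = ≡⇒≋ (T⁻-eq p _) ⨾ ≋-refl ⟨*⟩ (T-far p q l l' d f ⟨-⟩ ≋-refl ⨾ ≋-sym (lin-u- (T-lin q) (T-qt q) _ f)) ⨾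
    ≋-sym (T-qt q 0 (ℤ.- (+ 1)) _) ⨾
  T-cong q (≡⇒≋ (sym (T⁻-eq p f)))

T⁻-far' : ∀ {n} p q → suc p < n → suc q < n → suc q < p → (f : Poly n) → T⁻⟨ p ⟩ (T⟨ q ⟩ f) ≋ T⟨ q ⟩ (T⁻⟨ p ⟩ f)
T⁻-far' p q l l' d f = ≡⇒≋ (T⁻-eq p _) ⨾
    ≋-refl ⟨*⟩ (≋-sym (T-far q p l' l d f) ⟨-⟩ ≋-refl ⨾ ≋-sym (lin-u- (T-lin q) (T-qt q) _ f)) ⨾ ≋-sym (T-qt q 0 (ℤ.- (+ 1)) _) ⨾
  T-cong q (≡⇒≋ (sym (T⁻-eq p f)))

T⁻-braid : ∀ {n} p → suc (suc p) < n → (f : Poly n) → T⁻⟨ p ⟩ (T⁻⟨ suc p ⟩ (T⟨ p ⟩ f)) ≋ T⟨ suc p ⟩ (T⁻⟨ p ⟩ (T⁻⟨ suc p ⟩ f))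
T⁻-braid p l f = T⁻-cong p (T⁻-cong (suc p) (T-cong p (≋-sym (TT⁻ (suc p) l f) ⨾ T-cong (suc p) (≋-sym (TT⁻ p l' _))) ⨾
    T-braid p l _) ⨾ T⁻T (suc p) l _) ⨾ T⁻T p l' _
  where l' = ℕP.<-trans (ℕP.n<1+n (suc p)) l

T⁻-X₁ : ∀ {n} p → suc p < n → (f : Poly n) → T⁻⟨ p ⟩ (X (suc p) *ₚ f) ≋ 𝐭⁻ *ₚ (X p *ₚ T⟨ p ⟩ f)
T⁻-X₁ {n} p l f = ≡⇒≋ (T⁻-eq p _) ⨾
    ≋-refl ⟨*⟩ (T-X₁ p l f ⟨-⟩ ≋-refl ⨾ solve 2 (λ a b → (a :+ b) :- b := a) ≋-refl (X p *ₚ T⟨ p ⟩ f) (𝐮 *ₚ (X (suc p) *ₚ f)))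
  where open PolySolver {n}

T⁻-X-far : ∀ {n} p j → j ≢ p → j ≢ suc p → (f : Poly n) → T⁻⟨ p ⟩ (X j *ₚ f) ≋ X j *ₚ T⁻⟨ p ⟩ f
T⁻-X-far {n} p j a b f = ≡⇒≋ (T⁻-eq p _) ⨾ ≋-refl ⟨*⟩ (T-X-far p j a b f ⟨-⟩ ≋-refl) ⨾
  solve 5 (λ t⁻ x g u f → t⁻ :* (x :* g :- u :* (x :* f)) := x :* (t⁻ :* (g :- u :* f))) ≋-refl 𝐭⁻ (X j) (T⟨ p ⟩ f) 𝐮 f ⨾
      ≋-refl ⟨*⟩ ≡⇒≋ (sym (T⁻-eq p f))
  where open PolySolver {n}

-- The usual intertwiner T + (1 - t)/(1 - z), with z the ratio of two neighbouring eigenvalues,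
-- multiplied by 1 - z because the scalars contain no fractions.
intertwiner : ∀ {n} → ℕ → Poly n → Poly n → Poly n
intertwiner p z F = (1ₚ -ₚ z) *ₚ T⟨ p ⟩ F -ₚ 𝐮 *ₚ F

module Cherednik {N : ℕ} where
  up dn : ℕ → ℕ → Poly (suc N) → Poly (suc N)
  up = chain T⟨_⟩
  dn = chain T⁻⟨_⟩

  up-lin : ∀ a k → Lin (up a k)
  up-lin = chain-lin T-lin
  dn-lin : ∀ a k → Lin (dn a k)
  dn-lin = chain-lin T⁻-lin
  up-qt : ∀ a k → QT (up a k)
  up-qt = chain-qt T-lin T-qt
  dn-qt : ∀ a k → QT (dn a k)
  dn-qt = chain-qt T⁻-lin T⁻-qt

  -- Conjugation by T_a ⋯ T_{a+k-1} raises the index of a generator by one: the braid relation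
  -- applies where the chain contains T_j T_{j+1}, and the other factors commute past it.
  up-shift : ∀ k a j → a ℕ.+ k ≤ N → a ≤ j → suc j < a ℕ.+ k → ∀ f → T⟨ suc j ⟩ (up a k f) ≋ up a k (T⟨ j ⟩ f)
  up-shift zero a j _ l l' f = ⊥-elim (ℕP.<⇒≱ l' (ℕP.≤-trans (ℕP.≤-reflexive (ℕP.+-identityʳ a)) (ℕP.≤-trans l (ℕP.n≤1+n j))))
  up-shift (suc k) a j bd l l' f with a ℕ.≟ j
  up-shift (suc zero) a j _ l l' f | yes _ = ⊥-elim (ℕP.<⇒≱ l' (ℕP.≤-trans (ℕP.≤-reflexive (ℕP.+-comm a 1)) (s≤s l)))
  up-shift (suc (suc k)) a j bd l l' f | yes refl = ≋-sym (T-braid a (s≤s (ℕP.≤-trans (s≤s (s≤s (ℕP.m≤m+n a k))) bd')) _) ⨾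
      T-cong a (T-cong (suc a) (chain-comm T-lin (T-lin a) (suc (suc a)) k
        (λ i r r' g → T-far a i (s≤s (ℕP.≤-trans (s≤s (ℕP.≤-trans (ℕP.m≤m+n a k) (ℕP.n≤1+n _))) bd')) (s≤s (ℕP.≤-trans r' bd')) r
            g) f))
      where
      bd' : suc (suc (a ℕ.+ k)) ≤ N
      bd' = subst (_≤ N) (trans (ℕP.+-suc a (suc k)) (cong suc (ℕP.+-suc a k))) bd
  up-shift (suc k) a j bd l l' f | no ne =
      ≋-sym (T-far a (suc j) (ℕP.≤-trans (s≤s (s≤s l)) (ℕP.≤-trans l' (ℕP.≤-trans bd (ℕP.n≤1+n N)))) (s≤s (ℕP.≤-trans l' bd))
      (s≤s (ℕP.≤∧≢⇒< l ne)) _) ⨾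
      T-cong a (up-shift k (suc a) j (subst (_≤ N) (ℕP.+-suc a k) bd) (ℕP.≤∧≢⇒< l ne) (subst (suc j <_) (ℕP.+-suc a k) l') f)

  up-shift⁻ : ∀ k a j → a ℕ.+ k ≤ N → a ≤ j → suc j < a ℕ.+ k → ∀ f → T⁻⟨ suc j ⟩ (up a k f) ≋ up a k (T⁻⟨ j ⟩ f)
  up-shift⁻ k a j bd l l' f = T⁻-cong (suc j) (lin-cong (up-lin a k) (≋-sym (TT⁻ j sj<n f)) ⨾ ≋-sym (up-shift k a j bd l l' _)) ⨾
      T⁻T (suc j) (s≤s (ℕP.≤-trans l' bd)) _
    where
    sj<n : suc j < suc N
    sj<n = ℕP.≤-trans l' (ℕP.≤-trans bd (ℕP.n≤1+n N))

  dn-shift : ∀ k a j → a ℕ.+ k ≤ N → a ≤ j → suc j < a ℕ.+ k → ∀ f → dn a k (T⟨ j ⟩ f) ≋ T⟨ suc j ⟩ (dn a k f)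
  dn-shift zero a j _ l l' f = ⊥-elim (ℕP.<⇒≱ l' (ℕP.≤-trans (ℕP.≤-reflexive (ℕP.+-identityʳ a)) (ℕP.≤-trans l (ℕP.n≤1+n j))))
  dn-shift (suc k) a j bd l l' f with a ℕ.≟ j
  dn-shift (suc zero) a j _ l l' f | yes _ = ⊥-elim (ℕP.<⇒≱ l' (ℕP.≤-trans (ℕP.≤-reflexive (ℕP.+-comm a 1)) (s≤s l)))
  dn-shift (suc (suc k)) a j bd l l' f | yes refl = T⁻-cong a (T⁻-cong (suc a) (≋-sym (chain-comm T⁻-lin (T-lin a) (suc (suc a)) k
        (λ i r r' g → ≋-sym (T⁻-far' i a (s≤s (ℕP.≤-trans r' bd'))
            (s≤s (ℕP.≤-trans (s≤s (ℕP.≤-trans (ℕP.m≤m+n a k) (ℕP.n≤1+n _))) bd')) r g)) f))) ⨾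
      T⁻-braid a (s≤s (ℕP.≤-trans (s≤s (s≤s (ℕP.m≤m+n a k))) bd')) _
      where
      bd' : suc (suc (a ℕ.+ k)) ≤ N
      bd' = subst (_≤ N) (trans (ℕP.+-suc a (suc k)) (cong suc (ℕP.+-suc a k))) bd
  dn-shift (suc k) a j bd l l' f | no ne = T⁻-cong a
      (dn-shift k (suc a) j (subst (_≤ N) (ℕP.+-suc a k) bd) (ℕP.≤∧≢⇒< l ne) (subst (suc j <_) (ℕP.+-suc a k) l') f) ⨾
      T⁻-far a (suc j) (ℕP.≤-trans (s≤s (s≤s l)) (ℕP.≤-trans l' (ℕP.≤-trans bd (ℕP.n≤1+n N)))) (s≤s (ℕP.≤-trans l' bd))
          (s≤s (ℕP.≤∧≢⇒< l ne)) _

  -- Iterates T⁻¹ x_{p+1} = t⁻¹ x_p T: the variable travels to the left end and each inverse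
  -- generator that it passes becomes t⁻¹ times the generator.
  dn-X : ∀ k a → a ℕ.+ k ≤ N → ∀ f → dn a k (X (a ℕ.+ k) *ₚ f) ≋ qt 0 (ℤ.- (+ k)) *ₚ (X a *ₚ up a k f)
  dn-X zero a _ f = ≡⇒≋ (cong (λ b → X b *ₚ f) (ℕP.+-identityʳ a)) ⨾ ≋-sym (≡⇒≋ qt-one ⟨*⟩ ≋-refl ⨾ *ₚ-idˡ _)
  dn-X (suc k) a bd f = T⁻-cong a (≡⇒≋ (cong (λ b → dn (suc a) k (X b *ₚ f)) (ℕP.+-suc a k)) ⨾ dn-X k (suc a) bd' f) ⨾
      T⁻-qt a 0 (ℤ.- (+ k)) _ ⨾
    ≋-refl ⟨*⟩ T⁻-X₁ a (s≤s (ℕP.≤-trans (s≤s (ℕP.m≤m+n a k)) bd')) _ ⨾ ≋-sym (*ₚ-assoc _ _ _) ⨾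
        (qt-* 0 (ℤ.- (+ k)) 0 (ℤ.- (+ 1)) ⨾ ≡⇒≋ (cong (qt 0) (negsuc k))) ⟨*⟩ ≋-refl
    where
    bd' : suc (a ℕ.+ k) ≤ N
    bd' = subst (_≤ N) (ℕP.+-suc a k) bd
    negsuc : ∀ k → ℤ.- (+ k) ℤ.+ ℤ.- (+ 1) ≡ ℤ.- (+ suc k)
    negsuc k = trans (sym (ℤP.neg-distrib-+ (+ k) (+ 1))) (cong (λ e → ℤ.- (+ e)) (ℕP.+-comm k 1))

  -- Y w i d is Y_{i+1}, where i + d = n − 1; w is the weight of ω.
  Y : ℕ → ℕ → ℕ → Poly (suc N) → Poly (suc N)
  Y w i d f = qt 0 (ℤ.- (+ i)) *ₚ dn i d (ω w (up 0 i f))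

  Y-lin : ∀ w i d → Lin (Y w i d)
  Y-lin w i d = lin-mul (qt 0 (ℤ.- (+ i))) (lin-∘ (dn-lin i d) (lin-∘ (ω-lin w) (up-lin 0 i)))

  Y-qt : ∀ w i d → QT (Y w i d)
  Y-qt w i d = qt-mul (qt 0 (ℤ.- (+ i))) (qt-∘ (dn-lin i d) (dn-qt i d) (qt-∘ (ω-lin w) (ω-qt w) (up-qt 0 i)))
  private
    wk : ∀ {i d} → i ℕ.+ d ≡ N → i ≤ N
    wk {i} {d} refl = ℕP.m≤m+n i d

  Y-T-< : ∀ w i d j → i ℕ.+ d ≡ N → suc j < i → ∀ f → Y w i d (T⟨ j ⟩ f) ≋ T⟨ j ⟩ (Y w i d f)
  Y-T-< w i d j e l f = ≋-refl ⟨*⟩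
      (lin-cong (dn-lin i d) (lin-cong (ω-lin w) (≋-sym (up-shift i 0 j (wk e) z≤n l f)) ⨾ ω-T w j (ℕP.≤-trans l (wk e)) _) ⨾
      ≋-sym (chain-comm T⁻-lin (T-lin j) i d
          (λ k r r' g → ≋-sym (T⁻-far' k j (s≤s (subst (k <_) e r')) (ℕP.≤-trans l (ℕP.≤-trans (wk e) (ℕP.n≤1+n N)))
          (ℕP.≤-trans l r) g)) _)) ⨾
    ≋-sym (T-qt j 0 (ℤ.- (+ i)) _)

  Y-T-> : ∀ w i d j → i ℕ.+ d ≡ N → i < j → j < N → ∀ f → Y w i d (T⟨ j ⟩ f) ≋ T⟨ j ⟩ (Y w i d f)
  Y-T-> w i d (suc j) e (s≤s l) l' f = ≋-refl ⟨*⟩ (lin-cong (dn-lin i d) (lin-cong (ω-lin w)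
      (≋-sym (chain-comm T-lin (T-lin (suc j)) 0 i
          (λ k _ r g → ≋-sym (T-far k (suc j) (s≤s (ℕP.≤-trans r (wk e))) (s≤s l') (s≤s (ℕP.≤-trans r l)) g)) f)) ⨾
        ω-T w j l' _) ⨾ dn-shift d i j (ℕP.≤-reflexive e) l (subst (suc j <_) (sym e) l') _) ⨾
    ≋-sym (T-qt (suc j) 0 (ℤ.- (+ i)) _)

  -- The outermost inverse generator on the left cancels, and writing f = T T⁻¹ f lengthens the
  -- inner chain by one, so both sides are the same product. The factor t is the quotient of the two
  -- normalising powers.
  Y-adjacent : ∀ w i d → i ℕ.+ suc d ≡ N → ∀ f → T⟨ i ⟩ (Y w i (suc d) f) ≋ 𝐭 *ₚ Y w (suc i) d (T⁻⟨ i ⟩ f)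
  Y-adjacent w i d e f = T-qt i 0 (ℤ.- (+ i)) _ ⨾ ≋-refl ⟨*⟩ (TT⁻ i si<n _ ⨾ lin-cong (dn-lin (suc i) d) (lin-cong (ω-lin w)
      (lin-cong (up-lin 0 i) (≋-sym (TT⁻ i si<n f)) ⨾ ≡⇒≋ (sym (chain-snoc T⟨_⟩ 0 i _))))) ⨾
    ≋-sym (≋-sym (*ₚ-assoc _ _ _) ⨾ (qt-* 0 (+ 1) 0 (ℤ.- (+ suc i)) ⨾ ≡⇒≋ (cong (qt 0) (arith i))) ⟨*⟩ ≋-refl)
    where
    si<n : suc i < suc N
    si<n = s≤s (subst (suc i ≤_) e (subst (suc i ≤_) (sym (ℕP.+-suc i d)) (s≤s (ℕP.m≤m+n i d))))
    arith : ∀ i → + 1 ℤ.+ ℤ.- (+ suc i) ≡ ℤ.- (+ i)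
    arith zero = refl
    arith (suc i) = refl

  Y-suc-T : ∀ w i d → i ℕ.+ suc d ≡ N → ∀ f → Y w (suc i) d (T⟨ i ⟩ f) ≋ T⟨ i ⟩ (Y w i (suc d) f) +ₚ 𝐮 *ₚ Y w (suc i) d f
  Y-suc-T w i d e f = lin-cong (Y-lin w (suc i) d) (T-𝐭T⁻ i f) ⨾ lin-u+ (Y-lin w (suc i) d) (Y-qt w (suc i) d) _ f ⨾
    (Y-qt w (suc i) d 0 (+ 1) _ ⨾ ≋-sym (Y-adjacent w i d e f)) ⟨+⟩ ≋-refl

  Y-T-suc : ∀ w i d → i ℕ.+ suc d ≡ N → ∀ f → Y w i (suc d) (T⟨ i ⟩ f) ≋ T⟨ i ⟩ (Y w (suc i) d f) -ₚ 𝐮 *ₚ Y w (suc i) d f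
  Y-T-suc w i d e f = ≋-sym (T⁻T i si<n _) ⨾
      T⁻-cong i (Y-adjacent w i d e _ ⨾ ≋-refl ⟨*⟩ lin-cong (Y-lin w (suc i) d) (T⁻T i si<n f)) ⨾ T⁻-qt i 0 (+ 1) _ ⨾
    ≋-sym (≋-refl {f = T⟨ i ⟩ (Y w (suc i) d f) -ₚ 𝐮 *ₚ Y w (suc i) d f} ⨾ T-𝐭T⁻ i _ ⟨-⟩ ≋-refl ⨾
        solve 2 (λ a b → (a :+ b) :- b := a) ≋-refl _ (𝐮 *ₚ Y w (suc i) d f))
    where
    open PolySolver {suc N}
    si<n : suc i < suc N
    si<n = s≤s (subst (suc i ≤_) e (subst (suc i ≤_) (sym (ℕP.+-suc i d)) (s≤s (ℕP.m≤m+n i d))))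

  Eigen : ℕ → (ℕ → Poly (suc N)) → Poly (suc N) → Set
  Eigen w y F = ∀ i d → i ℕ.+ d ≡ N → Y w i d F ≋ y i *ₚ F

  module _ (w i d : ℕ) (e : i ℕ.+ suc d ≡ N) (a : ℕ) (ζ : ℤ) (F : Poly (suc N)) where
    private
      i<N : i < N
      i<N = subst (suc i ≤_) e (subst (suc i ≤_) (sym (ℕP.+-suc i d)) (s≤s (ℕP.m≤m+n i d)))
      z : Poly (suc N)
      z = qt a ζ
      expand : ∀ {A : Poly (suc N) → Poly (suc N)} → Lin A → QT A → A (intertwiner i z F) ≋ (1ₚ -ₚ z) *ₚ A (T⟨ i ⟩ F) -ₚ 𝐮 *ₚ A F
      expand {A} lA qA = lin-cong lA (solve 3 (λ z g w → (con 1ℚ :- z) :* g :- w := (g :- z :* g) :- w) ≋-refl z (T⟨ i ⟩ F)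
          (𝐮 *ₚ F)) ⨾
        lin-u- lA qA _ F ⨾ (lin-- lA _ _ ⨾ ≋-refl ⟨-⟩ qA a ζ _) ⟨-⟩ ≋-refl ⨾
        solve 3 (λ z g w → (g :- z :* g) :- w := (con 1ℚ :- z) :* g :- w) ≋-refl z (A (T⟨ i ⟩ F)) (𝐮 *ₚ A F)
        where open PolySolver {suc N}
      T-scalar : ∀ {b β} {y : Poly (suc N)} → y ≡ qt b β → ∀ g → T⟨ i ⟩ (y *ₚ g) ≋ y *ₚ T⟨ i ⟩ g
      T-scalar refl g = T-qt i _ _ g

    intertwiner-far : ∀ k k' y → k ℕ.+ k' ≡ N → k ≢ i → k ≢ suc i → (∃ λ b → ∃ λ β → y ≡ qt b β) → Y w k k' F ≋ y *ₚ F →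
      Y w k k' (intertwiner i z F) ≋ y *ₚ intertwiner i z F
    intertwiner-far k k' y e' ne ne' (b , β , yq) h = expand (Y-lin w k k') (Y-qt w k k') ⨾
        ≋-refl ⟨*⟩ (side (ℕP.<-cmp k i) ⨾ T-cong i h ⨾ T-scalar yq F) ⟨-⟩ ≋-refl ⟨*⟩ h ⨾
      solve 5 (λ z y g u f → (con 1ℚ :- z) :* (y :* g) :- u :* (y :* f) := y :* ((con 1ℚ :- z) :* g :- u :* f)) ≋-refl z y
          (T⟨ i ⟩ F) 𝐮 F
      where
      open PolySolver {suc N}
      side : Tri (k < i) (k ≡ i) (i < k) → Y w k k' (T⟨ i ⟩ F) ≋ T⟨ i ⟩ (Y w k k' F)
      side (tri< l _ _) = Y-T-> w k k' i e' l i<N F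
      side (tri≈ _ q _) = ⊥-elim (ne q)
      side (tri> _ _ l) = Y-T-< w k k' i e' (ℕP.≤∧≢⇒< l (λ q → ne' (sym q))) F

    module _ (y y' : Poly (suc N)) (b b' : ℕ) (β β' : ℤ) (yq : y ≡ qt b β) (yq' : y' ≡ qt b' β') (zy : z *ₚ y' ≋ y)
      (h : Y w i (suc d) F ≋ y *ₚ F) (h' : Y w (suc i) d F ≋ y' *ₚ F) where
      -- This is what z is chosen for: the correction terms add up to -z y' (t - 1) F, and this is
      -- -y (t - 1) F because z y' = y.
      intertwiner-suc : Y w (suc i) d (intertwiner i z F) ≋ y *ₚ intertwiner i z F
      intertwiner-suc = expand (Y-lin w (suc i) d) (Y-qt w (suc i) d) ⨾
        ≋-refl ⟨*⟩ (Y-suc-T w i d e F ⨾ (T-cong i h ⨾ T-scalar yq F) ⟨+⟩ ≋-refl ⟨*⟩ h') ⟨-⟩ ≋-refl ⟨*⟩ h' ⨾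
        solve 6 (λ z y y' g u f → (con 1ℚ :- z) :* (y :* g :+ u :* (y' :* f)) :- u :* (y' :* f) := (con 1ℚ :- z) :* (y :* g) :-
            (z :* y') :* (u :* f)) ≋-refl z y y' (T⟨ i ⟩ F) 𝐮 F ⨾
        ≋-refl ⟨-⟩ zy ⟨*⟩ ≋-refl ⨾
        solve 5 (λ z y g u f → (con 1ℚ :- z) :* (y :* g) :- y :* (u :* f) := y :* ((con 1ℚ :- z) :* g :- u :* f)) ≋-refl z y
            (T⟨ i ⟩ F) 𝐮 F
        where open PolySolver {suc N}

      intertwiner-at : Y w i (suc d) (intertwiner i z F) ≋ y' *ₚ intertwiner i z F
      intertwiner-at = expand (Y-lin w i (suc d)) (Y-qt w i (suc d)) ⨾
        ≋-refl ⟨*⟩ (Y-T-suc w i d e F ⨾ (T-cong i h' ⨾ T-scalar yq' F) ⟨-⟩ ≋-refl ⟨*⟩ h') ⟨-⟩ ≋-refl ⟨*⟩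
            (h ⨾ ≋-sym zy ⟨*⟩ ≋-refl) ⨾
        solve 5 (λ z y' g u f → (con 1ℚ :- z) :* (y' :* g :- u :* (y' :* f)) :- u :* (z :* y' :* f) := y' :*
            ((con 1ℚ :- z) :* g :- u :* f)) ≋-refl z y' (T⟨ i ⟩ F) 𝐮 F
        where open PolySolver {suc N}

  module _ (w : ℕ) (F : Poly (suc N)) (b : ℕ) (β : ℤ) (h : Y w N 0 F ≋ qt b β *ₚ F) where
    -- Up to a scalar this is x_1 ω⁻¹ F: as F is an eigenvector of Y_n, ω sends T_1 ⋯ T_{n-1} F to a
    -- multiple of F, see `ω-up`. The inverse of ω itself would require negative powers of q.
    bumped : Poly (suc N)
    bumped = X 0 *ₚ up 0 N F

    ω-up : ω w (up 0 N F) ≋ qt 0 (+ N) *ₚ (qt b β *ₚ F)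
    ω-up = ≋-sym (≋-refl ⟨*⟩ ≋-sym h ⨾ ≋-sym (*ₚ-assoc _ _ _) ⨾
        (qt-* 0 (+ N) 0 (ℤ.- (+ N)) ⨾ ≡⇒≋ (trans (cong (qt 0) (ℤP.+-inverseʳ (+ N))) qt-one)) ⟨*⟩ ≋-refl ⨾ *ₚ-idˡ _)

    bumped-zero : Y w 0 N bumped ≋ qt (w ℕ.+ b) β *ₚ bumped
    bumped-zero = ≡⇒≋ qt-one ⟨*⟩ ≋-refl ⨾ *ₚ-idˡ _ ⨾ lin-cong (dn-lin 0 N) (ω-X₀ w _ ⨾ ≋-refl ⟨*⟩ (≋-refl ⟨*⟩ ω-up) ⨾
        solve 5 (λ s x n y f → s :* (x :* (n :* (y :* f))) := s :* (n :* (y :* (x :* f)))) ≋-refl (qt w (+ 0)) (X N) (qt 0 (+ N))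
            (qt b β) F) ⨾
      dn-qt 0 N w (+ 0) _ ⨾ ≋-refl ⟨*⟩ (dn-qt 0 N 0 (+ N) _ ⨾ ≋-refl ⟨*⟩ (dn-qt 0 N b β _ ⨾ ≋-refl ⟨*⟩ dn-X N 0 ℕP.≤-refl F)) ⨾
      solve 5 (λ s n y n⁻ g → s :* (n :* (y :* (n⁻ :* g))) := (n :* n⁻) :* ((s :* y) :* g)) ≋-refl (qt w (+ 0)) (qt 0 (+ N))
          (qt b β) (qt 0 (ℤ.- (+ N))) bumped ⨾
      (qt-* 0 (+ N) 0 (ℤ.- (+ N)) ⨾ ≡⇒≋ (trans (cong (qt 0) (ℤP.+-inverseʳ (+ N))) qt-one)) ⟨*⟩
          ((qt-* w (+ 0) b β ⨾ ≡⇒≋ (cong (qt (w ℕ.+ b)) (ℤP.+-identityˡ β))) ⟨*⟩ ≋-refl) ⨾ *ₚ-idˡ _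
      where open PolySolver {suc N}

    private
      X-dn : ∀ d a → 0 < a → a ℕ.+ d ≤ N → ∀ g → dn a d (X 0 *ₚ g) ≋ X 0 *ₚ dn a d g
      X-dn d a pos bd g = ≋-sym (chain-comm T⁻-lin (lin-mul (X 0) lin-id) a d
        (λ j r _ k → ≋-sym (T⁻-X-far j 0 (λ { refl → ℕP.<⇒≱ pos r }) (λ ()) k)) g)

      dn-up : ∀ d i → i ℕ.+ suc d ≡ N → ∀ g → dn (suc i) d (up 0 N g) ≋ up 0 N (dn i d g)
      dn-up zero i e g = ≋-refl
      dn-up (suc d) i e g = T⁻-cong (suc i) (dn-up d (suc i) (trans (sym (ℕP.+-suc i (suc d))) e) g) ⨾
        up-shift⁻ N 0 i ℕP.≤-refl z≤n
            (subst (suc (suc i) ≤_) (trans (sym (ℕP.+-suc i (suc d))) e)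
            (ℕP.≤-trans (s≤s (s≤s (ℕP.m≤m+n i d))) (ℕP.≤-reflexive (cong suc (sym (ℕP.+-suc i d)))))) _

      up-up : ∀ a i → a ℕ.+ suc i ≤ N → ∀ g → up (suc a) i (up 0 N g) ≋ up 0 N (up a i g)
      up-up a zero _ g = ≋-refl
      up-up a (suc i) l g = T-cong (suc a) (up-up (suc a) i l' g) ⨾
          up-shift N 0 a ℕP.≤-refl z≤n (ℕP.≤-trans (s≤s (s≤s (ℕP.m≤m+n a i))) (subst (_≤ N) (cong suc (ℕP.+-suc a i)) l')) _
        where
        l' : suc (a ℕ.+ suc i) ≤ N
        l' = subst (_≤ N) (ℕP.+-suc a (suc i)) l

      ω-ups : ∀ a k → a ℕ.+ suc k ≤ N → ∀ g → ω w (up (suc a) k g) ≋ up a k (ω w g)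
      ω-ups a zero _ g = ≋-refl
      ω-ups a (suc k) l g = ω-T w a (ℕP.≤-trans (s≤s (s≤s (ℕP.m≤m+n a k))) (subst (_≤ N) (cong suc (ℕP.+-suc a k)) l')) _ ⨾
          T-cong a (ω-ups (suc a) k l' g)
        where
        l' : suc (a ℕ.+ suc k) ≤ N
        l' = subst (_≤ N) (ℕP.+-suc a (suc k)) l

    -- The chain T_1 ⋯ T_{n-1} raises the indices of generators and ω lowers them. So x_1 T_1 ⋯
    -- T_{n-1} carries Y_{i+1} to Y_{i+2}, and all eigenvalues but the last move one place to the
    -- right.
    bumped-suc : ∀ i d M → N ≡ suc M → i ℕ.+ suc d ≡ N → Y w (suc i) d bumped ≋ X 0 *ₚ up 0 N (Y w i (suc d) F)
    bumped-suc i d M refl e = ≋-refl ⟨*⟩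
        (lin-cong (dn-lin (suc i) d) (lin-cong (ω-lin w) front ⨾ ω-qt w 0 (+ 1) _ ⨾
        ≋-refl ⟨*⟩ (ω-X₊ w 0 (s≤s z≤n) _ ⨾ ≋-refl ⟨*⟩ ω-ups 0 M ℕP.≤-refl _)) ⨾
        dn-qt (suc i) d 0 (+ 1) _ ⨾ ≋-refl ⟨*⟩ (X-dn d (suc i) (s≤s z≤n) (ℕP.≤-reflexive (trans (sym (ℕP.+-suc i d)) e)) _ ⨾
            ≋-refl ⟨*⟩ back)) ⨾
      solve 4 (λ a t x g → a :* (t :* (x :* g)) := x :* ((t :* a) :* g)) ≋-refl (qt 0 (ℤ.- (+ suc i))) 𝐭 (X 0)
          (up 0 N (dn i (suc d) G)) ⨾
      ≋-refl ⟨*⟩ ((qt-* 0 (+ 1) 0 (ℤ.- (+ suc i)) ⨾ ≡⇒≋ (cong (qt 0) (arith i))) ⟨*⟩ ≋-refl ⨾ ≋-sym (up-qt 0 N 0 (ℤ.- (+ i)) _))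
      where
      open PolySolver {suc N}
      G : Poly (suc N)
      G = ω w (up 0 i F)
      arith : ∀ i → + 1 ℤ.+ ℤ.- (+ suc i) ≡ ℤ.- (+ i)
      arith zero = refl
      arith (suc i) = refl
      i<N : suc i ≤ N
      i<N = subst (suc i ≤_) (trans (sym (ℕP.+-suc i d)) e) (s≤s (ℕP.m≤m+n i d))
      iM : i ℕ.+ d ≡ M
      iM = ℕP.suc-injective (trans (sym (ℕP.+-suc i d)) e)
      -- The generator at position 0 turns x_1 into t x_2 and is itself inverted, which cancels the
      -- first generator of the shifted chain; ω will move x_2 back to x_1.
      front : up 0 (suc i) bumped ≋ 𝐭 *ₚ (X 1 *ₚ up 1 M (up 0 i F))
      front = T-cong 0 (≋-sym (chain-comm T-lin (lin-mul (X 0) lin-id) 1 i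
          (λ { (suc j) _ _ k → ≋-sym (T-X-far (suc j) 0 (λ ()) (λ ()) k) }) _)) ⨾
        T-X₀ 0 (s≤s (s≤s z≤n)) _ ⨾ ≋-refl ⟨*⟩ (T-𝐭T⁻ 0 _ ⟨-⟩ ≋-refl ⨾ solve 2 (λ a b → (a :+ b) :- b := a) ≋-refl _ _ ⨾
            ≋-refl ⟨*⟩ (T⁻-cong 0 (up-up 0 i i<N F) ⨾ T⁻T 0 (s≤s (s≤s z≤n)) _)) ⨾
        solve 3 (λ x t g → x :* (t :* g) := t :* (x :* g)) ≋-refl (X 1) 𝐭 (up 1 M (up 0 i F))
      back : dn (suc i) d (up 0 M G) ≋ up 0 N (dn i (suc d) G)
      back = lin-cong (dn-lin (suc i) d) (lin-cong (up-lin 0 M) (≋-sym (TT⁻ M ℕP.≤-refl G)) ⨾ ≡⇒≋ (sym (chain-snoc T⟨_⟩ 0 M _)))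
          ⨾ dn-up d i e _ ⨾
        lin-cong (up-lin 0 N) (≡⇒≋ (trans (cong (λ m → dn i d (T⁻⟨ m ⟩ G)) (sym iM)) (sym (chain-snoc T⁻⟨_⟩ i d G))))

    bumped-suc-eigen : ∀ i d c γ → i ℕ.+ suc d ≡ N → Y w i (suc d) F ≋ qt c γ *ₚ F → Y w (suc i) d bumped ≋ qt c γ *ₚ bumped
    bumped-suc-eigen i d c γ e h' = bumped-suc i d (i ℕ.+ d) (trans (sym e) (ℕP.+-suc i d)) e ⨾
        ≋-refl ⟨*⟩ (lin-cong (up-lin 0 N) h' ⨾ up-qt 0 N c γ F) ⨾
      solve 3 (λ x y g → x :* (y :* g) := y :* (x :* g)) ≋-refl (X 0) (qt c γ) (up 0 N F)
      where open PolySolver {suc N}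

open Cherednik public

foldr-applyUpTo : ∀ {n} (O O' : ℕ → Poly n → Poly n) → (∀ p → Lin (O' p)) → (∀ p f → O (suc p) f ≋ O' p f) → ∀ a k (g : ℕ → ℕ) →
    (∀ j → g j ≡ suc (a ℕ.+ j)) →
  ∀ f f' → f ≋ f' → L.foldr O f (L.applyUpTo g k) ≋ chain O' a k f'
foldr-applyUpTo O O' lO' h a zero g e f f' ff = ff
foldr-applyUpTo O O' lO' h a (suc k) g e f f' ff =
    ≡⇒≋ (cong (λ b → O b (L.foldr O f (L.applyUpTo (λ j → g (suc j)) k))) (trans (e 0) (cong suc (ℕP.+-identityʳ a)))) ⨾ h a _ ⨾
  lin-cong (lO' a) (foldr-applyUpTo O O' lO' h (suc a) k (λ j → g (suc j)) (λ j → trans (e (suc j)) (cong suc (ℕP.+-suc a j))) f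
      f' ff)

YOp-def : ∀ {N} i d → i ℕ.+ d ≡ N → (f : Poly (suc N)) → YOp (suc i) f ≋ Y 1 i d f
YOp-def {N} i d e f = ≡⇒≋ (sym (trans (*ₚ-def (qt 0 (ℤ.- (+ i))) body) (cong (_⊗ body) (qt-def 0 (ℤ.- (+ i)))))) ⨾
    ≋-refl ⟨*⟩ inner
  where
  body : Poly (suc N)
  body = L.foldr TinvOp (ωOp (L.foldr TOp f (L.map suc (L.upTo i)))) (L.map (suc i ℕ.+_) (L.upTo (suc N ∸ suc i)))
  ups : L.foldr TOp f (L.map suc (L.upTo i)) ≋ up 0 i f
  ups = ≡⇒≋ (cong (L.foldr TOp f) (LP.map-upTo suc i)) ⨾
      foldr-applyUpTo TOp T⟨_⟩ T-lin (λ p g → ≡⇒≋ (T-def p g)) 0 i suc (λ j → refl) f f ≋-refl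
  inner : body ≋ dn i d (ω 1 (up 0 i f))
  inner = ≡⇒≋ (cong (L.foldr TinvOp _)
      (trans (LP.map-upTo (suc i ℕ.+_) (N ∸ i))
      (cong (L.applyUpTo (suc i ℕ.+_)) (trans (cong (_∸ i) (sym e)) (ℕP.m+n∸m≡n i d))))) ⨾
    foldr-applyUpTo TinvOp T⁻⟨_⟩ T⁻-lin T⁻-def i d (suc i ℕ.+_) (λ j → refl) _ _ (ω-def _ ⨾ lin-cong (ω-lin 1) ups)

-- Ranks and types of compositions

+-left : ∀ a b c → a ℕ.+ (b ℕ.+ c) ≡ b ℕ.+ (a ℕ.+ c)
+-left a b c = trans (sym (ℕP.+-assoc a b c)) (trans (cong (ℕ._+ c) (ℕP.+-comm a b)) (ℕP.+-assoc b a c))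

bit : Bool → ℕ
bit b = if b then 1 else 0

cge : ∀ {n} → ℕ → Vec ℕ n → ℕ
cge a [] = 0
cge a (y ∷ ys) = bit (a ℕ.≤ᵇ y) ℕ.+ cge a ys

-- rank p v is the exponent yExp at the 0-based position p: the number of entries larger than the one at p,
-- where among equal entries those further right count as larger.
rank : ∀ {n} → ℕ → Vec ℕ n → ℕ
rank p [] = 0
rank zero (a ∷ ys) = cge a ys
rank (suc p) (x ∷ xs) = bit (getAt p xs ℕ.<ᵇ x) ℕ.+ rank p xs

lookup-getAt : ∀ {n} (v : Vec ℕ n) (i : Fin n) → V.lookup v i ≡ getAt (F.toℕ i) v
lookup-getAt (x ∷ v) F.zero = refl
lookup-getAt (x ∷ v) (F.suc i) = lookup-getAt v i

private
  count : ∀ {n} → (Fin n → Bool) → ℕ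
  count P = sum (L.tabulate (λ j → bit (P j)))

  countF-count : ∀ {n} (P : Fin n → Bool) → countF P ≡ count P
  countF-count P = cong sum (LP.map-tabulate (λ j → j) (λ j → if P j then 1 else 0))

  count-false : ∀ {n} → count {n} (λ _ → false) ≡ 0
  count-false {zero} = refl
  count-false {suc n} = count-false {n}

  count-cge : ∀ {n} a (v : Vec ℕ n) → count (λ j → a ℕ.≤ᵇ V.lookup v j) ≡ cge a v
  count-cge a [] = refl
  count-cge a (y ∷ v) = cong (bit (a ℕ.≤ᵇ y) ℕ.+_) (count-cge a v)

  rank-count : ∀ {n} (η : Vec ℕ n) (i : Fin n) →
    count (λ j → (F.toℕ i ℕ.<ᵇ F.toℕ j) ∧ (V.lookup η i ℕ.≤ᵇ V.lookup η j)) ℕ.+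
    count (λ j → (F.toℕ j ℕ.<ᵇ F.toℕ i) ∧ (V.lookup η i ℕ.<ᵇ V.lookup η j)) ≡ rank (F.toℕ i) η
  rank-count {suc n} (a ∷ ys) F.zero = trans (cong₂ ℕ._+_ (count-cge a ys) (count-false {n})) (ℕP.+-identityʳ _)
  rank-count (x ∷ xs) (F.suc i) =
      trans (+-left (count (λ j → (F.toℕ i ℕ.<ᵇ F.toℕ j) ∧ (V.lookup xs i ℕ.≤ᵇ V.lookup xs j))) (bit (V.lookup xs i ℕ.<ᵇ x)) _)
    (cong₂ (λ y z → bit (y ℕ.<ᵇ x) ℕ.+ z) (lookup-getAt xs i) (rank-count xs i))

yExp-rank : ∀ {n} (η : Vec ℕ n) i → yExp η i ≡ rank (F.toℕ i) η
yExp-rank η i = trans (cong₂ ℕ._+_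
  (countF-count (λ j → (F.toℕ i ℕ.<ᵇ F.toℕ j) ∧ (V.lookup η i ℕ.≤ᵇ V.lookup η j)))
  (countF-count (λ j → (F.toℕ j ℕ.<ᵇ F.toℕ i) ∧ (V.lookup η i ℕ.<ᵇ V.lookup η j)))) (rank-count η i)

countGe-cge : ∀ {n} b (η : Vec ℕ n) → countGe b η ≡ cge b η
countGe-cge b η = trans (countF-count (λ i → b ℕ.≤ᵇ V.lookup η i)) (count-cge b η)

<ᵇ-true : ∀ {a b} → a < b → (a ℕ.<ᵇ b) ≡ true
<ᵇ-true = ≤ᵇ-true

<ᵇ-false : ∀ {a b} → b ≤ a → (a ℕ.<ᵇ b) ≡ false
<ᵇ-false l = ≤ᵇ-false (s≤s l)

<ᵇ-suc : ∀ v a → (v ℕ.<ᵇ suc a) ≡ (v ℕ.≤ᵇ a)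
<ᵇ-suc zero a = refl
<ᵇ-suc (suc v) a = refl

≤ᵇ-not : ∀ a b → (a ℕ.≤ᵇ b) ≡ Bool.not (b ℕ.<ᵇ a)
≤ᵇ-not a b with a ℕ.≤? b
... | yes l = trans (≤ᵇ-true l) (sym (cong Bool.not (<ᵇ-false l)))
... | no l = trans (≤ᵇ-false (ℕP.≰⇒> l)) (sym (cong Bool.not (<ᵇ-true (ℕP.≰⇒> l))))

cge-swap : ∀ {n} a p (v : Vec ℕ n) → suc p < n → cge a (swapAt p v) ≡ cge a v
cge-swap a zero (x ∷ []) (s≤s ())
cge-swap a zero (x ∷ y ∷ v) l = +-left (bit (a ℕ.≤ᵇ y)) (bit (a ℕ.≤ᵇ x)) _
cge-swap a (suc p) (x ∷ v) (s≤s l) = cong (bit (a ℕ.≤ᵇ x) ℕ.+_) (cge-swap a p v l)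

getAt-swap-far : ∀ {n} p j (v : Vec ℕ n) → j ≢ p → j ≢ suc p → getAt j (swapAt p v) ≡ getAt j v
getAt-swap-far p j [] _ _ = refl
getAt-swap-far zero zero (x ∷ v) ne _ = ⊥-elim (ne refl)
getAt-swap-far zero (suc j) (x ∷ []) _ _ = refl
getAt-swap-far zero (suc zero) (x ∷ y ∷ v) _ ne = ⊥-elim (ne refl)
getAt-swap-far zero (suc (suc j)) (x ∷ y ∷ v) _ _ = refl
getAt-swap-far (suc p) zero (x ∷ v) _ _ = refl
getAt-swap-far (suc p) (suc j) (x ∷ v) a b = getAt-swap-far p j v (λ e → a (cong suc e)) (λ e → b (cong suc e))

getAt-swap₀ : ∀ {n} p (v : Vec ℕ n) → suc p < n → getAt p (swapAt p v) ≡ getAt (suc p) v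
getAt-swap₀ p v l = get-put₀ p _ _ v l

getAt-swap₁ : ∀ {n} p (v : Vec ℕ n) → suc p < n → getAt (suc p) (swapAt p v) ≡ getAt p v
getAt-swap₁ p v l = get-put₁ p _ _ v l

rank-swap₁ : ∀ {n} p (v : Vec ℕ n) → suc p < n → getAt (suc p) v < getAt p v → rank (suc p) (swapAt p v) ≡ rank p v
rank-swap₁ zero (x ∷ []) (s≤s ())
rank-swap₁ zero (x ∷ y ∷ v) l d rewrite <ᵇ-false {x} {y} (ℕP.<⇒≤ d) | ≤ᵇ-false d = refl
rank-swap₁ (suc p) (x ∷ v) (s≤s l) d = cong₂ (λ a b → bit (a ℕ.<ᵇ x) ℕ.+ b) (getAt-swap₁ p v l) (rank-swap₁ p v l d)

rank-swap₀ : ∀ {n} p (v : Vec ℕ n) → suc p < n → getAt (suc p) v < getAt p v → rank p (swapAt p v) ≡ rank (suc p) v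
rank-swap₀ zero (x ∷ []) (s≤s ())
rank-swap₀ zero (x ∷ y ∷ v) l d rewrite <ᵇ-true d | ≤ᵇ-true (ℕP.<⇒≤ d) = refl
rank-swap₀ (suc p) (x ∷ v) (s≤s l) d = cong₂ (λ a b → bit (a ℕ.<ᵇ x) ℕ.+ b) (getAt-swap₀ p v l) (rank-swap₀ p v l d)

rank-swap-far : ∀ {n} p j (v : Vec ℕ n) → suc p < n → j ≢ p → j ≢ suc p → rank j (swapAt p v) ≡ rank j v
rank-swap-far zero zero (x ∷ v) l ne _ = ⊥-elim (ne refl)
rank-swap-far zero (suc j) (x ∷ []) (s≤s ())
rank-swap-far zero (suc zero) (x ∷ y ∷ v) l _ ne = ⊥-elim (ne refl)
rank-swap-far zero (suc (suc j)) (x ∷ y ∷ v) l _ _ = +-left (bit (getAt j v ℕ.<ᵇ y)) (bit (getAt j v ℕ.<ᵇ x)) _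
rank-swap-far (suc p) zero (x ∷ v) (s≤s l) _ _ = cge-swap x p v l
rank-swap-far (suc p) (suc j) (x ∷ v) (s≤s l) a b = cong₂ (λ y z → bit (y ℕ.<ᵇ x) ℕ.+ z)
  (getAt-swap-far p j v (λ e → a (cong suc e)) (λ e → b (cong suc e)))
  (rank-swap-far p j v l (λ e → a (cong suc e)) (λ e → b (cong suc e)))

getAt-snoc : ∀ {N} j (xs : Vec ℕ N) a → j < N → getAt j (snoc xs a) ≡ getAt j xs
getAt-snoc zero (x ∷ xs) a l = refl
getAt-snoc (suc j) (x ∷ xs) a (s≤s l) = getAt-snoc j xs a l

getAt-last : ∀ {N} (xs : Vec ℕ N) a → getAt N (snoc xs a) ≡ a
getAt-last [] a = refl
getAt-last (x ∷ xs) a = getAt-last xs a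

cge-snoc : ∀ {N} b (xs : Vec ℕ N) a → cge b (snoc xs a) ≡ cge b xs ℕ.+ bit (b ℕ.≤ᵇ a)
cge-snoc b [] a = ℕP.+-identityʳ _
cge-snoc b (x ∷ xs) a = trans (cong (bit (b ℕ.≤ᵇ x) ℕ.+_) (cge-snoc b xs a)) (sym (ℕP.+-assoc (bit (b ℕ.≤ᵇ x)) _ _))

rank-bump₀ : ∀ {N} (xs : Vec ℕ N) a → rank N (snoc xs a) ≡ cge (suc a) xs
rank-bump₀ [] a = refl
rank-bump₀ (x ∷ xs) a = cong₂ (λ y z → bit (y ℕ.<ᵇ x) ℕ.+ z) (getAt-last xs a) (rank-bump₀ xs a)

rank-snoc : ∀ {N} j (xs : Vec ℕ N) a → j < N → rank j (snoc xs a) ≡ bit (getAt j xs ℕ.≤ᵇ a) ℕ.+ rank j xs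
rank-snoc zero (x ∷ xs) a l = trans (cge-snoc x xs a) (ℕP.+-comm (cge x xs) _)
rank-snoc (suc j) (x ∷ xs) a (s≤s l) = trans (cong₂ (λ y z → bit (y ℕ.<ᵇ x) ℕ.+ z) (getAt-snoc j xs a l) (rank-snoc j xs a l))
  (+-left (bit (getAt j xs ℕ.<ᵇ x)) (bit (getAt j xs ℕ.≤ᵇ a)) _)

rank-bump₊ : ∀ {N} j (xs : Vec ℕ N) a → j < N → rank (suc j) (suc a ∷ xs) ≡ rank j (snoc xs a)
rank-bump₊ j xs a l = trans (cong (λ e → bit e ℕ.+ rank j xs) (<ᵇ-suc (getAt j xs) a)) (sym (rank-snoc j xs a l))

-- At q = 1 two compositions have the same type exactly when the eigenvalues of the Y_i agree.
HeadType : ∀ {n} → ℕ → Vec ℕ n → ℕ → Vec ℕ n → Set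
HeadType x [] y [] = ⊤
HeadType x (a ∷ as) y (b ∷ bs) = ((x ℕ.≤ᵇ a) ≡ (y ℕ.≤ᵇ b)) × HeadType x as y bs

infix 4 _~_
_~_ : ∀ {n} → Vec ℕ n → Vec ℕ n → Set
[] ~ [] = ⊤
(x ∷ xs) ~ (y ∷ ys) = HeadType x xs y ys × xs ~ ys

HeadType-get : ∀ {n x y} (xs ys : Vec ℕ n) → HeadType x xs y ys → ∀ j → j < n → (x ℕ.≤ᵇ getAt j xs) ≡ (y ℕ.≤ᵇ getAt j ys)
HeadType-get (a ∷ xs) (b ∷ ys) (e , h) zero l = e
HeadType-get (a ∷ xs) (b ∷ ys) (e , h) (suc j) (s≤s l) = HeadType-get xs ys h j l

HeadType-mk : ∀ {n x y} (xs ys : Vec ℕ n) → (∀ j → j < n → (x ℕ.≤ᵇ getAt j xs) ≡ (y ℕ.≤ᵇ getAt j ys)) → HeadType x xs y ys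
HeadType-mk [] [] h = tt
HeadType-mk (a ∷ xs) (b ∷ ys) h = h 0 (s≤s z≤n) , HeadType-mk xs ys (λ j l → h (suc j) (s≤s l))

~-get : ∀ {n} (v v' : Vec ℕ n) → v ~ v' → ∀ i j → i < j → j < n → (getAt i v ℕ.≤ᵇ getAt j v) ≡ (getAt i v' ℕ.≤ᵇ getAt j v')
~-get (x ∷ xs) (y ∷ ys) (h , _) zero (suc j) _ (s≤s l) = HeadType-get xs ys h j l
~-get (x ∷ xs) (y ∷ ys) (_ , h) (suc i) (suc j) (s≤s d) (s≤s l) = ~-get xs ys h i j d l

~-mk : ∀ {n} (v v' : Vec ℕ n) → (∀ i j → i < j → j < n → (getAt i v ℕ.≤ᵇ getAt j v) ≡ (getAt i v' ℕ.≤ᵇ getAt j v')) → v ~ v'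
~-mk [] [] h = tt
~-mk (x ∷ xs) (y ∷ ys) h = HeadType-mk xs ys (λ j l → h 0 (suc j) (s≤s z≤n) (s≤s l)) , ~-mk xs ys
    (λ i j d l → h (suc i) (suc j) (s≤s d) (s≤s l))

~-refl : ∀ {n} {v : Vec ℕ n} → v ~ v
~-refl {v = v} = ~-mk v v (λ _ _ _ _ → refl)

~-sym : ∀ {n} {v v' : Vec ℕ n} → v ~ v' → v' ~ v
~-sym {v = v} {v'} h = ~-mk v' v (λ i j d l → sym (~-get v v' h i j d l))

~-trans : ∀ {n} {v v' v'' : Vec ℕ n} → v ~ v' → v' ~ v'' → v ~ v''
~-trans {v = v} {v'} {v''} h h' = ~-mk v v'' (λ i j d l → trans (~-get v v' h i j d l) (~-get v' v'' h' i j d l))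

HeadType-cge : ∀ {n x y} (xs ys : Vec ℕ n) → HeadType x xs y ys → cge x xs ≡ cge y ys
HeadType-cge [] [] h = refl
HeadType-cge (a ∷ xs) (b ∷ ys) (e , h) = cong₂ (λ u w → bit u ℕ.+ w) e (HeadType-cge xs ys h)

private
  not-inj : ∀ {a b} → Bool.not a ≡ Bool.not b → a ≡ b
  not-inj {false} {false} _ = refl
  not-inj {true} {true} _ = refl

  flip-≤ : ∀ a b c d → (a ℕ.≤ᵇ b) ≡ (c ℕ.≤ᵇ d) → (b ℕ.<ᵇ a) ≡ (d ℕ.<ᵇ c)
  flip-≤ a b c d e = not-inj (trans (sym (≤ᵇ-not a b)) (trans e (≤ᵇ-not c d)))

  flip-< : ∀ a b c d → (a ℕ.<ᵇ b) ≡ (c ℕ.<ᵇ d) → (b ℕ.≤ᵇ a) ≡ (d ℕ.≤ᵇ c)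
  flip-< a b c d e = trans (≤ᵇ-not b a) (trans (cong Bool.not e) (sym (≤ᵇ-not d c)))

~-rank : ∀ {n} (v v' : Vec ℕ n) → v ~ v' → ∀ j → j < n → rank j v ≡ rank j v'
~-rank (x ∷ xs) (y ∷ ys) (h , _) zero _ = HeadType-cge xs ys h
~-rank (x ∷ xs) (y ∷ ys) (h , t) (suc j) (s≤s l) = cong₂ (λ u w → bit u ℕ.+ w)
  (flip-≤ x (getAt j xs) y (getAt j ys) (HeadType-get xs ys h j l)) (~-rank xs ys t j l)

cge-mono : ∀ {n} {a b} (v : Vec ℕ n) → a ≤ b → cge b v ≤ cge a v
cge-mono [] l = z≤n
cge-mono {a = a} {b} (x ∷ v) l = ℕP.+-mono-≤ (bit-mono (b ℕ.≤? x)) (cge-mono v l)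
  where
  bit-mono : Dec (b ≤ x) → bit (b ℕ.≤ᵇ x) ≤ bit (a ℕ.≤ᵇ x)
  bit-mono (yes r) rewrite ≤ᵇ-true r | ≤ᵇ-true (ℕP.≤-trans l r) = ℕP.≤-refl
  bit-mono (no r) rewrite ≤ᵇ-false (ℕP.≰⇒> r) = z≤n

private
  rank-< : ∀ {n} x (xs : Vec ℕ n) j → j < n → x ≤ getAt j xs → rank j xs < cge x xs
  rank-< x (a ∷ xs) zero _ l rewrite ≤ᵇ-true l = s≤s (cge-mono xs l)
  rank-< x (a ∷ xs) (suc j) (s≤s d) l = ℕP.≤-trans (s≤s (ℕP.+-monoˡ-≤ (rank j xs) (bits (x ℕ.≤? a))))
    (ℕP.≤-trans (ℕP.≤-reflexive (sym (ℕP.+-suc _ (rank j xs)))) (ℕP.+-monoʳ-≤ (bit (x ℕ.≤ᵇ a)) (rank-< x xs j d l)))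
    where
    bits : Dec (x ≤ a) → bit (getAt j xs ℕ.<ᵇ a) ≤ bit (x ℕ.≤ᵇ a)
    bits (yes r) rewrite ≤ᵇ-true r with getAt j xs ℕ.<ᵇ a
    ... | true = ℕP.≤-refl
    ... | false = z≤n
    bits (no r) rewrite <ᵇ-false {getAt j xs} {a} (ℕP.≤-trans (ℕP.<⇒≤ (ℕP.≰⇒> r)) l) = z≤n

  rank-≥ : ∀ {n} x (xs : Vec ℕ n) j → j < n → getAt j xs < x → cge x xs ≤ rank j xs
  rank-≥ x (a ∷ xs) zero _ l rewrite ≤ᵇ-false {x} {a} l = cge-mono xs (ℕP.<⇒≤ l)
  rank-≥ x (a ∷ xs) (suc j) (s≤s d) l = ℕP.+-mono-≤ (bits (x ℕ.≤? a)) (rank-≥ x xs j d l)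
    where
    bits : Dec (x ≤ a) → bit (x ℕ.≤ᵇ a) ≤ bit (getAt j xs ℕ.<ᵇ a)
    bits (yes r) rewrite ≤ᵇ-true r | <ᵇ-true {getAt j xs} {a} (ℕP.≤-trans l r) = ℕP.≤-refl
    bits (no r) rewrite ≤ᵇ-false (ℕP.≰⇒> r) = z≤n

  head-cmp : ∀ {n} x (xs : Vec ℕ n) y (ys : Vec ℕ n) j → j < n → cge x xs ≡ cge y ys →
    bit (getAt j xs ℕ.<ᵇ x) ℕ.+ rank j xs ≡ bit (getAt j ys ℕ.<ᵇ y) ℕ.+ rank j ys → x ≤ getAt j xs → y ≤ getAt j ys
  head-cmp x xs y ys j d e e' l with y ℕ.≤? getAt j ys
  ... | yes r = r
  ... | no r = ⊥-elim (ℕP.<⇒≱ (ℕP.≤-trans (rank-< x xs j d l) (ℕP.≤-trans (ℕP.≤-reflexive e) (rank-≥ y ys j d (ℕP.≰⇒> r)))) lower)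
    where
    lower : rank j ys ≤ rank j xs
    lower = ℕP.≤-trans (ℕP.m≤n+m (rank j ys) (bit (getAt j ys ℕ.<ᵇ y)))
      (ℕP.≤-reflexive (trans (sym e') (cong (λ b → bit b ℕ.+ rank j xs) (<ᵇ-false l))))

-- The rank of the head separates the ranks, within the tail, of the entries that are at least the
-- head from those of the smaller entries. So equal ranks force equal comparisons with the head
-- (`head-cmp`); these contributions then cancel and the tails have equal ranks as well.
rank-~ : ∀ {n} (v v' : Vec ℕ n) → (∀ j → j < n → rank j v ≡ rank j v') → v ~ v'
rank-~ [] [] h = tt
rank-~ {suc n} (x ∷ xs) (y ∷ ys) h = HeadType-mk xs ys cmp , rank-~ xs ys tail
  where
  cmp : ∀ j → j < n → (x ℕ.≤ᵇ getAt j xs) ≡ (y ℕ.≤ᵇ getAt j ys)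
  cmp j l with x ℕ.≤? getAt j xs | y ℕ.≤? getAt j ys
  ... | yes a | _ = trans (≤ᵇ-true a) (sym (≤ᵇ-true (head-cmp x xs y ys j l (h 0 (s≤s z≤n)) (h (suc j) (s≤s l)) a)))
  ... | no a | yes b = ⊥-elim (a (head-cmp y ys x xs j l (sym (h 0 (s≤s z≤n))) (sym (h (suc j) (s≤s l))) b))
  ... | no a | no b = trans (≤ᵇ-false (ℕP.≰⇒> a)) (sym (≤ᵇ-false (ℕP.≰⇒> b)))
  tail : ∀ j → j < n → rank j xs ≡ rank j ys
  tail j l = ℕP.+-cancelˡ-≡ (bit (getAt j xs ℕ.<ᵇ x)) _ _ (trans (h (suc j) (s≤s l))
    (cong (λ b → bit b ℕ.+ rank j ys) (sym (flip-≤ x (getAt j xs) y (getAt j ys) (cmp j l)))))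

-- Since a + 1 ≤ x fails exactly when x ≤ a, the comparisons of the shifted part at the front carry
-- the same information as those of the original part at the end.
~-unbump : ∀ {N} a b (xs ys : Vec ℕ N) → (suc a ∷ xs) ~ (suc b ∷ ys) → snoc xs a ~ snoc ys b
~-unbump a b [] [] _ = tt , tt
~-unbump a b (x ∷ xs) (y ∷ ys) ((e , h) , (k , t)) = HT xs ys k , ~-unbump a b xs ys (h , t)
  where
  HT : ∀ {n} (as bs : Vec ℕ n) → HeadType x as y bs → HeadType x (snoc as a) y (snoc bs b)
  HT [] [] _ = flip-< a x b y e , tt
  HT (_ ∷ as) (_ ∷ bs) (p , q) = p , HT as bs q

~-unswap : ∀ {n} p (v v' : Vec ℕ n) → suc p < n → getAt (suc p) v < getAt p v → getAt (suc p) v' < getAt p v' →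
  swapAt p v ~ swapAt p v' → v ~ v'
~-unswap zero (x ∷ []) v' (s≤s ())
~-unswap zero (x ∷ y ∷ v) (x' ∷ y' ∷ v') l d d' ((_ , h) , (k , t)) = (trans (≤ᵇ-false d) (sym (≤ᵇ-false d')) , k) , (h , t)
~-unswap (suc p) (x ∷ v) (x' ∷ v') (s≤s l) d d' (h , t) = HT p v v' l h , ~-unswap p v v' l d d' t
  where
  HT : ∀ {n} p (v v' : Vec ℕ n) → suc p < n → HeadType x (swapAt p v) x' (swapAt p v') → HeadType x v x' v'
  HT zero (_ ∷ []) v' (s≤s ())
  HT zero (_ ∷ _ ∷ v) (_ ∷ _ ∷ v') l (a , b , c) = b , a , c
  HT (suc p) (_ ∷ v) (_ ∷ v') (s≤s l) (a , c) = a , HT p v v' l c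

swapAt-swapAt : ∀ {n} p (v : Vec ℕ n) → suc p < n → swapAt p (swapAt p v) ≡ v
swapAt-swapAt p v l rewrite getAt-swap₀ p v l | getAt-swap₁ p v l = trans (put-put p _ _ _ _ v) (put-self p v)

sum-snoc : ∀ {N} (xs : Vec ℕ N) a → V.sum (snoc xs a) ≡ V.sum xs ℕ.+ a
sum-snoc [] a = ℕP.+-identityʳ a
sum-snoc (x ∷ xs) a = trans (cong (x ℕ.+_) (sum-snoc xs a)) (sym (ℕP.+-assoc x _ a))

unsnoc : ∀ {N} (v : Vec ℕ (suc N)) → ∃ λ xs → ∃ λ a → v ≡ snoc xs a
unsnoc (a ∷ []) = [] , a , refl
unsnoc (x ∷ y ∷ v) with xs , a , e ← unsnoc (y ∷ v) = x ∷ xs , a , cong (x ∷_) e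

snoc-injective : ∀ {N} (xs ys : Vec ℕ N) a b → snoc xs a ≡ snoc ys b → xs ≡ ys × a ≡ b
snoc-injective [] [] a .a refl = refl , refl
snoc-injective (x ∷ xs) (y ∷ ys) a b e with snoc-injective xs ys a b (VP.∷-injectiveʳ e)
... | refl , refl = cong (_∷ xs) (VP.∷-injectiveˡ e) , refl

-- Supports and the order on compositions

-- Formulated with test functions instead of the listed terms, so that it is invariant under `≋`:
-- terms outside `P` may be listed as long as they cancel.
record Supp {n} (P : Vec ℕ n → Set) (f : Poly n) : Set where
  constructor supp
  field vanish : ∀ h → (∀ q t x → P x → h (mono q t x) ≡ 0ℚ) → ev f h ≡ 0ℚ
open Supp public

supp-≋ : ∀ {n} {P : Vec ℕ n → Set} {f g : Poly n} → f ≋ g → Supp P f → Supp P g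
supp-≋ e s = supp λ h v → trans (sym (at e h)) (vanish s h v)

supp-⊆ : ∀ {n} {P Q : Vec ℕ n → Set} {f : Poly n} → (∀ x → P x → Q x) → Supp P f → Supp Q f
supp-⊆ i s = supp λ h v → vanish s h (λ q t x p → v q t x (i x p))

supp-- : ∀ {n} {P : Vec ℕ n → Set} {f g : Poly n} → Supp P f → Supp P g → Supp P (f -ₚ g)
supp-- {f = f} {g} s s' = supp λ h v → trans (ev--ₚ₂ f g h) (cong₂ ℚ._-_ (vanish s h v) (vanish s' h v))

supp-*ˡ : ∀ {n} {P : Vec ℕ n → Set} (k : Poly n) {f : Poly n} → Supp (λ x → x ≡ V.replicate n 0) k → Supp P f → Supp P (k *ₚ f)
supp-*ˡ k {f} sk s = supp λ h v → trans (ev-*ₚ k f h)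
    (vanish sk _ (λ { q t x refl → vanish s _ (λ { q' t' x' p → trans (cong h (mono-cong refl refl
  (VP.zipWith-identityˡ ℕP.+-identityˡ x'))) (v _ _ x' p) }) }))

supp-qt₁ : ∀ {n} a z → Supp (λ x → x ≡ V.replicate n 0) (qt {n} a z)
supp-qt₁ a z = supp λ h v → trans (cong (λ e → ev e h) (qt-⟨⟩ a z)) (trans (ev-⟨⟩ _ h) (v _ _ _ refl))

supp-1ₚ : ∀ {n} → Supp (λ x → x ≡ V.replicate n 0) (1ₚ {n})
supp-1ₚ {n} = supp-≋ (≡⇒≋ qt-one) (supp-qt₁ {n} 0 (+ 0))

supp-X : ∀ {n} {P Q : Vec ℕ n → Set} p {f : Poly n} → (∀ x → P x → Q (inc p x)) → Supp P f → Supp Q (X p *ₚ f)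
supp-X p {f} i s = supp λ h v → trans (ev-X p f h) (vanish s _ (λ q t x px → v _ _ _ (i x px)))

Sum-zero : ∀ d {g} → (∀ j → j < d → g j ≡ 0ℚ) → Sum d g ≡ 0ℚ
Sum-zero zero e = refl
Sum-zero (suc d) e = cong₂ ℚ._+_ (e 0 (s≤s z≤n)) (Sum-zero d (λ j l → e (suc j) (s≤s l)))

D-zero : ∀ a b (k : ℕ → ℕ → ℚ) → (∀ u v → suc (u ℕ.+ v) ≡ a ℕ.+ b → a ℕ.⊓ b ≤ u → a ℕ.⊓ b ≤ v → k u v ≡ 0ℚ) → D a b k ≡ 0ℚ
D-zero a b k z with b ℕ.≤? a
... | yes l with d , refl ← ℕP.m≤n⇒∃[o]m+o≡n l = trans (D-ge b d k) (Sum-zero d (λ j j<d → z _ _ (arith j j<d) (low _) (low _)))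
  where
  low : ∀ c → (b ℕ.+ d) ℕ.⊓ b ≤ b ℕ.+ c
  low c = ℕP.≤-trans (ℕP.m⊓n≤n (b ℕ.+ d) b) (ℕP.m≤m+n b c)
  arith : ∀ j → j < d → suc (b ℕ.+ (d ∸ suc j) ℕ.+ (b ℕ.+ j)) ≡ b ℕ.+ d ℕ.+ b
  arith j l = trans (solve 3 (λ b x j → con 1 :+ (b :+ x :+ (b :+ j)) := b :+ (x :+ (con 1 :+ j)) :+ b) refl b (d ∸ suc j) j)
      (cong (λ e → b ℕ.+ e ℕ.+ b) (ℕP.m∸n+n≡m l))
    where open ℕS.+-*-Solver
... | no nl with d , refl ← ℕP.m≤n⇒∃[o]m+o≡n (ℕP.<⇒≤ (ℕP.≰⇒> nl)) =
    trans (D-le a d k) (cong ℚ.-_ (Sum-zero d (λ j j<d → z _ _ (arith j j<d) (low _) (low _))))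
  where
  low : ∀ c → a ℕ.⊓ (a ℕ.+ d) ≤ a ℕ.+ c
  low c = ℕP.≤-trans (ℕP.m⊓n≤m a (a ℕ.+ d)) (ℕP.m≤m+n a c)
  arith : ∀ j → j < d → suc (a ℕ.+ (d ∸ suc j) ℕ.+ (a ℕ.+ j)) ≡ a ℕ.+ (a ℕ.+ d)
  arith j l = trans (solve 3 (λ b x j → con 1 :+ (b :+ x :+ (b :+ j)) := b :+ (b :+ (x :+ (con 1 :+ j)))) refl a (d ∸ suc j) j)
      (cong (λ e → a ℕ.+ (a ℕ.+ e)) (ℕP.m∸n+n≡m l))
    where open ℕS.+-*-Solver

supp-∂ : ∀ {n} {P Q : Vec ℕ n → Set} p {f : Poly n} →
  (∀ x → P x → ∀ u v → suc (u ℕ.+ v) ≡ getAt p x ℕ.+ getAt (suc p) x → getAt p x ℕ.⊓ getAt (suc p) x ≤ u →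
      getAt p x ℕ.⊓ getAt (suc p) x ≤ v → Q (put p u v x)) →
  Supp P f → Supp Q (∂ p f)
supp-∂ p {f} i s = supp λ h v → trans (ev-∂ p f h)
    (vanish s _ (λ q t x px → D-zero _ _ _ (λ a b e l l' → v _ _ _ (i x px a b e l l'))))

Between : ℕ → ℕ → ℕ → ℕ → Set
Between a b u v = u ℕ.+ v ≡ a ℕ.+ b × a ℕ.⊓ b ≤ u × a ℕ.⊓ b ≤ v

supp-T : ∀ {n} {P Q : Vec ℕ n → Set} p {f : Poly n} →
  (∀ x → P x → ∀ u v → Between (getAt p x) (getAt (suc p) x) u v → Q (put p u v x)) → Supp P f → Supp Q (T⟨ p ⟩ f)
supp-T {n} {P} {Q} p {f} i s = supp-≋ (≋-sym (≡⇒≋ (T-eq p f) ⨾ expand)) (supp-- (supp-*ˡ 𝐭 (supp-qt₁ 0 (+ 1)) (supp-⊆ self s))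
    (supp-- (supp-*ˡ 𝐭 (supp-qt₁ 0 (+ 1)) (supp-X p (λ x r → proj₁ r) s∂)) (supp-X (suc p) (λ x r → proj₂ r) s∂)))
  where
  open PolySolver {n}
  expand : 𝐭 *ₚ f -ₚ (𝐭 *ₚ X p -ₚ X (suc p)) *ₚ ∂ p f ≋ 𝐭 *ₚ f -ₚ (𝐭 *ₚ (X p *ₚ ∂ p f) -ₚ X (suc p) *ₚ ∂ p f)
  expand = solve 5 (λ t f x y d → t :* f :- (t :* x :- y) :* d := t :* f :- (t :* (x :* d) :- y :* d)) ≋-refl 𝐭 f (X p)
      (X (suc p)) (∂ p f)
  self : ∀ x → P x → Q x
  self x px = subst Q (put-self p x) (i x px _ _ (refl , ℕP.m⊓n≤m _ _ , ℕP.m⊓n≤n (getAt p x) _))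
  s∂ : Supp (λ y → Q (inc p y) × Q (inc (suc p) y)) (∂ p f)
  s∂ = supp-∂ p (λ x px u v e l l' →
    subst Q (sym (inc-put₀ p u v x)) (i x px (suc u) v (e , ℕP.≤-trans l (ℕP.n≤1+n u) , l')) ,
    subst Q (sym (inc-put₁ p u v x)) (i x px u (suc v) (trans (ℕP.+-suc u v) e , l , ℕP.≤-trans l' (ℕP.n≤1+n v)))) s

lin-on-supp : ∀ {n m} {A B : Poly n → Poly m} {P : Vec ℕ n → Set} (lA : Lin A) (lB : Lin B) {f : Poly n} → Supp P f →
  (∀ h q t x → P x → adj lA h (mono q t x) ≡ adj lB h (mono q t x)) → A f ≋ B f
lin-on-supp lA lB {f} s e = mk≋ λ h → trans (ev-adj lA f h) (trans (x-y≡0⇒x≡y (trans (sym (minus h))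
    (vanish s _ (λ q t x p → trans (cong (ℚ._- adj lB h (mono q t x)) (e h q t x p)) (ℚP.+-inverseʳ (adj lB h (mono q t x)))))))
        (sym (ev-adj lB f h)))
  where
  minus : ∀ h → ev f (λ a → adj lA h a ℚ.- adj lB h a) ≡ ev f (adj lA h) ℚ.- ev f (adj lB h)
  minus h = trans (ev-+ f _ _) (cong (ev f (adj lA h) ℚ.+_) (ev-- f _))

-- The order ζ ≼ η compares the numbers mass i H. It is the Bruhat order of the affine symmetric group,
-- so unlike dominance it is compatible with the intertwiners and with the affine shift η ↦ (η_n + 1, η_1, …).
mass : ∀ {n} → ℕ → ℕ → Vec ℕ n → ℕ
mass i H [] = 0
mass zero H (a ∷ v) = (H ∸ suc a) ℕ.+ mass zero H v
mass (suc i) H (a ∷ v) = (H ∸ a) ℕ.+ mass i H v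

infix 4 _≼_
record _≼_ {n} (ζ η : Vec ℕ n) : Set where
  constructor below
  field
    same-sum : V.sum ζ ≡ V.sum η
    mass-≤ : ∀ i H → mass i H ζ ≤ mass i H η
open _≼_ public

≼-refl : ∀ {n} {η : Vec ℕ n} → η ≼ η
≼-refl = below refl (λ i H → ℕP.≤-refl)

mass-step : ∀ {n} p H (x : Vec ℕ n) → p < n → mass (suc p) H x ℕ.+ (H ∸ suc (getAt p x)) ≡ mass p H x ℕ.+ (H ∸ getAt p x)
mass-step zero H (a ∷ x) l = solve 3 (λ a b m → a :+ m :+ b := b :+ m :+ a) refl (H ∸ a) (H ∸ suc a) (mass 0 H x)
  where open ℕS.+-*-Solver
mass-step (suc p) H (a ∷ x) (s≤s l) = trans (ℕP.+-assoc (H ∸ a) _ _)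
    (trans (cong ((H ∸ a) ℕ.+_) (mass-step p H x l)) (sym (ℕP.+-assoc (H ∸ a) _ _)))

private
  local : ℕ → ℕ → ℕ → ℕ → ℕ → ℕ
  local zero p H u v = (H ∸ suc u) ℕ.+ (H ∸ suc v)
  local (suc i) (suc p) H u v = local i p H u v
  local (suc zero) zero H u v = (H ∸ u) ℕ.+ (H ∸ suc v)
  local (suc (suc i)) zero H u v = (H ∸ u) ℕ.+ (H ∸ v)

  shuffle : ∀ a b c d m → a ℕ.+ (b ℕ.+ m) ℕ.+ (c ℕ.+ d) ≡ c ℕ.+ (d ℕ.+ m) ℕ.+ (a ℕ.+ b)
  shuffle = solve 5 (λ a b c d m → a :+ (b :+ m) :+ (c :+ d) := c :+ (d :+ m) :+ (a :+ b)) refl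
    where open ℕS.+-*-Solver

  mass-put : ∀ {n} i p H u v (x : Vec ℕ n) → suc p < n →
    mass i H (put p u v x) ℕ.+ local i p H (getAt p x) (getAt (suc p) x) ≡ mass i H x ℕ.+ local i p H u v
  mass-put i zero H u v (a ∷ []) (s≤s ())
  mass-put zero zero H u v (a ∷ b ∷ x) l = shuffle (H ∸ suc u) (H ∸ suc v) (H ∸ suc a) (H ∸ suc b) (mass 0 H x)
  mass-put (suc zero) zero H u v (a ∷ b ∷ x) l = shuffle (H ∸ u) (H ∸ suc v) (H ∸ a) (H ∸ suc b) (mass 0 H x)
  mass-put (suc (suc i)) zero H u v (a ∷ b ∷ x) l = shuffle (H ∸ u) (H ∸ v) (H ∸ a) (H ∸ b) (mass i H x)
  mass-put zero (suc p) H u v (a ∷ x) (s≤s l) = trans (ℕP.+-assoc (H ∸ suc a) _ _)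
      (trans (cong ((H ∸ suc a) ℕ.+_) (mass-put zero p H u v x l)) (sym (ℕP.+-assoc (H ∸ suc a) _ _)))
  mass-put (suc i) (suc p) H u v (a ∷ x) (s≤s l) = trans (ℕP.+-assoc (H ∸ a) _ _)
      (trans (cong ((H ∸ a) ℕ.+_) (mass-put i p H u v x l)) (sym (ℕP.+-assoc (H ∸ a) _ _)))

  ∸-suc : ∀ H a → H ∸ suc a ≡ (H ∸ 1) ∸ a
  ∸-suc H a = sym (ℕP.∸-+-assoc H 1 a)

  ∸-step : ∀ H a → H ∸ a ≤ suc (H ∸ suc a)
  ∸-step zero zero = z≤n
  ∸-step zero (suc a) = z≤n
  ∸-step (suc H) zero = ℕP.≤-refl
  ∸-step (suc H) (suc a) = ∸-step H a

  -- Convexity of truncated subtraction `K ∸_`, at the points 0, x, y and x + y.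
  convex : ∀ K x y → (K ∸ x) ℕ.+ (K ∸ y) ≤ K ℕ.+ (K ∸ (x ℕ.+ y))
  convex K x y with x ℕ.≤? K
  ... | yes l = ℕP.≤-trans (ℕP.+-monoʳ-≤ (K ∸ x) (ℕP.m≤n+m∸n (K ∸ y) x))
    (ℕP.≤-reflexive (trans (sym (ℕP.+-assoc (K ∸ x) x _))
        (cong₂ ℕ._+_ (ℕP.m∸n+n≡m l) (trans (ℕP.∸-+-assoc K y x) (cong (K ∸_) (ℕP.+-comm y x))))))
  ... | no l = ℕP.≤-trans (ℕP.≤-reflexive (cong (ℕ._+ (K ∸ y)) (ℕP.m≤n⇒m∸n≡0 (ℕP.<⇒≤ (ℕP.≰⇒> l)))))
      (ℕP.≤-trans (ℕP.m∸n≤m K y) (ℕP.m≤m+n K _))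

  convex-≤ : ∀ H a b u v → a ≤ b → u ℕ.+ v ≡ a ℕ.+ b → a ≤ u → a ≤ v → (H ∸ u) ℕ.+ (H ∸ v) ≤ (H ∸ a) ℕ.+ (H ∸ b)
  convex-≤ H a b u v _ e lu lv with x , refl ← ℕP.m≤n⇒∃[o]m+o≡n lu | y , refl ← ℕP.m≤n⇒∃[o]m+o≡n lv =
    ℕP.≤-trans (ℕP.≤-reflexive (cong₂ ℕ._+_ (sym (ℕP.∸-+-assoc H a x)) (sym (ℕP.∸-+-assoc H a y))))
      (ℕP.≤-trans (convex (H ∸ a) x y)
          (ℕP.≤-reflexive (cong ((H ∸ a) ℕ.+_) (trans (ℕP.∸-+-assoc H a (x ℕ.+ y)) (cong (H ∸_) (sym b-eq))))))
    where
    b-eq : b ≡ a ℕ.+ (x ℕ.+ y)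
    b-eq = ℕP.+-cancelˡ-≡ a _ _ (trans (sym e) (solve 3 (λ a x y → a :+ x :+ (a :+ y) := a :+ (a :+ (x :+ y))) refl a x y))
      where open ℕS.+-*-Solver

  between-convex : ∀ H a b u v → Between a b u v → (H ∸ u) ℕ.+ (H ∸ v) ≤ (H ∸ a) ℕ.+ (H ∸ b)
  between-convex H a b u v (e , lu , lv) with ℕP.≤-total a b
  ... | inj₁ l = convex-≤ H a b u v l e (subst (_≤ u) (ℕP.m≤n⇒m⊓n≡m l) lu) (subst (_≤ v) (ℕP.m≤n⇒m⊓n≡m l) lv)
  ... | inj₂ l = ℕP.≤-trans (convex-≤ H b a u v l (trans e (ℕP.+-comm a b)) (subst (_≤ u) (ℕP.m≥n⇒m⊓n≡n l) lu)
      (subst (_≤ v) (ℕP.m≥n⇒m⊓n≡n l) lv)) (ℕP.≤-reflexive (ℕP.+-comm (H ∸ b) _))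

  between-convex⁺ : ∀ H a b u v → Between a b u v → (H ∸ suc u) ℕ.+ (H ∸ suc v) ≤ (H ∸ suc a) ℕ.+ (H ∸ suc b)
  between-convex⁺ H a b u v bt rewrite ∸-suc H u | ∸-suc H v | ∸-suc H a | ∸-suc H b = between-convex (H ∸ 1) a b u v bt

  -- Both positions are measured at the same height unless i = p + 1, and then convexity applies. At
  -- i = p + 1 the change of height falls between the two positions, and there an exchange of the
  -- entries can increase the mass.
  local-between : ∀ i p H a b u v → i ≢ suc p → Between a b u v → local i p H u v ≤ local i p H a b
  local-between zero p H a b u v ne bt = between-convex⁺ H a b u v bt
  local-between (suc zero) zero H a b u v ne bt = ⊥-elim (ne refl)
  local-between (suc (suc i)) zero H a b u v ne bt = between-convex H a b u v bt
  local-between (suc i) (suc p) H a b u v ne bt = local-between i p H a b u v (λ e → ne (cong suc e)) bt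

  local-mixed : ∀ p H u v → local (suc p) p H u v ≡ (H ∸ u) ℕ.+ (H ∸ suc v)
  local-mixed zero H u v = refl
  local-mixed (suc p) H u v = local-mixed p H u v

  local-comm : ∀ i p H u v → i ≢ suc p → local i p H u v ≡ local i p H v u
  local-comm zero p H u v ne = ℕP.+-comm (H ∸ suc u) _
  local-comm (suc zero) zero H u v ne = ⊥-elim (ne refl)
  local-comm (suc (suc i)) zero H u v ne = ℕP.+-comm (H ∸ u) _
  local-comm (suc i) (suc p) H u v ne = local-comm i p H u v (λ e → ne (cong suc e))

  transfer : ∀ {x a y b} → x ℕ.+ a ≡ y ℕ.+ b → b ≤ a → x ≤ y
  transfer {x} {a} {y} {b} e l = ℕP.+-cancelʳ-≤ a x y (ℕP.≤-trans (ℕP.≤-reflexive e) (ℕP.+-monoʳ-≤ y l))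

mass-between : ∀ {n} i p H u v (x : Vec ℕ n) → suc p < n → i ≢ suc p → Between (getAt p x) (getAt (suc p) x) u v →
    mass i H (put p u v x) ≤ mass i H x
mass-between i p H u v x l ne bt = transfer (mass-put i p H u v x l) (local-between i p H _ _ u v ne bt)

mass-zero : ∀ {n} i (x : Vec ℕ n) → mass i 0 x ≡ 0
mass-zero i [] = refl
mass-zero zero (a ∷ x) = mass-zero zero x
mass-zero (suc i) (a ∷ x) = trans (cong (ℕ._+ mass i 0 x) (ℕP.0∸n≡0 a)) (mass-zero i x)

sum-put : ∀ {n} p u v (x : Vec ℕ n) → suc p < n → u ℕ.+ v ≡ getAt p x ℕ.+ getAt (suc p) x → V.sum (put p u v x) ≡ V.sum x
sum-put zero u v (a ∷ []) (s≤s ())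
sum-put zero u v (a ∷ b ∷ x) l e = trans (sym (ℕP.+-assoc u v _)) (trans (cong (ℕ._+ V.sum x) e) (ℕP.+-assoc a b _))
sum-put (suc p) u v (a ∷ x) (s≤s l) e = cong (a ℕ.+_) (sum-put p u v x l e)

module _ {n} (p m : ℕ) (η : Vec ℕ n) (l : suc p < n) (e₀ : getAt p η ≡ suc m) (e₁ : getAt (suc p) η ≡ 0) where
  private
    swap-mass-far : ∀ i H → i ≢ suc p → mass i H (swapAt p η) ≡ mass i H η
    swap-mass-far i H ne = ℕP.+-cancelʳ-≡ _ _ _
        (trans (mass-put i p H _ _ η l) (cong (mass i H η ℕ.+_) (local-comm i p H _ _ ne)))

    swap-mass : ∀ H → mass (suc p) H (swapAt p η) ℕ.+ ((H ∸ suc m) ℕ.+ (H ∸ 1)) ≡ mass (suc p) H η ℕ.+ (H ℕ.+ (H ∸ suc (suc m)))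
    swap-mass H = trans (cong (mass (suc p) H (swapAt p η) ℕ.+_)
        (sym (trans (local-mixed p H _ _) (cong₂ (λ a b → (H ∸ a) ℕ.+ (H ∸ suc b)) e₀ e₁))))
      (trans (mass-put (suc p) p H _ _ η l)
          (cong (mass (suc p) H η ℕ.+_) (trans (local-mixed p H _ _) (cong₂ (λ a b → (H ∸ a) ℕ.+ (H ∸ suc b)) e₁ e₀))))

    swap-mass-low : ∀ H → H ≤ m → mass (suc p) (suc H) (swapAt p η) ≡ suc (mass (suc p) (suc H) η)
    swap-mass-low H le = ℕP.+-cancelʳ-≡ H _ _
        (trans (cong (λ e → mass (suc p) (suc H) (swapAt p η) ℕ.+ (e ℕ.+ H)) (sym (ℕP.m≤n⇒m∸n≡0 le)))
      (trans (swap-mass (suc H)) (trans (cong (λ e → mass (suc p) (suc H) η ℕ.+ (suc H ℕ.+ e)) (ℕP.m≤n⇒m∸n≡0 (ℕP.m≤n⇒m≤1+n le)))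
        (trans (cong (mass (suc p) (suc H) η ℕ.+_) (ℕP.+-identityʳ (suc H))) (ℕP.+-suc _ H)))))

    swap-mass-high : ∀ H → m < H → mass (suc p) (suc H) (swapAt p η) ≡ mass (suc p) (suc H) η
    swap-mass-high H lt = ℕP.+-cancelʳ-≡ _ _ _ (trans (swap-mass (suc H)) (cong (mass (suc p) (suc H) η ℕ.+_)
      (trans (sym (ℕP.+-suc H _)) (trans (cong (H ℕ.+_) (sym (ℕP.+-∸-assoc 1 lt))) (ℕP.+-comm H _)))))

  swap-⋠ : ¬ (swapAt p η ≼ η)
  swap-⋠ b = ℕP.<⇒≱ (ℕP.≤-reflexive (sym (swap-mass-low 0 z≤n))) (mass-≤ b (suc p) 1)

  -- Only the index i = p + 1 is critical. At heights up to m + 1 the swap raises the mass of η by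
  -- one, which is the most that T can add to the mass of ζ. At larger heights the swap leaves the
  -- mass of η unchanged. There the comparison passes through the index p: going from p to p + 1
  -- adds at most one to any mass, and exactly one to that of η.
  ≼-swap : ∀ ζ → ζ ≼ η → ∀ u v → Between (getAt p ζ) (getAt (suc p) ζ) u v → put p u v ζ ≼ swapAt p η
  ≼-swap ζ b u v bt = below
    (trans (sum-put p u v ζ l (proj₁ bt)) (trans (same-sum b) (sym (sum-put p _ _ η l (ℕP.+-comm (getAt (suc p) η) _))))) bound
    where
    bound : ∀ i H → mass i H (put p u v ζ) ≤ mass i H (swapAt p η)
    bound i H with i ℕ.≟ suc p
    ... | no ne = ℕP.≤-trans (mass-between i p H u v ζ l ne bt)
        (ℕP.≤-trans (mass-≤ b i H) (ℕP.≤-reflexive (sym (swap-mass-far i H ne))))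
    bound i zero | yes refl = ℕP.≤-trans (ℕP.≤-reflexive (mass-zero i (put p u v ζ))) z≤n
    bound i (suc H) | yes refl with H ℕ.≤? m
    ... | yes le = ℕP.≤-trans (transfer (trans (ℕP.+-suc _ L') (cong suc (mass-put (suc p) p (suc H) u v ζ l))) mixed)
        (ℕP.≤-trans (s≤s (mass-≤ b (suc p) (suc H))) (ℕP.≤-reflexive (sym (swap-mass-low H le))))
      where
      L L' : ℕ
      L = local (suc p) p (suc H) u v
      L' = local (suc p) p (suc H) (getAt p ζ) (getAt (suc p) ζ)
      mixed : L ≤ suc L'
      mixed = ℕP.≤-trans (ℕP.≤-reflexive (local-mixed p (suc H) u v))
          (ℕP.≤-trans (ℕP.+-monoʳ-≤ (suc H ∸ u) (ℕP.∸-monoʳ-≤ (suc H) (ℕP.n≤1+n v)))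
        (ℕP.≤-trans (between-convex (suc H) (getAt p ζ) (getAt (suc p) ζ) u v bt)
            (ℕP.≤-trans (ℕP.+-monoʳ-≤ (suc H ∸ getAt p ζ) (∸-step (suc H) (getAt (suc p) ζ)))
          (ℕP.≤-reflexive (trans (ℕP.+-suc _ _) (cong suc (sym (local-mixed p (suc H) _ _))))))))
    ... | no gt = ℕP.≤-trans (transfer (trans (ℕP.+-suc _ _) (cong suc (mass-step p (suc H) (put p u v ζ) p<n)))
        (∸-step (suc H) (getAt p (put p u v ζ))))
        (ℕP.≤-trans (s≤s (ℕP.≤-trans (mass-between p p (suc H) u v ζ l (λ e → ℕP.1+n≢n (sym e)) bt) (mass-≤ b p (suc H))))
          (ℕP.≤-reflexive (trans (sym step-η) (sym (swap-mass-high H m<H)))))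
      where
      m<H : m < H
      m<H = ℕP.≰⇒> gt
      p<n : p < n
      p<n = ℕP.<-trans (ℕP.n<1+n p) l
      step-η : mass (suc p) (suc H) η ≡ suc (mass p (suc H) η)
      step-η = ℕP.+-cancelʳ-≡ (H ∸ suc m) _ _
          (trans (cong (λ e → mass (suc p) (suc H) η ℕ.+ (H ∸ e)) (sym e₀)) (trans (mass-step p (suc H) η p<n)
        (trans (cong (λ e → mass p (suc H) η ℕ.+ (suc H ∸ e)) e₀)
            (trans (cong (mass p (suc H) η ℕ.+_) (ℕP.+-∸-assoc 1 m<H)) (ℕP.+-suc _ (H ∸ suc m))))))

mass-snoc : ∀ {N} i H (xs : Vec ℕ N) a → i ≤ N → mass i H (snoc xs a) ≡ (H ∸ suc a) ℕ.+ mass i H xs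
mass-snoc zero H [] a l = refl
mass-snoc zero H (x ∷ xs) a l = trans (cong ((H ∸ suc x) ℕ.+_) (mass-snoc zero H xs a z≤n)) (+-left (H ∸ suc x) (H ∸ suc a) _)
mass-snoc (suc i) H (x ∷ xs) a (s≤s l) = trans (cong ((H ∸ x) ℕ.+_) (mass-snoc i H xs a l)) (+-left (H ∸ x) (H ∸ suc a) _)

mass-cap : ∀ {N} i H (xs : Vec ℕ N) → N ≤ i → mass i H xs ≡ mass N H xs
mass-cap i H [] l = refl
mass-cap (suc i) H (x ∷ xs) (s≤s l) = cong ((H ∸ x) ℕ.+_) (mass-cap i H xs l)

mass-0 : ∀ {N} H (xs : Vec ℕ N) → mass 0 H xs ≡ mass N (H ∸ 1) xs
mass-0 H [] = refl
mass-0 H (x ∷ xs) = cong₂ ℕ._+_ (∸-suc H x) (mass-0 H xs)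

-- The shift moves the index of `mass` by one, because a + 1 measured from H in front equals a
-- measured from H - 1 at the end. The index 0 wraps around to the index n at height H - 1.
≼-bump : ∀ {N} (ys xs : Vec ℕ N) b a → snoc ys b ≼ snoc xs a → (suc b ∷ ys) ≼ (suc a ∷ xs)
≼-bump {N} ys xs b a le =
    below (cong suc (trans (ℕP.+-comm b _)
    (trans (sym (sum-snoc ys b)) (trans (same-sum le) (trans (sum-snoc xs a) (ℕP.+-comm _ a)))))) bound
  where
  inside : ∀ i H → i ≤ N → mass (suc i) H (suc b ∷ ys) ≤ mass (suc i) H (suc a ∷ xs)
  inside i H l = subst₂ _≤_ (mass-snoc i H ys b l) (mass-snoc i H xs a l) (mass-≤ le i H)
  bound : ∀ i H → mass i H (suc b ∷ ys) ≤ mass i H (suc a ∷ xs)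
  bound zero H = subst₂ _≤_ (sym (mass-0 H (suc b ∷ ys))) (sym (mass-0 H (suc a ∷ xs))) (inside N (H ∸ 1) ℕP.≤-refl)
  bound (suc i) H with i ℕ.≤? N
  ... | yes l = inside i H l
  ... | no g = subst₂ _≤_ (cong ((H ∸ suc b) ℕ.+_) (sym (mass-cap i H ys (ℕP.<⇒≤ (ℕP.≰⇒> g)))))
      (cong ((H ∸ suc a) ℕ.+_) (sym (mass-cap i H xs (ℕP.<⇒≤ (ℕP.≰⇒> g)))))
    (inside N H ℕP.≤-refl)

-- The recursion for E_η

initV : ∀ {N} → Vec ℕ (suc N) → Vec ℕ N
initV (a ∷ []) = []
initV (a ∷ b ∷ v) = a ∷ initV (b ∷ v)

lastV : ∀ {N} → Vec ℕ (suc N) → ℕ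
lastV {N} v = getAt N v

initV-snoc : ∀ {N} (xs : Vec ℕ N) a → initV (snoc xs a) ≡ xs
initV-snoc [] a = refl
initV-snoc (x ∷ []) a = refl
initV-snoc (x ∷ y ∷ xs) a = cong (x ∷_) (initV-snoc (y ∷ xs) a)

bumpV : ∀ {N} → Vec ℕ (suc N) → Vec ℕ (suc N)
bumpV v = suc (lastV v) ∷ initV v

bumpV-snoc : ∀ {N} (xs : Vec ℕ N) a → bumpV (snoc xs a) ≡ suc a ∷ xs
bumpV-snoc xs a = cong₂ (λ b v → suc b ∷ v) (getAt-last xs a) (initV-snoc xs a)

bumpM : ∀ {N} → ℕ → ℕ → Mono (suc N) → Mono (suc N)
bumpM w S (mono q t v) = mono (q ℕ.+ w ℕ.* (S ∸ lastV v)) t (bumpV v)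

opaque
  -- f ↦ q^S x_1 f(x_2, …, x_n, x_1/q) for f homogeneous of degree S and w = 1; the factor q^S keeps the
  -- exponent of q natural. For w = 0 this is its specialisation at q = 1.
  Φ : ∀ {N} → ℕ → ℕ → Poly (suc N) → Poly (suc N)
  Φ w S f = L.map (λ { (c , x) → (c , bumpM w S x) }) f

  ev-Φ : ∀ {N} w S (f : Poly (suc N)) h → ev (Φ w S f) h ≡ ev f (λ a → h (bumpM w S a))
  ev-Φ w S f h = ev-map (bumpM w S) f h

Φ-lin : ∀ {N} w S → Lin {suc N} (Φ w S)
Φ-lin w S = lin (λ h a → h (bumpM w S a)) (ev-Φ w S)

Φ-qt : ∀ {N} w S → QT {suc N} (Φ w S)
Φ-qt w S a z f = mk≋ λ h → trans (ev-Φ w S (qt a z *ₚ f) h) (trans (ev-qt a z f _)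
  (trans (ev-cong f (λ { (mono q t x) → cong h (mono-cong (ℕP.+-assoc a q (w ℕ.* (S ∸ lastV x))) refl refl) }))
      (sym (trans (ev-qt a z (Φ w S f) h) (ev-Φ w S f _)))))

Φ-ω : ∀ {N} w S (g : Poly (suc N)) → Supp (λ x → V.sum x ≡ S) g → Φ w S (ω w g) ≋ qt (w ℕ.* S) (+ 0) *ₚ (X 0 *ₚ g)
Φ-ω {N} w S g sp = mk≋ λ h → at (lin-on-supp (lin-∘ (Φ-lin w S) (ω-lin w)) rhs sp term) h
  where
  rhs : Lin (λ g → qt (w ℕ.* S) (+ 0) *ₚ (X 0 *ₚ g))
  rhs = lin (λ h a → h (shiftM (w ℕ.* S) (+ 0) (incM 0 a))) (λ f h → trans (ev-qt (w ℕ.* S) (+ 0) _ h) (ev-X 0 f _))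
  arith : ∀ q b R → b ℕ.+ R ≡ S → q ℕ.+ w ℕ.* b ℕ.+ w ℕ.* (S ∸ b) ≡ w ℕ.* S ℕ.+ q
  arith q b R refl = trans (ℕP.+-assoc q _ _)
      (trans (cong (q ℕ.+_) (trans (sym (ℕP.*-distribˡ-+ w b _)) (cong (λ e → w ℕ.* (b ℕ.+ e)) (ℕP.m+n∸m≡n b R))))
      (ℕP.+-comm q _))
  term : ∀ h q t x → V.sum x ≡ S → h (bumpM w S (rotM w (mono q t x))) ≡ h (shiftM (w ℕ.* S) (+ 0) (incM 0 (mono q t x)))
  term h q t (b ∷ x) e =
      cong h (mono-cong (trans (cong (λ c → q ℕ.+ w ℕ.* b ℕ.+ w ℕ.* (S ∸ c)) (getAt-last x b)) (arith q b (V.sum x) e))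
      (sym (ℤP.+-identityˡ t)) (bumpV-snoc x b))

qt-cancel : ∀ {n} a z {f g : Poly n} → qt a z *ₚ f ≋ qt a z *ₚ g → f ≋ g
qt-cancel a z {f} {g} e = mk≋ λ h → trans (sym (back f h)) (trans (at e (λ m → h (undo m))) (back g h))
  where
  undo : Mono _ → Mono _
  undo (mono q t x) = mono (q ∸ a) (ℤ.- z ℤ.+ t) x
  back : ∀ f h → ev (qt a z *ₚ f) (λ m → h (undo m)) ≡ ev f h
  back f h = trans (ev-qt a z f _) (ev-cong f (λ { (mono q t x) → cong h (mono-cong (ℕP.m+n∸m≡n a q)
    (trans (sym (ℤP.+-assoc (ℤ.- z) z t)) (trans (cong (ℤ._+ t) (ℤP.+-inverseˡ z)) (ℤP.+-identityˡ t))) refl) }))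

-- `Φ w S F` and `bumped` differ only by powers of q and t, which can be cancelled. So the
-- eigenvalue equations pass from the latter, where the Hecke relations apply, to the former, whose
-- coefficients are visible.
Φ-eigen : ∀ {N} w S b β (F : Poly (suc N)) → Supp (λ x → V.sum x ≡ S) F → (h : Y w N 0 F ≋ qt b β *ₚ F) →
  ∀ {A : Poly (suc N) → Poly (suc N)} → Lin A → QT A → ∀ c γ → A (bumped w F b β h) ≋ qt c γ *ₚ bumped w F b β h →
      A (Φ w S F) ≋ qt c γ *ₚ Φ w S F
Φ-eigen {N} w S b β F sp h {A} lA qA c γ e = qt-cancel b (+ N ℤ.+ β)
    (≋-sym (qA b (+ N ℤ.+ β) (Φ w S F)) ⨾ lin-cong lA (≋-sym Φ-bumped) ⨾ qA _ _ _ ⨾ ≋-refl ⟨*⟩ e ⨾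
    solve 3 (λ s y g → s :* (y :* g) := y :* (s :* g)) ≋-refl (qt (w ℕ.* S) (+ 0)) (qt c γ) (bumped w F b β h) ⨾
        ≋-refl ⟨*⟩ Φ-bumped ⨾
    solve 3 (λ s y g → s :* (y :* g) := y :* (s :* g)) ≋-refl (qt c γ) (qt b (+ N ℤ.+ β)) (Φ w S F))
  where
  open PolySolver {suc N}
  supp-up : ∀ a k → a ℕ.+ k ≤ N → Supp (λ x → V.sum x ≡ S) (up a k F)
  supp-up a zero _ = sp
  supp-up a (suc k) l = supp-T a
      (λ x e u v bt → trans (sum-put a u v x (s≤s (ℕP.≤-trans (s≤s (ℕP.m≤m+n a k)) (subst (_≤ N) (ℕP.+-suc a k) l))) (proj₁ bt))
      e) (supp-up (suc a) k (subst (_≤ N) (ℕP.+-suc a k) l))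
  Φ-bumped : qt (w ℕ.* S) (+ 0) *ₚ bumped w F b β h ≋ qt b (+ N ℤ.+ β) *ₚ Φ w S F
  Φ-bumped = ≋-sym (Φ-ω w S (up 0 N F) (supp-up 0 N ℕP.≤-refl)) ⨾
      lin-cong (Φ-lin w S) (ω-up w F b β h ⨾ ≋-sym (*ₚ-assoc _ _ _) ⨾ qt-* 0 (+ N) b β ⟨*⟩ ≋-refl) ⨾ Φ-qt w S b _ F

-- Coefficients of single monomials

eqVec-false : ∀ {n} (x y : Vec ℕ n) → x ≢ y → eqVec x y ≡ false
eqVec-false x y ne with eqVec x y in e
... | true = ⊥-elim (ne (eqVec-sound x y e))
... | false = refl

eqVec-iff : ∀ {n m} (x y : Vec ℕ n) (x' y' : Vec ℕ m) → (x ≡ y → x' ≡ y') → (x' ≡ y' → x ≡ y) → eqVec x y ≡ eqVec x' y'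
eqVec-iff x y x' y' to from with eqVec x y in e
... | true rewrite to (eqVec-sound x y e) = sym (eqVec-refl y')
... | false = sym (eqVec-false x' y' (λ q → absurd (trans (sym e) (trans (cong (λ z → eqVec z y) (from q)) (eqVec-refl y)))))
  where absurd : false ≡ true → ⊥
        absurd ()

coM : ∀ {n} → Vec ℕ n → (Mono 0 → ℚ) → Mono n → ℚ
coM ζ h (mono q t x) = if eqVec x ζ then h (mono q t []) else 0ℚ

opaque
  co : ∀ {n} → Vec ℕ n → Poly n → Poly 0
  co ζ f = xcoeff f ζ

  co-def : ∀ {n} (ζ : Vec ℕ n) f → xcoeff f ζ ≡ co ζ f
  co-def ζ f = refl

  ev-co : ∀ {n} (ζ : Vec ℕ n) f h → ev (co ζ f) h ≡ ev f (coM ζ h)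
  ev-co ζ [] h = refl
  ev-co ζ ((c , mono q t x) ∷ f) h with eqVec x ζ
  ... | true = cong (c ℚ.* h (mono q t []) ℚ.+_) (ev-co ζ f h)
  ... | false = trans (ev-co ζ f h) (trans (sym (ℚP.+-identityˡ _)) (cong (ℚ._+ ev f (coM ζ h)) (sym (ℚP.*-zeroʳ c))))

co-lin : ∀ {n} (ζ : Vec ℕ n) → Lin (co ζ)
co-lin ζ = lin (coM ζ) (ev-co ζ)

co-qt : ∀ {n} (ζ : Vec ℕ n) → QT (co ζ)
co-qt ζ a z f = mk≋ λ h → trans (ev-co ζ (qt a z *ₚ f) h)
    (trans (ev-qt a z f _) (sym (trans (ev-qt a z (co ζ f) h) (ev-co ζ f _))))

co-supp : ∀ {n} {P : Vec ℕ n → Set} {f : Poly n} ζ → Supp P f → ¬ P ζ → co ζ f ≋ 0ₚ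
co-supp {P = P} {f} ζ sp ne = mk≋ λ h → trans (ev-co ζ f h)
    (trans (vanish sp _ (λ q t x px → cong (λ b → if b then h (mono q t []) else 0ℚ)
  (eqVec-false x ζ (λ e → ne (subst P e px))))) (sym (ev-0ₚ h)))

co-X-zero : ∀ {n} p (ζ : Vec ℕ n) → p < n → getAt p ζ ≡ 0 → ∀ f → co ζ (X p *ₚ f) ≋ 0ₚ
co-X-zero p ζ l e f = mk≋ λ h → trans (ev-co ζ (X p *ₚ f) h) (trans (ev-X p f _) (trans (ev-cong f (λ { (mono q t x) →
  cong (λ b → if b then h (mono q t []) else 0ℚ)
      (eqVec-false (inc p x) ζ (λ q → ℕP.1+n≢0 (trans (sym (get-inc p x l)) (trans (cong (getAt p) q) e)))) }))
  (trans (ev-0 f) (sym (ev-0ₚ h)))))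

co-s : ∀ {n} p (ζ : Vec ℕ n) → suc p < n → ∀ f → co ζ (s p f) ≋ co (swapAt p ζ) f
co-s p ζ l f = mk≋ λ h → trans (ev-co ζ (s p f) h) (trans (ev-s p f _) (trans (ev-cong f (λ { (mono q t x) →
  cong (λ b → if b then h (mono q t []) else 0ℚ) (eqVec-iff (swapAt p x) ζ x (swapAt p ζ)
    (λ e → trans (sym (swapAt-swapAt p x l)) (cong (swapAt p) e)) (λ e → trans (cong (swapAt p) e) (swapAt-swapAt p ζ l))) }))
        (sym (ev-co (swapAt p ζ) f h))))

-- By `T-s` the operator T differs from s by a multiple of f - x_p ∂f. Here f has no ζ-coefficient,
-- and neither has a multiple of x_p, since ζ has exponent 0 there.
co-T : ∀ {n} p (ζ : Vec ℕ n) → suc p < n → getAt p ζ ≡ 0 → ∀ f → co ζ f ≋ 0ₚ → co ζ (T⟨ p ⟩ f) ≋ co (swapAt p ζ) f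
co-T p ζ l e f z = lin-cong (co-lin ζ) (T-s p l f) ⨾ lin-u+ (co-lin ζ) (co-qt ζ) _ _ ⨾
    co-s p ζ l f ⟨+⟩ ≋-refl ⟨*⟩ (lin-- (co-lin ζ) _ _ ⨾ z ⟨-⟩ co-X-zero p ζ (ℕP.<-trans (ℕP.n<1+n p) l) e _) ⨾
  ≋-refl ⟨+⟩ ≋-refl ⟨*⟩ (neg-invʳ 0ₚ) ⨾ ≋-refl ⟨+⟩ lin-0 (lin-mul 𝐮 lin-id) ⨾ +ₚ-idʳ _

co-Φ : ∀ {N} w S (xs : Vec ℕ N) a f → co (suc a ∷ xs) (Φ w S f) ≋ qt (w ℕ.* (S ∸ a)) (+ 0) *ₚ co (snoc xs a) f
co-Φ {N} w S xs a f = mk≋ λ h → trans (ev-co (suc a ∷ xs) (Φ w S f) h)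
    (trans (ev-Φ w S f _) (trans (ev-cong f (λ { (mono q t x) → term h q t x }))
  (sym (trans (ev-qt (w ℕ.* (S ∸ a)) (+ 0) (co (snoc xs a) f) h) (ev-co (snoc xs a) f _)))))
  where
  term : ∀ h q t x → coM (suc a ∷ xs) h (bumpM w S (mono q t x)) ≡ coM (snoc xs a) (λ m → h (shiftM (w ℕ.* (S ∸ a)) (+ 0) m))
      (mono q t x)
  term h q t x with ys , b , refl ← unsnoc x =
      trans (cong (coM (suc a ∷ xs) h) (mono-cong (cong (λ c → q ℕ.+ w ℕ.* (S ∸ c)) (getAt-last ys b)) refl (bumpV-snoc ys b)))
    (trans (cong (λ g → if g then h (mono (q ℕ.+ w ℕ.* (S ∸ b)) t []) else 0ℚ)
        (eqVec-iff (suc b ∷ ys) (suc a ∷ xs) (snoc ys b) (snoc xs a)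
      (λ { refl → refl }) (λ e → cong₂ (λ c v → suc c ∷ v) (proj₂ (snoc-injective ys xs b a e))
          (proj₁ (snoc-injective ys xs b a e))))) guarded)
    where
    guarded : (if eqVec (snoc ys b) (snoc xs a) then h (mono (q ℕ.+ w ℕ.* (S ∸ b)) t []) else 0ℚ)
      ≡ coM (snoc xs a) (λ m → h (shiftM (w ℕ.* (S ∸ a)) (+ 0) m)) (mono q t (snoc ys b))
    guarded with eqVec (snoc ys b) (snoc xs a) in e
    ... | true = cong h (mono-cong
        (trans (cong (λ c → q ℕ.+ w ℕ.* (S ∸ c)) (proj₂ (snoc-injective ys xs b a (eqVec-sound (snoc ys b) (snoc xs a) e))))
        (ℕP.+-comm q _)) (sym (ℤP.+-identityˡ t)) refl)
    ... | false = refl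

co-1 : ∀ {n} → co (V.replicate n 0) 1ₚ ≋ 1ₚ
co-1 {n} = mk≋ λ h → trans (ev-co (V.replicate n 0) 1ₚ h)
    (trans (cong (λ e → ev e (coM (V.replicate n 0) h)) 1ₚ-⟨⟩) (trans (ev-⟨⟩ one (coM (V.replicate n 0) h))
  (trans (cong (λ b → if b then h one else 0ℚ) (eqVec-refl (V.replicate n 0)))
      (sym (trans (cong (λ e → ev e h) 1ₚ-⟨⟩) (ev-⟨⟩ one h))))))

-- The exponent of t in the ratio z of the eigenvalues at positions k and k + 1. The exponent of q
-- in z is the part at position k, because the part after it is 0 whenever a swap is made.
shiftz : ∀ {n} → ℕ → Vec ℕ n → ℤ
shiftz k η = + rank (suc k) η ℤ.- + rank k η

-- Built k η F c: F / c is E_η, obtained by the recursion of Knop and Sahi, and k is the number of leading zeros of η.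
data Built : ∀ {n} → ℕ → Vec ℕ n → Poly n → Poly 0 → Set where
  base : ∀ {n} → Built {n} n (V.replicate n 0) 1ₚ 1ₚ
  bump : ∀ {N k} (xs : Vec ℕ N) a {η : Vec ℕ (suc N)} {F c} → η ≡ snoc xs a → Built k η F c →
    Built 0 (suc a ∷ xs) (Φ 1 (V.sum η) F) (qt (V.sum η ∸ a) (+ 0) *ₚ c)
  swap : ∀ {n k} m {η : Vec ℕ n} {F c} → suc k < n → getAt k η ≡ suc m → getAt (suc k) η ≡ 0 → Built k η F c →
    Built (suc k) (swapAt k η) (intertwiner k (qt (suc m) (shiftz k η)) F) ((1ₚ -ₚ qt (suc m) (shiftz k η)) *ₚ c)

drop : ∀ {m η₀ η₁} → η₀ ≡ suc m → η₁ ≡ 0 → η₁ < η₀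
drop refl refl = s≤s z≤n

built-supp : ∀ {n k} {η : Vec ℕ n} {F c} → Built k η F c → Supp (_≼ η) F
built-supp base = supp-⊆ (λ { x refl → ≼-refl }) supp-1ₚ
built-supp (bump xs a {F = F} refl B) = supp λ h v →
    trans (ev-Φ 1 _ F h) (vanish (built-supp B) _ (λ q t x le → v _ _ _ (step x le)))
  where
  step : ∀ x → x ≼ snoc xs a → bumpV x ≼ (suc a ∷ xs)
  step x le with ys , b , refl ← unsnoc x = subst (_≼ (suc a ∷ xs)) (sym (bumpV-snoc ys b)) (≼-bump ys xs b a le)
built-supp {n} (swap {k = k} m {η} {F} l e₀ e₁ B) =
    supp-- (supp-≋ (≋-sym expand) (supp-- sT (supp-*ˡ _ (supp-qt₁ (suc m) (shiftz k η)) sT)))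
    (supp-*ˡ 𝐮 (supp-- (supp-qt₁ 0 (+ 1)) supp-1ₚ)
        (supp-⊆ (λ x le → subst (_≼ swapAt k η) (put-self k x)
        (≼-swap k m η l e₀ e₁ x le _ _ (refl , ℕP.m⊓n≤m _ _ , ℕP.m⊓n≤n (getAt k x) _))) (built-supp B)))
  where
  open PolySolver {n}
  sT : Supp (_≼ swapAt k η) (T⟨ k ⟩ F)
  sT = supp-T k (≼-swap k m η l e₀ e₁) (built-supp B)
  expand : (1ₚ -ₚ qt (suc m) (shiftz k η)) *ₚ T⟨ k ⟩ F ≋ T⟨ k ⟩ F -ₚ qt (suc m) (shiftz k η) *ₚ T⟨ k ⟩ F
  expand = solve 2 (λ z g → (con 1ℚ :- z) :* g := g :- z :* g) ≋-refl (qt (suc m) (shiftz k η)) (T⟨ k ⟩ F)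

qt-comm-1- : ∀ {n m} {A : Poly n → Poly m} → Lin A → QT A → ∀ a z f → A ((1ₚ -ₚ qt a z) *ₚ f) ≋ (1ₚ -ₚ qt a z) *ₚ A f
qt-comm-1- {n} {m} {A} lA qA a z f = lin-cong lA (solve 2 (λ z f → (con 1ℚ :- z) :* f := f :- z :* f) ≋-refl (qt a z) f) ⨾
    lin-- lA _ _ ⨾ ≋-refl ⟨-⟩ qA a z f ⨾
  S'.solve 2 (λ z f → f S'.:- z S'.:* f S'.:= (S'.con 1ℚ S'.:- z) S'.:* f) ≋-refl (qt a z) (A f)
  where
  open PolySolver {n}
  module S' = PolySolver {m}

built-lead : ∀ {n k} {η : Vec ℕ n} {F c} → Built k η F c → co η F ≋ c
built-lead base = co-1
built-lead (bump xs a {F = F} refl B) = co-Φ 1 _ xs a F ⨾ ≡⇒≋ (cong (λ e → qt e (+ 0)) (ℕP.+-identityʳ _)) ⟨*⟩ built-lead B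
built-lead {n} (swap {k = k} m {η} {F} {c} l e₀ e₁ B) = lin-u- (co-lin ζ) (co-qt ζ) _ F ⨾
    (qt-comm-1- (co-lin ζ) (co-qt ζ) (suc m) (shiftz k η) _ ⨾
        ≋-refl ⟨*⟩ (co-T k ζ l (trans (getAt-swap₀ k η l) e₁) F absent ⨾ ≡⇒≋ (cong (λ v → co v F) (swapAt-swapAt k η l)) ⨾
        built-lead B)) ⟨-⟩
    (≋-refl ⟨*⟩ absent ⨾ lin-0 (lin-mul 𝐮 lin-id)) ⨾ ≋-refl ⟨+⟩ neg0 ⨾ +ₚ-idʳ _
  where
  ζ : Vec ℕ n
  ζ = swapAt k η
  absent : co ζ F ≋ 0ₚ
  absent = co-supp ζ (built-supp B) (swap-⋠ k m η l e₀ e₁)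
  neg0 : -ₚ 0ₚ ≋ 0ₚ
  neg0 = lin-0 (lin-negP lin-id)

eigenvalue : ∀ {n} → Vec ℕ n → ℕ → Poly n
eigenvalue η i = qt (getAt i η) (ℤ.- (+ rank i η))

eigenvalue-cong : ∀ {n} (η η' : Vec ℕ n) i j → getAt i η ≡ getAt j η' → rank i η ≡ rank j η' → eigenvalue η i ≡ eigenvalue η' j
eigenvalue-cong η η' i j = cong₂ (λ a b → qt a (ℤ.- (+ b)))

T⁻-1 : ∀ {n} p → T⁻⟨ p ⟩ (1ₚ {n}) ≋ 𝐭⁻
T⁻-1 {n} p = ≡⇒≋ (T⁻-eq p 1ₚ) ⨾ ≋-refl ⟨*⟩ (T-1 p ⟨-⟩ ≋-refl) ⨾
    solve 2 (λ t t⁻ → t⁻ :* (t :- (t :- con 1ℚ) :* con 1ℚ) := t⁻) ≋-refl 𝐭 𝐭⁻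
  where open PolySolver {n}

chain-1 : ∀ {n} {O : ℕ → Poly n → Poly n} (lO : ∀ p → Lin (O p)) (qO : ∀ p → QT (O p)) z → (∀ p → O p 1ₚ ≋ qt 0 z) → ∀ a k →
    chain O a k 1ₚ ≋ qt 0 (+ k ℤ.* z)
chain-1 lO qO z e a zero = ≡⇒≋ (sym qt-one)
chain-1 {n} lO qO z e a (suc k) = lin-cong (lO a) (chain-1 lO qO z e (suc a) k ⨾
    solve 1 (λ t → t := t :* con 1ℚ) ≋-refl (qt 0 (+ k ℤ.* z))) ⨾
  qO a 0 (+ k ℤ.* z) 1ₚ ⨾ ≋-refl ⟨*⟩ e a ⨾ qt-* 0 (+ k ℤ.* z) 0 z ⨾
      ≡⇒≋ (cong (qt 0) (trans (ℤP.+-comm (+ k ℤ.* z) z) (sym (ℤP.suc-* (+ k) z))))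
  where open PolySolver {n}

cge-replicate : ∀ n → cge 0 (V.replicate n 0) ≡ n
cge-replicate zero = refl
cge-replicate (suc n) = cong suc (cge-replicate n)

rank-replicate : ∀ i d → rank i (V.replicate (suc (i ℕ.+ d)) 0) ≡ d
rank-replicate zero d = cge-replicate d
rank-replicate (suc i) d = trans (cong (ℕ._+ rank i (V.replicate (suc (i ℕ.+ d)) 0)) refl) (rank-replicate i d)

1-eigen : ∀ i d → Y {i ℕ.+ d} 1 i d 1ₚ ≋ eigenvalue (V.replicate (suc (i ℕ.+ d)) 0) i *ₚ 1ₚ
1-eigen i d = ≋-refl ⟨*⟩ (lin-cong (dn-lin i d) (lin-cong (ω-lin 1) (chain-1 T-lin T-qt (+ 1) T-1 0 i ⨾ unit _) ⨾ ω-qt 1 0 _ 1ₚ ⨾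
    ≋-refl ⟨*⟩ ω-1 1) ⨾ dn-qt i d 0 _ 1ₚ ⨾ ≋-refl ⟨*⟩ chain-1 T⁻-lin T⁻-qt (ℤ.- (+ 1)) T⁻-1 i d) ⨾
  ≋-refl ⟨*⟩ qt-* 0 _ 0 _ ⨾ qt-* 0 _ 0 _ ⨾ unit _ ⨾
      ≡⇒≋ (cong₂ qt (sym (getAt-replicate {suc (i ℕ.+ d)} i)) (trans arith (cong (λ r → ℤ.- (+ r)) (sym (rank-replicate i d)))))
      ⟨*⟩ ≋-refl
  where
  unit : ∀ z → qt 0 z ≋ qt 0 z *ₚ 1ₚ
  unit z = solve 1 (λ t → t := t :* con 1ℚ) ≋-refl (qt 0 z)
    where open PolySolver {suc (i ℕ.+ d)}
  arith : ℤ.- (+ i) ℤ.+ (+ i ℤ.* + 1 ℤ.+ + d ℤ.* ℤ.- (+ 1)) ≡ ℤ.- (+ d)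
  arith = solve 2 (λ i d → (:- i) :+ (i :* con (+ 1) :+ d :* (:- con (+ 1))) := :- d) refl (+ i) (+ d)
    where open ℤS.+-*-Solver

built-eigen : ∀ {N k} {η : Vec ℕ (suc N)} {F c} → Built k η F c → Eigen 1 (eigenvalue η) F
built-eigen base i d refl = 1-eigen i d
built-eigen {N} (bump xs a {F = F} refl B) = go
  where
  hN : Y 1 N 0 F ≋ qt (getAt N (snoc xs a)) (ℤ.- (+ rank N (snoc xs a))) *ₚ F
  hN = built-eigen B N 0 (ℕP.+-identityʳ N)
  sp : Supp (λ x → V.sum x ≡ V.sum (snoc xs a)) F
  sp = supp-⊆ (λ x le → same-sum le) (built-supp B)
  go : Eigen 1 (eigenvalue (suc a ∷ xs)) (Φ 1 (V.sum (snoc xs a)) F)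
  go zero d refl = Φ-eigen 1 _ _ _ F sp hN (Y-lin 1 0 N) (Y-qt 1 0 N) _ _ (bumped-zero 1 F _ _ hN ⨾
    ≡⇒≋ (cong₂ (λ b r → qt (suc b) (ℤ.- (+ r))) (getAt-last xs a) (rank-bump₀ xs a)) ⟨*⟩ ≋-refl)
  go (suc i) d e = Φ-eigen 1 _ _ _ F sp hN (Y-lin 1 (suc i) d) (Y-qt 1 (suc i) d) _ _
    (bumped-suc-eigen 1 F _ _ hN i d _ _ e' (built-eigen B i (suc d) e' ⨾
      ≡⇒≋ (eigenvalue-cong (snoc xs a) (suc a ∷ xs) i (suc i) (getAt-snoc i xs a i<N) (sym (rank-bump₊ i xs a i<N))) ⟨*⟩ ≋-refl))
    where
    e' : i ℕ.+ suc d ≡ N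
    e' = trans (ℕP.+-suc i d) e
    i<N : i < N
    i<N = subst (suc i ≤_) e (s≤s (ℕP.m≤m+n i d))
built-eigen {N} (swap {k = k} m {η} {F} l e₀ e₁ B) = go
  where
  z : Poly (suc N)
  z = qt (suc m) (shiftz k η)
  zy : z *ₚ eigenvalue η (suc k) ≋ eigenvalue η k
  zy = qt-* (suc m) (shiftz k η) (getAt (suc k) η) _ ⨾
      ≡⇒≋ (cong₂ qt (trans (cong (suc m ℕ.+_) e₁) (trans (ℕP.+-identityʳ (suc m)) (sym e₀)))
      (solve 2 (λ a b → (a :- b) :+ (:- a) := :- b) refl (+ rank (suc k) η) (+ rank k η)))
    where open ℤS.+-*-Solver
  there : ∀ d → k ℕ.+ suc d ≡ N → suc k ℕ.+ d ≡ N
  there d e = trans (sym (ℕP.+-suc k d)) e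
  go : Eigen 1 (eigenvalue (swapAt k η)) (intertwiner k z F)
  go i d e with near k i
  go i zero e | at₀ refl = ⊥-elim (ℕP.<⇒≱ l (s≤s (ℕP.≤-reflexive (trans (sym e) (ℕP.+-identityʳ k)))))
  go i (suc d) e | at₀ refl = intertwiner-at 1 k d e (suc m) (shiftz k η) F _ _ _ _ _ _ refl refl zy (built-eigen B k (suc d) e)
      (built-eigen B (suc k) d (there d e)) ⨾
      ≡⇒≋ (sym (eigenvalue-cong (swapAt k η) η k (suc k) (getAt-swap₀ k η l) (rank-swap₀ k η l (drop e₀ e₁)))) ⟨*⟩ ≋-refl
  go i d e | at₁ refl = intertwiner-suc 1 k d e' (suc m) (shiftz k η) F _ _ _ _ _ _ refl refl zy (built-eigen B k (suc d) e')
      (built-eigen B (suc k) d e) ⨾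
      ≡⇒≋ (sym (eigenvalue-cong (swapAt k η) η (suc k) k (getAt-swap₁ k η l) (rank-swap₁ k η l (drop e₀ e₁)))) ⟨*⟩ ≋-refl
    where
    e' : k ℕ.+ suc d ≡ N
    e' = trans (ℕP.+-suc k d) e
  go i d e | far a b = intertwiner-far 1 k (N ∸ suc k) (trans (ℕP.+-suc k _) (ℕP.m+[n∸m]≡n (ℕP.≤-pred l))) (suc m) (shiftz k η) F
      i d (eigenvalue η i) e a b (_ , _ , refl) (built-eigen B i d e) ⨾
      ≡⇒≋ (sym (eigenvalue-cong (swapAt k η) η i i (getAt-swap-far k i η a b) (rank-swap-far k i η l a b))) ⟨*⟩ ≋-refl

-- From ≼ to dominance

private
  Σ∸ : ℕ → List ℕ → ℕ
  Σ∸ H xs = sum (L.map (_∸ H) xs)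

  ∸Σ : ℕ → List ℕ → ℕ
  ∸Σ H xs = sum (L.map (H ∸_) xs)

  exchange : ∀ H xs → sum xs ℕ.+ ∸Σ H xs ≡ L.length xs ℕ.* H ℕ.+ Σ∸ H xs
  exchange H [] = refl
  exchange H (x ∷ xs) = trans (four x (sum xs) (H ∸ x) (∸Σ H xs))
      (trans (cong₂ ℕ._+_ (both x) (exchange H xs)) (four H (x ∸ H) (L.length xs ℕ.* H) (Σ∸ H xs)))
    where
    four : ∀ a b c d → a ℕ.+ b ℕ.+ (c ℕ.+ d) ≡ a ℕ.+ c ℕ.+ (b ℕ.+ d)
    four = solve 4 (λ a b c d → a :+ b :+ (c :+ d) := a :+ c :+ (b :+ d)) refl
      where open ℕS.+-*-Solver
    both : ∀ x → x ℕ.+ (H ∸ x) ≡ H ℕ.+ (x ∸ H)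
    both x with ℕP.≤-total x H
    ... | inj₁ l = trans (ℕP.m+[n∸m]≡n l) (sym (trans (cong (H ℕ.+_) (ℕP.m≤n⇒m∸n≡0 l)) (ℕP.+-identityʳ H)))
    ... | inj₂ l = trans (cong (x ℕ.+_) (ℕP.m≤n⇒m∸n≡0 l)) (trans (ℕP.+-identityʳ x) (sym (ℕP.m+[n∸m]≡n l)))

  take-≤ : ∀ k H xs → sum (L.take k xs) ≤ k ℕ.* H ℕ.+ Σ∸ H xs
  take-≤ zero H xs = z≤n
  take-≤ (suc k) H [] = z≤n
  take-≤ (suc k) H (x ∷ xs) = ℕP.≤-trans (ℕP.+-mono-≤ (ℕP.m≤n+m∸n x H) (take-≤ k H xs))
    (ℕP.≤-reflexive (solve 4 (λ a b c d → a :+ b :+ (c :+ d) := a :+ c :+ (b :+ d)) refl H (x ∸ H) (k ℕ.* H) (Σ∸ H xs)))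
    where open ℕS.+-*-Solver

  Descending : List ℕ → Set
  Descending = AllPairs (λ x y → y ≤ x)

  Σ∸-zero : ∀ H xs → All (_≤ H) xs → Σ∸ H xs ≡ 0
  Σ∸-zero H [] [] = refl
  Σ∸-zero H (x ∷ xs) (l ∷ ls) = cong₂ ℕ._+_ (ℕP.m≤n⇒m∸n≡0 l) (Σ∸-zero H xs ls)

  -- The witness H is the last of the first k + 1 entries; for a decreasing list the bound `take-≤`
  -- is attained there.
  take-desc : ∀ k ys → Descending ys → suc k ≤ L.length ys →
    ∃ λ H → suc k ℕ.* H ℕ.+ Σ∸ H ys ≤ sum (L.take (suc k) ys) × (∀ z → All (_≤ z) ys → H ≤ z)
  take-desc zero (y ∷ ys) (l ∷ d) _ = y , ℕP.≤-reflexive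
      (cong₂ ℕ._+_ (ℕP.*-identityˡ y) (cong₂ ℕ._+_ (ℕP.n∸n≡0 y) (Σ∸-zero y ys l))) , λ { z (p ∷ _) → p }
  take-desc (suc k) (y ∷ ys) (l ∷ d) (s≤s le) with H , b , low ← take-desc k ys d le = H ,
    ℕP.≤-trans (ℕP.≤-reflexive
        (trans (solve 4 (λ a b c d → (a :+ c) :+ (b :+ d) := (a :+ b) :+ (c :+ d)) refl H (y ∸ H) (suc k ℕ.* H) (Σ∸ H ys))
      (cong (ℕ._+ (suc k ℕ.* H ℕ.+ Σ∸ H ys)) (ℕP.m+[n∸m]≡n (low y l))))) (ℕP.+-monoʳ-≤ y b) ,
    λ { z (p ∷ ps) → low z ps }
    where open ℕS.+-*-Solver

  scanl-≤ : ∀ a b xs ys → L.length xs ≡ L.length ys → (∀ k → k ≤ L.length ys → a ℕ.+ sum (L.take k xs) ≤ b ℕ.+ sum (L.take k ys))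
      →
    Pointwise _≤_ (L.scanl ℕ._+_ a xs) (L.scanl ℕ._+_ b ys)
  scanl-≤ a b [] [] e h = first ∷ []
    where first = subst₂ _≤_ (ℕP.+-identityʳ a) (ℕP.+-identityʳ b) (h 0 z≤n)
  scanl-≤ a b (x ∷ xs) (y ∷ ys) e h = subst₂ _≤_ (ℕP.+-identityʳ a) (ℕP.+-identityʳ b) (h 0 z≤n) ∷
    scanl-≤ (a ℕ.+ x) (b ℕ.+ y) xs ys (ℕP.suc-injective e)
        (λ k l → subst₂ _≤_ (sym (ℕP.+-assoc a x _)) (sym (ℕP.+-assoc b y _)) (h (suc k) (s≤s l)))

  -- For a decreasing list the sum of the first k entries is the minimum over H of k H + Σ max(x -
  -- H, 0), and for any list it is at most that. So it suffices to compare these sums of excesses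
  -- for every H, and by `exchange` they are governed by the sums of `H ∸ x`.
  dominance : ∀ xs ys → L.length xs ≡ L.length ys → Descending ys → sum xs ≡ sum ys → (∀ H → ∸Σ H xs ≤ ∸Σ H ys) → PSumLe xs ys
  dominance xs ys e d s h = scanl-≤ 0 0 xs ys e bound
    where
    Σ-≤ : ∀ H → Σ∸ H xs ≤ Σ∸ H ys
    Σ-≤ H = ℕP.+-cancelˡ-≤ (L.length ys ℕ.* H) _ _
        (subst₂ _≤_ (trans (exchange H xs) (cong (λ n → n ℕ.* H ℕ.+ Σ∸ H xs) e)) (exchange H ys)
      (ℕP.+-mono-≤ (ℕP.≤-reflexive s) (h H)))
    bound : ∀ k → k ≤ L.length ys → sum (L.take k xs) ≤ sum (L.take k ys)
    bound zero _ = z≤n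
    bound (suc k) l with H , b , _ ← take-desc k ys d l =
        ℕP.≤-trans (take-≤ (suc k) H xs) (ℕP.≤-trans (ℕP.+-monoʳ-≤ (suc k ℕ.* H) (Σ-≤ H)) b)

  open import Data.List.Sort.InsertionSort.Properties ℕP.≤-decTotalOrder using (sort-↭; sort-↗)

  sortDesc-↭ : ∀ {n} (η : Vec ℕ n) → sortDesc η ↭ V.toList η
  sortDesc-↭ η = ↭-trans (PermP.↭-reverse _) (sort-↭ (V.toList η))

  reverse-desc : ∀ xs → AllPairs _≤_ xs → Descending (L.reverse xs)
  reverse-desc [] [] = []
  reverse-desc (x ∷ xs) (p ∷ ps) = subst Descending (sym (LP.unfold-reverse x xs))
    (AllPairsP.++⁺ (reverse-desc xs ps) ([] ∷ []) (All.map (λ l → l ∷ []) (PermP.All-resp-↭ (↭-sym (PermP.↭-reverse xs)) p)))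

  mass-list : ∀ {n} H (v : Vec ℕ n) → mass n H v ≡ ∸Σ H (V.toList v)
  mass-list H [] = refl
  mass-list H (x ∷ v) = cong ((H ∸ x) ℕ.+_) (mass-list H v)

  sum-list : ∀ {n} (v : Vec ℕ n) → sum (V.toList v) ≡ V.sum v
  sum-list [] = refl
  sum-list (x ∷ v) = cong (x ℕ.+_) (sum-list v)

-- At the index n the mass is symmetric in the parts, hence unchanged by sorting, and `dominance`
-- applies to the sorted lists.
≼⇒CompLe : ∀ {n} {ζ η : Vec ℕ n} → ζ ≼ η → CompLe ζ η
≼⇒CompLe {n} {ζ} {η} le = inj₁ (sums , dominance (sortDesc ζ) (sortDesc η) lengths
    (reverse-desc _ (LinkedP.Linked⇒AllPairs ℕP.≤-trans (sort-↗ (V.toList η)))) sums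
    (λ H → subst₂ _≤_ (masses H ζ) (masses H η) (mass-≤ le n H)))
  where
  sum-sorted : ∀ v → sum (sortDesc v) ≡ V.sum v
  sum-sorted v = trans (sum-↭ (sortDesc-↭ v)) (sum-list v)
  sums : sum (sortDesc ζ) ≡ sum (sortDesc η)
  sums = trans (sum-sorted ζ) (trans (same-sum le) (sym (sum-sorted η)))
  len : ∀ (v : Vec ℕ n) → L.length (sortDesc v) ≡ n
  len v = trans (PermP.↭-length (sortDesc-↭ v)) (VP.length-toList v)
  lengths : L.length (sortDesc ζ) ≡ L.length (sortDesc η)
  lengths = trans (len ζ) (sym (len η))
  masses : ∀ H v → mass n H v ≡ ∸Σ H (sortDesc v)
  masses H v = trans (mass-list H v) (sym (sum-↭ (PermP.map⁺ (H ∸_) (sortDesc-↭ v))))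

-- Specialisation at q = 1

qM : ∀ {n} → Mono n → Mono n
qM (mono q t x) = mono 0 t x

opaque
  q1 : ∀ {n} → Poly n → Poly n
  q1 = atQ1

  q1-def : ∀ {n} (f : Poly n) → atQ1 f ≡ q1 f
  q1-def f = refl

  ev-q1 : ∀ {n} (f : Poly n) h → ev (q1 f) h ≡ ev f (λ m → h (qM m))
  ev-q1 f h = ev-map qM f h

q1-lin : ∀ {n} → Lin (q1 {n})
q1-lin = lin (λ h m → h (qM m)) ev-q1

q1-* : ∀ {n} (f g : Poly n) → q1 (f *ₚ g) ≋ q1 f *ₚ q1 g
q1-* f g = mk≋ λ h → trans (ev-q1 (f *ₚ g) h)
    (trans (ev-*ₚ f g _) (sym (trans (ev-*ₚ (q1 f) (q1 g) h) (trans (ev-q1 f _) (ev-cong f (λ m → ev-q1 g _))))))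

q1-qt : ∀ {n} a z → q1 (qt {n} a z) ≋ qt 0 z
q1-qt {n} a z = mk≋ λ h → trans (ev-q1 (qt a z) h)
    (trans (cong (λ e → ev e (λ m → h (qM m))) (qt-⟨⟩ {n} a z)) (trans (ev-⟨⟩ (mono a z (V.replicate n 0)) (λ m → h (qM m)))
  (sym (trans (cong (λ e → ev e h) (qt-⟨⟩ 0 z)) (ev-⟨⟩ _ h)))))

q1-1 : ∀ {n} → q1 (1ₚ {n}) ≋ 1ₚ
q1-1 = lin-cong q1-lin (≡⇒≋ (sym qt-one)) ⨾ q1-qt 0 (+ 0) ⨾ ≡⇒≋ qt-one

q1-X : ∀ {n} p (f : Poly n) → q1 (X p *ₚ f) ≋ X p *ₚ q1 f
q1-X p f = mk≋ λ h → trans (ev-q1 (X p *ₚ f) h) (trans (ev-X p f _) (sym (trans (ev-X p (q1 f) h) (ev-q1 f _))))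

q1-qt* : ∀ {n} a z (f : Poly n) → q1 (qt a z *ₚ f) ≋ qt 0 z *ₚ q1 f
q1-qt* a z f = q1-* (qt a z) f ⨾ q1-qt a z ⟨*⟩ ≋-refl

q1-∂ : ∀ {n} p (f : Poly n) → q1 (∂ p f) ≋ ∂ p (q1 f)
q1-∂ p f = mk≋ λ h → trans (ev-q1 (∂ p f) h) (trans (ev-∂ p f _) (sym (trans (ev-∂ p (q1 f) h) (ev-q1 f _))))

q1-u : ∀ {n} (f : Poly n) → q1 (𝐮 *ₚ f) ≋ 𝐮 *ₚ q1 f
q1-u f = q1-* 𝐮 f ⨾ (lin-- q1-lin 𝐭 1ₚ ⨾ q1-qt 0 (+ 1) ⟨-⟩ q1-1) ⟨*⟩ ≋-refl

q1-T : ∀ {n} p (f : Poly n) → q1 (T⟨ p ⟩ f) ≋ T⟨ p ⟩ (q1 f)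
q1-T {n} p f = lin-cong q1-lin (≡⇒≋ (T-eq p f) ⨾ split f (∂ p f)) ⨾ lin-- q1-lin _ _ ⨾ q1-qt* 0 (+ 1) f ⟨-⟩
    (lin-- q1-lin _ _ ⨾ (q1-qt* 0 (+ 1) _ ⨾ ≋-refl ⟨*⟩ (q1-X p _ ⨾ ≋-refl ⟨*⟩ q1-∂ p f)) ⟨-⟩
        (q1-X (suc p) _ ⨾ ≋-refl ⟨*⟩ q1-∂ p f)) ⨾
  ≋-sym (split (q1 f) (∂ p (q1 f))) ⨾ ≡⇒≋ (sym (T-eq p (q1 f)))
  where
  open PolySolver {n}
  split : ∀ f d → 𝐭 *ₚ f -ₚ (𝐭 *ₚ X p -ₚ X (suc p)) *ₚ d ≋ 𝐭 *ₚ f -ₚ (𝐭 *ₚ (X p *ₚ d) -ₚ X (suc p) *ₚ d)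
  split f d = solve 5 (λ t f x y d → t :* f :- (t :* x :- y) :* d := t :* f :- (t :* (x :* d) :- y :* d)) ≋-refl 𝐭 f (X p)
      (X (suc p)) d

q1-T⁻ : ∀ {n} p (f : Poly n) → q1 (T⁻⟨ p ⟩ f) ≋ T⁻⟨ p ⟩ (q1 f)
q1-T⁻ p f = lin-cong q1-lin (≡⇒≋ (T⁻-eq p f)) ⨾ q1-qt* 0 (ℤ.- (+ 1)) _ ⨾ ≋-refl ⟨*⟩ (lin-- q1-lin _ _ ⨾ q1-T p f ⟨-⟩ q1-u f) ⨾
    ≡⇒≋ (sym (T⁻-eq p (q1 f)))

q1-ω : ∀ {n} (f : Poly n) → q1 (ω 1 f) ≋ ω 0 (q1 f)
q1-ω f = mk≋ λ h → trans (ev-q1 (ω 1 f) h) (trans (ev-ω 1 f _) (sym (trans (ev-ω 0 (q1 f) h) (ev-q1 f _))))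

q1-Φ : ∀ {N} S (f : Poly (suc N)) → q1 (Φ 1 S f) ≋ Φ 0 S (q1 f)
q1-Φ S f = mk≋ λ h → trans (ev-q1 (Φ 1 S f) h) (trans (ev-Φ 1 S f _) (sym (trans (ev-Φ 0 S (q1 f) h) (ev-q1 f _))))

q1-chain : ∀ {n} {O : ℕ → Poly n → Poly n} → (∀ p → Lin (O p)) → (∀ p f → q1 (O p f) ≋ O p (q1 f)) → ∀ a k f →
    q1 (chain O a k f) ≋ chain O a k (q1 f)
q1-chain lO e a zero f = ≋-refl
q1-chain lO e a (suc k) f = e a _ ⨾ lin-cong (lO a) (q1-chain lO e (suc a) k f)

q1-Y : ∀ {N} i d (f : Poly (suc N)) → q1 (Y 1 i d f) ≋ Y 0 i d (q1 f)
q1-Y i d f = q1-qt* 0 (ℤ.- (+ i)) _ ⨾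
    ≋-refl ⟨*⟩ (q1-chain T⁻-lin q1-T⁻ i d _ ⨾ lin-cong (dn-lin i d) (q1-ω _ ⨾ lin-cong (ω-lin 0) (q1-chain T-lin q1-T 0 i f)))

q1-1-qt : ∀ {n} a z (f : Poly n) → q1 ((1ₚ -ₚ qt a z) *ₚ f) ≋ (1ₚ -ₚ qt 0 z) *ₚ q1 f
q1-1-qt a z f = q1-* _ f ⨾ (lin-- q1-lin 1ₚ (qt a z) ⨾ q1-1 ⟨-⟩ q1-qt a z) ⟨*⟩ ≋-refl

q1-intertwiner : ∀ {n} p a z (f : Poly n) → q1 (intertwiner p (qt a z) f) ≋ intertwiner p (qt 0 z) (q1 f)
q1-intertwiner p a z f = lin-- q1-lin _ _ ⨾ (q1-1-qt a z _ ⨾ ≋-refl ⟨*⟩ q1-T p f) ⟨-⟩ q1-u f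

q1-co : ∀ {n} (ζ : Vec ℕ n) f → q1 (co ζ f) ≋ co ζ (q1 f)
q1-co ζ f = mk≋ λ h → trans (ev-q1 (co ζ f) h) (trans (ev-co ζ f _) (sym (trans (ev-co ζ (q1 f) h) (ev-q1 f _))))

supp-q1 : ∀ {n} {P : Vec ℕ n → Set} {f : Poly n} → Supp P f → Supp P (q1 f)
supp-q1 {f = f} s = supp λ h v → trans (ev-q1 f h) (vanish s _ (λ q t x p → v 0 t x p))

built-eigen₁ : ∀ {N k} {η : Vec ℕ (suc N)} {F c} → Built k η F c → Eigen 0 (λ i → qt 0 (ℤ.- (+ rank i η))) (q1 F)
built-eigen₁ {η = η} {F} B i d e = ≋-sym (q1-Y i d F) ⨾ lin-cong q1-lin (built-eigen B i d e) ⨾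
    q1-qt* (getAt i η) (ℤ.- (+ rank i η)) F

-- Denominators and regular elements

liftM : ∀ {n} → Mono 0 → Mono n
liftM {n} (mono q t x) = mono q t (V.replicate n 0)

opaque
  lift : ∀ {n} → Poly 0 → Poly n
  lift = liftC

  lift-def : ∀ {n} (c : Poly 0) → liftC {n} c ≡ lift c
  lift-def c = refl

  ev-lift : ∀ {n} (c : Poly 0) (h : Mono n → ℚ) → ev (lift c) h ≡ ev c (λ m → h (liftM m))
  ev-lift c h = ev-map liftM c h

lift-lin : ∀ {n} → Lin (lift {n})
lift-lin = lin (λ h m → h (liftM m)) ev-lift

lift-⟨⟩ : ∀ {n} (m : Mono 0) → lift {n} ⟨ m ⟩ ≋ qt (Mono.qe m) (Mono.te m)
lift-⟨⟩ m = mk≋ λ h → trans (ev-lift ⟨ m ⟩ h)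
    (trans (ev-⟨⟩ m (λ m → h (liftM m))) (sym (trans (cong (λ e → ev e h) (qt-⟨⟩ (Mono.qe m) (Mono.te m))) (ev-⟨⟩ _ h))))

lift-qt : ∀ {n} a z → lift {n} (qt a z) ≋ qt a z
lift-qt a z = lin-cong lift-lin (≡⇒≋ (qt-⟨⟩ a z)) ⨾ lift-⟨⟩ _

lift-1 : ∀ {n} → lift {n} 1ₚ ≋ 1ₚ
lift-1 = lin-cong lift-lin (≡⇒≋ (sym qt-one)) ⨾ lift-qt 0 (+ 0) ⨾ ≡⇒≋ qt-one

lift-* : ∀ {n} (c d : Poly 0) → lift {n} (c *ₚ d) ≋ lift c *ₚ lift d
lift-* {n} c d = mk≋ λ h → trans (ev-lift (c *ₚ d) h)
    (trans (ev-*ₚ c d _) (sym (trans (ev-*ₚ (lift c) (lift d) h) (trans (ev-lift c _) (ev-cong c (λ m → trans (ev-lift d _)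
  (ev-cong d (λ m' → cong h (mono-cong refl refl (VP.zipWith-identityˡ ℕP.+-identityˡ (V.replicate n 0)))))))))))

lift-1-qt : ∀ {n} a z (c : Poly 0) → lift {n} ((1ₚ -ₚ qt a z) *ₚ c) ≋ (1ₚ -ₚ qt a z) *ₚ lift c
lift-1-qt a z c = lift-* _ c ⨾ (lin-- lift-lin _ _ ⨾ lift-1 ⟨-⟩ lift-qt a z) ⟨*⟩ ≋-refl

lift-comm : ∀ {n m} {A : Poly n → Poly m} → Lin A → QT A → ∀ c f → A (lift c *ₚ f) ≋ lift c *ₚ A f
lift-comm lA qA c f = lin-ext (lin-∘ lA (lin-mulʳ f lift-lin)) (lin-mulʳ _ lift-lin)
  (λ m → lin-cong lA (lift-⟨⟩ m ⟨*⟩ ≋-refl) ⨾ qA _ _ f ⨾ ≋-sym (lift-⟨⟩ m) ⟨*⟩ ≋-refl) c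

-- Nonvanishing is tracked as regularity: it passes to products and permits cancellation without a
-- proof that the polynomial ring is a domain.
NZD : ∀ {n} → Poly n → Set
NZD {n} p = ∀ (f : Poly n) → p *ₚ f ≋ 0ₚ → f ≋ 0ₚ

nzd-≋ : ∀ {n} {p p' : Poly n} → p ≋ p' → NZD p → NZD p'
nzd-≋ e z f h = z f (e ⟨*⟩ ≋-refl ⨾ h)

nzd-* : ∀ {n} {p p' : Poly n} → NZD p → NZD p' → NZD (p *ₚ p')
nzd-* z z' f h = z' f (z _ (≋-sym (*ₚ-assoc _ _ f) ⨾ h))

*-zeroʳ : ∀ {n} (p : Poly n) → p *ₚ 0ₚ ≋ 0ₚ
*-zeroʳ p = lin-0 (lin-mul p lin-id)

nzd-qt : ∀ {n} a z → NZD (qt {n} a z)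
nzd-qt a z f h = qt-cancel a z (h ⨾ ≋-sym (*-zeroʳ (qt a z)))

nzd-1 : ∀ {n} → NZD (1ₚ {n})
nzd-1 = nzd-≋ (≡⇒≋ qt-one) (nzd-qt 0 (+ 0))

nzd-cancel : ∀ {n} {p : Poly n} → NZD p → ∀ {f g} → p *ₚ f ≋ p *ₚ g → f ≋ g
nzd-cancel {n} {p} z {f} {g} e = solve 2 (λ f g → f := (f :- g) :+ g) ≋-refl f g ⨾
    z (f -ₚ g) (solve 3 (λ p f g → p :* (f :- g) := p :* f :- p :* g) ≋-refl p f g ⨾ e ⟨-⟩ ≋-refl ⨾ neg-invʳ _) ⟨+⟩ ≋-refl ⨾
  +ₚ-comm 0ₚ g ⨾ +ₚ-idʳ g
  where open PolySolver {n}

1≉0 : ∀ {n} → ¬ (1ₚ {n} ≋ 0ₚ)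
1≉0 e = absurd (trans (sym (ℚP.*-identityʳ 1ℚ))
    (trans (sym (ev-const 1ℚ (λ _ → 1ℚ))) (trans (at e (λ _ → 1ℚ)) (ev-0ₚ (λ _ → 1ℚ)))))
  where absurd : 1ℚ ≡ 0ℚ → ⊥
        absurd ()

-- If t^{k+1} f = f then f is fixed by all powers of t^{k+1}, so its t-exponents leave every bounded set.
nzd-1-t : ∀ {n} k → NZD (1ₚ {n} -ₚ qt 0 (+ suc k))
nzd-1-t {n} k f e = ≈⇒≋ (λ m → trans (coeff-ev f m) (trans (vanishing m) (sym (trans (coeff-ev 0ₚ m) (ev-0ₚ (δ m))))))
  where
  open PolySolver {n}
  fixed : f ≋ qt 0 (+ suc k) *ₚ f
  fixed = solve 2 (λ f z → f := (con 1ℚ :- z) :* f :+ z :* f) ≋-refl f (qt 0 (+ suc k)) ⨾ e ⟨+⟩ ≋-refl ⨾ +ₚ-comm 0ₚ _ ⨾ +ₚ-idʳ _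
  power : ∀ j → f ≋ qt 0 (+ (j ℕ.* suc k)) *ₚ f
  power zero = ≋-sym (≡⇒≋ qt-one ⟨*⟩ ≋-refl ⨾ *ₚ-idˡ f)
  power (suc j) = fixed ⨾ ≋-refl ⟨*⟩ power j ⨾ ≋-sym (*ₚ-assoc _ _ f) ⨾ qt-* 0 (+ suc k) 0 (+ (j ℕ.* suc k)) ⟨*⟩ ≋-refl
  distance : Mono n → Poly n → ℕ
  distance m [] = 0
  distance m ((c , mono q t x) ∷ g) = ℤ.∣ Mono.te m ℤ.- t ∣ ℕ.+ distance m g
  beyond : ∀ m M (g : Poly n) → distance m g < M → ev g (λ a → δ m (shiftM 0 (+ (M ℕ.* suc k)) a)) ≡ 0ℚ
  beyond m M [] l = refl
  beyond m M ((c , mono q t x) ∷ g) l =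
      trans (cong₂ ℚ._+_ (trans (cong (λ b → c ℚ.* (if b then 1ℚ else 0ℚ)) differ) (ℚP.*-zeroʳ c))
      (beyond m M g (ℕP.≤-trans (s≤s (ℕP.m≤n+m (distance m g) _)) l))) refl
    where
    differ : eqMono m (mono q (+ (M ℕ.* suc k) ℤ.+ t) x) ≡ false
    differ with eqMono m (mono q (+ (M ℕ.* suc k) ℤ.+ t) x) in p
    ... | false = refl
    ... | true = ⊥-elim (ℕP.<⇒≱ (ℕP.≤-trans (s≤s (ℕP.m≤m+n _ (distance m g))) l)
        (ℕP.≤-trans (ℕP.m≤m*n M (suc k))
            (ℕP.≤-reflexive (sym (cong ℤ.∣_∣
            (trans (cong (ℤ._- t) (cong Mono.te (eqMono-sound m _ p))) (cancel (+ (M ℕ.* suc k)) t)))))))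
      where
      cancel : ∀ a b → a ℤ.+ b ℤ.- b ≡ a
      cancel = solveℤ 2 (λ a b → a ⊞ b ⊟ b ⊜ a) refl
        where open ℤS.+-*-Solver renaming (solve to solveℤ; _:+_ to _⊞_; _:-_ to _⊟_; _:=_ to _⊜_)
  vanishing : ∀ m → ev f (δ m) ≡ 0ℚ
  vanishing m = trans (at (power M) (δ m)) (trans (ev-qt 0 (+ (M ℕ.* suc k)) f (δ m)) (beyond m M f ℕP.≤-refl))
    where
    M : ℕ
    M = suc (distance m f)

-- This makes the exponent `shiftz` positive at a descent, so that at q = 1 the factor 1 - z of a
-- denominator becomes 1 - t^r with r > 0.
rank-descent : ∀ {n} p (v : Vec ℕ n) → suc p < n → getAt (suc p) v < getAt p v → rank p v < rank (suc p) v
rank-descent zero (x ∷ []) (s≤s ())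
rank-descent zero (x ∷ y ∷ v) l d rewrite <ᵇ-true d | ≤ᵇ-false d = s≤s (cge-mono v (ℕP.<⇒≤ d))
rank-descent (suc p) (x ∷ v) (s≤s l) d = ℕP.+-mono-≤-< (bits (getAt p v ℕ.<? x)) (rank-descent p v l d)
  where
  bits : Dec (getAt p v < x) → bit (getAt p v ℕ.<ᵇ x) ≤ bit (getAt (suc p) v ℕ.<ᵇ x)
  bits (yes r) rewrite <ᵇ-true r | <ᵇ-true (ℕP.<-trans d r) = ℕP.≤-refl
  bits (no r) rewrite <ᵇ-false {getAt p v} {x} (ℕP.≮⇒≥ r) = z≤n

built-nzd : ∀ {m n k} {η : Vec ℕ n} {F c} → Built k η F c → NZD (lift {m} (q1 c))
built-nzd base = nzd-≋ (≋-sym (lin-cong lift-lin q1-1 ⨾ lift-1)) nzd-1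
built-nzd (bump xs a {η} {c = c} e B) =
    nzd-≋ (≋-sym (lin-cong lift-lin (q1-qt* (V.sum η ∸ a) (+ 0) c) ⨾ lift-* _ _ ⨾ lift-qt 0 (+ 0) ⟨*⟩ ≋-refl))
    (nzd-* (nzd-qt 0 (+ 0)) (built-nzd B))
built-nzd {m'} (swap {k = k} m {η} {c = c} l e₀ e₁ B) =
    nzd-≋ (≋-sym (lin-cong lift-lin (q1-1-qt (suc m) (shiftz k η) c) ⨾ lift-1-qt 0 (shiftz k η) _)) (nzd-* factor (built-nzd B))
  where
  factor : NZD (1ₚ {m'} -ₚ qt 0 (shiftz k η))
  factor with o , e ← ℕP.m≤n⇒∃[o]m+o≡n (rank-descent k η l (drop e₀ e₁)) =
      subst (λ z → NZD (1ₚ -ₚ qt 0 z)) (sym shift) (nzd-1-t o)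
    where
    shift : shiftz k η ≡ + suc o
    shift = trans (cong (λ r → + r ℤ.- + rank k η) (sym e))
        (trans (cong (ℤ._- + rank k η) (cong +_ (sym (ℕP.+-suc (rank k η) o))))
      (trans (cong (ℤ._- + rank k η) (ℤP.+-comm (+ rank k η) (+ suc o)))
          (trans (ℤP.+-assoc (+ suc o) (+ rank k η) (ℤ.- (+ rank k η)))
          (trans (cong (ℤ._+_ (+ suc o)) (ℤP.+-inverseʳ (+ rank k η))) (ℤP.+-identityʳ _)))))

built-IsE : ∀ {n k} {η : Vec ℕ n} {F c} → Built k η F c → IsE η F c
built-IsE {n} {k} {η} {F} {c} B =
  (λ e → 1≉0 {0} (built-nzd {0} B 1ₚ (lin-cong lift-lin (lin-cong q1-lin (≈⇒≋ e ⨾ ≡⇒≋ (sym 0ₚ-def)) ⨾ lin-0 q1-lin) ⟨*⟩ ≋-refl ⨾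
      lin-0 lift-lin ⟨*⟩ ≋-refl ⨾ *ₚ-comm 0ₚ 1ₚ ⨾ *-zeroʳ 1ₚ))) ,
  (λ ζ ne → ≋⇒≈ (≡⇒≋ (co-def ζ F) ⨾ co-supp ζ (built-supp B) (λ le → ne (≼⇒CompLe le)) ⨾ ≡⇒≋ 0ₚ-def)) ,
  ≋⇒≈ (≡⇒≋ (co-def η F) ⨾ built-lead B) ,
  eigen B
  where
  eigen : ∀ {n k} {η : Vec ℕ n} {F c} → Built k η F c → (i : Fin n) → YOp (suc (F.toℕ i)) F ≈ yVal η i ⊗ F
  eigen {suc N} {η = η} {F} B i = ≋⇒≈ (YOp-def (F.toℕ i) (N ∸ F.toℕ i) e F ⨾ built-eigen B (F.toℕ i) (N ∸ F.toℕ i) e ⨾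
      ≡⇒≋ (trans (*ₚ-def _ F)
          (cong (_⊗ F) (trans (qt-def _ _)
          (cong₂ (λ a r → qtMono a (ℤ.- (+ r))) (sym (lookup-getAt η i)) (sym (yExp-rank η i)))))))
    where
    e : F.toℕ i ℕ.+ (N ∸ F.toℕ i) ≡ N
    e = ℕP.m+[n∸m]≡n (ℕP.≤-pred (FP.toℕ<n i))

-- Existence of the recursion for every composition

record Lead {n} (k : ℕ) (η : Vec ℕ n) : Set where
  constructor lead
  field
    k≤n : k ≤ n
    zeros : ∀ j → j < k → getAt j η ≡ 0
    positive : k < n → ∃ λ m → getAt k η ≡ suc m
open Lead public

lead-exists : ∀ {n} (η : Vec ℕ n) → ∃ λ k → Lead k η
lead-exists [] = 0 , lead z≤n (λ _ ()) (λ ())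
lead-exists (suc a ∷ η) = 0 , lead z≤n (λ _ ()) (λ _ → a , refl)
lead-exists (zero ∷ η) with k , L ← lead-exists η = suc k , lead (s≤s (k≤n L))
    (λ { zero _ → refl ; (suc j) (s≤s l) → zeros L j l }) (λ { (s≤s l) → positive L l })

lead-built : ∀ {n k} {η : Vec ℕ n} {F c} → Built k η F c → Lead k η
lead-built {n} base = lead ℕP.≤-refl (λ j _ → getAt-replicate {n} j) (λ l → ⊥-elim (ℕP.<-irrefl refl l))
lead-built (bump xs a e B) = lead z≤n (λ _ ()) (λ _ → a , refl)
lead-built {n} (swap {k = k} m {η} l e₀ e₁ B) = lead (ℕP.<⇒≤ l) zs (λ _ → m , trans (getAt-swap₁ k η l) e₀)
  where
  zs : ∀ j → j < suc k → getAt j (swapAt k η) ≡ 0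
  zs j (s≤s le) with j ℕ.≟ k
  ... | yes refl = trans (getAt-swap₀ k η l) e₁
  ... | no ne = trans (getAt-swap-far k j η ne (λ e → ℕP.<-irrefl e (s≤s le))) (zeros (lead-built B) j (ℕP.≤∧≢⇒< le ne))

lead-≤ : ∀ {n k k'} {η : Vec ℕ n} → Lead k η → Lead k' η → k ≤ k'
lead-≤ {n} {k} {k'} L L' with k ℕ.≤? k'
... | yes l = l
... | no g with m , e ← positive L' (ℕP.≤-trans (ℕP.≰⇒> g) (k≤n L)) = ⊥-elim (ℕP.1+n≢0 (trans (sym e) (zeros L k' (ℕP.≰⇒> g))))

lead-unique : ∀ {n k k'} {η : Vec ℕ n} → Lead k η → Lead k' η → k ≡ k'
lead-unique L L' = ℕP.≤-antisym (lead-≤ L L') (lead-≤ L' L)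

all-zero : ∀ {n} (η : Vec ℕ n) → (∀ j → j < n → getAt j η ≡ 0) → η ≡ V.replicate n 0
all-zero [] h = refl
all-zero (x ∷ η) h = cong₂ _∷_ (h 0 (s≤s z≤n)) (all-zero η (λ j l → h (suc j) (s≤s l)))

unswap-lead : ∀ {n} k (η : Vec ℕ n) → suc k < n → Lead (suc k) η → Lead k (swapAt k η)
unswap-lead k η l L = lead (ℕP.<⇒≤ (ℕP.<-trans (ℕP.n<1+n k) l))
  (λ j lt → trans (getAt-swap-far k j η (λ e → ℕP.<-irrefl e lt) (λ e → ℕP.<-irrefl e (ℕP.m<n⇒m<1+n lt)))
      (zeros L j (ℕP.m<n⇒m<1+n lt)))
  (λ _ → proj₁ (positive L l) , trans (getAt-swap₀ k η l) (proj₂ (positive L l)))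

BuiltFor : ∀ {n} → ℕ → Vec ℕ n → Set
BuiltFor {n} k η = Σ (Poly n) λ F → Σ (Poly 0) λ c → Built k η F c

private
  -- Lexicographic descent: undoing a shift lowers the degree bound `S`, and undoing a swap keeps it
  -- while lowering the number k of leading zeros.
  build : ∀ S {n} k (η : Vec ℕ n) → V.sum η ≤ S → Lead k η → BuiltFor k η
  build S zero [] _ _ = _ , _ , base
  build S zero (zero ∷ xs) le L = ⊥-elim (ℕP.1+n≢0 (sym (proj₂ (positive L (s≤s z≤n)))))
  build (suc S) zero (suc a ∷ xs) (s≤s le) L with k , L' ← lead-exists (snoc xs a) with F , c , B ← build S k (snoc xs a)
      (subst (_≤ S) (trans (ℕP.+-comm a _) (sym (sum-snoc xs a))) le) L' =
    _ , _ , bump xs a refl B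
  build S {n} (suc k) η le L with suc k ℕ.≟ n
  ... | yes refl = subst (BuiltFor n) (sym (all-zero η (zeros L))) (_ , _ , base)
  ... | no ne = unswap (build S k (swapAt k η) (subst (_≤ S) (sym (sum-put k _ _ η l (ℕP.+-comm (getAt (suc k) η) _))) le)
      (unswap-lead k η l L))
    where
    l : suc k < n
    l = ℕP.≤∧≢⇒< (k≤n L) ne
    unswap : BuiltFor k (swapAt k η) → BuiltFor (suc k) η
    unswap (F , c , B) = subst (BuiltFor (suc k)) (swapAt-swapAt k η l)
      (_ , _ , swap (proj₁ (positive L l)) l (trans (getAt-swap₀ k η l) (proj₂ (positive L l)))
          (trans (getAt-swap₁ k η l) (zeros L k (ℕP.n<1+n k))) B)

built-exists : ∀ {n} (η : Vec ℕ n) → ∃ λ k → BuiltFor k η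
built-exists η with k , L ← lead-exists η = k , build (V.sum η) k η ℕP.≤-refl L

-- Elementary symmetric polynomials

Sub : ∀ n → ℕ → (Vec ℕ n → ℚ) → ℚ
Sub zero zero g = g []
Sub zero (suc k) g = 0ℚ
Sub (suc n) zero g = Sub n zero (λ x → g (0 ∷ x))
Sub (suc n) (suc k) g = Sub n (suc k) (λ x → g (0 ∷ x)) ℚ.+ Sub n k (λ x → g (1 ∷ x))

Sub-cong : ∀ n k {g g'} → (∀ x → g x ≡ g' x) → Sub n k g ≡ Sub n k g'
Sub-cong zero zero e = e []
Sub-cong zero (suc k) e = refl
Sub-cong (suc n) zero e = Sub-cong n zero (λ x → e _)
Sub-cong (suc n) (suc k) e = cong₂ ℚ._+_ (Sub-cong n (suc k) (λ x → e _)) (Sub-cong n k (λ x → e _))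

Sub-neg : ∀ n k g → Sub n k (λ x → ℚ.- g x) ≡ ℚ.- Sub n k g
Sub-neg zero zero g = refl
Sub-neg zero (suc k) g = refl
Sub-neg (suc n) zero g = Sub-neg n zero _
Sub-neg (suc n) (suc k) g = trans (cong₂ ℚ._+_ (Sub-neg n (suc k) _) (Sub-neg n k _))
    (sym (ℚP.neg-distrib-+ (Sub n (suc k) (λ x → g (0 ∷ x))) _))

opaque
  e : ∀ {n} → ℕ → Poly n
  e {n} k = esym n k

  e-def : ∀ {n} k → esym n k ≡ e {n} k
  e-def k = refl

  ev-e : ∀ {n} k (h : Mono n → ℚ) → ev (e k) h ≡ Sub n k (λ x → h (mono 0 (+ 0) x))
  ev-e {n} k h = trans (terms (subsets01 n k)) (go n k (λ x → h (mono 0 (+ 0) x)))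
    where
    Σg : ∀ {m} → (Vec ℕ m → ℚ) → List (Vec ℕ m) → ℚ
    Σg g [] = 0ℚ
    Σg g (x ∷ xs) = g x ℚ.+ Σg g xs
    terms : ∀ xs → ev (L.map (λ x → (1ℚ , mono 0 (+ 0) x)) xs) h ≡ Σg (λ x → h (mono 0 (+ 0) x)) xs
    terms [] = refl
    terms (x ∷ xs) = cong₂ ℚ._+_ (ℚP.*-identityˡ (h (mono 0 (+ 0) x))) (terms xs)
    Σg-map : ∀ {m} a (g : Vec ℕ (suc m) → ℚ) xs → Σg g (L.map (a ∷_) xs) ≡ Σg (λ x → g (a ∷ x)) xs
    Σg-map a g [] = refl
    Σg-map a g (x ∷ xs) = cong (g (a ∷ x) ℚ.+_) (Σg-map a g xs)
    Σg-++ : ∀ {m} (g : Vec ℕ m → ℚ) xs ys → Σg g (xs ++ ys) ≡ Σg g xs ℚ.+ Σg g ys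
    Σg-++ g [] ys = sym (ℚP.+-identityˡ _)
    Σg-++ g (x ∷ xs) ys = trans (cong (g x ℚ.+_) (Σg-++ g xs ys)) (sym (ℚP.+-assoc (g x) _ _))
    go : ∀ m k (g : Vec ℕ m → ℚ) → Σg g (subsets01 m k) ≡ Sub m k g
    go zero zero g = ℚP.+-identityʳ _
    go zero (suc k) g = refl
    go (suc m) zero g = trans (Σg-map 0 g (subsets01 m 0)) (go m 0 _)
    go (suc m) (suc k) g = trans (Σg-++ g (L.map (0 ∷_) (subsets01 m (suc k))) _)
        (cong₂ ℚ._+_ (trans (Σg-map 0 g (subsets01 m (suc k))) (go m (suc k) _)) (trans (Σg-map 1 g (subsets01 m k)) (go m k _)))

ev-e* : ∀ {n} k (f : Poly n) h → ev (e k *ₚ f) h ≡ Sub n k (λ x → ev f (λ m → h (monoMul (mono 0 (+ 0) x) m)))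
ev-e* k f h = trans (ev-*ₚ (e k) f h) (ev-e k _)

private
  middle₃ : ∀ a b c → a ℚ.+ b ℚ.+ c ≡ a ℚ.+ c ℚ.+ b
  middle₃ = solve 3 (λ a b c → a :+ b :+ c := a :+ c :+ b) refl
    where open ℚS.+-*-Solver

  middle₄ : ∀ a b c d → a ℚ.+ b ℚ.+ (c ℚ.+ d) ≡ a ℚ.+ c ℚ.+ (b ℚ.+ d)
  middle₄ = solve 4 (λ a b c d → a :+ b :+ (c :+ d) := a :+ c :+ (b :+ d)) refl
    where open ℚS.+-*-Solver

Sub-swap : ∀ n k p g → suc p < n → Sub n k (λ x → g (swapAt p x)) ≡ Sub n k g
Sub-swap (suc zero) k p g (s≤s ())
Sub-swap (suc (suc n)) zero zero g l = refl
Sub-swap (suc (suc n)) (suc zero) zero g l = middle₃ (Sub n 1 (λ x → g (0 ∷ 0 ∷ x))) (Sub n 0 (λ x → g (1 ∷ 0 ∷ x)))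
    (Sub n 0 (λ x → g (0 ∷ 1 ∷ x)))
Sub-swap (suc (suc n)) (suc (suc k)) zero g l = middle₄ (Sub n (suc (suc k)) (λ x → g (0 ∷ 0 ∷ x)))
    (Sub n (suc k) (λ x → g (1 ∷ 0 ∷ x))) (Sub n (suc k) (λ x → g (0 ∷ 1 ∷ x))) (Sub n k (λ x → g (1 ∷ 1 ∷ x)))
Sub-swap (suc n) zero (suc p) g (s≤s l) = Sub-swap n zero p (λ x → g (0 ∷ x)) l
Sub-swap (suc n) (suc k) (suc p) g (s≤s l) = cong₂ ℚ._+_ (Sub-swap n (suc k) p (λ x → g (0 ∷ x)) l)
    (Sub-swap n k p (λ x → g (1 ∷ x)) l)

Sub-snoc : ∀ n k g → Sub (suc n) (suc k) g ≡ Sub n (suc k) (λ x → g (snoc x 0)) ℚ.+ Sub n k (λ x → g (snoc x 1))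
Sub-snoc₀ : ∀ n g → Sub (suc n) 0 g ≡ Sub n 0 (λ x → g (snoc x 0))
Sub-snoc₀ zero g = refl
Sub-snoc₀ (suc n) g = Sub-snoc₀ n (λ x → g (0 ∷ x))
Sub-snoc zero zero g = refl
Sub-snoc zero (suc k) g = refl
Sub-snoc (suc n) zero g = trans (cong₂ ℚ._+_ (Sub-snoc n 0 (λ x → g (0 ∷ x))) (Sub-snoc₀ n (λ x → g (1 ∷ x))))
  (middle₃ (Sub n 1 (λ x → g (0 ∷ snoc x 0))) (Sub n 0 (λ x → g (0 ∷ snoc x 1))) (Sub n 0 (λ x → g (1 ∷ snoc x 0))))
Sub-snoc (suc n) (suc k) g = trans (cong₂ ℚ._+_ (Sub-snoc n (suc k) (λ x → g (0 ∷ x))) (Sub-snoc n k (λ x → g (1 ∷ x))))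
  (middle₄ (Sub n (suc (suc k)) (λ x → g (0 ∷ snoc x 0))) (Sub n (suc k) (λ x → g (0 ∷ snoc x 1)))
      (Sub n (suc k) (λ x → g (1 ∷ snoc x 0))) (Sub n k (λ x → g (1 ∷ snoc x 1))))

Sub-rotl : ∀ N k g → Sub (suc N) k (λ x → g (rotl x)) ≡ Sub (suc N) k g
Sub-rotl N zero g = sym (Sub-snoc₀ N g)
Sub-rotl N (suc k) g = sym (Sub-snoc N k g)

rotr : ∀ {N} → Vec ℕ (suc N) → Vec ℕ (suc N)
rotr v = lastV v ∷ initV v

Sub-rotr : ∀ N k g → Sub (suc N) k (λ x → g (rotr x)) ≡ Sub (suc N) k g
Sub-rotr N k g = trans (sym (Sub-rotl N k (λ x → g (rotr x))))
    (Sub-cong (suc N) k (λ { (a ∷ x) → cong g (cong₂ _∷_ (getAt-last x a) (initV-snoc x a)) }))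

s-* : ∀ {n} p (f g : Poly n) → s p (f *ₚ g) ≋ s p f *ₚ s p g
s-* p f g = mk≋ λ h → trans (ev-s p (f *ₚ g) h) (trans (ev-*ₚ f g _) (sym (trans (ev-*ₚ (s p f) (s p g) h) (trans (ev-s p f _)
  (ev-cong f (λ { (mono q t x) → trans (ev-s p g _)
      (ev-cong g (λ { (mono q' t' y) → cong h (mono-cong refl refl (swap-zip p x y)) })) }))))))
  where
  swap-zip : ∀ {n} p (x y : Vec ℕ n) → V.zipWith ℕ._+_ (swapAt p x) (swapAt p y) ≡ swapAt p (V.zipWith ℕ._+_ x y)
  swap-zip p [] [] = refl
  swap-zip zero (a ∷ []) (b ∷ []) = refl
  swap-zip zero (a ∷ a' ∷ x) (b ∷ b' ∷ y) = refl
  swap-zip (suc p) (a ∷ x) (b ∷ y) = cong ((a ℕ.+ b) ∷_) (swap-zip p x y)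

s-X₀ : ∀ {n} p → suc p < n → (f : Poly n) → s p (X p *ₚ f) ≋ X (suc p) *ₚ s p f
s-X₀ p l f = mk≋ λ h → trans (ev-s p (X p *ₚ f) h)
    (trans (ev-X p f _) (trans (ev-cong f (λ { (mono q t x) → cong h (mono-cong refl refl (vec x)) }))
    (sym (trans (ev-X (suc p) (s p f) h) (ev-s p f _)))))
  where
  vec : ∀ x → swapAt p (inc p x) ≡ inc (suc p) (swapAt p x)
  vec x rewrite get-inc-≢ (suc p) p x (λ ()) | get-inc p x (ℕP.<-trans (ℕP.n<1+n p) l) =
      trans (put-inc₀ p _ _ x) (sym (inc-put₁ p _ _ x))

s-X₁ : ∀ {n} p → suc p < n → (f : Poly n) → s p (X (suc p) *ₚ f) ≋ X p *ₚ s p f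
s-X₁ p l f = mk≋ λ h → trans (ev-s p (X (suc p) *ₚ f) h)
    (trans (ev-X (suc p) f _) (trans (ev-cong f (λ { (mono q t x) → cong h (mono-cong refl refl (vec x)) }))
    (sym (trans (ev-X p (s p f) h) (ev-s p f _)))))
  where
  vec : ∀ x → swapAt p (inc (suc p) x) ≡ inc p (swapAt p x)
  vec x rewrite get-inc-≢ p (suc p) x (λ ()) | get-inc (suc p) x l = trans (put-inc₁ p _ _ x) (sym (inc-put₀ p _ _ x))

s-X-far : ∀ {n} p j → j ≢ p → j ≢ suc p → (f : Poly n) → s p (X j *ₚ f) ≋ X j *ₚ s p f
s-X-far p j a b f = mk≋ λ h → trans (ev-s p (X j *ₚ f) h)
    (trans (ev-X j f _) (trans (ev-cong f (λ { (mono q t x) → cong h (mono-cong refl refl (vec x)) }))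
    (sym (trans (ev-X j (s p f) h) (ev-s p f _)))))
  where
  vec : ∀ x → swapAt p (inc j x) ≡ inc j (swapAt p x)
  vec x rewrite get-inc-≢ p j x (λ e → a (sym e)) | get-inc-≢ (suc p) j x (λ e → b (sym e)) = put-inc-≢ p j _ _ x a b

s-qt : ∀ {n} p → QT {n} (s p)
s-qt p a z f = mk≋ λ h → trans (ev-s p (qt a z *ₚ f) h) (trans (ev-qt a z f _) (sym (trans (ev-qt a z (s p f) h) (ev-s p f _))))

s-1 : ∀ {n} p → s p (1ₚ {n}) ≋ 1ₚ
s-1 {n} p = mk≋ λ h → trans (cong (λ u → ev (s p u) h) 1ₚ-⟨⟩)
    (trans (ev-s p ⟨ one ⟩ h) (trans (ev-⟨⟩ one (λ a → h (sM p a))) (trans (cong h (mono-cong refl refl fix))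
  (sym (trans (cong (λ u → ev u h) 1ₚ-⟨⟩) (ev-⟨⟩ one h))))))
  where
  fix : swapAt p (V.replicate n 0) ≡ V.replicate n 0
  fix = trans (cong₂ (λ a b → put p a b (V.replicate n 0)) (trans (getAt-replicate {n} (suc p)) (sym (getAt-replicate {n} p)))
      (trans (getAt-replicate {n} p) (sym (getAt-replicate {n} (suc p)))))
    (put-self p (V.replicate n 0))

∂-Leibniz : ∀ {n} p → suc p < n → ∀ g f → ∂ p (f *ₚ g) ≋ ∂ p f *ₚ g +ₚ s p f *ₚ ∂ p g
∂-Leibniz {n} p l g = mono-ind (lin-∘ (∂-lin p) (lin-mulʳ g lin-id)) (lin-add (lin-mulʳ g (∂-lin p)) (lin-mulʳ (∂ p g) (s-lin p)))
    (λ a z f → lin-cong (∂-lin p) (*ₚ-assoc _ _ g) ⨾ ∂-qt p a z _) (qt-add (qtʳ g (∂-qt p)) (qtʳ (∂ p g) (s-qt p)))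
    (lin-cong (∂-lin p) (*ₚ-idˡ g) ⨾ ≋-sym ((∂-1 p ⟨*⟩ ≋-refl ⨾ *ₚ-comm 0ₚ g ⨾ *-zeroʳ g) ⟨+⟩ (s-1 p ⟨*⟩ ≋-refl ⨾ *ₚ-idˡ _) ⨾
        +ₚ-comm 0ₚ _ ⨾ +ₚ-idʳ _)) step
  where
  open PolySolver {n}
  qtʳ : ∀ {A : Poly n → Poly n} k → QT A → QT (λ f → A f *ₚ k)
  qtʳ k qA a z f = qA a z f ⟨*⟩ ≋-refl ⨾ *ₚ-assoc _ _ k
  step : ∀ j → j < n → ∀ f → ∂ p (f *ₚ g) ≋ ∂ p f *ₚ g +ₚ s p f *ₚ ∂ p g →
      ∂ p (X j *ₚ f *ₚ g) ≋ ∂ p (X j *ₚ f) *ₚ g +ₚ s p (X j *ₚ f) *ₚ ∂ p g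
  step j _ f h with near p j
  ... | at₀ refl = lin-cong (∂-lin p) (*ₚ-assoc _ f g) ⨾ ∂-X₀ p l _ ⨾ ≋-refl ⟨+⟩ ≋-refl ⟨*⟩ h ⨾
      solve 6 (λ f g y d s d' → f :* g :+ y :* (d :* g :+ s :* d') := (f :+ y :* d) :* g :+ y :* s :* d') ≋-refl f g (X (suc p))
          (∂ p f) (s p f) (∂ p g) ⨾
      ≋-sym (∂-X₀ p l f) ⟨*⟩ ≋-refl ⟨+⟩ ≋-sym (s-X₀ p l f) ⟨*⟩ ≋-refl
  ... | at₁ refl = lin-cong (∂-lin p) (*ₚ-assoc _ f g) ⨾ ∂-X₁ p l _ ⨾ ≋-refl ⟨*⟩ h ⟨-⟩ ≋-refl ⨾
      solve 6 (λ f g y d s d' → y :* (d :* g :+ s :* d') :- f :* g := (y :* d :- f) :* g :+ y :* s :* d') ≋-refl f g (X p)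
          (∂ p f) (s p f) (∂ p g) ⨾
      ≋-sym (∂-X₁ p l f) ⟨*⟩ ≋-refl ⟨+⟩ ≋-sym (s-X₁ p l f) ⟨*⟩ ≋-refl
  ... | far a b = lin-cong (∂-lin p) (*ₚ-assoc _ f g) ⨾ ∂-X-far p j a b _ ⨾ ≋-refl ⟨*⟩ h ⨾
      solve 5 (λ g y d s d' → y :* (d :* g :+ s :* d') := y :* d :* g :+ y :* s :* d') ≋-refl g (X j) (∂ p f) (s p f) (∂ p g) ⨾
      ≋-sym (∂-X-far p j a b f) ⟨*⟩ ≋-refl ⟨+⟩ ≋-sym (s-X-far p j a b f) ⟨*⟩ ≋-refl

D-anti : ∀ a b k → D b a k ≡ ℚ.- D a b k
D-anti a b k with ℕP.≤-total a b
... | inj₁ l with d , refl ← ℕP.m≤n⇒∃[o]m+o≡n l = trans (D-ge a d k) (trans (neg-neg _) (cong ℚ.-_ (sym (D-le a d k))))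
  where
  neg-neg : ∀ x → x ≡ ℚ.- (ℚ.- x)
  neg-neg = solve 1 (λ x → x := :- (:- x)) refl
    where open ℚS.+-*-Solver
... | inj₂ l with d , refl ← ℕP.m≤n⇒∃[o]m+o≡n l = trans (D-le b d k) (cong ℚ.-_ (sym (D-ge b d k)))

s-e : ∀ {n} p k → suc p < n → s p (e {n} k) ≋ e k
s-e {n} p k l = mk≋ λ h → trans (ev-s p (e k) h)
    (trans (ev-e k _) (trans (Sub-swap n k p (λ x → h (mono 0 (+ 0) x)) l) (sym (ev-e k h))))

-- The divided difference of a monomial changes sign when the two exponents are exchanged, and this
-- exchange permutes the monomials of e_k. A rational equal to its own negative is 0.
∂-e : ∀ {n} p k → suc p < n → ∂ p (e {n} k) ≋ 0ₚ
∂-e {n} p k l = mk≋ λ h → trans (ev-∂ p (e k) h) (trans (ev-e k _) (trans (self-neg (antisymmetric h)) (sym (ev-0ₚ h))))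
  where
  G : (Mono n → ℚ) → Vec ℕ n → ℚ
  G h x = ∂adj p h (mono 0 (+ 0) x)
  antisymmetric : ∀ h → Sub n k (G h) ≡ ℚ.- Sub n k (G h)
  antisymmetric h = trans (sym (Sub-swap n k p (G h) l)) (trans (Sub-cong n k flip) (Sub-neg n k (G h)))
    where
    flip : ∀ x → G h (swapAt p x) ≡ ℚ.- G h x
    flip x rewrite getAt-swap₀ p x l | getAt-swap₁ p x l =
        trans (D-cong _ _ (λ u v → cong (λ y → h (mono 0 (+ 0) y)) (put-put p u v _ _ x)))
        (D-anti (getAt p x) (getAt (suc p) x) _)
  self-neg : ∀ {a} → a ≡ ℚ.- a → a ≡ 0ℚ
  self-neg {a} q = trans (solve 1 (λ a → a := con ℚ.½ :* (a :- (:- a))) refl a)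
      (trans (cong (λ b → ℚ.½ ℚ.* (a ℚ.- b)) (sym q)) (trans (cong (ℚ.½ ℚ.*_) (ℚP.+-inverseʳ a)) (ℚP.*-zeroʳ ℚ.½)))
    where open ℚS.+-*-Solver

Symm : ∀ {n} → (Poly n → Poly n) → Poly n → Set
Symm A g = ∀ f → A (g *ₚ f) ≋ g *ₚ A f

T-e : ∀ {n} p k → suc p < n → Symm T⟨ p ⟩ (e {n} k)
T-e {n} p k l f = ≡⇒≋ (T-eq p _) ⨾
    ≋-refl ⟨-⟩ ≋-refl ⟨*⟩ (∂-Leibniz p l f (e k) ⨾ (∂-e p k l ⟨*⟩ ≋-refl ⨾ *ₚ-comm 0ₚ f ⨾ *-zeroʳ f) ⟨+⟩ s-e p k l ⟨*⟩ ≋-refl ⨾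
    +ₚ-comm 0ₚ _ ⨾ +ₚ-idʳ _) ⨾
  solve 5 (λ t a d g f → t :* (g :* f) :- a :* (g :* d) := g :* (t :* f :- a :* d)) ≋-refl 𝐭 (𝐭 *ₚ X p -ₚ X (suc p)) (∂ p f)
      (e k) f ⨾ ≋-refl ⟨*⟩ ≡⇒≋ (sym (T-eq p f))
  where open PolySolver {n}

T⁻-e : ∀ {n} p k → suc p < n → Symm T⁻⟨ p ⟩ (e {n} k)
T⁻-e p k l f = T⁻-cong p (≋-refl ⟨*⟩ ≋-sym (TT⁻ p l f) ⨾ ≋-sym (T-e p k l _)) ⨾ T⁻T p l _

-- The weight 0 is essential: only at q = 1 is ω a mere cyclic permutation of the variables, which
-- fixes symmetric polynomials.
ω-e : ∀ {N} k → Symm (ω 0) (e {suc N} k)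
ω-e {N} k f = mk≋ λ h → trans (ev-ω 0 (e k *ₚ f) h)
    (trans (ev-e* k f _) (sym (trans (ev-e* k (ω 0 f) h) (trans (Sub-cong (suc N) k (λ x → ev-ω 0 f _))
  (trans (sym (Sub-rotl N k _))
      (Sub-cong (suc N) k (λ { (a ∷ x) → ev-cong f (λ { (mono q t (b ∷ y)) → cong h (mono-cong refl refl (zip-snoc x y a b)) })
      })))))))
  where
  zip-snoc : ∀ {m} (x y : Vec ℕ m) a b → V.zipWith ℕ._+_ (snoc x a) (snoc y b) ≡ snoc (V.zipWith ℕ._+_ x y) (a ℕ.+ b)
  zip-snoc [] [] a b = refl
  zip-snoc (c ∷ x) (d ∷ y) a b = cong (_ ∷_) (zip-snoc x y a b)

Φ-e : ∀ {N} S k → Symm (Φ 0 S) (e {suc N} k)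
Φ-e {N} S k f = mk≋ λ h → trans (ev-Φ 0 S (e k *ₚ f) h)
    (trans (ev-e* k f _) (sym (trans (ev-e* k (Φ 0 S f) h) (trans (Sub-cong (suc N) k (λ x → ev-Φ 0 S f _))
  (trans (sym (Sub-rotr N k _))
      (Sub-cong (suc N) k (λ x → ev-cong f (λ { (mono q t y) → cong h (mono-cong refl refl (bump-zip x y)) }))))))))
  where
  bump-zip : ∀ {M} (x y : Vec ℕ (suc M)) → V.zipWith ℕ._+_ (rotr x) (bumpV y) ≡ bumpV (V.zipWith ℕ._+_ x y)
  bump-zip x y = cong₂ _∷_ (trans (ℕP.+-suc (lastV x) _) (cong suc (last-zip x y))) (init-zip x y)
    where
    last-zip : ∀ {M} (x y : Vec ℕ (suc M)) → lastV x ℕ.+ lastV y ≡ lastV (V.zipWith ℕ._+_ x y)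
    last-zip (a ∷ []) (b ∷ []) = refl
    last-zip (a ∷ a' ∷ x) (b ∷ b' ∷ y) = last-zip (a' ∷ x) (b' ∷ y)
    init-zip : ∀ {M} (x y : Vec ℕ (suc M)) → V.zipWith ℕ._+_ (initV x) (initV y) ≡ initV (V.zipWith ℕ._+_ x y)
    init-zip (a ∷ []) (b ∷ []) = refl
    init-zip (a ∷ a' ∷ x) (b ∷ b' ∷ y) = cong ((a ℕ.+ b) ∷_) (init-zip (a' ∷ x) (b' ∷ y))

e-zero : ∀ {n} → e {n} 0 ≋ 1ₚ
e-zero {n} = mk≋ λ h → trans (ev-e 0 h) (trans (Sub-0 n _) (sym (trans (cong (λ u → ev u h) 1ₚ-⟨⟩) (ev-⟨⟩ one h))))
  where
  Sub-0 : ∀ n g → Sub n 0 g ≡ g (V.replicate n 0)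
  Sub-0 zero g = refl
  Sub-0 (suc n) g = Sub-0 n (λ x → g (0 ∷ x))

-- Restriction to x_1 = 0

slM : ∀ {n} → ℕ → (Mono n → ℚ) → Mono (suc n) → ℚ
slM a h (mono q t (b ∷ x)) = if b ℕ.≡ᵇ a then h (mono q t x) else 0ℚ

opaque
  -- sl a f is the coefficient of x_1^a in f, as a polynomial in the remaining variables.
  sl : ∀ {n} → ℕ → Poly (suc n) → Poly n
  sl a = L.concatMap (λ { (c , mono q t (b ∷ x)) → if b ℕ.≡ᵇ a then (c , mono q t x) ∷ [] else [] })

  ev-sl : ∀ {n} a (f : Poly (suc n)) h → ev (sl a f) h ≡ ev f (slM a h)
  ev-sl a [] h = refl
  ev-sl a ((c , mono q t (b ∷ x)) ∷ f) h with b ℕ.≡ᵇ a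
  ... | true = cong (c ℚ.* h (mono q t x) ℚ.+_) (ev-sl a f h)
  ... | false = trans (ev-sl a f h) (trans (sym (ℚP.+-identityˡ _)) (cong (ℚ._+ ev f (slM a h)) (sym (ℚP.*-zeroʳ c))))

sl-lin : ∀ {n} a → Lin (sl {n} a)
sl-lin a = lin (slM a) (ev-sl a)

sl-qt : ∀ {n} a → QT (sl {n} a)
sl-qt a r z f = mk≋ λ h → trans (ev-sl a (qt r z *ₚ f) h)
    (trans (ev-qt r z f _) (trans (ev-cong f (λ { (mono q t (b ∷ x)) → refl }))
    (sym (trans (ev-qt r z (sl a f) h) (ev-sl a f _)))))

sl-zero-X₀ : ∀ {n} (f : Poly (suc n)) → sl 0 (X 0 *ₚ f) ≋ 0ₚ
sl-zero-X₀ f = mk≋ λ h → trans (ev-sl 0 (X 0 *ₚ f) h)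
    (trans (ev-X 0 f _) (trans (ev-cong f (λ { (mono q t (b ∷ x)) → refl })) (trans (ev-0 f) (sym (ev-0ₚ h)))))

sl-X₊ : ∀ {n} a p (f : Poly (suc n)) → sl a (X (suc p) *ₚ f) ≋ X p *ₚ sl a f
sl-X₊ a p f = mk≋ λ h → trans (ev-sl a (X (suc p) *ₚ f) h)
    (trans (ev-X (suc p) f _) (trans (ev-cong f (λ { (mono q t (b ∷ x)) → refl }))
    (sym (trans (ev-X p (sl a f) h) (ev-sl a f _)))))

sl-∂ : ∀ {n} a p (f : Poly (suc n)) → sl a (∂ (suc p) f) ≋ ∂ p (sl a f)
sl-∂ {n} a p f = mk≋ λ h → trans (ev-sl a (∂ (suc p) f) h)
    (trans (ev-∂ (suc p) f _)
    (trans (ev-cong f (λ { (mono q t (b ∷ x)) → guard (b ℕ.≡ᵇ a) (λ u v → h (mono q t (put p u v x))) (getAt p x)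
    (getAt (suc p) x) }))
  (sym (trans (ev-∂ p (sl a f) h) (ev-sl a f _)))))
  where
  guard : ∀ g k c d → D c d (λ u v → if g then k u v else 0ℚ) ≡ (if g then D c d k else 0ℚ)
  guard true k c d = refl
  guard false k c d = D-zero c d _ (λ _ _ _ _ _ → refl)

sl-T : ∀ {n} a p (f : Poly (suc n)) → sl a (T⟨ suc p ⟩ f) ≋ T⟨ p ⟩ (sl a f)
sl-T {n} a p f = lin-cong (sl-lin a) (≡⇒≋ (T-eq (suc p) f) ⨾
    solve 5 (λ t f x y d → t :* f :- (t :* x :- y) :* d := t :* f :- (t :* (x :* d) :- y :* d)) ≋-refl 𝐭 f (X (suc p))
    (X (suc (suc p))) (∂ (suc p) f)) ⨾
  lin-- (sl-lin a) _ _ ⨾ sl-qt a 0 (+ 1) f ⟨-⟩ (lin-- (sl-lin a) _ _ ⨾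
      (sl-qt a 0 (+ 1) _ ⨾ ≋-refl ⟨*⟩ (sl-X₊ a p _ ⨾ ≋-refl ⟨*⟩ sl-∂ a p f)) ⟨-⟩ (sl-X₊ a (suc p) _ ⨾ ≋-refl ⟨*⟩ sl-∂ a p f)) ⨾
  S'.solve 5 (λ t f x y d → t S'.:* f S'.:- (t S'.:* (x S'.:* d) S'.:- y S'.:* d) S'.:= t S'.:* f S'.:- (t S'.:* x S'.:- y) S'.:*
      d) ≋-refl 𝐭 (sl a f) (X p) (X (suc p)) (∂ p (sl a f)) ⨾ ≡⇒≋ (sym (T-eq p (sl a f)))
  where
  open PolySolver {suc n}
  module S' = PolySolver {n}

sl-e-zero : ∀ {n} k (f : Poly (suc n)) → sl 0 (e (suc k) *ₚ f) ≋ e (suc k) *ₚ sl 0 f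
sl-e-zero {n} k f = mk≋ λ h → trans (ev-sl 0 (e (suc k) *ₚ f) h) (trans (ev-e* (suc k) f _) (trans (cong₂ ℚ._+_
    (Sub-cong n (suc k) (λ x → trans (ev-cong f (λ { (mono q t (b ∷ y)) → refl })) (sym (ev-sl 0 f _))))
    (trans (Sub-cong n k (λ x → trans (ev-cong f (λ { (mono q t (b ∷ y)) → refl })) (ev-0 f))) (zeroes n k)))
  (trans (ℚP.+-identityʳ _) (sym (ev-e* (suc k) (sl 0 f) h)))))
  where
  zeroes : ∀ n k → Sub n k (λ _ → 0ℚ) ≡ 0ℚ
  zeroes zero zero = refl
  zeroes zero (suc k) = refl
  zeroes (suc n) zero = zeroes n zero
  zeroes (suc n) (suc k) = cong₂ ℚ._+_ (zeroes n (suc k)) (zeroes n k)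

sl-e-suc : ∀ {n} a k (f : Poly (suc n)) → sl (suc a) (e (suc k) *ₚ f) ≋ e (suc k) *ₚ sl (suc a) f +ₚ e k *ₚ sl a f
sl-e-suc {n} a k f = mk≋ λ h → trans (ev-sl (suc a) (e (suc k) *ₚ f) h) (trans (ev-e* (suc k) f _) (trans (cong₂ ℚ._+_
    (trans (Sub-cong n (suc k) (λ x → trans (ev-cong f (λ { (mono q t (b ∷ y)) → refl })) (sym (ev-sl (suc a) f _))))
        (sym (ev-e* (suc k) (sl (suc a) f) h)))
    (trans (Sub-cong n k (λ x → trans (ev-cong f (λ { (mono q t (b ∷ y)) → refl })) (sym (ev-sl a f _))))
        (sym (ev-e* k (sl a f) h))))
  (sym (ev-+ₚ _ _ h))))

sl-e : ∀ {n} k (f : Poly (suc n)) → sl 0 (e k *ₚ f) ≋ e k *ₚ sl 0 f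
sl-e zero f = lin-cong (sl-lin 0) (e-zero ⟨*⟩ ≋-refl ⨾ *ₚ-idˡ f) ⨾ ≋-sym (e-zero ⟨*⟩ ≋-refl ⨾ *ₚ-idˡ _)
sl-e (suc k) f = sl-e-zero k f

e-empty : ∀ {n} k → n < k → e {n} k ≋ 0ₚ
e-empty {n} k l = mk≋ λ h → trans (ev-e k h) (trans (empty n k l _) (sym (ev-0ₚ h)))
  where
  empty : ∀ n k → n < k → ∀ g → Sub n k g ≡ 0ℚ
  empty zero (suc k) _ g = refl
  empty (suc n) (suc k) (s≤s l) g = cong₂ ℚ._+_ (empty n (suc k) (ℕP.m<n⇒m<1+n l) _) (empty n k l _)

δ-zero : ∀ {n} {f : Poly n} → (∀ m → ev f (δ m) ≡ 0ℚ) → f ≋ 0ₚ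
δ-zero {f = f} z = ≈⇒≋ (λ m → trans (coeff-ev f m) (trans (z m) (sym (trans (coeff-ev 0ₚ m) (ev-0ₚ (δ m))))))

≡ᵇ-sym : ∀ a b → (a ℕ.≡ᵇ b) ≡ (b ℕ.≡ᵇ a)
≡ᵇ-sym zero zero = refl
≡ᵇ-sym zero (suc b) = refl
≡ᵇ-sym (suc a) zero = refl
≡ᵇ-sym (suc a) (suc b) = ≡ᵇ-sym a b

∧-guard : ∀ p q g → (if p ∧ (q ∧ g) then 1ℚ else 0ℚ) ≡ (if g then (if p ∧ (q ∧ true) then 1ℚ else 0ℚ) else 0ℚ)
∧-guard p q true = refl
∧-guard false q false = refl
∧-guard true false false = refl
∧-guard true true false = refl

sl-ext : ∀ {n} {f : Poly (suc n)} → (∀ a → sl a f ≋ 0ₚ) → f ≋ 0ₚ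
sl-ext {f = f} z = δ-zero (λ { (mono q t (b ∷ x)) → trans (ev-cong f (λ { (mono q' t' (b' ∷ x')) → term q t b x q' t' b' x' }))
  (trans (sym (ev-sl b f (δ (mono q t x)))) (trans (at (z b) _) (ev-0ₚ _))) })
  where
  term : ∀ q t b x q' t' b' x' → δ (mono q t (b ∷ x)) (mono q' t' (b' ∷ x')) ≡ slM b (δ (mono q t x)) (mono q' t' (b' ∷ x'))
  term q t b x q' t' b' x' rewrite ≡ᵇ-sym b' b with b ℕ.≡ᵇ b'
  ... | true = refl
  ... | false = ∧-guard (q ℕ.≡ᵇ q') (does (t ℤ.≟ t')) false

-- Split e_k = e_k(x') + x_1 e_{k-1}(x') with x' the variables other than x_1, and compare powers of
-- x_1. If k is less than the number of variables, the slices of f vanish one after another,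
-- starting from the lowest. If k equals it, only x_1 e_{k-1}(x') is left.
nzd-e : ∀ {n} k → k ≤ n → NZD (e {n} k)
nzd-e zero _ = nzd-≋ (≋-sym e-zero) nzd-1
nzd-e {suc n} (suc k) (s≤s l) f h with suc k ℕ.≤? n
... | yes l' = sl-ext slices
  where
  slices : ∀ a → sl a f ≋ 0ₚ
  slices zero = nzd-e (suc k) l' _ (≋-sym (sl-e-zero k f) ⨾ lin-zero (sl-lin 0) h)
  slices (suc a) = nzd-e (suc k) l' _ (≋-sym (+ₚ-idʳ _) ⨾ ≋-refl ⟨+⟩ ≋-sym (≋-refl ⟨*⟩ slices a ⨾ *-zeroʳ (e k)) ⨾
      ≋-sym (sl-e-suc a k f) ⨾ lin-zero (sl-lin (suc a)) h)
... | no g = sl-ext (λ a → nzd-e k l _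
    (≋-sym (sl-e-suc a k f ⨾ (e-empty (suc k) (ℕP.≰⇒> g) ⟨*⟩ ≋-refl ⨾ *ₚ-comm 0ₚ _ ⨾ *-zeroʳ _) ⟨+⟩ ≋-refl ⨾ +ₚ-comm 0ₚ _ ⨾
    +ₚ-idʳ _) ⨾ lin-zero (sl-lin (suc a)) h))

-- Weighting the terms of f by h gives a polynomial all of whose coefficients are 0, and `ev f h` is
-- its value at the constant function 1.
ev-vanish : ∀ {n} (f : Poly n) h → (∀ m → h m ≡ 0ℚ ⊎ ev f (δ m) ≡ 0ℚ) → ev f h ≡ 0ℚ
ev-vanish f h z = trans (ev-cong f (λ m → sym (ℚP.*-identityʳ (h m))))
    (trans (sym (ev-scale f (λ _ → 1ℚ)))
    (trans (at (δ-zero {f = scale f}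
    (λ m → trans (ev-scale f (δ m)) (trans (ev-cong f (concentrated m)) (trans (ev-* f (h m) (δ m)) (product m (z m))))))
    (λ _ → 1ℚ)) (ev-0ₚ (λ _ → 1ℚ))))
  where
  scale : Poly _ → Poly _
  scale = L.map (λ { (c , m) → (c ℚ.* h m , m) })
  ev-scale : ∀ f k → ev (scale f) k ≡ ev f (λ m → h m ℚ.* k m)
  ev-scale [] k = refl
  ev-scale ((c , m) ∷ f) k = cong₂ ℚ._+_ (ℚP.*-assoc c (h m) (k m)) (ev-scale f k)
  concentrated : ∀ m a → h a ℚ.* δ m a ≡ h m ℚ.* δ m a
  concentrated m a with eqMono m a in q
  ... | true = cong (λ b → h b ℚ.* 1ℚ) (sym (eqMono-sound m a q))
  ... | false = trans (ℚP.*-zeroʳ (h a)) (sym (ℚP.*-zeroʳ (h m)))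
  product : ∀ m → h m ≡ 0ℚ ⊎ ev f (δ m) ≡ 0ℚ → h m ℚ.* ev f (δ m) ≡ 0ℚ
  product m (inj₁ p) = trans (cong (ℚ._* ev f (δ m)) p) (ℚP.*-zeroˡ (ev f (δ m)))
  product m (inj₂ p) = trans (cong (h m ℚ.*_) p) (ℚP.*-zeroʳ (h m))

supp-co : ∀ {n} {P : Vec ℕ n → Set} {f : Poly n} → (∀ ζ → Dec (P ζ)) → (∀ ζ → ¬ P ζ → co ζ f ≋ 0ₚ) → Supp P f
supp-co {f = f} d z = supp λ h v → ev-vanish f h (λ { (mono q t ζ) → decide h v q t ζ (d ζ) })
  where
  term : ∀ q t ζ q' t' x → δ (mono q t ζ) (mono q' t' x) ≡ coM ζ (δ (mono q t [])) (mono q' t' x)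
  term q t ζ q' t' x = trans (∧-guard (q ℕ.≡ᵇ q') (does (t ℤ.≟ t')) (eqVec ζ x))
      (cong (λ g → if g then _ else 0ℚ) (eqVec-iff ζ x x ζ sym sym))
  decide : ∀ h v q t ζ → Dec _ → h (mono q t ζ) ≡ 0ℚ ⊎ ev f (δ (mono q t ζ)) ≡ 0ℚ
  decide h v q t ζ (yes p) = inj₁ (v q t ζ p)
  decide h v q t ζ (no np) =
      inj₂ (trans (ev-cong f (λ { (mono q' t' x) → term q t ζ q' t' x }))
      (trans (sym (ev-co ζ f (δ (mono q t [])))) (trans (at (z ζ np) (δ (mono q t []))) (ev-0ₚ (δ (mono q t []))))))

intertwiner-lin : ∀ {n} p a z → Lin {n} (intertwiner p (qt a z))
intertwiner-lin p a z = lin-sub (lin-mul _ (T-lin p)) (lin-mul 𝐮 lin-id)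

intertwiner-qt : ∀ {n} p a z → QT {n} (intertwiner p (qt a z))
intertwiner-qt p a z = qt-sub (qt-mul _ (T-qt p)) (qt-mul 𝐮 (λ _ _ _ → ≋-refl))

sl-intertwiner : ∀ {n} p a z (f : Poly (suc n)) → sl 0 (intertwiner (suc p) (qt a z) f) ≋ intertwiner p (qt a z) (sl 0 f)
sl-intertwiner p a z f = lin-u- (sl-lin 0) (sl-qt 0) _ f ⨾
    (qt-comm-1- (sl-lin 0) (sl-qt 0) a z _ ⨾ ≋-refl ⟨*⟩ sl-T 0 p f) ⟨-⟩ ≋-refl

sl-Φ : ∀ {n} w S (f : Poly (suc n)) → sl 0 (Φ w S f) ≋ 0ₚ
sl-Φ w S f = mk≋ λ h → trans (ev-sl 0 (Φ w S f) h)
    (trans (ev-Φ w S f _) (trans (ev-cong f (λ { (mono q t x) → refl })) (trans (ev-0 f) (sym (ev-0ₚ h)))))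

sl-s-Φ : ∀ {n} w S (f : Poly (suc (suc n))) → sl 0 (s 0 (Φ w S f)) ≋ Φ w S (sl 0 f)
sl-s-Φ w S f = mk≋ λ h → trans (ev-sl 0 (s 0 (Φ w S f)) h)
    (trans (ev-s 0 (Φ w S f) _) (trans (ev-Φ w S f _) (trans (ev-cong f (λ { (mono q t (b ∷ c ∷ x)) → refl }))
  (sym (trans (ev-Φ w S (sl 0 f) h) (ev-sl 0 f _))))))

-- `Φ w S f` is divisible by x_1, so by `T-s` the operator T reduces at x_1 = 0 to s. What remains
-- is s applied to `Φ w S f`, and restricting that amounts to applying Φ to the restriction of f.
sl-first : ∀ {n} w S a z (f : Poly (suc (suc n))) → sl 0 (intertwiner 0 (qt a z) (Φ w S f)) ≋ (1ₚ -ₚ qt a z) *ₚ Φ w S (sl 0 f)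
sl-first w S a z f = lin-u- (sl-lin 0) (sl-qt 0) _ _ ⨾
    (qt-comm-1- (sl-lin 0) (sl-qt 0) a z _ ⨾
    ≋-refl ⟨*⟩ (lin-cong (sl-lin 0) (T-s 0 (s≤s (s≤s z≤n)) _) ⨾ lin-u+ (sl-lin 0) (sl-qt 0) _ _ ⨾
    sl-s-Φ w S f ⟨+⟩ (≋-refl ⟨*⟩ (lin-- (sl-lin 0) _ _ ⨾ sl-Φ w S f ⟨-⟩ sl-zero-X₀ _ ⨾ neg-invʳ 0ₚ) ⨾ *-zeroʳ 𝐮) ⨾ +ₚ-idʳ _)) ⟨-⟩
        (≋-refl ⟨*⟩ sl-Φ w S f ⨾ *-zeroʳ 𝐮) ⨾
  ≋-refl ⟨+⟩ lin-0 (lin-negP lin-id) ⨾ +ₚ-idʳ _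

-- Setting x_1 = 0 maps E_{(0,ν)} to E_ν.
built-tail : ∀ {n k} {η : Vec ℕ (suc n)} {F c} → Built (suc k) η F c →
  Σ (Poly n) λ F₀ → Σ (Poly 0) λ c₀ → Built k (V.tail η) F₀ c₀ × sl 0 F *ₚ lift c₀ ≋ F₀ *ₚ lift c
built-tail {n} base = 1ₚ , 1ₚ , base , (sl-1 ⟨*⟩ ≋-refl)
  where
  sl-1 : sl 0 1ₚ ≋ 1ₚ
  sl-1 = mk≋ λ h → trans (ev-sl 0 1ₚ h)
      (trans (cong (λ u → ev u (slM 0 h)) 1ₚ-⟨⟩)
      (trans (ev-⟨⟩ one (slM 0 h)) (sym (trans (cong (λ u → ev u h) 1ₚ-⟨⟩) (ev-⟨⟩ one h)))))
built-tail {n} (swap {k = suc k} m {x ∷ η} {F} {c} l e₀ e₁ B) with F₀ , c₀ , B₀ , r ← built-tail B with refl ← zeros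
    (lead-built B) 0 (s≤s z≤n) =
  _ , _ , swap m (ℕP.≤-pred l) e₀ e₁ B₀ ,
  (sl-intertwiner k (suc m) ζ F ⟨*⟩ lift-1-qt (suc m) ζ c₀ ⨾
      solve 3 (λ a z c → a :* (z :* c) := z :* (c :* a)) ≋-refl (I (sl 0 F)) (1ₚ -ₚ qt (suc m) ζ) (lift c₀) ⨾
    ≋-refl ⟨*⟩ (≋-sym (I-comm c₀ (sl 0 F)) ⨾ lin-cong I-lin (*ₚ-comm (lift c₀) (sl 0 F) ⨾ r ⨾ *ₚ-comm F₀ (lift c)) ⨾ I-comm c F₀)
        ⨾
    solve 3 (λ a z c → z :* (c :* a) := a :* (z :* c)) ≋-refl (I F₀) (1ₚ -ₚ qt (suc m) ζ) (lift c) ⨾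
        ≋-refl ⟨*⟩ ≋-sym (lift-1-qt (suc m) ζ c))
  where
  open PolySolver {n}
  ζ : ℤ
  ζ = shiftz k η
  I : Poly n → Poly n
  I = intertwiner k (qt (suc m) ζ)
  I-lin : Lin I
  I-lin = intertwiner-lin k (suc m) ζ
  I-comm : ∀ c f → I (lift c *ₚ f) ≋ lift c *ₚ I f
  I-comm = lift-comm I-lin (intertwiner-qt k (suc m) ζ)
built-tail {zero} (swap {k = zero} m (s≤s ()) e₀ e₁ (bump xs a e B))
built-tail {suc n} (swap {k = zero} m l e₀ refl (bump {k = zero} (.0 ∷ xs) a refl B)) with positive (lead-built B) (s≤s z≤n)
... | _ , ()
-- The composition before the shift begins with 0, as its first entry is the one that the swap
-- brings to the front again. Shift and swap together restrict to the shift in the remaining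
-- variables.
built-tail {suc n} (swap {k = zero} m l e₀ refl (bump {k = suc k} (.0 ∷ xs) a {F = F} {c} refl B)) with F₀ , c₀ , B₀ , r ←
    built-tail B =
  _ , _ , bump xs a refl B₀ ,
  (sl-first 1 S (suc m) ζ F ⟨*⟩ (lift-* _ c₀ ⨾ lift-qt (S ∸ a) (+ 0) ⟨*⟩ ≋-refl) ⨾
      solve 4 (λ z a q c → z :* a :* (q :* c) := z :* q :* (c :* a)) ≋-refl z (Φ 1 S (sl 0 F)) q (lift c₀) ⨾
    ≋-refl ⟨*⟩ (≋-sym (Φ-comm c₀ (sl 0 F)) ⨾ lin-cong (Φ-lin 1 S) (*ₚ-comm (lift c₀) (sl 0 F) ⨾ r ⨾ *ₚ-comm F₀ (lift c)) ⨾
        Φ-comm c F₀) ⨾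
    solve 4 (λ z a q c → z :* q :* (c :* a) := a :* (z :* (q :* c))) ≋-refl z (Φ 1 S F₀) q (lift c) ⨾
    ≋-refl ⟨*⟩ ≋-sym (lift-1-qt (suc m) ζ _ ⨾ ≋-refl ⟨*⟩ (lift-* _ c ⨾ lift-qt (S ∸ a) (+ 0) ⟨*⟩ ≋-refl)))
  where
  open PolySolver {suc n}
  S : ℕ
  S = V.sum (snoc xs a)
  ζ : ℤ
  ζ = shiftz 0 (suc a ∷ 0 ∷ xs)
  z q : Poly (suc n)
  z = 1ₚ -ₚ qt (suc m) ζ
  q = qt (S ∸ a) (+ 0)
  Φ-comm : ∀ c f → Φ 1 S (lift c *ₚ f) ≋ lift c *ₚ Φ 1 S f
  Φ-comm = lift-comm (Φ-lin 1 S) (Φ-qt 1 S)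

-- Uniqueness of eigenvectors at q = 1

private
  ΣN : ℕ → (ℕ → ℕ) → ℕ
  ΣN zero g = 0
  ΣN (suc k) g = g 0 ℕ.+ ΣN k (λ j → g (suc j))

  ΣN-mono : ∀ k {f g} → (∀ j → f j ≤ g j) → ΣN k f ≤ ΣN k g
  ΣN-mono zero h = z≤n
  ΣN-mono (suc k) h = ℕP.+-mono-≤ (h 0) (ΣN-mono k (λ j → h (suc j)))

  ΣN-eq : ∀ k {f g} → (∀ j → f j ≤ g j) → ΣN k g ≤ ΣN k f → ∀ j → j < k → f j ≡ g j
  ΣN-eq (suc k) {f} {g} h l zero _ = ℕP.≤-antisym (h 0) (ℕP.+-cancelʳ-≤ (ΣN k (λ j → f (suc j))) _ _
    (ℕP.≤-trans (ℕP.+-monoʳ-≤ (g 0) (ΣN-mono k (λ j → h (suc j)))) l))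
  ΣN-eq (suc k) {f} {g} h l (suc j) (s≤s lt) = ΣN-eq k (λ j → h (suc j))
      (ℕP.+-cancelˡ-≤ (f 0) _ _ (ℕP.≤-trans (ℕP.+-monoˡ-≤ _ (h 0)) l)) j lt

  get-≤-sum : ∀ {n} p (v : Vec ℕ n) → getAt p v ≤ V.sum v
  get-≤-sum p [] = z≤n
  get-≤-sum zero (x ∷ v) = ℕP.m≤m+n x _
  get-≤-sum (suc p) (x ∷ v) = ℕP.≤-trans (get-≤-sum p v) (ℕP.m≤n+m _ x)

vec-ext : ∀ {n} (v v' : Vec ℕ n) → (∀ j → j < n → getAt j v ≡ getAt j v') → v ≡ v'
vec-ext [] [] h = refl
vec-ext (x ∷ v) (y ∷ v') h = cong₂ _∷_ (h 0 (s≤s z≤n)) (vec-ext v v' (λ j l → h (suc j) (s≤s l)))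

-- A strictly monotone statistic for ≼ on compositions of S.
ρ : ∀ {n} → ℕ → Vec ℕ n → ℕ
ρ {n} S ζ = ΣN (suc n) (λ i → ΣN (suc (suc S)) (λ H → mass i H ζ))

≼-ρ : ∀ {n} S {ζ η : Vec ℕ n} → ζ ≼ η → ρ S ζ ≤ ρ S η
≼-ρ {n} S le = ΣN-mono (suc n) (λ i → ΣN-mono (suc (suc S)) (λ H → mass-≤ le i H))

-- Equal totals force each mass in `ρ` to be equal, and the parts can be recovered: at height H the
-- masses at p + 1 and at p differ by 1 if the part at p is below H, and by 0 otherwise. Heights up
-- to S + 1 detect every part, since none exceeds S.
ρ-strict : ∀ {n} S {ζ η : Vec ℕ n} → V.sum η ≡ S → ζ ≼ η → ρ S η ≤ ρ S ζ → ζ ≡ η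
ρ-strict {n} S {ζ} {η} refl le l = vec-ext ζ η (λ p p<n → ℕP.≤-antisym
    (entry-≤ η ζ (λ i H a b → sym (same i H a b)) p p<n (get-≤-sum p η))
    (entry-≤ ζ η same p p<n (ℕP.≤-trans (get-≤-sum p ζ) (ℕP.≤-reflexive (same-sum le)))))
  where
  same : ∀ i H → i < suc n → H < suc (suc S) → mass i H ζ ≡ mass i H η
  same i H a b = ΣN-eq (suc (suc S)) (λ H → mass-≤ le i H)
      (ℕP.≤-reflexive (sym (ΣN-eq (suc n) (λ i → ΣN-mono (suc (suc S)) (λ H → mass-≤ le i H)) l i a))) H b
  entry-≤ : ∀ (ζ η : Vec ℕ n) → (∀ i H → i < suc n → H < suc (suc S) → mass i H ζ ≡ mass i H η) → ∀ p → p < n → getAt p ζ ≤ S →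
      getAt p η ≤ getAt p ζ
  entry-≤ ζ η same p p<n bd with getAt p η ℕ.≤? getAt p ζ
  ... | yes r = r
  ... | no r = ⊥-elim (ℕP.1+n≢n (ℕP.+-cancelˡ-≡ (mass p (suc a) ζ) _ _
      (trans (trans (cong (mass p (suc a) ζ ℕ.+_) (sym (trans (ℕP.+-∸-assoc 1 (ℕP.≤-refl {a})) (cong suc (ℕP.n∸n≡0 a)))))
      (sym (mass-step p (suc a) ζ p<n))) (trans (cong₂ ℕ._+_ (same (suc p) (suc a) (s≤s p<n) (s≤s (s≤s bd))) (ℕP.n∸n≡0 a))
      (trans (cong (mass (suc p) (suc a) η ℕ.+_) (sym (ℕP.m≤n⇒m∸n≡0 (ℕP.≤-trans (ℕP.≰⇒> r) (ℕP.n≤1+n _)))))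
          (trans (mass-step p (suc a) η p<n)
      (cong₂ ℕ._+_ (sym (same p (suc a) (ℕP.<-trans p<n (ℕP.n<1+n n)) (s≤s (s≤s bd)))) (ℕP.m≤n⇒m∸n≡0 (ℕP.≰⇒> r)))))))))
    where
    a : ℕ
    a = getAt p ζ

lift-id : (c : Poly 0) → lift c ≋ c
lift-id c = mk≋ λ h → trans (ev-lift c h) (ev-cong c (λ { (mono q t []) → refl }))

co-same : ∀ {n} (ζ : Vec ℕ n) → co ζ ⟨ mono 0 (+ 0) ζ ⟩ ≋ 1ₚ
co-same ζ = mk≋ λ h → trans (ev-co ζ _ h)
    (trans (ev-⟨⟩ (mono 0 (+ 0) ζ) (coM ζ h)) (trans (cong (λ g → if g then h one else 0ℚ) (eqVec-refl ζ))
  (sym (trans (cong (λ u → ev u h) 1ₚ-⟨⟩) (ev-⟨⟩ one h)))))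

co-other : ∀ {n} (ξ ζ : Vec ℕ n) → ζ ≢ ξ → co ξ ⟨ mono 0 (+ 0) ζ ⟩ ≋ 0ₚ
co-other ξ ζ ne = mk≋ λ h → trans (ev-co ξ _ h)
    (trans (ev-⟨⟩ (mono 0 (+ 0) ζ) (coM ξ h)) (trans (cong (λ g → if g then h one else 0ℚ) (eqVec-false ζ ξ ne)) (sym (ev-0ₚ h))))

⟨⟩-qt : ∀ {n} q t (ζ : Vec ℕ n) → ⟨ mono q t ζ ⟩ ≋ qt q t *ₚ ⟨ mono 0 (+ 0) ζ ⟩
⟨⟩-qt q t x = mk≋ λ h → trans (ev-⟨⟩ (mono q t x) h) (sym (trans (ev-qt q t ⟨ mono 0 (+ 0) x ⟩ h)
  (trans (ev-⟨⟩ (mono 0 (+ 0) x) (λ m → h (shiftM q t m))) (cong h (mono-cong (ℕP.+-identityʳ q) (ℤP.+-identityʳ t) refl)))))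

qt-separate-< : ∀ {n} r r' {g : Poly n} → r < r' → qt 0 (ℤ.- (+ r)) *ₚ g ≋ qt 0 (ℤ.- (+ r')) *ₚ g → g ≋ 0ₚ
qt-separate-< {n} r r' {g} l eq with o , refl ← ℕP.m≤n⇒∃[o]m+o≡n l =
    nzd-1-t o g (solve 2 (λ z g → (con 1ℚ :- z) :* g := g :- z :* g) ≋-refl (qt 0 (+ suc o)) g ⨾
    ≋-refl ⟨-⟩ qt-cancel 0 (ℤ.- (+ suc (r ℕ.+ o))) (≋-sym (*ₚ-assoc _ _ g) ⨾
        (qt-* 0 (ℤ.- (+ suc (r ℕ.+ o))) 0 (+ suc o) ⨾ ≡⇒≋ (cong (qt 0) arith)) ⟨*⟩ ≋-refl ⨾ eq) ⨾ neg-invʳ g)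
  where
  open PolySolver {n}
  cancel : ∀ a b → ℤ.- (a ℤ.+ b) ℤ.+ b ≡ ℤ.- a
  cancel = solveℤ 2 (λ a b → ⊟ (a ⊞ b) ⊞ b ⊜ ⊟ a) refl
    where open ℤS.+-*-Solver renaming (solve to solveℤ; _:+_ to _⊞_; :-_ to ⊟_; _:=_ to _⊜_)
  arith : ℤ.- (+ suc (r ℕ.+ o)) ℤ.+ + suc o ≡ ℤ.- (+ r)
  arith = trans (cong (λ s → ℤ.- (+ s) ℤ.+ + suc o) (sym (ℕP.+-suc r o))) (cancel (+ r) (+ suc o))

qt-separate : ∀ {n} r r' {g : Poly n} → r ≢ r' → qt 0 (ℤ.- (+ r)) *ₚ g ≋ qt 0 (ℤ.- (+ r')) *ₚ g → g ≋ 0ₚ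
qt-separate r r' ne eq with ℕP.<-cmp r r'
... | tri≈ _ q _ = ⊥-elim (ne q)
... | tri< l _ _ = qt-separate-< r r' l eq
... | tri> _ _ l = qt-separate-< r' r l (≋-sym eq)

supp-0ₚ : ∀ {n} {P : Vec ℕ n → Set} {f : Poly n} → f ≋ 0ₚ → Supp P f
supp-0ₚ z = supp λ h v → trans (at z h) (ev-0ₚ h)

module _ {N : ℕ} (S : ℕ) where
  Lower : ℕ → Vec ℕ (suc N) → Set
  Lower M ζ = V.sum ζ ≡ S × ρ S ζ < M

  Lower? : ∀ M ζ → Dec (Lower M ζ)
  Lower? M ζ with V.sum ζ ℕ.≟ S | ρ S ζ ℕ.<? M
  ... | yes a | yes b = yes (a , b)
  ... | no a | _ = no (λ p → a (proj₁ p))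
  ... | _ | no b = no (λ p → b (proj₂ p))

  lower-zero : ∀ {f} → Supp (Lower 0) f → f ≋ 0ₚ
  lower-zero s = mk≋ λ h → trans (vanish s h (λ { _ _ _ (_ , ()) })) (sym (ev-0ₚ h))

  private
    -- The operators Y_i at q = 1 are triangular for ρ with the expected diagonal, since the E_ζ form a unitriangular eigenbasis.
    module Triangular (i d : ℕ) (i+d : i ℕ.+ d ≡ N) where
      A : Poly (suc N) → Poly (suc N)
      A = Y 0 i d
      A-lin : Lin A
      A-lin = Y-lin 0 i d
      A-qt : QT A
      A-qt = Y-qt 0 i d
      y : ∀ {m} → Vec ℕ (suc N) → Poly m
      y ζ = qt 0 (ℤ.- (+ rank i ζ))

      Diagonal : ℕ → Poly (suc N) → Set
      Diagonal M f = ∀ ξ → V.sum ξ ≡ S → suc (ρ S ξ) ≡ M → co ξ (A f) ≋ y ξ *ₚ co ξ f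

      module Monomial (M : ℕ) (IH : ∀ f → Supp (Lower M) f → Supp (Lower M) (A f)) (ζ : Vec ℕ (suc N)) (sζ : V.sum ζ ≡ S)
          (lζ : ρ S ζ ≤ M)
        {k F c} (B : Built k ζ F c) where
        x G h : Poly (suc N)
        x = ⟨ mono 0 (+ 0) ζ ⟩
        G = q1 F
        κ : ∀ {m} → Poly m
        κ = lift (q1 c)
        -- The scaled monomial and the eigenvector have the same leading term, so the difference is
        -- strictly lower and the induction hypothesis controls its image.
        h = κ *ₚ x -ₚ G

        G-supp : Supp (_≼ ζ) G
        G-supp = supp-q1 (built-supp B)

        co-κ : ∀ (ξ : Vec ℕ (suc N)) f → co ξ (κ *ₚ f) ≋ κ *ₚ co ξ f
        co-κ ξ = lift-comm (co-lin ξ) (co-qt ξ) (q1 c)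

        top : ∀ ξ → ρ S ζ ≤ ρ S ξ → co ξ G ≋ κ *ₚ co ξ x
        top ξ l with VP.≡-dec ℕ._≟_ ζ ξ
        ... | yes refl = ≋-sym (q1-co ζ F) ⨾ lin-cong q1-lin (built-lead B) ⨾
            ≋-sym (≋-refl ⟨*⟩ co-same ζ ⨾ *ₚ-comm κ 1ₚ ⨾ *ₚ-idˡ κ ⨾ lift-id (q1 c))
        ... | no ne = co-supp ξ G-supp (λ le → ne (sym (ρ-strict S sζ le l))) ⨾ ≋-sym (≋-refl ⟨*⟩ co-other ξ ζ ne ⨾ *-zeroʳ κ)

        h-supp : Supp (Lower M) h
        h-supp = supp-co (Lower? M) off
          where
          off : ∀ ξ → ¬ Lower M ξ → co ξ h ≋ 0ₚ
          off ξ nl with V.sum ξ ℕ.≟ S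
          ... | no ne = lin-- (co-lin ξ) _ _ ⨾
              (co-κ ξ x ⨾ ≋-refl ⟨*⟩ co-other ξ ζ (λ q → ne (trans (cong V.sum (sym q)) sζ)) ⨾ *-zeroʳ κ) ⟨-⟩
              co-supp ξ G-supp (λ le → ne (trans (same-sum le) sζ)) ⨾ neg-invʳ 0ₚ
          ... | yes s = lin-- (co-lin ξ) _ _ ⨾ co-κ ξ x ⟨-⟩ top ξ (ℕP.≤-trans lζ (ℕP.≮⇒≥ (λ l → nl (s , l)))) ⨾ neg-invʳ _

        κA : κ *ₚ A x ≋ A h +ₚ y ζ *ₚ G
        κA = ≋-sym (lift-comm A-lin A-qt (q1 c) x) ⨾ lin-cong A-lin (solve 2 (λ a g → a := a :- g :+ g) ≋-refl (κ *ₚ x) G) ⨾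
            lin-+ A-lin h G ⨾ ≋-refl ⟨+⟩ built-eigen₁ B i d i+d
          where open PolySolver {suc N}

        coκA : ∀ ξ → ¬ Lower M ξ → κ *ₚ co ξ (A x) ≋ y ζ *ₚ co ξ G
        coκA ξ nl = ≋-sym (co-κ ξ _) ⨾ lin-cong (co-lin ξ) κA ⨾ lin-+ (co-lin ξ) _ _ ⨾
            co-supp ξ (IH h h-supp) nl ⟨+⟩ co-qt ξ 0 _ G ⨾ +ₚ-comm 0ₚ _ ⨾ +ₚ-idʳ _

        Ax-supp : Supp (Lower (suc M)) (A x)
        Ax-supp = supp-co (Lower? (suc M)) (λ ξ nl → built-nzd B _ (coκA ξ (λ { (s , l) → nl (s , ℕP.m<n⇒m<1+n l) }) ⨾
          ≋-refl ⟨*⟩ co-supp ξ G-supp (λ le → nl (trans (same-sum le) sζ , s≤s (ℕP.≤-trans (≼-ρ S le) lζ))) ⨾ *-zeroʳ (y ζ)))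

        Ax-diagonal : Diagonal (suc M) x
        Ax-diagonal ξ s r = nzd-cancel (built-nzd B) (coκA ξ (λ { (_ , l) → ℕP.<-irrefl (ℕP.suc-injective r) l }) ⨾
            ≋-refl ⟨*⟩ top ξ (ℕP.≤-trans lζ (ℕP.≤-reflexive (sym (ℕP.suc-injective r)))) ⨾ finish)
          where
          open PolySolver {0}
          finish : y ζ *ₚ (κ *ₚ co ξ x) ≋ κ *ₚ (y ξ *ₚ co ξ x)
          finish with VP.≡-dec ℕ._≟_ ζ ξ
          ... | yes refl = solve 3 (λ a b c → a :* (b :* c) := b :* (a :* c)) ≋-refl (y ζ) κ (co ζ x)
          ... | no ne = ≋-refl ⟨*⟩ (≋-refl ⟨*⟩ co-other ξ ζ ne ⨾ *-zeroʳ κ) ⨾ *-zeroʳ (y ζ) ⨾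
              ≋-sym (≋-refl ⟨*⟩ (≋-refl ⟨*⟩ co-other ξ ζ ne ⨾ *-zeroʳ (y ξ)) ⨾ *-zeroʳ κ)

      triangular : ∀ M f → Supp (Lower M) f → Supp (Lower M) (A f)
      triangular zero f s = supp-0ₚ (lin-zero A-lin (lower-zero s))
      triangular (suc M) f s = supp λ h v → trans (ev-adj A-lin f h) (vanish s _ (λ { q t ζ (sζ , s≤s lζ) →
        trans (sym (adj-⟨⟩ A-lin (mono q t ζ) h)) (vanish (term q t ζ sζ lζ) h v) }))
        where
        term : ∀ q t ζ → V.sum ζ ≡ S → ρ S ζ ≤ M → Supp (Lower (suc M)) (A ⟨ mono q t ζ ⟩)
        term q t ζ sζ lζ = supp-≋ (≋-sym (lin-cong A-lin (⟨⟩-qt q t ζ) ⨾ A-qt q t _)) (supp-*ˡ (qt q t) (supp-qt₁ q t)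
          (Monomial.Ax-supp M (triangular M) ζ sζ lζ (proj₂ (proj₂ (proj₂ (built-exists ζ))))))

      diagonal : ∀ M f → Supp (Lower (suc M)) f → Diagonal (suc M) f
      diagonal M f s ξ sξ r = lin-on-supp (lin-∘ (co-lin ξ) A-lin) (lin-mul (y ξ) (co-lin ξ)) s (λ { h q t ζ (sζ , s≤s lζ) →
        trans (sym (adj-⟨⟩ (lin-∘ (co-lin ξ) A-lin) (mono q t ζ) h))
            (trans (at (term q t ζ sζ lζ) h) (adj-⟨⟩ (lin-mul (y ξ) (co-lin ξ)) (mono q t ζ) h)) })
        where
        open PolySolver {0}
        term : ∀ q t ζ → V.sum ζ ≡ S → ρ S ζ ≤ M → co ξ (A ⟨ mono q t ζ ⟩) ≋ y ξ *ₚ co ξ ⟨ mono q t ζ ⟩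
        term q t ζ sζ lζ = lin-cong (co-lin ξ) (lin-cong A-lin (⟨⟩-qt q t ζ) ⨾ A-qt q t _) ⨾ co-qt ξ q t _ ⨾
          ≋-refl ⟨*⟩ Monomial.Ax-diagonal M (triangular M) ζ sζ lζ (proj₂ (proj₂ (proj₂ (built-exists ζ)))) ξ sξ r ⨾
          solve 3 (λ a b c → a :* (b :* c) := b :* (a :* c)) ≋-refl (qt q t) (y ξ) (co ξ ⟨ mono 0 (+ 0) ζ ⟩) ⨾
          ≋-refl ⟨*⟩ ≋-sym (lin-cong (co-lin ξ) (⟨⟩-qt q t ζ) ⨾ co-qt ξ q t _)

    search : ∀ (u v : ℕ → ℕ) k → (∀ j → j < k → u j ≡ v j) ⊎ ∃ λ j → j < k × u j ≢ v j
    search u v zero = inj₁ (λ _ ())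
    search u v (suc k) with search u v k | u k ℕ.≟ v k
    ... | inj₂ (j , l , ne) | _ = inj₂ (j , ℕP.m<n⇒m<1+n l , ne)
    ... | inj₁ _ | no ne = inj₂ (k , ℕP.n<1+n k , ne)
    ... | inj₁ h | yes q = inj₁ (λ j l → upto j (ℕP.m≤n⇒m<n∨m≡n (ℕP.≤-pred l)))
      where
      upto : ∀ j → j < k ⊎ j ≡ k → u j ≡ v j
      upto j (inj₁ l) = h j l
      upto j (inj₂ refl) = q

    mass-≤-zero : ∀ {n} i H (v : Vec ℕ n) → mass i H v ≤ mass i H (V.replicate n 0)
    mass-≤-zero i H [] = z≤n
    mass-≤-zero zero H (a ∷ v) = ℕP.+-mono-≤ (ℕP.∸-monoʳ-≤ H (s≤s z≤n)) (mass-≤-zero zero H v)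
    mass-≤-zero (suc i) H (a ∷ v) = ℕP.+-mono-≤ (ℕP.m∸n≤m H a) (mass-≤-zero i H v)

  -- Let ξ have the largest `ρ` among the monomials of f. By triangularity Y_{j+1} multiplies its
  -- coefficient by the power of t belonging to `rank j ξ`, while the eigenvalue belongs to
  -- `rank j w`. If these ranks differ for some j, the coefficient is 0; if they agree for all j,
  -- then ξ has the type of w by `rank-~` and the last hypothesis applies.
  eigen-unique : ∀ w (f : Poly (suc N)) → Supp (λ ζ → V.sum ζ ≡ S) f → Eigen 0 (λ i → qt 0 (ℤ.- (+ rank i w))) f →
    (∀ ζ → V.sum ζ ≡ S → ζ ~ w → co ζ f ≋ 0ₚ) → f ≋ 0ₚ
  -- The descent starts from the zero vector, which has the largest masses of all and thus bounds
  -- `ρ`.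
  eigen-unique w f s E z = descend (suc (ρ {suc N} S (V.replicate (suc N) 0)))
      (supp-⊆ (λ ζ q → q , s≤s (ΣN-mono (suc (suc N)) (λ i → ΣN-mono (suc (suc S)) (λ H → mass-≤-zero i H ζ)))) s)
    where
    descend : ∀ M → Supp (Lower M) f → f ≋ 0ₚ
    descend zero sp = lower-zero sp
    descend (suc M) sp = descend M (supp-co (Lower? M) off)
      where
      kill : ∀ ξ → V.sum ξ ≡ S → ρ S ξ ≡ M → (∀ j → j < suc N → rank j ξ ≡ rank j w) ⊎ (∃ λ j → j < suc N × rank j ξ ≢ rank j w)
          → co ξ f ≋ 0ₚ
      kill ξ sξ r (inj₁ same) = z ξ sξ (rank-~ ξ w same)
      kill ξ sξ r (inj₂ (j , s≤s l , ne)) = qt-separate (rank j ξ) (rank j w) ne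
        (≋-sym (Triangular.diagonal j (N ∸ j) (ℕP.m+[n∸m]≡n l) M f sp ξ sξ (cong suc r)) ⨾
            lin-cong (co-lin ξ) (E j (N ∸ j) (ℕP.m+[n∸m]≡n l)) ⨾ co-qt ξ 0 _ f)
      off : ∀ ξ → ¬ Lower M ξ → co ξ f ≋ 0ₚ
      off ξ nl with Lower? (suc M) ξ
      ... | no nl' = co-supp ξ sp nl'
      ... | yes (sξ , s≤s l) = kill ξ sξ (ℕP.≤-antisym l (ℕP.≮⇒≥ (λ g → nl (sξ , g))))
          (search (λ j → rank j ξ) (λ j → rank j w) (suc N))

-- Ratios at q = 1

cge-≤ : ∀ {n} r (v : Vec ℕ n) → cge r v ≤ n
cge-≤ r [] = z≤n
cge-≤ r (x ∷ v) with r ℕ.≤ᵇ x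
... | true = s≤s (cge-≤ r v)
... | false = ℕP.m≤n⇒m≤1+n (cge-≤ r v)

-- For M at least the largest part this is ∏_{r ≥ 1} e_{#{i : η_i ≥ r}}.
eprod : ∀ {n} → ℕ → Vec ℕ n → Poly n
eprod zero η = 1ₚ
eprod (suc M) η = e (cge (suc M) η) *ₚ eprod M η

nzd-eprod : ∀ {n} M (η : Vec ℕ n) → NZD (eprod M η)
nzd-eprod zero η = nzd-1
nzd-eprod (suc M) η = nzd-* (nzd-e _ (cge-≤ (suc M) η)) (nzd-eprod M η)

eprod-cong : ∀ {n} M (η η' : Vec ℕ n) → (∀ r → 1 ≤ r → r ≤ M → cge r η ≡ cge r η') → eprod M η ≋ eprod M η'
eprod-cong zero η η' h = ≋-refl
eprod-cong (suc M) η η' h = ≡⇒≋ (cong e (h (suc M) (s≤s z≤n) ℕP.≤-refl)) ⟨*⟩ eprod-cong M η η'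
    (λ r l l' → h r l (ℕP.m≤n⇒m≤1+n l'))

module _ {n} {A : Poly n → Poly n} (lA : Lin A) where
  symm-* : ∀ {g g'} → Symm A g → Symm A g' → Symm A (g *ₚ g')
  symm-* s s' f = lin-cong lA (*ₚ-assoc _ _ f) ⨾ s _ ⨾ ≋-refl ⟨*⟩ s' f ⨾ ≋-sym (*ₚ-assoc _ _ _)

  symm-eprod : (∀ k → Symm A (e k)) → ∀ M η → Symm A (eprod M η)
  symm-eprod s zero η f = lin-cong lA (*ₚ-idˡ f) ⨾ ≋-sym (*ₚ-idˡ _)
  symm-eprod s (suc M) η = symm-* (s (cge (suc M) η)) (symm-eprod s M η)

symm-chain : ∀ {n} {O : ℕ → Poly n → Poly n} (lO : ∀ p → Lin (O p)) g a k → (∀ j → j < a ℕ.+ k → Symm (O j) g) →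
    Symm (chain O a k) g
symm-chain lO g a zero h f = ≋-refl
symm-chain lO g a (suc k) h f = lin-cong (lO a) (symm-chain lO g (suc a) k (λ j l → h j (subst (j <_) (sym (ℕP.+-suc a k)) l)) f)
    ⨾ h a (ℕP.m<m+n a (s≤s z≤n)) _

Y-e : ∀ {N} i d k → i ℕ.+ d ≡ N → Symm (Y {N} 0 i d) (e k)
Y-e {N} i d k refl f = ≋-refl ⟨*⟩
    (lin-cong (dn-lin i d)
    (lin-cong (ω-lin 0) (symm-chain T-lin (e k) 0 i (λ j l → T-e j k (s≤s (ℕP.≤-trans l (ℕP.m≤m+n i d)))) f) ⨾ ω-e k _) ⨾
    symm-chain T⁻-lin (e k) i d (λ j l → T⁻-e j k (s≤s l)) _) ⨾
  solve 3 (λ a b c → a :* (b :* c) := b :* (a :* c)) ≋-refl (qt 0 (ℤ.- (+ i))) (e k) _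
  where open PolySolver {suc N}

intertwiner-e : ∀ {n} p a z k → suc p < n → Symm (intertwiner {n} p (qt a z)) (e k)
intertwiner-e {n} p a z k l f = ≋-refl ⟨*⟩ T-e p k l f ⟨-⟩ ≋-refl ⨾
  solve 5 (λ z g u k f → z :* (k :* g) :- u :* (k :* f) := k :* (z :* g :- u :* f)) ≋-refl (1ₚ -ₚ qt a z) (T⟨ p ⟩ f) 𝐮 (e k) f
  where open PolySolver {n}

-- The equation G / (K P) = G' / (K' P') of fractions, cleared of denominators.
Cross : ∀ {n} → (G K P G' K' P' : Poly n) → Set
Cross G K P G' K' P' = G *ₚ K' *ₚ P' ≋ G' *ₚ K *ₚ P

cross-trans : ∀ {n} {G₁ K₁ P₁ G₂ K₂ P₂ G₃ K₃ P₃ : Poly n} → NZD K₂ → NZD P₂ → Cross G₁ K₁ P₁ G₂ K₂ P₂ → Cross G₂ K₂ P₂ G₃ K₃ P₃ →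
    Cross G₁ K₁ P₁ G₃ K₃ P₃
cross-trans {n} {G₁} {K₁} {P₁} {G₂} {K₂} {P₂} {G₃} {K₃} {P₃} nK nP h h' = nzd-cancel (nzd-* nK nP)
  (solve 5 (λ g k p k' p' → k :* p :* (g :* k' :* p') := g :* k :* p :* (k' :* p')) ≋-refl G₁ K₂ P₂ K₃ P₃ ⨾ h ⟨*⟩ ≋-refl ⨾
   solve 5 (λ g k p k' p' → g :* k :* p :* (k' :* p') := g :* k' :* p' :* (k :* p)) ≋-refl G₂ K₁ P₁ K₃ P₃ ⨾ h' ⟨*⟩ ≋-refl ⨾
   solve 5 (λ g k p k' p' → g :* k :* p :* (k' :* p') := k :* p :* (g :* k' :* p')) ≋-refl G₃ K₂ P₂ K₁ P₁)
  where open PolySolver {n}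

-- E_η / E_η' at q = 1 equals eprod M η / eprod M η'.
Ratio : ∀ {n} → ℕ → Vec ℕ n → Poly n → Poly 0 → Vec ℕ n → Poly n → Poly 0 → Set
Ratio M η F c η' F' c' = Cross (q1 F) (lift (q1 c)) (eprod M η) (q1 F') (lift (q1 c')) (eprod M η')

-- The range `M` of the products stays free above `D`, so that it need not change when the recursion
-- passes to a smaller degree.
RatioUpTo : ℕ → ℕ → Set
RatioUpTo n D = ∀ {k k'} {η η' : Vec ℕ n} {F c F' c'} M → D ≤ M → Built k η F c → Built k' η' F' c' → η ~ η' → V.sum η ≤ D →
    V.sum η' ≤ D → Ratio M η F c η' F' c'

-- The shift affects a single factor, the one for r = a + 1, whose index grows by one. The old index
-- is the rank of the new first part and so depends only on the type; both sides of a ratio change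
-- by the same quotient.
eprod-bump : ∀ {N} (xs : Vec ℕ N) a d → eprod (suc a ℕ.+ d) (suc a ∷ xs) *ₚ e (cge (suc a) xs) ≋ eprod (suc a ℕ.+ d) (snoc xs a)
    *ₚ e (suc (cge (suc a) xs))
eprod-bump {N} xs a zero rewrite ℕP.+-identityʳ a = ≡⇒≋ (cong (λ b → e (bit b ℕ.+ cge (suc a) xs)) (≤ᵇ-true (ℕP.≤-refl {suc a})))
    ⟨*⟩ eprod-cong a (suc a ∷ xs) (snoc xs a) low ⟨*⟩ ≋-refl ⨾
    solve 3 (λ a b c → a :* b :* c := c :* b :* a) ≋-refl (e (suc (cge (suc a) xs))) (eprod a (snoc xs a)) (e (cge (suc a) xs)) ⨾
    ≡⇒≋ (cong e (sym (trans (cge-snoc (suc a) xs a)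
        (trans (cong (λ b → cge (suc a) xs ℕ.+ bit b) (≤ᵇ-false (ℕP.n<1+n a))) (ℕP.+-identityʳ _))))) ⟨*⟩ ≋-refl ⟨*⟩ ≋-refl
  where
  open PolySolver {suc N}
  low : ∀ r → 1 ≤ r → r ≤ a → cge r (suc a ∷ xs) ≡ cge r (snoc xs a)
  low r _ l = trans (cong (λ b → bit b ℕ.+ cge r xs) (trans (≤ᵇ-true (ℕP.m≤n⇒m≤1+n l)) (sym (≤ᵇ-true l))))
      (trans (ℕP.+-comm (bit (r ℕ.≤ᵇ a)) _) (sym (cge-snoc r xs a)))
eprod-bump {N} xs a (suc d) rewrite ℕP.+-suc a d = *ₚ-assoc _ _ _ ⨾ ≡⇒≋ (cong e high) ⟨*⟩ eprod-bump xs a d ⨾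
    ≋-sym (*ₚ-assoc _ _ _)
  where
  high : cge (suc (suc (a ℕ.+ d))) (suc a ∷ xs) ≡ cge (suc (suc (a ℕ.+ d))) (snoc xs a)
  high = trans (cong (λ b → bit b ℕ.+ cge (suc (suc (a ℕ.+ d))) xs)
      (trans (≤ᵇ-false (s≤s (s≤s (ℕP.m≤m+n a d)))) (sym (≤ᵇ-false {_} {a} (s≤s (ℕP.≤-trans (ℕP.m≤m+n a d) (ℕP.n≤1+n _)))))))
    (trans (ℕP.+-comm (bit (suc (suc (a ℕ.+ d)) ℕ.≤ᵇ a)) _) (sym (cge-snoc _ xs a)))

Φ₀-any : ∀ {N} S S' (f : Poly (suc N)) → Φ 0 S f ≋ Φ 0 S' f
Φ₀-any S S' f = mk≋ λ h → trans (ev-Φ 0 S f h) (sym (ev-Φ 0 S' f h))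

bump-scalar : ∀ {n} a (c : Poly 0) → lift {n} (q1 (qt a (+ 0) *ₚ c)) ≋ lift (q1 c)
bump-scalar a c = lin-cong lift-lin (q1-qt* a (+ 0) c ⨾ ≡⇒≋ qt-one ⟨*⟩ ≋-refl ⨾ *ₚ-idˡ _)

eprod-swap : ∀ {n} M k (η : Vec ℕ n) → suc k < n → eprod M (swapAt k η) ≋ eprod M η
eprod-swap M k η l = eprod-cong M _ η (λ r _ _ → cge-swap r k η l)

-- Undoing a swap keeps the two numbers of leading zeros equal, so the lemma calls itself. Undoing a
-- shift may make them differ; there the full statement in smaller degree is used.
ratio-same-zeros : ∀ {n} D → (∀ D' → suc D' ≡ D → RatioUpTo n D') → ∀ {k} {η η' : Vec ℕ n} {F c F' c'} M → D ≤ M →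
    Built k η F c → Built k η' F' c' → η ~ η' →
  V.sum η ≤ D → V.sum η' ≤ D → Ratio M η F c η' F' c'
ratio-same-zeros D IH M DM base base t s s' = ≋-refl
ratio-same-zeros D IH M DM base (swap m l e₀ e₁ B') t s s' = ⊥-elim (ℕP.<-irrefl refl l)
ratio-same-zeros D IH M DM (swap m l e₀ e₁ B) base t s s' = ⊥-elim (ℕP.<-irrefl refl l)
ratio-same-zeros {suc N} (suc D) IH M DM (bump xs a {F = F} {c} refl B) (bump ys b {F = F'} {c'} refl B') t (s≤s s) (s≤s s') =
    nzd-cancel (nzd-e p (ℕP.≤-trans (cge-≤ _ xs) (ℕP.n≤1+n N)))
    (≋-refl ⟨*⟩ (left ⟨*⟩ bump-scalar _ c' ⟨*⟩ ≋-refl) ⨾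
        solve 4 (λ p g k q → p :* (g :* k :* q) := g :* k :* (q :* p)) ≋-refl (e p) (Φ 0 S G) K' (eprod M (suc b ∷ ys)) ⨾
     ≋-refl ⟨*⟩ (≋-refl ⟨*⟩ ≡⇒≋ (cong e pp) ⨾ eprodM ys b (ℕP.≤-trans (s≤s (ℕP.≤-trans (ℕP.m≤m+n b _) s')) DM) ⨾
         ≋-refl ⟨*⟩ ≡⇒≋ (cong (λ r → e (suc r)) (sym pp))) ⨾
     solve 4 (λ g k q r → g :* k :* (q :* r) := (g :* k :* q) :* r) ≋-refl (Φ 0 S G) K' (eprod M (snoc ys b)) (e (suc p)) ⨾
         pushed ⟨*⟩ ≋-refl ⨾
     solve 4 (λ g k q r → (g :* k :* q) :* r := g :* k :* (q :* r)) ≋-refl (Φ 0 S G') K (eprod M (snoc xs a)) (e (suc p)) ⨾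
     ≋-refl ⟨*⟩ ≋-sym (eprodM xs a (ℕP.≤-trans (s≤s (ℕP.≤-trans (ℕP.m≤m+n a _) s)) DM)) ⨾
     ≋-sym (≋-refl ⟨*⟩ (right ⟨*⟩ bump-scalar _ c ⟨*⟩ ≋-refl) ⨾
         solve 4 (λ p g k q → p :* (g :* k :* q) := g :* k :* (q :* p)) ≋-refl (e p) (Φ 0 S G') K (eprod M (suc a ∷ xs))))
  where
  open PolySolver {suc N}
  S p : ℕ
  S = V.sum (snoc xs a)
  p = cge (suc a) xs
  pp : p ≡ cge (suc b) ys
  pp = ~-rank (suc a ∷ xs) (suc b ∷ ys) t 0 (s≤s z≤n)
  G G' K K' : Poly (suc N)
  G = q1 F
  G' = q1 F'
  K = lift (q1 c)
  K' = lift (q1 c')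
  left : q1 (Φ 1 S F) ≋ Φ 0 S G
  left = q1-Φ S F
  right : q1 (Φ 1 (V.sum (snoc ys b)) F') ≋ Φ 0 S G'
  right = q1-Φ _ F' ⨾ Φ₀-any _ S _
  eprodM : ∀ (xs : Vec ℕ N) a → suc a ≤ M → eprod M (suc a ∷ xs) *ₚ e (cge (suc a) xs) ≋ eprod M (snoc xs a) *ₚ e
      (suc (cge (suc a) xs))
  eprodM xs a l with d , refl ← ℕP.m≤n⇒∃[o]m+o≡n l = eprod-bump xs a d
  rotate : ∀ g c η → Φ 0 S (g *ₚ lift c *ₚ eprod M η) ≋ Φ 0 S g *ₚ lift c *ₚ eprod M η
  rotate g c η = lin-cong (Φ-lin 0 S) (solve 3 (λ g k q → g :* k :* q := q :* (k :* g)) ≋-refl g (lift c) (eprod M η)) ⨾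
      symm-eprod (Φ-lin 0 S) (Φ-e S) M η _ ⨾
    ≋-refl ⟨*⟩ lift-comm (Φ-lin 0 S) (Φ-qt 0 S) c g ⨾
        solve 3 (λ g k q → q :* (k :* g) := g :* k :* q) ≋-refl (Φ 0 S g) (lift c) (eprod M η)
  sum-≤ : ∀ (xs : Vec ℕ N) a → a ℕ.+ V.sum xs ≤ D → V.sum (snoc xs a) ≤ D
  sum-≤ xs a l = ℕP.≤-trans (ℕP.≤-reflexive (trans (sum-snoc xs a) (ℕP.+-comm _ a))) l
  pushed : Φ 0 S G *ₚ K' *ₚ eprod M (snoc ys b) ≋ Φ 0 S G' *ₚ K *ₚ eprod M (snoc xs a)
  pushed = ≋-sym (rotate G (q1 c') (snoc ys b)) ⨾
    lin-cong (Φ-lin 0 S) (IH D refl M (ℕP.≤-trans (ℕP.n≤1+n D) DM) B B' (~-unbump a b xs ys t) (sum-≤ xs a s) (sum-≤ ys b s')) ⨾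
        rotate G' (q1 c) (snoc xs a)
ratio-same-zeros {n} D IH M DM (swap {k = k} m {η} {F} {c} l e₀ e₁ B) (swap m' {η'} {F'} {c'} l' e₀' e₁' B') t s s' =
    q1-intertwiner k _ ζ F ⟨*⟩ scalar c' (suc m') ζ' (sym ζζ') ⟨*⟩ eprod-swap M k η' l ⨾
    solve 4 (λ g z k q → g :* (z :* k) :* q := z :* (g :* k :* q)) ≋-refl (I G) z K' (eprod M η') ⨾
    ≋-refl ⟨*⟩ (≋-sym (through G (q1 c') η') ⨾
        lin-cong (intertwiner-lin k 0 ζ) (ratio-same-zeros D IH M DM B B' t₀ (before η s) (before η' s')) ⨾ through G' (q1 c) η) ⨾
    ≋-sym ((q1-intertwiner k _ ζ' F' ⨾ ≡⇒≋ (cong (λ ζ → intertwiner k (qt 0 ζ) (q1 F')) (sym ζζ'))) ⟨*⟩ scalar c (suc m) ζ refl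
        ⟨*⟩ eprod-swap M k η l ⨾
      solve 4 (λ g z k q → g :* (z :* k) :* q := z :* (g :* k :* q)) ≋-refl (I G') z K (eprod M η))
  where
  open PolySolver {n}
  t₀ : η ~ η'
  t₀ = ~-unswap k η η' l (drop e₀ e₁) (drop e₀' e₁') t
  ζ ζ' : ℤ
  ζ = shiftz k η
  ζ' = shiftz k η'
  ζζ' : ζ ≡ ζ'
  ζζ' = cong₂ (λ a b → + a ℤ.- + b) (~-rank η η' t₀ (suc k) l) (~-rank η η' t₀ k (ℕP.<-trans (ℕP.n<1+n k) l))
  z G G' K K' : Poly n
  z = 1ₚ -ₚ qt 0 ζ
  G = q1 F
  G' = q1 F'
  K = lift (q1 c)
  K' = lift (q1 c')
  I : Poly n → Poly n
  I = intertwiner k (qt 0 ζ)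
  scalar : ∀ c a ξ → ξ ≡ ζ → lift (q1 ((1ₚ -ₚ qt a ξ) *ₚ c)) ≋ z *ₚ lift (q1 c)
  scalar c a ξ refl = lin-cong lift-lin (q1-1-qt a ζ c) ⨾ lift-1-qt 0 ζ _
  through : ∀ g c η → I (g *ₚ lift c *ₚ eprod M η) ≋ I g *ₚ lift c *ₚ eprod M η
  through g c η = lin-cong (intertwiner-lin k 0 ζ)
      (solve 3 (λ g k q → g :* k :* q := q :* (k :* g)) ≋-refl g (lift c) (eprod M η)) ⨾
    symm-eprod (intertwiner-lin k 0 ζ) (λ j → intertwiner-e k 0 ζ j l) M η _ ⨾
    ≋-refl ⟨*⟩ lift-comm (intertwiner-lin k 0 ζ) (intertwiner-qt k 0 ζ) c g ⨾
        solve 3 (λ g k q → q :* (k :* g) := g :* k :* q) ≋-refl (I g) (lift c) (eprod M η)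
  before : ∀ η → V.sum (swapAt k η) ≤ D → V.sum η ≤ D
  before η = subst (_≤ D) (sum-put k _ _ η l (ℕP.+-comm (getAt (suc k) η) _))

-- Adding one to all parts behind the leading zeros

plusV : ∀ {n} → ℕ → Vec ℕ n → Vec ℕ n
plusV k [] = []
plusV zero (x ∷ v) = suc x ∷ plusV zero v
plusV (suc k) (x ∷ v) = x ∷ plusV k v

minusV : ∀ {n} → ℕ → Vec ℕ n → Vec ℕ n
minusV k [] = []
minusV zero (x ∷ v) = ℕ.pred x ∷ minusV zero v
minusV (suc k) (x ∷ v) = x ∷ minusV k v

get-plus-< : ∀ {n} k j (v : Vec ℕ n) → j < k → getAt j (plusV k v) ≡ getAt j v
get-plus-< k j [] l = refl
get-plus-< (suc k) zero (x ∷ v) l = refl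
get-plus-< (suc k) (suc j) (x ∷ v) (s≤s l) = get-plus-< k j v l

get-plus-≥ : ∀ {n} k j (v : Vec ℕ n) → k ≤ j → j < n → getAt j (plusV k v) ≡ suc (getAt j v)
get-plus-≥ zero zero (x ∷ v) _ _ = refl
get-plus-≥ zero (suc j) (x ∷ v) _ (s≤s l) = get-plus-≥ zero j v z≤n l
get-plus-≥ (suc k) (suc j) (x ∷ v) (s≤s d) (s≤s l) = get-plus-≥ k j v d l

plus-minus : ∀ {n} k (v : Vec ℕ n) → (∀ j → k ≤ j → j < n → getAt j v ≢ 0) → plusV k (minusV k v) ≡ v
plus-minus k [] h = refl
plus-minus zero (zero ∷ v) h = ⊥-elim (h 0 z≤n (s≤s z≤n) refl)
plus-minus zero (suc x ∷ v) h = cong (suc x ∷_) (plus-minus zero v (λ j _ l → h (suc j) z≤n (s≤s l)))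
plus-minus (suc k) (x ∷ v) h = cong (x ∷_) (plus-minus k v (λ j d l → h (suc j) (s≤s d) (s≤s l)))

get-minus-< : ∀ {n} k j (v : Vec ℕ n) → j < k → getAt j (minusV k v) ≡ getAt j v
get-minus-< k j [] l = refl
get-minus-< (suc k) zero (x ∷ v) l = refl
get-minus-< (suc k) (suc j) (x ∷ v) (s≤s l) = get-minus-< k j v l

sum-plus : ∀ {n} k (v : Vec ℕ n) → V.sum (plusV k v) ≡ V.sum v ℕ.+ (n ∸ k)
sum-plus {zero} k [] = sym (ℕP.0∸n≡0 k)
sum-plus {suc n} zero (x ∷ v) = trans (cong (λ s → suc (x ℕ.+ s)) (sum-plus zero v))
    (trans (cong suc (sym (ℕP.+-assoc x _ n))) (sym (ℕP.+-suc (x ℕ.+ V.sum v) n)))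
sum-plus {suc n} (suc k) (x ∷ v) = trans (cong (x ℕ.+_) (sum-plus k v)) (sym (ℕP.+-assoc x _ _))

plus-~ : ∀ {n} k (v : Vec ℕ n) → (∀ j → j < k → getAt j v ≡ 0) → plusV k v ~ v
plus-~ k v z = ~-mk _ v cmp
  where
  cmp : ∀ i j → i < j → j < _ → (getAt i (plusV k v) ℕ.≤ᵇ getAt j (plusV k v)) ≡ (getAt i v ℕ.≤ᵇ getAt j v)
  cmp i j i<j l with k ℕ.≤? i
  ... | yes r = trans (cong₂ ℕ._≤ᵇ_ (get-plus-≥ k i v r (ℕP.<-trans i<j l)) (get-plus-≥ k j v (ℕP.≤-trans r (ℕP.<⇒≤ i<j)) l))
      (<ᵇ-suc (getAt i v) (getAt j v))
  ... | no r rewrite get-plus-< k i v (ℕP.≰⇒> r) | z i (ℕP.≰⇒> r) = refl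

plus-lead : ∀ {n} k (v : Vec ℕ n) → k ≤ n → (∀ j → j < k → getAt j v ≡ 0) → Lead k (plusV k v)
plus-lead k v l z = lead l (λ j lt → trans (get-plus-< k j v lt) (z j lt)) (λ lt → _ , get-plus-≥ k k v ℕP.≤-refl lt)

cge-1-plus : ∀ {n} k (v : Vec ℕ n) → (∀ j → j < k → getAt j v ≡ 0) → cge 1 (plusV k v) ≡ n ∸ k
cge-1-plus {zero} k [] z = sym (ℕP.0∸n≡0 k)
cge-1-plus {suc n} zero (x ∷ v) z = cong suc (cge-1-plus zero v (λ _ ()))
cge-1-plus {suc n} (suc k) (x ∷ v) z rewrite z 0 (s≤s z≤n) = cge-1-plus k v (λ j l → z (suc j) (s≤s l))

cge-suc-plus : ∀ {n} k (v : Vec ℕ n) r → (∀ j → j < k → getAt j v ≡ 0) → cge (suc (suc r)) (plusV k v) ≡ cge (suc r) v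
cge-suc-plus k [] r z = refl
cge-suc-plus zero (x ∷ v) r z = cong (bit (suc r ℕ.≤ᵇ x) ℕ.+_) (cge-suc-plus zero v r (λ _ ()))
cge-suc-plus (suc k) (x ∷ v) r z rewrite z 0 (s≤s z≤n) = cge-suc-plus k v r (λ j l → z (suc j) (s≤s l))

cge-above : ∀ {n} r (v : Vec ℕ n) → V.sum v < r → cge r v ≡ 0
cge-above r [] l = refl
cge-above r (x ∷ v) l rewrite ≤ᵇ-false {r} {x} (ℕP.≤-trans (s≤s (ℕP.m≤m+n x _)) l) =
    cge-above r v (ℕP.≤-trans (s≤s (ℕP.m≤n+m _ x)) l)

-- All counts move up by one and the count n - k enters at r = 1. The factor pushed out at the top
-- is e_0 = 1, since `M` is at least the larger degree.
eprod-plus : ∀ {n} M k (v : Vec ℕ n) → (∀ j → j < k → getAt j v ≡ 0) → V.sum (plusV k v) ≤ M →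
    eprod M (plusV k v) ≋ e (n ∸ k) *ₚ eprod M v
eprod-plus {n} M k v z l with n ∸ k in l₀
... | zero = eprod-cong M _ v (λ r _ _ → cong (cge r) (trans (sym unchanged) refl)) ⨾ ≋-sym (e-zero ⟨*⟩ ≋-refl ⨾ *ₚ-idˡ _)
  where
  unchanged : v ≡ plusV k v
  unchanged = vec-ext v _ (λ j j<n → sym (get-plus-< k j v (ℕP.≤-trans j<n (ℕP.m∸n≡0⇒m≤n l₀))))
... | suc o = go M (subst (_≤ M) (trans (sum-plus k v) (cong (V.sum v ℕ.+_) l₀)) l)
  where
  shift : ∀ M → eprod (suc M) (plusV k v) ≋ e (suc o) *ₚ eprod M v
  shift zero = ≡⇒≋ (cong e (trans (cge-1-plus k v z) l₀)) ⟨*⟩ ≋-refl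
  shift (suc M) = ≡⇒≋ (cong e (cge-suc-plus k v M z)) ⟨*⟩ shift M ⨾
      solve 3 (λ a b c → a :* (b :* c) := b :* (a :* c)) ≋-refl (e (cge (suc M) v)) (e (suc o)) (eprod M v)
    where open PolySolver {n}
  go : ∀ M → V.sum v ℕ.+ suc o ≤ M → eprod M (plusV k v) ≋ e (suc o) *ₚ eprod M v
  go zero l = ⊥-elim (ℕP.1+n≰n (ℕP.≤-trans (s≤s z≤n) (ℕP.≤-trans (ℕP.m≤n+m (suc o) _) l)))
  go (suc M) l = shift M ⨾
      ≋-refl ⟨*⟩ ≋-sym (≡⇒≋
      (cong e (cge-above (suc M) v
      (ℕP.≤-trans (ℕP.m≤m+n (suc (V.sum v)) o) (ℕP.≤-trans (ℕP.≤-reflexive (sym (ℕP.+-suc _ o))) l)))) ⟨*⟩ ≋-refl ⨾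
      e-zero ⟨*⟩ ≋-refl ⨾ *ₚ-idˡ _)

private
  get-init : ∀ {N} i (v : Vec ℕ (suc N)) → i < N → getAt i (initV v) ≡ getAt i v
  get-init zero (a ∷ b ∷ v) l = refl
  get-init (suc i) (a ∷ b ∷ v) (s≤s l) = get-init i (b ∷ v) l

  bumps : ∀ {N} → ℕ → Vec ℕ (suc N) → Vec ℕ (suc N)
  bumps zero v = v
  bumps (suc j) v = bumpV (bumps j v)

  bumps-low : ∀ {N} j (v : Vec ℕ (suc N)) i → i ℕ.+ j < suc N → getAt (i ℕ.+ j) (bumps j v) ≡ getAt i v
  bumps-low zero v i l = cong (λ a → getAt a v) (ℕP.+-identityʳ i)
  bumps-low (suc j) v i l rewrite ℕP.+-suc i j = trans (get-init (i ℕ.+ j) (bumps j v) (ℕP.≤-pred l))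
      (bumps-low j v i (ℕP.<-trans (ℕP.n<1+n _) l))

  bumps-high : ∀ {N} j (v : Vec ℕ (suc N)) i → i < j → j ≤ suc N → getAt i (bumps j v) ≡ suc (getAt (i ℕ.+ (suc N ∸ j)) v)
  bumps-high {N} (suc j) v zero _ (s≤s l) = cong suc
      (trans (cong (λ a → getAt a (bumps j v)) (sym (ℕP.m∸n+n≡m l)))
      (bumps-low j v (N ∸ j) (s≤s (ℕP.≤-reflexive (ℕP.m∸n+n≡m l)))))
  bumps-high {N} (suc j) v (suc i) (s≤s i<j) (s≤s l) = trans (get-init i (bumps j v) (ℕP.≤-trans i<j l))
      (trans (bumps-high j v i i<j (ℕP.m≤n⇒m≤1+n l))
    (cong (λ a → suc (getAt a v)) (trans (cong (i ℕ.+_) (ℕP.+-∸-assoc 1 l)) (ℕP.+-suc i _))))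

  bumps-all : ∀ {N} (v : Vec ℕ (suc N)) → bumps (suc N) v ≡ plusV 0 v
  bumps-all {N} v = vec-ext _ _ (λ i l → trans (bumps-high (suc N) v i l ℕP.≤-refl)
      (trans (cong (λ a → suc (getAt a v)) (trans (cong (i ℕ.+_) (ℕP.n∸n≡0 N)) (ℕP.+-identityʳ i)))
      (sym (get-plus-≥ 0 i v z≤n l))))

  Φs : ∀ {N} → ℕ → Poly (suc N) → Poly (suc N)
  Φs zero f = f
  Φs (suc j) f = Φ 0 0 (Φs j f)

  ev-Φs : ∀ {N} j (f : Poly (suc N)) h → ev (Φs j f) h ≡ ev f (λ { (mono q t x) → h (mono q t (bumps j x)) })
  ev-Φs zero f h = ev-cong f (λ _ → refl)
  ev-Φs (suc j) f h = trans (ev-Φ 0 0 (Φs j f) h)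
      (trans (ev-Φs j f _) (ev-cong f (λ { (mono q t x) → cong h (mono-cong (ℕP.+-identityʳ q) refl refl) })))

  Φs-all : ∀ {N} (f : Poly (suc N)) → Φs (suc N) f ≋ e (suc N) *ₚ f
  Φs-all {N} f = mk≋ λ h → trans (ev-Φs (suc N) f h)
      (sym (trans (ev-e* (suc N) f h)
      (trans (full (suc N) (λ x → ev f (λ m → h (monoMul (mono 0 (+ 0) x) m))))
      (ev-cong f (λ { (mono q t x) → cong h (mono-cong refl (ℤP.+-identityˡ t) (trans (ones x) (sym (bumps-all x)))) })))))
    where
    full : ∀ n g → Sub n n g ≡ g (V.replicate n 1)
    full zero g = refl
    full (suc n) g = trans (cong₂ ℚ._+_ (empty n _ (ℕP.n<1+n n)) (full n (λ x → g (1 ∷ x)))) (ℚP.+-identityˡ _)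
      where
      empty : ∀ n {k} g' → n < k → Sub n k g' ≡ 0ℚ
      empty zero {suc k} g' _ = refl
      empty (suc n) {suc k} g' (s≤s l) = cong₂ ℚ._+_ (empty n _ (ℕP.m<n⇒m<1+n l)) (empty n _ l)
    ones : ∀ {n} (x : Vec ℕ n) → V.zipWith ℕ._+_ (V.replicate n 1) x ≡ plusV 0 x
    ones [] = refl
    ones (a ∷ x) = cong (suc a ∷_) (ones x)

  built-bumps : ∀ {N k} {v : Vec ℕ (suc N)} {F c} j → Built k v F c → ∃ λ k' → Σ (Poly (suc N)) λ F' → Σ (Poly 0) λ c' →
    Built k' (bumps j v) F' c' × q1 F' ≋ Φs j (q1 F) × lift {suc N} (q1 c') ≋ lift (q1 c)
  built-bumps zero B = _ , _ , _ , B , ≋-refl , ≋-refl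
  built-bumps {v = v} (suc j) B with _ , F' , c' , B' , f , g ← built-bumps j B with xs , a , eq ← unsnoc (bumps j v) =
    0 , Φ 1 S F' , qt (S ∸ a) (+ 0) *ₚ c' , subst (λ η → Built 0 η (Φ 1 S F') (qt (S ∸ a) (+ 0) *ₚ c'))
        (sym (trans (cong bumpV eq) (bumpV-snoc xs a))) (bump xs a eq B') ,
    (q1-Φ S F' ⨾ Φ₀-any S 0 _ ⨾ lin-cong (Φ-lin 0 0) f) , (bump-scalar (S ∸ a) c' ⨾ g)
    where
    S : ℕ
    S = V.sum (bumps j v)

BuiltRatio : ∀ {n} → ℕ → ℕ → Vec ℕ n → Vec ℕ n → Poly n → Poly 0 → Set
BuiltRatio {n} k M η η' F' c' = Σ (Poly n) λ F → Σ (Poly 0) λ c → Built k η F c × Ratio M η F c η' F' c'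

ratio-plus-0 : ∀ {N k} {ζ : Vec ℕ (suc N)} {F c} M → V.sum (plusV 0 ζ) ≤ M → Built k ζ F c → BuiltRatio 0 M (plusV 0 ζ) ζ F c
ratio-plus-0 {N} {ζ = ζ} {F} {c} M l B with k' , F' , c' , B' , f , g ← built-bumps (suc N) B with B'' ← subst
    (λ η → Built k' η F' c') (bumps-all ζ) B'
  with refl ← lead-unique (lead-built B'') (plus-lead 0 ζ z≤n (λ _ ())) =
  F' , c' , B'' , ((f ⨾ Φs-all (q1 F)) ⟨*⟩ ≋-refl ⟨*⟩ ≋-refl ⨾
      solve 4 (λ a g k p → a :* g :* k :* p := g :* k :* (a :* p)) ≋-refl (e (suc N)) (q1 F) (lift (q1 c)) (eprod M ζ) ⨾
    ≋-refl ⟨*⟩ ≋-sym g ⟨*⟩ ≋-sym (eprod-plus M 0 ζ (λ _ ()) l))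
  where open PolySolver {suc N}

-- Reduction to a composition of least degree in its type

Minimal : ∀ {n} → Vec ℕ n → Set
Minimal ζ = ∀ ξ → ξ ~ ζ → V.sum ζ ≤ V.sum ξ

-- Descent on the degree. Whether a smaller composition of the same type exists is not decided,
-- hence the double negation; `≋-stable` removes it later, because equality of rational coefficients
-- is decidable.
minimal-exists : ∀ {n} b (η : Vec ℕ n) → V.sum η ≤ b → ¬ ¬ (∃ λ ζ → ζ ~ η × Minimal ζ)
minimal-exists zero η l none = none (η , ~-refl {v = η} , λ ξ t → ℕP.≤-trans l z≤n)
minimal-exists (suc b) η l none = none (η , ~-refl {v = η} , least)
  where
  least : Minimal η
  least ξ t with V.sum η ℕ.≤? V.sum ξ
  ... | yes r = r
  ... | no r = ⊥-elim (minimal-exists b ξ (ℕP.≤-pred (ℕP.≤-trans (ℕP.≰⇒> r) l))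
      (λ { (ζ , t' , m) → none (ζ , ~-trans {v = ζ} t' t , m) }))

supp-lift : ∀ {n} (c : Poly 0) → Supp (λ x → x ≡ V.replicate n 0) (lift {n} c)
supp-lift c = supp λ h v → trans (ev-lift c h) (trans (ev-cong c (λ { (mono q t []) → v q t _ refl })) (ev-0 c))

supp-e* : ∀ {n} S k {f : Poly n} → Supp (λ x → V.sum x ≡ S) f → Supp (λ x → V.sum x ≡ S ℕ.+ k) (e k *ₚ f)
supp-e* {n} S k {f} s = supp λ h v → trans (ev-e* k f h)
    (Sub-zero n k _ (λ x sx →
    vanish s _ (λ q t y sy → v q _ _ (trans (sum-zip x y) (trans (cong₂ ℕ._+_ sx sy) (ℕP.+-comm k S))))))
  where
  sum-zip : ∀ {n} (x y : Vec ℕ n) → V.sum (V.zipWith ℕ._+_ x y) ≡ V.sum x ℕ.+ V.sum y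
  sum-zip [] [] = refl
  sum-zip (a ∷ x) (b ∷ y) = trans (cong (a ℕ.+ b ℕ.+_) (sum-zip x y))
      (solve 4 (λ a b x y → a :+ b :+ (x :+ y) := a :+ x :+ (b :+ y)) refl a b (V.sum x) (V.sum y))
    where open ℕS.+-*-Solver
  Sub-zero : ∀ n k g → (∀ x → V.sum x ≡ k → g x ≡ 0ℚ) → Sub n k g ≡ 0ℚ
  Sub-zero zero zero g z = z [] refl
  Sub-zero zero (suc k) g z = refl
  Sub-zero (suc n) zero g z = Sub-zero n zero _ (λ x q → z (0 ∷ x) q)
  Sub-zero (suc n) (suc k) g z = cong₂ ℚ._+_ (Sub-zero n (suc k) _ (λ x q → z (0 ∷ x) q))
      (Sub-zero n k _ (λ x q → z (1 ∷ x) (cong suc q)))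

q1-sl : ∀ {n} a (f : Poly (suc n)) → q1 (sl a f) ≋ sl a (q1 f)
q1-sl a f = mk≋ λ h → trans (ev-q1 (sl a f) h)
    (trans (ev-sl a f _) (trans (ev-cong f (λ { (mono q t (b ∷ x)) → refl })) (sym (trans (ev-sl a (q1 f) h) (ev-q1 f _)))))

q1-lift : ∀ {n} (c : Poly 0) → q1 (lift {n} c) ≋ lift (q1 c)
q1-lift c = mk≋ λ h → trans (ev-q1 (lift c) h) (trans (ev-lift c _) (sym (trans (ev-lift (q1 c) h) (ev-q1 c _))))

co-sl : ∀ {n} (ξ : Vec ℕ n) f → co (0 ∷ ξ) f ≋ co ξ (sl 0 f)
co-sl ξ f = mk≋ λ h → trans (ev-co (0 ∷ ξ) f h)
    (trans (ev-cong f (λ { (mono q t (b ∷ x)) → term h q t b x })) (sym (trans (ev-co ξ (sl 0 f) h) (ev-sl 0 f _))))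
  where
  term : ∀ h q t b x → coM (0 ∷ ξ) h (mono q t (b ∷ x)) ≡ slM 0 (coM ξ h) (mono q t (b ∷ x))
  term h q t b x with b ℕ.≡ᵇ 0
  ... | true = refl
  ... | false = refl

-- With l = n − k nonzero parts in ζ⁺, the difference E_ζ⁺ − e_l E_ζ is an eigenvector of the type of ζ. It vanishes at
-- x_1 = 0 by the case of n − 1 variables, so a monomial of that type in it has only positive exponents, and lowering them
-- all by one contradicts the minimality of ζ.
ratio-plus-suc : ∀ {N k kζ} {ζ : Vec ℕ (suc N)} {F c} → (∀ D → RatioUpTo N D) → ∀ M → suc k < suc kζ → Minimal ζ →
    V.sum (plusV (suc k) ζ) ≤ M → Built (suc kζ) ζ F c →
  BuiltRatio (suc k) M (plusV (suc k) ζ) ζ F c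
ratio-plus-suc {N} {k} {kζ} {z₀ ∷ ζ} {F} {c} IH M lt min bd B with k' , F⁺ , c⁺ , B⁺ ← built-exists (plusV (suc k) (z₀ ∷ ζ))
  with refl ← lead-unique (lead-built B⁺)
      (plus-lead (suc k) (z₀ ∷ ζ) (ℕP.≤-trans (ℕP.<⇒≤ lt) (k≤n (lead-built B)))
      (λ j l → zeros (lead-built B) j (ℕP.<-trans l lt)))
  with F₀ , c₀ , B₀ , r ← built-tail B | F₀⁺ , c₀⁺ , B₀⁺ , r⁺ ← built-tail B⁺ =
  F⁺ , c⁺ , B⁺ , (difference ⟨*⟩ ≋-refl ⨾ solve 4 (λ a g k p → a :* g :* k :* p := g :* k :* (a :* p)) ≋-refl (e l) G K⁺
      (eprod M ζ₊) ⨾ ≋-refl ⟨*⟩ ≋-sym (eprod-plus M (suc k) ζ₊ zs bd))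
  where
  open PolySolver {suc N}
  module S' = PolySolver {N}
  ζ₊ : Vec ℕ (suc N)
  ζ₊ = z₀ ∷ ζ
  l S : ℕ
  l = N ∸ k
  S = V.sum ζ₊ ℕ.+ l
  zs : ∀ j → j < suc k → getAt j ζ₊ ≡ 0
  zs j lj = zeros (lead-built B) j (ℕP.<-trans lj lt)
  zs' : ∀ j → j < k → getAt j ζ ≡ 0
  zs' j lj = zs (suc j) (s≤s lj)
  G G⁺ K K⁺ f : Poly (suc N)
  G = q1 F
  G⁺ = q1 F⁺
  K = lift (q1 c)
  K⁺ = lift (q1 c⁺)
  f = G⁺ *ₚ K -ₚ e l *ₚ G *ₚ K⁺
  tail-relation : ∀ {F c F₀ c₀} → sl 0 F *ₚ lift c₀ ≋ F₀ *ₚ lift c → sl 0 (q1 F) *ₚ lift {N} (q1 c₀) ≋ q1 F₀ *ₚ lift (q1 c)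
  tail-relation {F} {c} {F₀} {c₀} r = ≋-sym (q1-sl 0 F) ⟨*⟩ ≋-sym (q1-lift c₀) ⨾ ≋-sym (q1-* _ _) ⨾ lin-cong q1-lin r ⨾
      q1-* _ _ ⨾ ≋-refl ⟨*⟩ q1-lift c
  lower : Ratio M (plusV k ζ) F₀⁺ c₀⁺ ζ F₀ c₀
  lower = IH M M ℕP.≤-refl B₀⁺ B₀ (plus-~ k ζ zs') (ℕP.≤-trans (ℕP.m≤n+m _ z₀) bd)
    (ℕP.≤-trans (ℕP.≤-trans (ℕP.m≤m+n (V.sum ζ) _) (ℕP.≤-reflexive (sym (sum-plus k ζ)))) (ℕP.≤-trans (ℕP.m≤n+m _ z₀) bd))
  sl-f : sl 0 f ≋ 0ₚ
  sl-f = lin-- (sl-lin 0) _ _ ⨾ (lin-cong (sl-lin 0) (*ₚ-comm G⁺ K) ⨾ lift-comm (sl-lin 0) (sl-qt 0) (q1 c) G⁺) ⟨-⟩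
      (lin-cong (sl-lin 0) (*ₚ-comm _ K⁺) ⨾ lift-comm (sl-lin 0) (sl-qt 0) (q1 c⁺) _ ⨾ ≋-refl ⟨*⟩ sl-e l G) ⨾
    -- After multiplication by the denominators of both restrictions and by `eprod M ζ`, the
    -- difference vanishes by the relation `lower` in N variables.
    nzd-* (nzd-* (built-nzd B₀⁺) (built-nzd B₀)) (nzd-eprod M ζ) _
     (S'.solve 8 (λ k₀⁺ k₀ p κ g⁺ κ⁺ E g → k₀⁺ S'.:* k₀ S'.:* p S'.:* (κ S'.:* g⁺ S'.:- κ⁺ S'.:* (E S'.:* g)) S'.:= κ S'.:*
         ((g⁺ S'.:* k₀⁺) S'.:* k₀ S'.:* p) S'.:- κ⁺ S'.:* ((g S'.:* k₀) S'.:* k₀⁺ S'.:* (E S'.:* p)))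
        ≋-refl (lift (q1 c₀⁺)) (lift (q1 c₀)) (eprod M ζ) (lift (q1 c)) (sl 0 G⁺) (lift (q1 c⁺)) (e l) (sl 0 G) ⨾
      (≋-refl ⟨*⟩ (tail-relation r⁺ ⟨*⟩ ≋-refl ⟨*⟩ ≋-refl) ⨾
          S'.solve 5 (λ κ h κ⁺ k₀ p → κ S'.:* (h S'.:* κ⁺ S'.:* k₀ S'.:* p) S'.:= κ S'.:* κ⁺ S'.:* (h S'.:* k₀ S'.:* p)) ≋-refl
          (lift (q1 c)) (q1 F₀⁺) (lift (q1 c⁺)) (lift (q1 c₀)) (eprod M ζ) ⨾ ≋-refl ⟨*⟩ lower) ⟨-⟩
      (≋-refl ⟨*⟩ (tail-relation r ⟨*⟩ ≋-refl ⟨*⟩ ≋-sym (eprod-plus M k ζ zs' (ℕP.≤-trans (ℕP.m≤n+m _ z₀) bd))) ⨾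
        S'.solve 5 (λ κ⁺ h κ k₀⁺ p → κ⁺ S'.:* (h S'.:* κ S'.:* k₀⁺ S'.:* p) S'.:= κ S'.:* κ⁺ S'.:* (h S'.:* k₀⁺ S'.:* p)) ≋-refl
            (lift (q1 c⁺)) (q1 F₀) (lift (q1 c)) (lift (q1 c₀⁺)) (eprod M (plusV k ζ))) ⨾ neg-invʳ _)
  f-supp : Supp (λ ξ → V.sum ξ ≡ S) f
  f-supp = supp-- (supp-≋ (*ₚ-comm K G⁺)
      (supp-*ˡ K (supp-lift (q1 c)) (supp-⊆ (λ x le → trans (same-sum le) (sum-plus (suc k) ζ₊)) (supp-q1 (built-supp B⁺)))))
    (supp-≋ (*ₚ-comm K⁺ _) (supp-*ˡ K⁺ (supp-lift (q1 c⁺))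
        (supp-e* (V.sum ζ₊) l (supp-⊆ (λ x le → same-sum le) (supp-q1 (built-supp B))))))
  f-eigen : Eigen 0 (λ i → qt 0 (ℤ.- (+ rank i ζ₊))) f
  f-eigen i d id = lin-- (Y-lin 0 i d) _ _ ⨾
    (lin-cong (Y-lin 0 i d) (*ₚ-comm G⁺ K) ⨾ lift-comm (Y-lin 0 i d) (Y-qt 0 i d) (q1 c) G⁺ ⨾
        ≋-refl ⟨*⟩ (built-eigen₁ B⁺ i d id ⨾
        ≡⇒≋ (cong (λ r → qt 0 (ℤ.- (+ r)))
        (~-rank (plusV (suc k) ζ₊) ζ₊ (plus-~ (suc k) ζ₊ zs) i (s≤s (ℕP.≤-trans (ℕP.m≤m+n i d) (ℕP.≤-reflexive id))))) ⟨*⟩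
        ≋-refl)) ⟨-⟩
    (lin-cong (Y-lin 0 i d) (*ₚ-comm _ K⁺) ⨾ lift-comm (Y-lin 0 i d) (Y-qt 0 i d) (q1 c⁺) _ ⨾
        ≋-refl ⟨*⟩ (Y-e i d l id G ⨾ ≋-refl ⟨*⟩ built-eigen₁ B i d id)) ⨾
    solve 6 (λ κ y g⁺ κ⁺ E g → κ :* (y :* g⁺) :- κ⁺ :* (E :* (y :* g)) := y :* (g⁺ :* κ :- E :* g :* κ⁺)) ≋-refl K
        (qt 0 (ℤ.- (+ rank i ζ₊))) G⁺ K⁺ (e l) G
  f-type : ∀ ξ → V.sum ξ ≡ S → ξ ~ ζ₊ → co ξ f ≋ 0ₚ
  f-type (zero ∷ ξ) sξ t = co-sl ξ f ⨾ lin-zero (co-lin ξ) sl-f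
  f-type (suc a ∷ ξ) sξ t =
      ⊥-elim (ℕP.<⇒≱ shorter
      (min ξ⁻ (~-trans {v = ξ⁻} (~-sym {v = plusV 0 ξ⁻} (plus-~ 0 ξ⁻ (λ _ ()))) (subst (_~ ζ₊) (sym restored) t))))
    where
    ξ⁻ : Vec ℕ (suc N)
    ξ⁻ = minusV 0 (suc a ∷ ξ)
    nonzero : ∀ j → 0 ≤ j → j < suc N → getAt j (suc a ∷ ξ) ≢ 0
    -- `ζ₊` begins with 0, which is at most every later entry; as the types agree, a + 1 is at most
    -- every later entry of ξ.
    nonzero zero _ _ ()
    nonzero (suc j) _ lj q =
        absurd (trans (sym (trans (~-get (suc a ∷ ξ) ζ₊ t 0 (suc j) (s≤s z≤n) lj)
        (cong (ℕ._≤ᵇ getAt (suc j) ζ₊) (zs 0 (s≤s z≤n))))) (cong (suc a ℕ.≤ᵇ_) q))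
      where absurd : true ≡ false → ⊥
            absurd ()
    restored : plusV 0 ξ⁻ ≡ suc a ∷ ξ
    restored = plus-minus 0 _ nonzero
    -- Lowering all exponents removes N + 1 from the degree, whereas f exceeds the degree of `ζ₊`
    -- only by l = N - k.
    shorter : V.sum ξ⁻ < V.sum ζ₊
    shorter = ℕP.+-cancelʳ-< (suc N) _ _
        (ℕP.≤-trans (s≤s (ℕP.≤-reflexive (trans (sym (sum-plus 0 ξ⁻)) (trans (cong V.sum restored) sξ))))
      (ℕP.≤-trans (ℕP.≤-reflexive (sym (ℕP.+-suc (V.sum ζ₊) l))) (ℕP.+-monoʳ-≤ (V.sum ζ₊) (s≤s (ℕP.m∸n≤m N k)))))
  difference : G⁺ *ₚ K ≋ e l *ₚ G *ₚ K⁺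
  difference = solve 2 (λ a b → a := a :- b :+ b) ≋-refl (G⁺ *ₚ K) (e l *ₚ G *ₚ K⁺) ⨾
      eigen-unique S ζ₊ f f-supp f-eigen f-type ⟨+⟩ ≋-refl ⨾ +ₚ-comm 0ₚ _ ⨾ +ₚ-idʳ _

≋-stable : ∀ {n} {f g : Poly n} → ¬ ¬ (f ≋ g) → f ≋ g
≋-stable {f = f} {g} nn = ≈⇒≋ (λ m → decidable-stable (coeff f m ℚ.≟ coeff g m) (λ ne → nn (λ q → ne (≋⇒≈ q m))))

Previous : ℕ → Set
Previous zero = ⊤
Previous (suc N) = ∀ D → RatioUpTo N D

ratio-plus : ∀ {n k kζ} {ζ : Vec ℕ n} {F c} → Previous n → ∀ M → k < kζ → Minimal ζ → V.sum (plusV k ζ) ≤ M → Built kζ ζ F c →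
    BuiltRatio k M (plusV k ζ) ζ F c
ratio-plus {zero} prev M l min bd B = ⊥-elim (ℕP.<⇒≱ l (ℕP.≤-trans (k≤n (lead-built B)) z≤n))
ratio-plus {suc N} {zero} prev M l min bd B = ratio-plus-0 M bd B
ratio-plus {suc N} {suc k} {suc kζ} prev M l min bd B = ratio-plus-suc prev M l min bd B

-- At position k the composition ζ still has a 0, which is at most every later entry. By equality of
-- types the positive entry of η at k is at most every later entry of η.
zeros-initial : ∀ {n k k'} {η ζ : Vec ℕ n} → Lead k η → Lead k' ζ → k < k' → η ~ ζ → ∀ j → k ≤ j → j < n → getAt j η ≢ 0
zeros-initial {k = k} {η = η} {ζ} L L' l t j k≤j j<n q with ℕP.m≤n⇒m<n∨m≡n k≤j | positive L (ℕP.≤-trans l (k≤n L'))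
... | inj₂ refl | m , p = ℕP.1+n≢0 (trans (sym p) q)
... | inj₁ k<j | m , p = absurd (trans (sym (trans (~-get η ζ t k j k<j j<n) (cong (ℕ._≤ᵇ getAt j ζ) (zeros L' k l))))
    (cong₂ ℕ._≤ᵇ_ p q))
  where absurd : true ≡ false → ⊥
        absurd ()

module _ {n} (prev : Previous n) (D : ℕ) (IH : ∀ D' → suc D' ≡ D → RatioUpTo n D') (M : ℕ) (D≤M : D ≤ M) where
  private
    stripped : ∀ {k} (η : Vec ℕ n) → Lead k η → (∀ j → k ≤ j → j < n → getAt j η ≢ 0) →
        minusV k η ~ η × V.sum η ≡ V.sum (minusV k η) ℕ.+ (n ∸ k)
    stripped {k} η L nz = ~-sym {v = η}
        (subst (_~ minusV k η) back (plus-~ k (minusV k η) (λ j l → trans (get-minus-< k j η l) (zeros L j l)))) ,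
      trans (cong V.sum (sym back)) (sum-plus k (minusV k η))
      where
      back : plusV k (minusV k η) ≡ η
      back = plus-minus k η nz

  ratio-minimal : ∀ {k kζ} {η ζ : Vec ℕ n} {F c F' c'} → Built k η F c → Built kζ ζ F' c' → η ~ ζ → Minimal ζ → V.sum η ≤ D →
      Ratio M η F c ζ F' c'
  ratio-minimal {k} {kζ} {η} {ζ} B Bζ t min s with ℕP.<-cmp k kζ
  ... | tri≈ _ refl _ = ratio-same-zeros D IH M D≤M B Bζ t s (ℕP.≤-trans (min η t) s)
  -- Having fewer leading zeros than η, ζ has no other zeros. Lowering its positive parts by one
  -- keeps the type and contradicts minimality.
  ... | tri> _ _ l = ⊥-elim
      (ℕP.<⇒≱ (ℕP.≤-trans (ℕP.m<m+n _ (ℕP.m<n⇒0<n∸m (ℕP.≤-trans l (k≤n (lead-built B))))) (ℕP.≤-reflexive (sym (proj₂ st))))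
      (min _ (proj₁ st)))
    where
    st : minusV kζ ζ ~ ζ × V.sum ζ ≡ V.sum (minusV kζ ζ) ℕ.+ (n ∸ kζ)
    st = stripped ζ (lead-built Bζ) (zeros-initial (lead-built Bζ) (lead-built B) l (~-sym {v = η} t))
  -- `plusV k ζ` has as many leading zeros as η and serves as the intermediate term. Its degree does
  -- not exceed that of η, because lowering the positive parts of η gives a composition of the type
  -- of ζ, to which minimality applies.
  ... | tri< l _ _ = through (ratio-plus prev M l min (ℕP.≤-trans plus-≤ D≤M) Bζ)
    where
    st : minusV k η ~ η × V.sum η ≡ V.sum (minusV k η) ℕ.+ (n ∸ k)
    st = stripped η (lead-built B) (zeros-initial (lead-built B) (lead-built Bζ) l t)
    plus-≤ : V.sum (plusV k ζ) ≤ D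
    plus-≤ = ℕP.≤-trans (ℕP.≤-reflexive (sum-plus k ζ))
        (ℕP.≤-trans (ℕP.+-monoˡ-≤ (n ∸ k) (min _ (~-trans {v = minusV k η} {v' = η} (proj₁ st) t)))
        (ℕP.≤-trans (ℕP.≤-reflexive (sym (proj₂ st))) s))
    through : BuiltRatio k M (plusV k ζ) ζ _ _ → Ratio M η _ _ ζ _ _
    through (F⁺ , c⁺ , B⁺ , r) = cross-trans (built-nzd B⁺) (nzd-eprod M (plusV k ζ))
      (ratio-same-zeros D IH M D≤M B B⁺
          (~-trans {v = η} t (~-sym {v = plusV k ζ} (plus-~ k ζ (λ j lj → zeros (lead-built Bζ) j (ℕP.<-trans lj l))))) s plus-≤)
          r

-- Both compositions are compared with a common one of least degree. The goal is an equation `≋`,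
-- hence stable, so the existence of that composition up to double negation is enough.
ratio-from : ∀ {n} → Previous n → ∀ D → RatioUpTo n D
ratio-step : ∀ {n} → Previous n → ∀ D D' → suc D' ≡ D → RatioUpTo n D'
ratio-from prev D {η = η} {η'} M D≤M B B' t s s' = ≋-stable
    (λ no → minimal-exists (V.sum η) η ℕP.≤-refl (λ { (ζ , tζ , min) → no (via ζ tζ min) }))
  where
  via : ∀ ζ → ζ ~ η → Minimal ζ → Ratio M η _ _ η' _ _
  via ζ tζ min with kζ , Fζ , cζ , Bζ ← built-exists ζ = cross-trans (built-nzd Bζ) (nzd-eprod M ζ)
    (ratio-minimal prev D (ratio-step prev D) M D≤M B Bζ (~-sym {v = ζ} tζ) min s)
    (≋-sym (ratio-minimal prev D (ratio-step prev D) M D≤M B' Bζ (~-trans {v = η'} (~-sym {v = η} t) (~-sym {v = ζ} tζ)) min s'))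
ratio-step prev (suc D) D' refl = ratio-from prev D'

ratio : ∀ n D → RatioUpTo n D
ratio zero = ratio-from tt
ratio (suc N) = ratio-from (ratio N)

-- The ratio for a replacement of parts

pow : ∀ {n} → Poly n → ℕ → Poly n
pow f zero = 1ₚ
pow f (suc k) = f *ₚ pow f k

pow-def : ∀ {n} (f : Poly n) k → f ^^ k ≡ pow f k
pow-def f zero = sym 1ₚ-def
pow-def f (suc k) = trans (cong (f ⊗_) (pow-def f k)) (sym (*ₚ-def f (pow f k)))

upper : ∀ {n} → ℕ → ℕ → Vec ℕ n → Poly n
upper b zero η = 1ₚ
upper b (suc m) η = e (cge (suc (b ℕ.+ m)) η) *ₚ upper b m η

upper-cong : ∀ {n} b m (η η' : Vec ℕ n) → (∀ r → b < r → cge r η ≡ cge r η') → upper b m η ≋ upper b m η'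
upper-cong b zero η η' h = ≋-refl
upper-cong b (suc m) η η' h = ≡⇒≋ (cong e (h _ (s≤s (ℕP.m≤m+n b m)))) ⟨*⟩ upper-cong b m η η' h

nzd-upper : ∀ {n} b m (η : Vec ℕ n) → NZD (upper b m η)
nzd-upper b zero η = nzd-1
nzd-upper b (suc m) η = nzd-* (nzd-e _ (cge-≤ _ η)) (nzd-upper b m η)

eprod-upper : ∀ {n} b m (η : Vec ℕ n) → eprod (b ℕ.+ m) η ≋ upper b m η *ₚ eprod b η
eprod-upper b zero η rewrite ℕP.+-identityʳ b = ≋-sym (*ₚ-idˡ _)
eprod-upper b (suc m) η rewrite ℕP.+-suc b m = ≋-refl ⟨*⟩ eprod-upper b m η ⨾ ≋-sym (*ₚ-assoc _ _ _)

NoPartBetween : ∀ {n} → ℕ → ℕ → Vec ℕ n → Set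
NoPartBetween {n} a b η = ∀ j → j < n → ¬ (a < getAt j η × getAt j η < b)

cge-gap : ∀ {n} a b (η : Vec ℕ n) → NoPartBetween a b η → ∀ r → a < r → r ≤ b → cge r η ≡ cge b η
cge-gap a b [] h r _ _ = refl
cge-gap a b (x ∷ η) h r a<r r≤b = cong₂ (λ p m → bit p ℕ.+ m) entry (cge-gap a b η (λ j l → h (suc j) (s≤s l)) r a<r r≤b)
  where
  entry : (r ℕ.≤ᵇ x) ≡ (b ℕ.≤ᵇ x)
  entry with b ℕ.≤? x
  ... | yes l = trans (≤ᵇ-true (ℕP.≤-trans r≤b l)) (sym (≤ᵇ-true l))
  ... | no g = trans (≤ᵇ-false (ℕP.≤-trans (s≤s (ℕP.≮⇒≥ (λ a<x → h 0 (s≤s z≤n) (a<x , ℕP.≰⇒> g)))) a<r))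
      (sym (≤ᵇ-false (ℕP.≰⇒> g)))

-- This is the origin of the exponent b - a: with no part strictly between a and b, the factors for
-- a < r ≤ b all coincide.
eprod-gap : ∀ {n} a d (η : Vec ℕ n) k → (∀ r → a < r → r ≤ a ℕ.+ d → cge r η ≡ k) → eprod (a ℕ.+ d) η ≋ pow (e k) d *ₚ eprod a η
eprod-gap a zero η k h rewrite ℕP.+-identityʳ a = ≋-sym (*ₚ-idˡ _)
eprod-gap a (suc d) η k h rewrite ℕP.+-suc a d = ≡⇒≋ (cong e (h _ (s≤s (ℕP.m≤m+n a d)) ℕP.≤-refl)) ⟨*⟩ eprod-gap a d η k
    (λ r l l' → h r l (ℕP.m≤n⇒m≤1+n l')) ⨾ ≋-sym (*ₚ-assoc _ _ _)

module Replace (a b : ℕ) (a<b : a < b) where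
  data Replaced (x y : ℕ) : Set where
    kept : x ≡ y → x ≢ a → Replaced x y
    raised : x ≡ a → y ≡ b → Replaced x y

  -- Raising a to b could alter a comparison only with a value strictly between them, or by turning
  -- b > a into b ≤ b when b stands to the left of a. The last three hypotheses exclude this.
  compare-≤ : ∀ {x x' y y'} → Replaced x x' → Replaced y y' → ¬ (a < x × x < b) → ¬ (a < y × y < b) → ¬ (x ≡ b × y ≡ a) →
      (x ℕ.≤ᵇ y) ≡ (x' ℕ.≤ᵇ y')
  compare-≤ (kept refl _) (kept refl _) _ _ _ = refl
  compare-≤ (raised refl refl) (raised refl refl) _ _ _ = trans (≤ᵇ-true (ℕP.≤-refl {a})) (sym (≤ᵇ-true (ℕP.≤-refl {b})))
  compare-≤ {y = y} (raised refl refl) (kept refl ne) _ g _ with a ℕ.≤? y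
  ... | yes l = trans (≤ᵇ-true l) (sym (≤ᵇ-true (ℕP.≮⇒≥ (λ y<b → g (ℕP.≤∧≢⇒< l (λ q → ne (sym q)) , y<b)))))
  ... | no l = trans (≤ᵇ-false (ℕP.≰⇒> l)) (sym (≤ᵇ-false (ℕP.<-trans (ℕP.≰⇒> l) a<b)))
  compare-≤ {x = x} (kept refl ne) (raised refl refl) g _ ex with x ℕ.≤? a
  ... | yes l = trans (≤ᵇ-true l) (sym (≤ᵇ-true (ℕP.≤-trans l (ℕP.<⇒≤ a<b))))
  ... | no l = trans (≤ᵇ-false (ℕP.≰⇒> l))
      (sym (≤ᵇ-false (ℕP.≤∧≢⇒< (ℕP.≮⇒≥ (λ x<b → g (ℕP.≰⇒> l , x<b))) (λ q → ex (sym q , refl)))))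

  Pointwise-Replaced : ∀ {n} → Vec ℕ n → Vec ℕ n → Set
  Pointwise-Replaced {n} η η' = ∀ j → j < n → Replaced (getAt j η) (getAt j η')

  replaced-cge : ∀ {n} (η η' : Vec ℕ n) → Pointwise-Replaced η η' → ∀ r → r ≤ a ⊎ b < r → cge r η ≡ cge r η'
  replaced-cge [] [] h r _ = refl
  replaced-cge (x ∷ η) (x' ∷ η') h r out = cong₂ (λ p m → bit p ℕ.+ m) (entry (h 0 (s≤s z≤n)) out)
      (replaced-cge η η' (λ j l → h (suc j) (s≤s l)) r out)
    where
    entry : Replaced x x' → r ≤ a ⊎ b < r → (r ℕ.≤ᵇ x) ≡ (r ℕ.≤ᵇ x')
    entry (kept refl _) _ = refl
    entry (raised refl refl) (inj₁ l) = trans (≤ᵇ-true l) (sym (≤ᵇ-true (ℕP.≤-trans l (ℕP.<⇒≤ a<b))))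
    entry (raised refl refl) (inj₂ l) = trans (≤ᵇ-false (ℕP.<-trans a<b l)) (sym (≤ᵇ-false l))

  replaced-~ : ∀ {n} (η η' : Vec ℕ n) → Pointwise-Replaced η η' → NoPartBetween a b η →
      (∀ i j → i < j → j < n → ¬ (getAt i η ≡ b × getAt j η ≡ a)) → η ~ η'
  replaced-~ η η' h g ex = ~-mk η η' (λ i j i<j l → compare-≤ (h i (ℕP.<-trans i<j l)) (h j l) (g i (ℕP.<-trans i<j l)) (g j l)
      (ex i j i<j l))

  replaceParts-raised : ∀ {n} (η : Vec ℕ n) → Pointwise-Replaced η (replaceParts a b η)
  replaceParts-raised (x ∷ η) (suc j) (s≤s l) = replaceParts-raised η j l
  replaceParts-raised (x ∷ η) zero _ with x ℕ.≡ᵇ a in q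
  ... | true = raised (ℕP.≡ᵇ⇒≡ x a (subst T (sym q) tt)) refl
  ... | false = kept refl (λ { refl → absurd (trans (sym q) (≡ᵇ-refl a)) })
    where absurd : false ≡ true → ⊥
          absurd ()

getAt-map : ∀ {n} (f : ℕ → ℕ) j (v : Vec ℕ n) → j < n → getAt j (V.map f v) ≡ f (getAt j v)
getAt-map f zero (x ∷ v) l = refl
getAt-map f (suc j) (x ∷ v) (s≤s l) = getAt-map f j v l

Conclusion : ∀ {n} → ℕ → ℕ → Vec ℕ n → Vec ℕ n → Set
Conclusion {n} a b η ηh = Σ (Poly n) λ F → Σ (Poly 0) λ c → Σ (Poly n) λ Fh → Σ (Poly 0) λ ch →
  IsE η F c × IsE ηh Fh ch × ¬ (atQ1 c ≈ zeroP) × ¬ (atQ1 ch ≈ zeroP)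
  × (atQ1 F ⊗ liftC (atQ1 ch) ⊗ (esym n (countGe b ηh) ^^ (b ∸ a)) ≈ atQ1 Fh ⊗ liftC (atQ1 c) ⊗ (esym n (countGe b η) ^^ (b ∸ a)))

conclude : ∀ {n} a b → a < b → (η ηh : Vec ℕ n) → η ~ ηh → NoPartBetween a b η → NoPartBetween a b ηh →
  (∀ r → r ≤ a ⊎ b < r → cge r η ≡ cge r ηh) → Conclusion a b η ηh
conclude {n} a b a<b η ηh t gap gaph out with k , F , c , B ← built-exists η | kh , Fh , ch , Bh ← built-exists ηh =
  F , c , Fh , ch , built-IsE B , built-IsE Bh , nonzero B , nonzero Bh ,
  ≋⇒≈ (≡⇒≋ (convert F ch ηh) ⨾ identity ⨾ ≡⇒≋ (sym (convert Fh c η)))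
  where
  open PolySolver {n}
  nonzero : ∀ {k} {η : Vec ℕ n} {F c} → Built k η F c → ¬ (atQ1 c ≈ zeroP)
  nonzero B q = 1≉0 {0} (built-nzd {0} B 1ₚ (lin-cong lift-lin (≡⇒≋ (sym (q1-def _)) ⨾ ≈⇒≋ q ⨾ ≡⇒≋ (sym 0ₚ-def)) ⟨*⟩ ≋-refl ⨾
      lin-0 lift-lin ⟨*⟩ ≋-refl ⨾ *ₚ-comm 0ₚ 1ₚ ⨾ *-zeroʳ 1ₚ))
  d m : ℕ
  d = b ∸ a
  -- A common bound for both degrees. The products run up to b + m, so that they split at a and at
  -- b.
  m = V.sum η ℕ.+ V.sum ηh
  ad : a ℕ.+ d ≡ b
  ad = ℕP.m+[n∸m]≡n (ℕP.<⇒≤ a<b)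
  convert : ∀ F c η → atQ1 F ⊗ liftC (atQ1 c) ⊗ (esym n (countGe b η) ^^ d) ≡ q1 F *ₚ lift (q1 c) *ₚ pow (e (cge b η)) d
  convert F c η = trans
      (cong₂ _⊗_ (trans (cong₂ _⊗_ (q1-def F) (trans (cong liftC (q1-def c)) (lift-def (q1 c))))
      (sym (*ₚ-def (q1 F) (lift (q1 c)))))
      (trans (cong (_^^ d) (trans (cong (esym n) (countGe-cge b η)) (e-def (cge b η)))) (pow-def (e (cge b η)) d)))
          (sym (*ₚ-def _ _))
  factors : ∀ η → NoPartBetween a b η → eprod (b ℕ.+ m) η ≋ upper b m η *ₚ (pow (e (cge b η)) d *ₚ eprod a η)
  factors η gap = eprod-upper b m η ⨾
      ≋-refl ⟨*⟩ (≡⇒≋ (cong (λ b → eprod b η) (sym ad)) ⨾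
      eprod-gap a d η (cge b η) (λ r l l' → cge-gap a b η gap r l (subst (r ≤_) ad l')))
  factorsh : eprod (b ℕ.+ m) ηh ≋ upper b m η *ₚ (pow (e (cge b ηh)) d *ₚ eprod a η)
  factorsh = factors ηh gaph ⨾ ≋-sym (upper-cong b m η ηh (λ r l → out r (inj₂ l))) ⟨*⟩
      (≋-refl ⟨*⟩ ≋-sym (eprod-cong a η ηh (λ r _ l → out r (inj₁ l))))
  identity : q1 F *ₚ lift (q1 ch) *ₚ pow (e (cge b ηh)) d ≋ q1 Fh *ₚ lift (q1 c) *ₚ pow (e (cge b η)) d
  identity = nzd-cancel (nzd-* (nzd-upper b m η) (nzd-eprod a η))
    (solve 5 (λ u v g k p → u :* v :* (g :* k :* p) := g :* k :* (u :* (p :* v))) ≋-refl (upper b m η) (eprod a η) (q1 F)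
        (lift (q1 ch)) (pow (e (cge b ηh)) d) ⨾
     ≋-refl ⟨*⟩ ≋-sym factorsh ⨾
     ratio n m (b ℕ.+ m) (ℕP.m≤n+m m b) B Bh t (ℕP.m≤m+n _ _) (ℕP.m≤n+m _ _) ⨾
     ≋-refl ⟨*⟩ factors η gap ⨾
     solve 5 (λ u v g k p → g :* k :* (u :* (p :* v)) := u :* v :* (g :* k :* p)) ≋-refl (upper b m η) (eprod a η) (q1 Fh)
         (lift (q1 c)) (pow (e (cge b η)) d))

theorem4p1 : (n : ℕ) (η : Vec ℕ n) (a b : ℕ) → a < b
    → (∀ (i j : Fin n) → lookup η i ≡ a → lookup η j ≡ b → i Fin.< j)
    → (∀ (i : Fin n) → ¬ (a < lookup η i × lookup η i < b))
    → (ηh : Vec ℕ n) → (ηh ≡ replaceParts a b η ⊎ ηh ≡ replaceParts b a η)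
    → Σ (Poly n) λ F → Σ (Poly 0) λ c → Σ (Poly n) λ Fh → Σ (Poly 0) λ ch →
    IsE η F c × IsE ηh Fh ch
    × ¬ (atQ1 c ≈ zeroP) × ¬ (atQ1 ch ≈ zeroP)
    × (atQ1 F ⊗ liftC (atQ1 ch) ⊗ (esym n (countGe b ηh) ^^ (b ∸ a))
    ≈ atQ1 Fh ⊗ liftC (atQ1 c) ⊗ (esym n (countGe b η) ^^ (b ∸ a)))
theorem4p1 n η a b a<b order gap = result
  where
  open Replace a b a<b
  at-Fin : ∀ j (l : j < n) → lookup η (F.fromℕ< l) ≡ getAt j η
  at-Fin j l = trans (lookup-getAt η (F.fromℕ< l)) (cong (λ k → getAt k η) (FP.toℕ-fromℕ< l))
  gapη : NoPartBetween a b η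
  gapη j l (p , q) = gap (F.fromℕ< l) (subst (a <_) (sym (at-Fin j l)) p , subst (_< b) (sym (at-Fin j l)) q)
  ordered : ∀ i j → i < j → j < n → ¬ (getAt i η ≡ b × getAt j η ≡ a)
  ordered i j i<j l (p , q) = ℕP.<-asym i<j (subst₂ _<_ (FP.toℕ-fromℕ< l) (FP.toℕ-fromℕ< (ℕP.<-trans i<j l))
    (order (F.fromℕ< l) (F.fromℕ< (ℕP.<-trans i<j l)) (trans (at-Fin j l) q) (trans (at-Fin i (ℕP.<-trans i<j l)) p)))
  R : Vec ℕ n
  R = replaceParts a b η
  between : ∀ {x y} → Replaced x y → ¬ (a < x × x < b) → ¬ (a < y × y < b)
  between (kept refl _) g = g
  between (raised _ refl) _ (_ , l) = ℕP.<-irrefl refl l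
  result : ∀ ηh → (ηh ≡ R ⊎ ηh ≡ replaceParts b a η) → Conclusion a b η ηh
  result _ (inj₁ refl) = conclude a b a<b η R (replaced-~ η R (replaceParts-raised η) gapη ordered) gapη
    (λ j l → between (replaceParts-raised η j l) (gapη j l)) (replaced-cge η R (replaceParts-raised η))
  -- Raising a to b turns the lowered composition L into the same R as it does η, so L and η both
  -- have the type of R and the lowering needs no comparison of its own.
  result _ (inj₂ refl) = conclude a b a<b η L
      (~-trans {v = η} (replaced-~ η R (replaceParts-raised η) gapη ordered)
      (~-sym {v = L} (replaced-~ L R L-raised gapL (λ i j i<j l → no-b i j (ℕP.<-trans i<j l))))) gapη gapL
    (λ r o → trans (replaced-cge η R (replaceParts-raised η) r o) (sym (replaced-cge L R L-raised r o)))
    where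
    low : ℕ → ℕ
    low x = if x ℕ.≡ᵇ b then a else x
    L : Vec ℕ n
    L = replaceParts b a η
    low-cases : ∀ x → (x ≡ b × low x ≡ a) ⊎ (x ≢ b × low x ≡ x)
    low-cases x with x ℕ.≡ᵇ b in q
    ... | true = inj₁ (ℕP.≡ᵇ⇒≡ x b (subst T (sym q) tt) , refl)
    ... | false = inj₂ ((λ { refl → absurd (trans (sym q) (≡ᵇ-refl b)) }) , refl)
      where absurd : false ≡ true → ⊥
            absurd ()
    high : ℕ → ℕ
    high x = if x ℕ.≡ᵇ a then b else x
    high-low : ∀ x → high (low x) ≡ high x
    high-low x with low-cases x
    ... | inj₁ (refl , p) rewrite p | ≡ᵇ-refl a with x ℕ.≡ᵇ a
    ...   | true = refl
    ...   | false = refl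
    high-low x | inj₂ (_ , p) rewrite p = refl
    raised-again : replaceParts a b L ≡ R
    raised-again = trans (sym (VP.map-∘ high low η)) (VP.map-cong high-low η)
    L-raised : Pointwise-Replaced L R
    L-raised = subst (Pointwise-Replaced L) raised-again (replaceParts-raised L)
    entry : ∀ {P : ℕ → Set} j → j < n → P (low (getAt j η)) → P (getAt j L)
    entry {P} j l = subst P (sym (getAt-map low j η l))
    gapL : NoPartBetween a b L
    gapL j l with low-cases (getAt j η)
    ... | inj₁ (_ , p) = entry {λ x → ¬ (a < x × x < b)} j l (λ { (q , _) → ℕP.<-irrefl (sym p) q })
    ... | inj₂ (_ , p) = entry {λ x → ¬ (a < x × x < b)} j l (subst (λ x → ¬ (a < x × x < b)) (sym p) (gapη j l))
    no-b : ∀ i j → i < n → ¬ (getAt i L ≡ b × getAt j L ≡ a)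
    no-b i j l (p , _) with low-cases (getAt i η)
    ... | inj₁ (_ , q) = ℕP.<⇒≢ a<b (trans (sym q) (trans (sym (getAt-map low i η l)) p))
    ... | inj₂ (ne , q) = ne (trans (sym q) (trans (sym (getAt-map low i η l)) p))
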